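{- For any $k,\ell\ge1$, $\lambda\in\mathrm{Par}^k_\ell$ and $m\in[\ell]$, $$H(\Delta^k(\lambda);\lambda-\epsilon_m)=\sum_{T\in\mathrm{VSMT}^k_{(1)}(\lambda),\ \mathrm{marks}(T)=\{m\}}t^{\mathrm{spin}(T)}\,\mathfrak s^{(k)}_{\mathrm{inside}(T)}.$$
   Context: $[n]=\{1,\dots,n\}$; $\epsilon_i\in\mathbb Z^\ell$ standard basis vectors. For $\gamma\in\mathbb Z^\ell$, $s_\gamma=\det(h_{\gamma_i+j-i})_{1\le i,j\le\ell}$. $\Delta^+_\ell=\{(i,j):1\le i<j\le\ell\}$. For $\Psi\subset\Delta^+_\ell$ and $\gamma\in\mathbb Z^\ell$, $H(\Psi;\gamma)$ is obtained by expanding $\prod_{(i,j)\in\Psi}(1-tz_i/z_j)^{ -1}z^\gamma$ as a power series in $t$ and applying coefficientwise the linear map $z^\beta\mapsto s_\beta$. $\mathrm{Par}^k_\ell=\{\mu\in\mathbb Z^\ell:k\ge\mu_1\ge\dots\ge\mu_\ell\ge0\}$, $\mathrm{Par}^k$ the partitions with largest part $\le k$ (identified with their zero-paddings). $\Delta^k(\mu)=\{(i,j)\in\Delta^+_\ell:k-\mu_i+i<j\}$, $\mathfrak s^{(k)}_\mu=H(\Delta^k(\mu);\mu)$. Hook length (English notation): boxes below in the column plus those weakly right in the row. A $(k+1)$-core is a partition with no box of hook length $k+1$; $\mathfrak p(\kappa)$ has $r$-th part the number of boxes in row $r$ of $\kappa$ with hook length $\le k$ (a bijection from $(k+1)$-cores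 to $\mathrm{Par}^k$). A strong cover $\tau\Rightarrow\kappa$: $(k+1)$-cores, $\tau\subset\kappa$, $|\mathfrak p(\tau)|+1=|\mathfrak p(\kappa)|$; a strong marked cover $\tau\xRightarrow{r}\kappa$ adds a positive integer $r$ equal to the smallest row index of some connected component of $\kappa/\tau$; its spin is $c(h-1)+N$ with $c$ the number of components, $h$ the common height of each component, $N$ the number of components entirely in rows $>r$. $\mathrm{VSMT}^k_{(1)}(\lambda)$ is the set of strong marked covers $T=(\tau\xRightarrow{r}\kappa)$ with $\mathfrak p(\kappa)=\lambda$; $\mathrm{inside}(T)=\mathfrak p(\tau)$, $\mathrm{marks}(T)=\{r\}$, $\mathrm{spin}(T)$ its spin. -}

module Defs where

open import Data.Nat as ℕ using (ℕ; zero; suc; _≤_; _<_; _+_; _*_; _∸_; _⊔_; _⊓_; _<ᵇ_; _≤ᵇ_; _≡ᵇ_)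
open import Data.Nat.Properties using () renaming (_≟_ to _≟ℕ_)
open import Data.Integer as ℤ using (ℤ; +_; -[1+_])
open import Data.Fin as Fin using (Fin; toℕ; punchIn)
open import Data.Fin.Properties using () renaming (_≟_ to _≟F_)
open import Data.List as List using (List; []; _∷_; _++_; map; concatMap; upTo; allFin; filterᵇ; length; replicate; foldr)
open import Data.Nat.ListAction using (sum)
open import Data.List.Properties using (≡-dec)
open import Data.List.Relation.Unary.All using (All)
open import Data.Vec as Vec using (Vec; lookup; fromList; toList)
open import Data.Product using (_×_; _,_)
open import Data.Bool using (Bool; true; false; if_then_else_; _∧_; not)
open import Relation.Nullary.Decidable using (does)
open import Relation.Binary.PropositionalEquality using (_≡_)

-- The ring of symmetric functions Λ (over ℤ), realised as the polynomial
-- ring ℤ[h₁, h₂, …] (Λ is freely generated by the complete homogeneous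
-- symmetric functions).  An element is a finite formal sum of terms
-- c · h_{w₁} ⋯ h_{w_r}; a monomial is a list of indices (order irrelevant).

Mono : Set
Mono = List ℕ

Λ : Set
Λ = List (ℤ × Mono)

insertℕ : ℕ → List ℕ → List ℕ
insertℕ x [] = x ∷ []
insertℕ x (y ∷ ys) = if x ≤ᵇ y then x ∷ y ∷ ys else y ∷ insertℕ x ys

sortℕ : List ℕ → List ℕ
sortℕ = foldr insertℕ []

0Λ : Λ
0Λ = []

1Λ : Λ
1Λ = (ℤ.1ℤ , []) ∷ []

_+Λ_ : Λ → Λ → Λ
_+Λ_ = _++_

scaleΛ : ℤ → Λ → Λ
scaleΛ a = map (λ (c , w) → (a ℤ.* c , w))

_*Λ_ : Λ → Λ → Λ
p *Λ q = concatMap (λ (c , w) → map (λ (d , v) → (c ℤ.* d , w ++ v)) q) p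

sumΛ : List Λ → Λ
sumΛ = foldr _+Λ_ 0Λ

coeff : Λ → Mono → ℤ
coeff p μ = foldr (λ (c , w) acc → if does (≡-dec _≟ℕ_ (sortℕ w) μ) then c ℤ.+ acc else acc) ℤ.0ℤ p

_≈Λ_ : Λ → Λ → Set
p ≈Λ q = ∀ μ → coeff p μ ≡ coeff q μ

h : ℤ → Λ
h (+ zero) = 1Λ
h (+ suc n) = (ℤ.1ℤ , suc n ∷ []) ∷ []
h -[1+ n ] = 0Λ

sign : ℕ → ℤ
sign zero = ℤ.1ℤ
sign (suc n) = ℤ.- sign n

det : (n : ℕ) → (Fin n → Fin n → Λ) → Λ
det zero M = 1Λ
det (suc n) M = sumΛ (map (λ j → scaleΛ (sign (toℕ j))
                    (M Fin.zero j *Λ det n (λ a b → M (Fin.suc a) (punchIn j b))))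
                  (allFin (suc n)))

schur : (ℓ : ℕ) → (Fin ℓ → ℤ) → Λ
schur ℓ γ = det ℓ (λ i j → h (γ i ℤ.+ + toℕ j ℤ.- + toℕ i))

-- Formal power series in t with coefficients in Λ: d ↦ coefficient of t^d.

Series : Set
Series = ℕ → Λ

tShift : ℕ → Series → Series
tShift s f d = if s ≤ᵇ d then f (d ∸ s) else 0Λ

raise : {ℓ : ℕ} → Fin ℓ → Fin ℓ → ℕ → (Fin ℓ → ℤ) → (Fin ℓ → ℤ)
raise i j a γ x =
  γ x ℤ.+ (if does (x ≟F i) then + a else ℤ.0ℤ)
      ℤ.- (if does (x ≟F j) then + a else ℤ.0ℤ)

-- coefficient of t^d in  ∏_{(i,j)∈Ψ} (1 - t z_i/z_j)^{-1} z^γ,  after z^β ↦ s_β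
Hcoef : {ℓ : ℕ} → List (Fin ℓ × Fin ℓ) → (Fin ℓ → ℤ) → ℕ → Λ
Hcoef {ℓ} [] γ zero = schur ℓ γ
Hcoef [] γ (suc d) = 0Λ
Hcoef ((i , j) ∷ Ψ) γ d =
  sumΛ (map (λ a → Hcoef Ψ (raise i j a γ) (d ∸ a)) (upTo (suc d)))

-- H(Ψ;γ) (Ψ given as a duplicate-free list of pairs)
H : {ℓ : ℕ} → List (Fin ℓ × Fin ℓ) → (Fin ℓ → ℤ) → Series
H Ψ γ d = Hcoef Ψ γ d

allPairs : (ℓ : ℕ) → List (Fin ℓ × Fin ℓ)
allPairs ℓ = concatMap (λ i → map (λ j → (i , j)) (allFin ℓ)) (allFin ℓ)

-- Δ^k(μ) = {(i,j) : 1 ≤ i < j ≤ ℓ, k - μ_i + i < j}  (1-based i, j)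
Δk : (k : ℕ) {ℓ : ℕ} → Vec ℕ ℓ → List (Fin ℓ × Fin ℓ)
Δk k {ℓ} μ = filterᵇ (λ (i , j) → (toℕ i <ᵇ toℕ j) ∧
    does ((+ k ℤ.- + lookup μ i ℤ.+ + suc (toℕ i)) ℤ.<? + suc (toℕ j)))
  (allPairs ℓ)

kSchur : (k : ℕ) {ℓ : ℕ} → Vec ℕ ℓ → Series
kSchur k μ = H (Δk k μ) (λ i → + lookup μ i)

minusε : {ℓ : ℕ} → Vec ℕ ℓ → Fin ℓ → (Fin ℓ → ℤ)
minusε la m x = + lookup la x ℤ.- (if does (x ≟F m) then ℤ.1ℤ else ℤ.0ℤ)

ParK : (k : ℕ) {ℓ : ℕ} → Vec ℕ ℓ → Set
ParK k la = (∀ i → lookup la i ≤ k) × (∀ i j → toℕ i ≤ toℕ j → lookup la j ≤ lookup la i)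

-- Partitions as lists of parts; rows and columns are 0-based here.

rowLen : List ℕ → ℕ → ℕ
rowLen [] _ = 0
rowLen (a ∷ _) zero = a
rowLen (_ ∷ as) (suc r) = rowLen as r

colLen : List ℕ → ℕ → ℕ
colLen κ c = length (filterᵇ (λ a → c <ᵇ a) κ)

IsPartition : List ℕ → Set
IsPartition κ = All (0 <_) κ × (∀ r → rowLen κ (suc r) ≤ rowLen κ r)

hook : List ℕ → ℕ → ℕ → ℕ
hook κ r c = (rowLen κ r ∸ c ∸ 1) + (colLen κ c ∸ r ∸ 1) + 1

allᵇ : List Bool → Bool
allᵇ = foldr _∧_ true

coreᵇ : ℕ → List ℕ → Bool
coreᵇ k κ = allᵇ (concatMap (λ r → map (λ c → not (hook κ r c ≡ᵇ suc k))
                                       (upTo (rowLen κ r)))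
                            (upTo (length κ)))

pmap : ℕ → List ℕ → List ℕ
pmap k κ = map (λ r → length (filterᵇ (λ c → hook κ r c ≤ᵇ k) (upTo (rowLen κ r))))
               (upTo (length κ))

consT : ℕ → List ℕ → List ℕ
consT zero [] = []
consT (suc x) [] = suc x ∷ []
consT x (y ∷ ys) = x ∷ y ∷ ys

trim : List ℕ → List ℕ
trim [] = []
trim (x ∷ xs) = consT x (trim xs)

pad : ℕ → List ℕ → List ℕ
pad ℓ μ = μ ++ replicate (ℓ ∸ length μ) 0

-- all partitions τ ⊆ κ, each listed once, zero-padded to length κ
gen : List ℕ → ℕ → List (List ℕ)
gen [] u = [] ∷ []
gen (a ∷ as) u = concatMap (λ b → map (b ∷_) (gen as b)) (upTo (suc (a ⊓ u)))

subParts : List ℕ → List (List ℕ)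
subParts κ = gen κ (rowLen κ 0)

-- Connected components of the skew shape κ/τ (τ ⊆ κ).
-- Row r of κ/τ is the interval of columns [τ_r, κ_r); the rows r and r+1
-- contain edge-adjacent boxes iff these intervals share a column.

nonemptyRow : List ℕ → List ℕ → ℕ → Bool
nonemptyRow τ κ r = rowLen τ r <ᵇ rowLen κ r

linked : List ℕ → List ℕ → ℕ → Bool
linked τ κ r = (rowLen τ r ⊔ rowLen τ (suc r)) <ᵇ (rowLen κ r ⊓ rowLen κ (suc r))

-- row r is the smallest row of a connected component of κ/τ
starts : List ℕ → List ℕ → ℕ → Bool
starts τ κ zero = nonemptyRow τ κ zero
starts τ κ (suc r) = nonemptyRow τ κ (suc r) ∧ not (linked τ κ r)

heightFrom : List ℕ → List ℕ → ℕ → ℕ → ℕ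
heightFrom τ κ zero r = 1
heightFrom τ κ (suc f) r = if linked τ κ r then suc (heightFrom τ κ f (suc r)) else 1

countᵇ : List Bool → ℕ
countᵇ bs = length (filterᵇ (λ b → b) bs)

ncomp : List ℕ → List ℕ → ℕ
ncomp τ κ = countᵇ (map (starts τ κ) (upTo (length κ)))

nBelow : List ℕ → List ℕ → ℕ → ℕ
nBelow τ κ r = countᵇ (map (λ s → (r <ᵇ s) ∧ starts τ κ s) (upTo (length κ)))

spin : List ℕ → List ℕ → ℕ → ℕ
spin τ κ r = ncomp τ κ * (heightFrom τ κ (length κ) r ∸ 1) + nBelow τ κ r

-- τ ⇒ κ is a strong cover (given τ ⊆ κ, κ a (k+1)-core) with mark
-- at (1-based) row r+1
markedCoverᵇ : ℕ → List ℕ → List ℕ → ℕ → Bool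
markedCoverᵇ k τ κ r = coreᵇ k τ ∧ (suc (sum (pmap k τ)) ≡ᵇ sum (pmap k κ)) ∧ starts τ κ r

-- coefficient of t^d in  Σ_{T ∈ VSMT, marks(T) = {m}} t^{spin T} 𝔰^(k)_{inside T}
-- where κ is the outer core; 0-based mark row r
rhs : (k ℓ : ℕ) → List ℕ → ℕ → Series
rhs k ℓ κ r d =
  sumΛ (map (λ τ → tShift (spin τ κ r) (kSchur k (fromList (pad ℓ (trim (pmap k τ))))) d)
            (filterᵇ (λ τ → markedCoverᵇ k τ κ r) (subParts κ)))

-- Write λ for the partition and D r = r + k + 1 − λ_r for the first root column of row r of Δᵏ(λ). In terms of the
-- beads b_r = κ_r − r of the core κ the bounce edge r ↦ D r is b_(D r) = b_r − (k + 1). Expanding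
-- H(Δᵏ(λ); λ − ε_z) at the root (z , D z) gives A_z + t H(Δᵏ(λ); λ − ε_(D z)), where A_z lacks that root, so the
-- left side is the sum of t^j A_z over the rows z = D^j m. If rows z, …, z + w are the rows from z on with part λ_z,
-- then repeated reflection in adjacent rows and columns evaluates A_z: it is t^(p w) 𝔰 of an explicit partition when
-- the p blocks of w + 1 rows lying above z on the bounce graph are aligned and only the last w rows of the top
-- block continue upwards, and 0 otherwise.
--
-- On the side of cores, such a z yields the core obtained from κ by removing p translated ribbons of height w + 1,
-- with heads in the rows of the bounce path above z; marking at m makes the spin p w + j. Conversely, let τ ⊊ κ be
-- cores. Among the ways of moving all beads c, c + (k + 1), … of κ down to the gaps e, e + (k + 1), … without
-- falling below τ, one with c − e minimal is a removal of this kind. Hence every smaller core lies below one of these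
-- covers, the length strictly increases under inclusion, and these are all strong covers.
module Submission where

-- The reflections are not directly available in the root set of A_z: exchanging rows and columns z,
-- z + 1 needs equal columns, and a row u whose roots begin in column z + 1 spoils this. Adding the
-- root (u , z) restores the symmetry; the price is a factor t and the same problem one pair of rows
-- higher. So a block is not treated at once. It grows by one row at a time, each pass runs through
-- all p levels and costs t^p, and w passes give t^(p w). Every root set met on the way is still
-- determined by the first root columns of its rows, which is why only these are stored.
--
-- On the core side the pair (e , c) is never searched for. If no admissible pair were tight, each
-- could be replaced by a closer one, which cannot go on. The classification of covers is therefore
-- obtained under a double negation; this is harmless, since it is only used for membership in a
-- finite list, which is decidable.

open import Defs

-- Linear inequalities over the natural numbers.

module LinearArithmetic where
  open import Data.Nat using (ℕ; zero; suc; _+_; _*_; _∸_; _≤_; _<_; z≤n; _<ᵇ_; _≤ᵇ_; _≡ᵇ_)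
  open import Data.Maybe using (Maybe; just; nothing; _<∣>_)
  import Data.Vec.Relation.Unary.All as VecAll
  import Data.Vec.Relation.Unary.All.Properties as VecAllP
  open import Data.Nat.Properties
  open import Data.Fin using (Fin; zero; suc)
  open import Data.Bool using (Bool; true; false; if_then_else_; _∧_; not; T; T?)
  open import Data.Bool.Properties using (T-∧; T-∨)
  open import Data.List using (List; []; _∷_; map; concatMap; filterᵇ)
  open import Data.Bool.ListAction using (any)
  open import Data.List.Relation.Unary.All as All using (All; []; _∷_)
  open import Data.List.Relation.Unary.All.Properties using (map⁺; concat⁺; filter⁺)
  open import Data.Vec as Vec using (Vec; []; _∷_; lookup; zipWith; tabulate)
  open import Data.Vec.N-ary using (N-ary; _$ⁿ_)
  open import Data.Product using (_×_; _,_; proj₁; proj₂)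
  open import Data.Sum using (inj₁; inj₂)
  open import Data.Empty using (⊥)
  open import Function using (_∘_)
  open import Function.Bundles using (Equivalence)
  open import Relation.Binary.PropositionalEquality
  import Algebra.Properties.CommutativeSemigroup as CSG

  open CSG +-commutativeSemigroup using (interchange)

  -- Fourier–Motzkin elimination: every derived row is a nonnegative combination of the hypotheses.

  infixl 6 _:+_
  infixl 7 _:*_
  infix 4 _:≤_ _:<_ _:≡_
  infix 3 ⊢_
  infixr 3 _⇒_

  data Expr (n : ℕ) : Set where
    con  : ℕ → Expr n
    atom : Fin n → Expr n
    _:+_ : Expr n → Expr n → Expr n
    _:*_ : ℕ → Expr n → Expr n

  data Rel (n : ℕ) : Set where
    _:≤_ _:<_ _:≡_ : Expr n → Expr n → Rel n
    absurd : Rel n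

  data Sequent (n : ℕ) : Set where
    ⊢_ : Rel n → Sequent n
    _⇒_ : Rel n → Sequent n → Sequent n

  module _ {n : ℕ} (ρ : Vec ℕ n) where
    ⟦_⟧ᵉ : Expr n → ℕ
    ⟦ con c ⟧ᵉ = c
    ⟦ atom i ⟧ᵉ = lookup ρ i
    ⟦ e :+ f ⟧ᵉ = ⟦ e ⟧ᵉ + ⟦ f ⟧ᵉ
    ⟦ c :* e ⟧ᵉ = c * ⟦ e ⟧ᵉ

    ⟦_⟧ʳ : Rel n → Set
    ⟦ e :≤ f ⟧ʳ = ⟦ e ⟧ᵉ ≤ ⟦ f ⟧ᵉ
    ⟦ e :< f ⟧ʳ = ⟦ e ⟧ᵉ < ⟦ f ⟧ᵉ
    ⟦ e :≡ f ⟧ʳ = ⟦ e ⟧ᵉ ≡ ⟦ f ⟧ᵉ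
    ⟦ absurd ⟧ʳ = ⊥

    ⟦_⟧ˢ : Sequent n → Set
    ⟦ ⊢ r ⟧ˢ = ⟦ r ⟧ʳ
    ⟦ r ⇒ s ⟧ˢ = ⟦ r ⟧ʳ → ⟦ s ⟧ˢ

  Linear : ℕ → Set
  Linear n = ℕ × Vec ℕ n

  -- A row (A , B) stands for the constraint A ≤ B.
  Row : ℕ → Set
  Row n = Linear n × Linear n

  scaleL : ∀ {n} → ℕ → Linear n → Linear n
  scaleL a (c , v) = a * c , Vec.map (a *_) v

  addL : ∀ {n} → Linear n → Linear n → Linear n
  addL (c , v) (d , w) = c + d , zipWith _+_ v w

  unit : ∀ {n} → Fin n → Vec ℕ n
  unit zero = 1 ∷ Vec.replicate _ 0
  unit (suc i) = 0 ∷ unit i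

  linear : ∀ {n} → Expr n → Linear n
  linear (con c) = c , Vec.replicate _ 0
  linear (atom i) = 0 , unit i
  linear (e :+ f) = addL (linear e) (linear f)
  linear (c :* e) = scaleL c (linear e)

  combine : ∀ {n} → ℕ → Row n → ℕ → Row n → Row n
  combine a (A , B) b (A' , B') = addL (scaleL a A) (scaleL b A') , addL (scaleL a B) (scaleL b B')

  excess : ∀ {n} → Fin n → Row n → ℕ
  excess i ((_ , v) , (_ , w)) = lookup w i ∸ lookup v i

  deficit : ∀ {n} → Fin n → Row n → ℕ
  deficit i ((_ , v) , (_ , w)) = lookup v i ∸ lookup w i

  dominates : ∀ {n} → Vec ℕ n → Vec ℕ n → Bool
  dominates [] [] = true
  dominates (a ∷ v) (b ∷ w) = (b ≤ᵇ a) ∧ dominates v w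

  informative : ∀ {n} → Row n → Bool
  informative ((c , v) , (d , w)) = not ((c ≤ᵇ d) ∧ dominates w v)

  substitute : ∀ {n} → Fin n → Row n → Row n → Row n
  substitute i e@(A , B) r with excess i r | deficit i r
  ... | zero | zero = r
  ... | suc x | _ = if 0 <ᵇ deficit i e then combine (deficit i e) r (suc x) e else combine (excess i e) r (suc x) (B , A)
  ... | zero | suc y = if 0 <ᵇ excess i e then combine (excess i e) r (suc y) e else combine (deficit i e) r (suc y) (B , A)

  firstWith : ∀ {n m} → (Fin n → Bool) → Vec (Fin n) m → Maybe (Fin n)
  firstWith p [] = nothing
  firstWith p (i ∷ is) = if p i then just i else firstWith p is

  -- A net coefficient of absolute value 1 is preferred, since the rows substituted into are then
  -- not multiplied up.
  pivot : ∀ {n} → Row n → Maybe (Fin n)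
  pivot {n} e = firstWith (λ i → (excess i e + deficit i e) ≡ᵇ 1) (Vec.allFin n) <∣> firstWith (λ i → 0 <ᵇ (excess i e + deficit i e)) (Vec.allFin n)

  -- The pivot of an equation stays constrained by being a natural number, so one inequality is kept.
  substituteAll : ∀ {n m} → Vec (Row n) m → List (Row n) → List (Row n)
  substituteAll [] rs = rs
  substituteAll (e@(A , B) ∷ es) rs with pivot e
  ... | nothing = substituteAll es (e ∷ (B , A) ∷ rs)
  ... | just i = substituteAll (Vec.map (substitute i e) es) ((if 0 <ᵇ deficit i e then e else (B , A)) ∷ map (substitute i e) rs)

  cancelWith : ∀ {n} → Fin n → Row n → Row n → List (Row n)
  cancelWith i r s with deficit i s
  ... | zero = []
  ... | suc a = combine (suc a) r (excess i r) s ∷ []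

  -- Rows with positive excess bound x_i from below and are combined with all upper bounds. The
  -- upper bounds themselves stay: combining them with 0 ≤ x_i would only erase their x_i, and
  -- `contradictory` allows for that by comparing coefficients instead of demanding zeros.
  eliminateRow : ∀ {n} → Fin n → List (Row n) → Row n → List (Row n)
  eliminateRow i rs r with excess i r
  ... | zero = r ∷ []
  ... | suc _ = concatMap (cancelWith i r) rs

  eliminate : ∀ {n} → Fin n → List (Row n) → List (Row n)
  eliminate i rs = filterᵇ informative (concatMap (eliminateRow i rs) rs)

  eliminateAll : ∀ {n m} → Vec (Fin n) m → List (Row n) → List (Row n)
  eliminateAll [] rs = rs
  eliminateAll (i ∷ is) rs = eliminateAll is (eliminate i rs)

  contradictory : ∀ {n} → Row n → Bool
  contradictory ((c , v) , (d , w)) = (d <ᵇ c) ∧ dominates v w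

  -- The equations, then the inequalities.
  System : ℕ → Set
  System n = List (Row n) × List (Row n)

  refutes : ∀ {n} → System n → Bool
  refutes {n} (es , rs) = any contradictory (eliminateAll (Vec.allFin n) (filterᵇ informative (substituteAll (Vec.fromList es) rs)))

  assume : ∀ {n} → Rel n → System n → System n
  assume (e :≤ f) (es , rs) = es , (linear e , linear f) ∷ rs
  assume (e :< f) (es , rs) = es , (linear (con 1 :+ e) , linear f) ∷ rs
  assume (e :≡ f) (es , rs) = (linear e , linear f) ∷ es , rs
  assume absurd s = s

  provable : ∀ {n} → System n → Rel n → Bool
  provable s (e :≤ f) = refutes (assume (f :< e) s)
  provable s (e :< f) = refutes (assume (f :≤ e) s)
  provable s (e :≡ f) = refutes (assume (f :< e) s) ∧ refutes (assume (e :< f) s)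
  provable s absurd = refutes s

  check : ∀ {n} → System n → Sequent n → Bool
  check s (⊢ r) = provable s r
  check s (r ⇒ q) = check (assume r s) q

  module _ {n : ℕ} (ρ : Vec ℕ n) where
    dot : ∀ {m} → Vec ℕ m → Vec ℕ m → ℕ
    dot [] [] = 0
    dot (a ∷ v) (x ∷ xs) = a * x + dot v xs

    ⟦_⟧ˡ : Linear n → ℕ
    ⟦ c , v ⟧ˡ = c + dot v ρ

    Holds : Row n → Set
    Holds (A , B) = ⟦ A ⟧ˡ ≤ ⟦ B ⟧ˡ

    dot-scale : ∀ {m} a (v xs : Vec ℕ m) → dot (Vec.map (a *_) v) xs ≡ a * dot v xs
    dot-scale a [] [] = sym (*-zeroʳ a)
    dot-scale a (b ∷ v) (x ∷ xs) =
      trans (cong₂ _+_ (*-assoc a b x) (dot-scale a v xs)) (sym (*-distribˡ-+ a (b * x) (dot v xs)))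

    dot-add : ∀ {m} (v w xs : Vec ℕ m) → dot (zipWith _+_ v w) xs ≡ dot v xs + dot w xs
    dot-add [] [] [] = refl
    dot-add (a ∷ v) (b ∷ w) (x ∷ xs) =
      trans (cong₂ _+_ (*-distribʳ-+ x a b) (dot-add v w xs)) (interchange (a * x) (b * x) (dot v xs) (dot w xs))

    dot-zero : ∀ {m} (xs : Vec ℕ m) → dot (Vec.replicate _ 0) xs ≡ 0
    dot-zero [] = refl
    dot-zero (x ∷ xs) = dot-zero xs

    dot-unit : ∀ {m} (i : Fin m) (xs : Vec ℕ m) → dot (unit i) xs ≡ lookup xs i
    dot-unit zero (x ∷ xs) = trans (cong₂ _+_ (+-identityʳ x) (dot-zero xs)) (+-identityʳ x)
    dot-unit (suc i) (x ∷ xs) = dot-unit i xs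

    ⟦scaleL⟧ : ∀ a A → ⟦ scaleL a A ⟧ˡ ≡ a * ⟦ A ⟧ˡ
    ⟦scaleL⟧ a (c , v) = trans (cong (a * c +_) (dot-scale a v ρ)) (sym (*-distribˡ-+ a c (dot v ρ)))

    ⟦addL⟧ : ∀ A B → ⟦ addL A B ⟧ˡ ≡ ⟦ A ⟧ˡ + ⟦ B ⟧ˡ
    ⟦addL⟧ (c , v) (d , w) = trans (cong (c + d +_) (dot-add v w ρ)) (interchange c d (dot v ρ) (dot w ρ))

    ⟦linear⟧ : ∀ e → ⟦ linear e ⟧ˡ ≡ ⟦_⟧ᵉ ρ e
    ⟦linear⟧ (con c) = trans (cong (c +_) (dot-zero ρ)) (+-identityʳ c)
    ⟦linear⟧ (atom i) = dot-unit i ρ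
    ⟦linear⟧ (e :+ f) = trans (⟦addL⟧ (linear e) (linear f)) (cong₂ _+_ (⟦linear⟧ e) (⟦linear⟧ f))
    ⟦linear⟧ (c :* e) = trans (⟦scaleL⟧ c (linear e)) (cong (c *_) (⟦linear⟧ e))

    combine-holds : ∀ a r b s → Holds r → Holds s → Holds (combine a r b s)
    combine-holds a (A , B) b (A' , B') p q = subst₂ _≤_ (sym (side A A')) (sym (side B B'))
      (+-mono-≤ (*-monoʳ-≤ a p) (*-monoʳ-≤ b q))
      where
      side : ∀ X Y → ⟦ addL (scaleL a X) (scaleL b Y) ⟧ˡ ≡ a * ⟦ X ⟧ˡ + b * ⟦ Y ⟧ˡ
      side X Y = trans (⟦addL⟧ (scaleL a X) (scaleL b Y)) (cong₂ _+_ (⟦scaleL⟧ a X) (⟦scaleL⟧ b Y))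

    cancelWith-holds : ∀ i r s → Holds r → Holds s → All Holds (cancelWith i r s)
    cancelWith-holds i r s p q with deficit i s
    ... | zero = []
    ... | suc a = combine-holds (suc a) r (excess i r) s p q ∷ []

    HoldsEq : Row n → Set
    HoldsEq (A , B) = ⟦ A ⟧ˡ ≡ ⟦ B ⟧ˡ

    orient : ∀ b (e : Row n) → HoldsEq e → Holds (if b then e else (proj₂ e , proj₁ e))
    orient true e p = ≤-reflexive p
    orient false e p = ≤-reflexive (sym p)

    substitute-holds : ∀ i e r → HoldsEq e → Holds r → Holds (substitute i e r)
    substitute-holds i e r p q with excess i r | deficit i r
    ... | zero | zero = q
    substitute-holds i e r p q | suc x | _ with 0 <ᵇ deficit i e
    ... | true = combine-holds (deficit i e) r (suc x) e q (≤-reflexive p)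
    ... | false = combine-holds (excess i e) r (suc x) (proj₂ e , proj₁ e) q (≤-reflexive (sym p))
    substitute-holds i e r p q | zero | suc y with 0 <ᵇ excess i e
    ... | true = combine-holds (excess i e) r (suc y) e q (≤-reflexive p)
    ... | false = combine-holds (deficit i e) r (suc y) (proj₂ e , proj₁ e) q (≤-reflexive (sym p))

    holdsEq-combine : ∀ a r b s → HoldsEq r → HoldsEq s → HoldsEq (combine a r b s)
    holdsEq-combine a r b s p q = ≤-antisym (combine-holds a r b s (≤-reflexive p) (≤-reflexive q))
      (combine-holds a (proj₂ r , proj₁ r) b (proj₂ s , proj₁ s) (≤-reflexive (sym p)) (≤-reflexive (sym q)))

    substitute-holdsEq : ∀ i e r → HoldsEq e → HoldsEq r → HoldsEq (substitute i e r)
    substitute-holdsEq i e r p q with excess i r | deficit i r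
    ... | zero | zero = q
    substitute-holdsEq i e r p q | suc x | _ with 0 <ᵇ deficit i e
    ... | true = holdsEq-combine (deficit i e) r (suc x) e q p
    ... | false = holdsEq-combine (excess i e) r (suc x) (proj₂ e , proj₁ e) q (sym p)
    substitute-holdsEq i e r p q | zero | suc y with 0 <ᵇ excess i e
    ... | true = holdsEq-combine (excess i e) r (suc y) e q p
    ... | false = holdsEq-combine (deficit i e) r (suc y) (proj₂ e , proj₁ e) q (sym p)

    substituteAll-holds : ∀ {m} (es : Vec (Row n) m) rs → VecAll.All HoldsEq es → All Holds rs → All Holds (substituteAll es rs)
    substituteAll-holds [] rs VecAll.[] qs = qs
    substituteAll-holds (e ∷ es) rs (p VecAll.∷ ps) qs with pivot e
    ... | nothing = substituteAll-holds es _ ps (≤-reflexive p ∷ ≤-reflexive (sym p) ∷ qs)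
    ... | just i = substituteAll-holds (Vec.map (substitute i e) es) _
      (VecAllP.map⁺ (VecAll.map (λ {r} → substitute-holdsEq i e r p) ps))
      (orient (0 <ᵇ deficit i e) e p ∷ map⁺ (All.map (λ {r} → substitute-holds i e r p) qs))

    concatMap-All : ∀ {f : Row n → List (Row n)} {rs} → All (λ r → All Holds (f r)) rs → All Holds (concatMap f rs)
    concatMap-All ps = concat⁺ (map⁺ ps)

    eliminateRow-holds : ∀ i rs r → All Holds rs → Holds r → All Holds (eliminateRow i rs r)
    eliminateRow-holds i rs r ps p with excess i r
    ... | zero = p ∷ []
    ... | suc _ = concatMap-All (All.map (λ {s} → cancelWith-holds i r s p) ps)

    eliminateAll-holds : ∀ {m} (is : Vec (Fin n) m) rs → All Holds rs → All Holds (eliminateAll is rs)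
    eliminateAll-holds [] rs ps = ps
    eliminateAll-holds (i ∷ is) rs ps =
      eliminateAll-holds is _ (filter⁺ (T? ∘ informative) (concatMap-All (All.map (λ {r} → eliminateRow-holds i rs r ps) ps)))

    dominates-sound : ∀ {m} (v w xs : Vec ℕ m) → T (dominates v w) → dot w xs ≤ dot v xs
    dominates-sound [] [] [] _ = z≤n
    dominates-sound (a ∷ v) (b ∷ w) (x ∷ xs) t with Equivalence.to T-∧ t
    ... | b≤a , t' = +-mono-≤ (*-monoˡ-≤ x (≤ᵇ⇒≤ b a b≤a)) (dominates-sound v w xs t')

    contradictory-sound : ∀ r → Holds r → T (contradictory r) → ⊥
    contradictory-sound ((c , v) , (d , w)) p t with Equivalence.to T-∧ t
    ... | d<c , t' = <-irrefl refl (<-≤-trans (+-mono-<-≤ (<ᵇ⇒< d c d<c) (dominates-sound v w ρ t')) p)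

    any-sound : ∀ rs → All Holds rs → T (any contradictory rs) → ⊥
    any-sound (r ∷ rs) (p ∷ ps) t with Equivalence.to T-∨ t
    ... | inj₁ t' = contradictory-sound r p t'
    ... | inj₂ t' = any-sound rs ps t'

    Model : System n → Set
    Model (es , rs) = All HoldsEq es × All Holds rs

    fromList-All : ∀ {es} → All HoldsEq es → VecAll.All HoldsEq (Vec.fromList es)
    fromList-All [] = VecAll.[]
    fromList-All (p ∷ ps) = p VecAll.∷ fromList-All ps

    refutes-sound : ∀ s → Model s → T (refutes s) → ⊥
    refutes-sound (es , rs) (ps , qs) t = any-sound _ (eliminateAll-holds (Vec.allFin n) _
      (filter⁺ (T? ∘ informative) (substituteAll-holds (Vec.fromList es) rs (fromList-All ps) qs))) t

    row-holds : ∀ e f → ⟦_⟧ᵉ ρ e ≤ ⟦_⟧ᵉ ρ f → Holds (linear e , linear f)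
    row-holds e f = subst₂ _≤_ (sym (⟦linear⟧ e)) (sym (⟦linear⟧ f))

    assume-model : ∀ r s → ⟦_⟧ʳ ρ r → Model s → Model (assume r s)
    assume-model (e :≤ f) s p (ps , qs) = ps , row-holds e f p ∷ qs
    assume-model (e :< f) s p (ps , qs) = ps , row-holds (con 1 :+ e) f p ∷ qs
    assume-model (e :≡ f) s p (ps , qs) = trans (⟦linear⟧ e) (trans p (sym (⟦linear⟧ f))) ∷ ps , qs

    provable-sound : ∀ s r → Model s → T (provable s r) → ⟦_⟧ʳ ρ r
    provable-sound s (e :≤ f) ps t = ≮⇒≥ (λ q → refutes-sound _ (assume-model (f :< e) s q ps) t)
    provable-sound s (e :< f) ps t = ≰⇒> (λ q → refutes-sound _ (assume-model (f :≤ e) s q ps) t)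
    provable-sound s (e :≡ f) ps t with Equivalence.to T-∧ t
    ... | t₁ , t₂ = ≤-antisym (≮⇒≥ (λ q → refutes-sound _ (assume-model (f :< e) s q ps) t₁))
                              (≮⇒≥ (λ q → refutes-sound _ (assume-model (e :< f) s q ps) t₂))
    provable-sound s absurd ps t = refutes-sound s ps t

    check-sound : ∀ s q → Model s → T (check s q) → ⟦_⟧ˢ ρ q
    check-sound s (⊢ r) ps t = provable-sound s r ps t
    check-sound s (r ⇒ q) ps t = λ p → check-sound _ q (assume-model r s p ps) t

  abstract
    -- Hypotheses and goal occur twice, reflected in `f` and as ordinary arguments. If the check
    -- succeeds, the implicit argument has unit type and is inferred. Atoms are arbitrary numbers,
    -- so a product such as `j * suc k` may be one.
    linarith : ∀ {n} (ρ : Vec ℕ n) (f : N-ary n (Expr n) (Sequent n)) →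
               {_ : T (check ([] , []) (f $ⁿ tabulate atom))} → ⟦_⟧ˢ ρ (f $ⁿ tabulate atom)
    linarith ρ f {t} = check-sound ρ ([] , []) (f $ⁿ tabulate atom) ([] , []) t

-- Symmetric functions, determinants and Schur functions of integer vectors.

module SymmetricFunctions where
  open import Data.Nat as ℕ using (ℕ; zero; suc; _≤_; _<_; s≤s)
  open import Data.Integer as ℤ using (ℤ; +_; -[1+_]; 0ℤ; 1ℤ; -1ℤ)
  import Data.Integer.Properties as ℤP
  open import Data.Fin as Fin using (Fin; zero; suc; toℕ; punchIn; pinch)
  open import Data.List using ([]; _∷_; _++_; map; tabulate)
  open import Data.List.Properties using (map-tabulate; ++-assoc; ≡-dec)
  open import Data.List.Relation.Binary.Permutation.Propositional using (_↭_; prep; swap)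
  open import Data.List.Relation.Binary.Permutation.Propositional.Properties using (++-comm; ++⁺ˡ)
  import Data.List.Relation.Binary.Permutation.Propositional as Perm
  open import Data.Bool using (true; false; if_then_else_; T)
  open import Data.Nat.Properties using (≤ᵇ⇒≤; ≤⇒≤ᵇ; ≤-antisym; ≤-trans; ≤-total) renaming (_≟_ to _≟ℕ_)
  open import Data.Product using (_,_)
  open import Data.Sum using (inj₁; inj₂)
  open import Data.Empty using (⊥-elim)
  open import Data.Unit using (tt)
  open import Relation.Nullary.Decidable using (does)
  open import Function using (_∘_; id)
  open import Relation.Binary.PropositionalEquality hiding (setoid)
  open import Algebra.Bundles using (CommutativeRing)
  import Algebra.Properties.CommutativeMonoid.Sum as MonoidSum
  import Algebra.Properties.Semiring.Sum as SemiringSum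
  import Algebra.Properties.CommutativeSemigroup as CSG
  import Algebra.Properties.Ring as RingProperties
  import Data.Integer.Tactic.RingSolver as ℤSolver
  import Data.Fin.Properties as FinP
  import Data.Nat.Properties as ℕP

  pair : (Mono → ℤ) → Λ → ℤ
  pair φ [] = 0ℤ
  pair φ ((c , w) ∷ p) = c ℤ.* φ w ℤ.+ pair φ p

  PermInvariant : (Mono → ℤ) → Set
  PermInvariant φ = ∀ {w v} → w ↭ v → φ w ≡ φ v

  -- Equality of formal sums tested on all linear functionals of commutative monomials;
  -- unlike equality of coefficients it is visibly a congruence for the product.
  infix 4 _≃_
  record _≃_ (p q : Λ) : Set where
    constructor equal
    field pairing : ∀ φ → PermInvariant φ → pair φ p ≡ pair φ q
  open _≃_

  pair-++ : ∀ φ p q → pair φ (p ++ q) ≡ pair φ p ℤ.+ pair φ q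
  pair-++ φ [] q = sym (ℤP.+-identityˡ _)
  pair-++ φ ((c , w) ∷ p) q = trans (cong₂ ℤ._+_ (refl {x = c ℤ.* φ w}) (pair-++ φ p q)) (sym (ℤP.+-assoc (c ℤ.* φ w) (pair φ p) (pair φ q)))

  pair-scale : ∀ φ a p → pair φ (scaleΛ a p) ≡ a ℤ.* pair φ p
  pair-scale φ a [] = sym (ℤP.*-zeroʳ a)
  pair-scale φ a ((c , w) ∷ p) = trans (cong₂ ℤ._+_ (ℤP.*-assoc a c (φ w)) (pair-scale φ a p))
                                       (sym (ℤP.*-distribˡ-+ a (c ℤ.* φ w) (pair φ p)))

  pair-cong : ∀ {φ ψ} → (∀ w → φ w ≡ ψ w) → ∀ p → pair φ p ≡ pair ψ p
  pair-cong e [] = refl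
  pair-cong e ((c , w) ∷ p) = cong₂ ℤ._+_ (cong (c ℤ.*_) (e w)) (pair-cong e p)

  pair-term : ∀ φ c w q → pair φ (map (λ (d , v) → (c ℤ.* d , w ++ v)) q) ≡ c ℤ.* pair (λ v → φ (w ++ v)) q
  pair-term φ c w [] = sym (ℤP.*-zeroʳ c)
  pair-term φ c w ((d , v) ∷ q) = trans (cong₂ ℤ._+_ (ℤP.*-assoc c d (φ (w ++ v))) (pair-term φ c w q))
                                        (sym (ℤP.*-distribˡ-+ c (d ℤ.* φ (w ++ v)) (pair _ q)))

  pair-* : ∀ φ p q → pair φ (p *Λ q) ≡ pair (λ w → pair (λ v → φ (w ++ v)) q) p
  pair-* φ [] q = refl
  pair-* φ ((c , w) ∷ p) q = trans (pair-++ φ (map (λ (d , v) → (c ℤ.* d , w ++ v)) q) (p *Λ q)) (cong₂ ℤ._+_ (pair-term φ c w q) (pair-* φ p q))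

  pair-0 : ∀ p → pair (λ _ → 0ℤ) p ≡ 0ℤ
  pair-0 [] = refl
  pair-0 ((c , w) ∷ p) = trans (cong₂ ℤ._+_ (ℤP.*-zeroʳ c) (pair-0 p)) refl

  pair-linear : ∀ c φ ψ q → pair (λ v → c ℤ.* φ v ℤ.+ ψ v) q ≡ c ℤ.* pair φ q ℤ.+ pair ψ q
  pair-linear c φ ψ [] = sym (trans (cong (ℤ._+ 0ℤ) (ℤP.*-zeroʳ c)) refl)
  pair-linear c φ ψ ((d , v) ∷ q) = trans (cong₂ ℤ._+_ (refl {x = d ℤ.* (c ℤ.* φ v ℤ.+ ψ v)}) (pair-linear c φ ψ q)) (shuffle c d (φ v) (ψ v) (pair φ q) (pair ψ q))
    where
    shuffle : ∀ c d x y p q → d ℤ.* (c ℤ.* x ℤ.+ y) ℤ.+ (c ℤ.* p ℤ.+ q) ≡ c ℤ.* (d ℤ.* x ℤ.+ p) ℤ.+ (d ℤ.* y ℤ.+ q)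
    shuffle = ℤSolver.solve-∀

  pair-fubini : ∀ (F : Mono → Mono → ℤ) p q → pair (λ w → pair (F w) q) p ≡ pair (λ v → pair (λ w → F w v) p) q
  pair-fubini F [] q = sym (pair-0 q)
  pair-fubini F ((c , w) ∷ p) q = trans (cong₂ ℤ._+_ (refl {x = c ℤ.* pair (F w) q}) (pair-fubini F p q))
                                        (sym (pair-linear c (F w) (λ v → pair (λ w → F w v) p) q))

  ≃-refl : ∀ {p} → p ≃ p
  ≃-refl = equal λ φ _ → refl

  ≃-reflexive : ∀ {p q} → p ≡ q → p ≃ q
  ≃-reflexive refl = ≃-refl

  ≃-sym : ∀ {p q} → p ≃ q → q ≃ p
  ≃-sym e = equal λ φ i → sym (pairing e φ i)

  ≃-trans : ∀ {p q r} → p ≃ q → q ≃ r → p ≃ r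
  ≃-trans e f = equal λ φ i → trans (pairing e φ i) (pairing f φ i)

  +Λ-cong : ∀ {p q r s} → p ≃ q → r ≃ s → p +Λ r ≃ q +Λ s
  +Λ-cong {p} {q} {r} {s} e f = equal λ φ i →
    trans (pair-++ φ p r) (trans (cong₂ ℤ._+_ (pairing e φ i) (pairing f φ i)) (sym (pair-++ φ q s)))

  +Λ-comm : ∀ p q → p +Λ q ≃ q +Λ p
  +Λ-comm p q = equal λ φ i → trans (pair-++ φ p q) (trans (ℤP.+-comm (pair φ p) _) (sym (pair-++ φ q p)))

  scaleΛ-cong : ∀ a {p q} → p ≃ q → scaleΛ a p ≃ scaleΛ a q
  scaleΛ-cong a {p} {q} e = equal λ φ i → trans (pair-scale φ a p) (trans (cong (a ℤ.*_) (pairing e φ i)) (sym (pair-scale φ a q)))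

  *Λ-comm : ∀ p q → p *Λ q ≃ q *Λ p
  *Λ-comm p q = equal λ φ i → begin
    pair φ (p *Λ q)                                  ≡⟨ pair-* φ p q ⟩
    pair (λ w → pair (λ v → φ (w ++ v)) q) p         ≡⟨ pair-fubini (λ w v → φ (w ++ v)) p q ⟩
    pair (λ v → pair (λ w → φ (w ++ v)) p) q         ≡⟨ pair-cong (λ v → pair-cong (λ w → i (++-comm w v)) p) q ⟩
    pair (λ v → pair (λ w → φ (v ++ w)) p) q         ≡⟨ pair-* φ q p ⟨
    pair φ (q *Λ p)                                  ∎
    where open ≡-Reasoning

  *Λ-congˡ : ∀ p {q r} → q ≃ r → p *Λ q ≃ p *Λ r
  *Λ-congˡ p {q} {r} e = equal λ φ i → trans (pair-* φ p q)
    (trans (pair-cong (λ w → pairing e (λ v → φ (w ++ v)) (λ s → i (++⁺ˡ w s))) p) (sym (pair-* φ p r)))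

  *Λ-cong : ∀ {p q r s} → p ≃ q → r ≃ s → p *Λ r ≃ q *Λ s
  *Λ-cong {p} {q} {r} {s} e f =
    ≃-trans (*Λ-congˡ p f) (≃-trans (*Λ-comm p s) (≃-trans (*Λ-congˡ s e) (*Λ-comm s q)))

  *Λ-assoc : ∀ p q r → (p *Λ q) *Λ r ≃ p *Λ (q *Λ r)
  *Λ-assoc p q r = equal λ φ i → begin
    pair φ ((p *Λ q) *Λ r)                                                   ≡⟨ pair-* φ (p *Λ q) r ⟩
    pair (λ u → pair (λ x → φ (u ++ x)) r) (p *Λ q)                          ≡⟨ pair-* _ p q ⟩
    pair (λ w → pair (λ v → pair (λ x → φ ((w ++ v) ++ x)) r) q) p           ≡⟨ pair-cong (λ w → pair-cong (λ v → pair-cong (λ x → cong φ (++-assoc w v x)) r) q) p ⟩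
    pair (λ w → pair (λ v → pair (λ x → φ (w ++ (v ++ x))) r) q) p           ≡⟨ pair-cong (λ w → pair-* (λ y → φ (w ++ y)) q r) p ⟨
    pair (λ w → pair (λ y → φ (w ++ y)) (q *Λ r)) p                          ≡⟨ pair-* φ p (q *Λ r) ⟨
    pair φ (p *Λ (q *Λ r))                                                   ∎
    where open ≡-Reasoning

  *Λ-identityˡ : ∀ p → 1Λ *Λ p ≃ p
  *Λ-identityˡ p = equal λ φ i → trans (pair-* φ 1Λ p) (trans (ℤP.+-identityʳ _) (ℤP.*-identityˡ (pair φ p)))

  *Λ-distribʳ : ∀ p q r → (q +Λ r) *Λ p ≃ (q *Λ p) +Λ (r *Λ p)
  *Λ-distribʳ p q r = equal λ φ i → begin
    pair φ ((q +Λ r) *Λ p)                        ≡⟨ pair-* φ (q ++ r) p ⟩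
    pair (λ w → pair (λ v → φ (w ++ v)) p) (q ++ r) ≡⟨ pair-++ _ q r ⟩
    pair _ q ℤ.+ pair _ r                         ≡⟨ cong₂ ℤ._+_ (pair-* φ q p) (pair-* φ r p) ⟨
    pair φ (q *Λ p) ℤ.+ pair φ (r *Λ p)           ≡⟨ pair-++ φ (q *Λ p) (r *Λ p) ⟨
    pair φ ((q *Λ p) +Λ (r *Λ p))                 ∎
    where open ≡-Reasoning

  -Λ_ : Λ → Λ
  -Λ_ = scaleΛ -1ℤ

  pair-neg : ∀ φ p → pair φ (-Λ p) ≡ ℤ.- pair φ p
  pair-neg φ p = trans (pair-scale φ -1ℤ p) (ℤP.-1*i≡-i (pair φ p))

  +Λ-inverseˡ : ∀ p → (-Λ p) +Λ p ≃ 0Λ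
  +Λ-inverseˡ p = equal λ φ i → trans (pair-++ φ (-Λ p) p) (trans (cong (ℤ._+ pair φ p) (pair-neg φ p)) (ℤP.+-inverseˡ (pair φ p)))

  -- The functionals take values in ℤ, where x = - x forces x = 0. This turns a change of sign under
  -- a reflection into vanishing.
  self-negative : ∀ {p} → p ≃ (-Λ p) → p ≃ 0Λ
  self-negative {p} e = equal λ φ i → zeroℤ (pair φ p) (trans (pairing e φ i) (pair-neg φ p))
    where
    zeroℤ : ∀ (x : ℤ) → x ≡ ℤ.- x → x ≡ 0ℤ
    zeroℤ (+ zero) _ = refl

  ΛR : CommutativeRing _ _
  ΛR = record
    { Carrier = Λ ; _≈_ = _≃_ ; _+_ = _+Λ_ ; _*_ = _*Λ_ ; -_ = -Λ_ ; 0# = 0Λ ; 1# = 1Λ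
    ; isCommutativeRing = record
      { isRing = record
        { +-isAbelianGroup = record
          { isGroup = record
            { isMonoid = record
              { isSemigroup = record
                { isMagma = record { isEquivalence = record { refl = ≃-refl ; sym = ≃-sym ; trans = ≃-trans } ; ∙-cong = +Λ-cong }
                ; assoc = λ p q r → ≃-reflexive (++-assoc p q r) }
              ; identity = (λ p → ≃-refl) , (λ p → ≃-trans (+Λ-comm p 0Λ) ≃-refl) }
            ; inverse = +Λ-inverseˡ , (λ p → ≃-trans (+Λ-comm p (-Λ p)) (+Λ-inverseˡ p))
            ; ⁻¹-cong = scaleΛ-cong -1ℤ }
          ; comm = +Λ-comm }
        ; *-cong = *Λ-cong
        ; *-assoc = *Λ-assoc
        ; *-identity = *Λ-identityˡ , (λ p → ≃-trans (*Λ-comm p 1Λ) (*Λ-identityˡ p))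
        ; distrib = (λ p q r → ≃-trans (*Λ-comm p (q +Λ r)) (≃-trans (*Λ-distribʳ p q r) (+Λ-cong (*Λ-comm q p) (*Λ-comm r p)))) , *Λ-distribʳ }
      ; *-comm = *Λ-comm } }

  ≤ᵇ-false : ∀ x y → (x ℕ.≤ᵇ y) ≡ false → y ≤ x
  ≤ᵇ-false x y e with ≤-total x y
  ... | inj₁ x≤y = ⊥-elim (subst T e (≤⇒≤ᵇ {x} {y} x≤y))
  ... | inj₂ y≤x = y≤x

  ≤ᵇ-true : ∀ x y → (x ℕ.≤ᵇ y) ≡ true → x ≤ y
  ≤ᵇ-true x y e = ≤ᵇ⇒≤ x y (subst T (sym e) tt)

  insertℕ-comm : ∀ x y xs → insertℕ x (insertℕ y xs) ≡ insertℕ y (insertℕ x xs)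
  insertℕ-comm x y [] with x ℕ.≤ᵇ y in e | y ℕ.≤ᵇ x in f
  ... | true | true = cong₂ (λ a b → a ∷ b ∷ []) (≤-antisym (≤ᵇ-true x y e) (≤ᵇ-true y x f)) (≤-antisym (≤ᵇ-true y x f) (≤ᵇ-true x y e))
  ... | true | false = refl
  ... | false | true = refl
  ... | false | false = cong₂ (λ a b → a ∷ b ∷ []) (≤-antisym (≤ᵇ-false x y e) (≤ᵇ-false y x f)) (≤-antisym (≤ᵇ-false y x f) (≤ᵇ-false x y e))
  insertℕ-comm x y (z ∷ zs) with y ℕ.≤ᵇ z in yz | x ℕ.≤ᵇ z in xz
  ... | true | true with x ℕ.≤ᵇ y in e | y ℕ.≤ᵇ x in f
  ...   | true | true = cong₂ (λ a b → a ∷ b ∷ z ∷ zs) (≤-antisym (≤ᵇ-true x y e) (≤ᵇ-true y x f)) (≤-antisym (≤ᵇ-true y x f) (≤ᵇ-true x y e))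
  ...   | true | false rewrite yz = refl
  ...   | false | true rewrite xz = refl
  ...   | false | false = ⊥-elim (subst T e (≤⇒≤ᵇ {x} {y} (≤ᵇ-false y x f)))
  insertℕ-comm x y (z ∷ zs) | true | false with x ℕ.≤ᵇ y in e
  ... | true = ⊥-elim (subst T xz (≤⇒≤ᵇ {x} {z} (≤-trans (≤ᵇ-true x y e) (≤ᵇ-true y z yz))))
  ... | false rewrite xz | yz = refl
  insertℕ-comm x y (z ∷ zs) | false | true with y ℕ.≤ᵇ x in f
  ... | true = ⊥-elim (subst T yz (≤⇒≤ᵇ {y} {z} (≤-trans (≤ᵇ-true y x f) (≤ᵇ-true x z xz))))
  ... | false rewrite xz | yz = refl
  insertℕ-comm x y (z ∷ zs) | false | false rewrite xz | yz = cong (z ∷_) (insertℕ-comm x y zs)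

  sortℕ-↭ : ∀ {w v} → w ↭ v → sortℕ w ≡ sortℕ v
  sortℕ-↭ Perm.refl = refl
  sortℕ-↭ (prep x s) = cong (insertℕ x) (sortℕ-↭ s)
  sortℕ-↭ (swap {ys = v} x y s) = trans (cong (insertℕ x ∘ insertℕ y) (sortℕ-↭ s)) (insertℕ-comm x y (sortℕ v))
  sortℕ-↭ (Perm.trans s t) = trans (sortℕ-↭ s) (sortℕ-↭ t)

  coeff-pair : ∀ p μ → coeff p μ ≡ pair (λ w → if does (≡-dec _≟ℕ_ (sortℕ w) μ) then 1ℤ else 0ℤ) p
  coeff-pair [] μ = refl
  coeff-pair ((c , w) ∷ p) μ with does (≡-dec _≟ℕ_ (sortℕ w) μ)
  ... | true = cong₂ ℤ._+_ (sym (ℤP.*-identityʳ c)) (coeff-pair p μ)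
  ... | false = trans (coeff-pair p μ) (sym (trans (cong (ℤ._+ _) (ℤP.*-zeroʳ c)) (ℤP.+-identityˡ _)))

  -- Reading off the coefficient of μ is one of the tested functionals: whether `sortℕ w` is μ does
  -- not depend on the order of w.
  ≃⇒≈Λ : ∀ {p q} → p ≃ q → p ≈Λ q
  ≃⇒≈Λ {p} {q} e μ = trans (coeff-pair p μ) (trans
    (pairing e _ (λ s → cong (λ u → if does (≡-dec _≟ℕ_ u μ) then 1ℤ else 0ℤ) (sortℕ-↭ s))) (sym (coeff-pair q μ)))

  -- Two distinct columns are coded by the first one, j, and the position b of the other after j is
  -- deleted. The pair (`punchIn j b` , `pinch b j`) codes the same columns in the opposite order.
  punchIn-exchange : ∀ {n} (j : Fin (suc n)) (b : Fin n) → punchIn (punchIn j b) (pinch b j) ≡ j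
  punchIn-exchange {suc n} zero b = refl
  punchIn-exchange (suc j) zero = refl
  punchIn-exchange (suc j) (suc b) = cong suc (punchIn-exchange j b)

  punchIn-punchIn : ∀ {n} (j : Fin (suc (suc n))) (b : Fin (suc n)) (x : Fin n) →
    punchIn (punchIn j b) (punchIn (pinch b j) x) ≡ punchIn j (punchIn b x)
  punchIn-punchIn zero b x = refl
  punchIn-punchIn (suc j) zero x = refl
  punchIn-punchIn (suc j) (suc b) zero = refl
  punchIn-punchIn (suc j) (suc b) (suc x) = cong suc (punchIn-punchIn j b x)

  exchange01 : ∀ {n} → Fin n → Fin n
  exchange01 {suc (suc n)} zero = suc zero
  exchange01 {suc (suc n)} (suc zero) = zero
  exchange01 x = x

  -- Exchanges z and z + 1; the identity if z + 1 is out of range.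
  transposition : ∀ {n} → ℕ → Fin n → Fin n
  transposition zero x = exchange01 x
  transposition (suc z) zero = zero
  transposition (suc z) (suc x) = suc (transposition z x)

  module Determinant {c ℓ} (𝓡 : CommutativeRing c ℓ) where
    open CommutativeRing 𝓡 hiding (refl; sym; trans; zero)
    private
      module ≈ = CommutativeRing 𝓡
    open MonoidSum +-commutativeMonoid using (sum-cong-≋; ∑-distrib-+) renaming (sum to ∑)
    open SemiringSum semiring using (*-distribˡ-sum)
    open CSG +-commutativeSemigroup using () renaming (x∙yz≈y∙xz to +-leftComm)
    open CSG *-commutativeSemigroup using () renaming (x∙yz≈y∙xz to *-leftComm)
    open RingProperties ring using (-‿distribˡ-*; -‿distribʳ-*; -‿involutive; -0#≈0#; -‿+-comm)
    open import Relation.Binary.Reasoning.Setoid setoid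

    sgn : ℕ → Carrier
    sgn zero = 1#
    sgn (suc n) = - sgn n

    minor : ∀ {n} → (Fin (suc n) → Fin (suc n) → Carrier) → Fin (suc n) → Fin n → Fin n → Carrier
    minor M j a b = M (suc a) (punchIn j b)

    determinant : (n : ℕ) → (Fin n → Fin n → Carrier) → Carrier
    determinant zero M = 1#
    determinant (suc n) M = ∑ (λ j → sgn (toℕ j) * (M zero j * determinant n (minor M j)))

    determinant-cong : ∀ n {M N : Fin n → Fin n → Carrier} → (∀ i j → M i j ≈ N i j) → determinant n M ≈ determinant n N
    determinant-cong zero e = ≈.refl
    determinant-cong (suc n) e = sum-cong-≋ λ j →
      *-congˡ {sgn (toℕ j)} (*-cong (e zero j) (determinant-cong n (λ a b → e (suc a) (punchIn j b))))

    ∑-0 : ∀ {n} {f : Fin n → Carrier} → (∀ i → f i ≈ 0#) → ∑ f ≈ 0#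
    ∑-0 {zero} e = ≈.refl
    ∑-0 {suc n} e = ≈.trans (+-cong (e zero) (∑-0 (λ i → e (suc i)))) (+-identityˡ 0#)

    ∑-neg : ∀ {n} (f : Fin n → Carrier) → ∑ (λ i → - f i) ≈ - ∑ f
    ∑-neg {zero} f = ≈.sym -0#≈0#
    ∑-neg {suc n} f = ≈.trans (+-congˡ (∑-neg (λ i → f (suc i)))) (-‿+-comm (f zero) _)

    determinant-zeroRow : ∀ n (M : Fin n → Fin n → Carrier) i → (∀ j → M i j ≈ 0#) → determinant n M ≈ 0#
    determinant-zeroRow (suc n) M zero e = ∑-0 λ j →
      ≈.trans (*-congˡ {sgn (toℕ j)} (≈.trans (*-congʳ {determinant n (minor M j)} (e j)) (zeroˡ (determinant n (minor M j))))) (zeroʳ (sgn (toℕ j)))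
    determinant-zeroRow (suc n) M (suc i) e = ∑-0 λ j →
      ≈.trans (*-congˡ {sgn (toℕ j)} (≈.trans (*-congˡ {M zero j} (determinant-zeroRow n (minor M j) i (λ b → e (punchIn j b)))) (zeroʳ (M zero j)))) (zeroʳ (sgn (toℕ j)))

    -- Pairs of distinct columns (j , punchIn j b) are reindexed by exchanging the two columns.
    ∑∑-exchange : ∀ {n} (f : Fin (suc n) → Fin n → Carrier) →
      ∑ (λ j → ∑ (f j)) ≈ ∑ (λ j → ∑ (λ b → f (punchIn j b) (pinch b j)))
    ∑∑-exchange {zero} f = ≈.refl
    ∑∑-exchange {suc n} f = begin
      ∑ (f zero) + ∑ (λ j → f (suc j) zero + ∑ (λ b → f (suc j) (suc b)))
        ≈⟨ +-congˡ (∑-distrib-+ (λ j → f (suc j) zero) (λ j → ∑ (λ b → f (suc j) (suc b)))) ⟩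
      ∑ (f zero) + (∑ (λ j → f (suc j) zero) + ∑ (λ j → ∑ (λ b → f (suc j) (suc b))))
        ≈⟨ +-leftComm (∑ (f zero)) (∑ (λ j → f (suc j) zero)) _ ⟩
      ∑ (λ j → f (suc j) zero) + (∑ (f zero) + ∑ (λ j → ∑ (λ b → f (suc j) (suc b))))
        ≈⟨ +-congˡ (+-congˡ (∑∑-exchange (λ j b → f (suc j) (suc b)))) ⟩
      ∑ (λ j → f (suc j) zero) + (∑ (f zero) + ∑ (λ j → ∑ (λ b → f (suc (punchIn j b)) (suc (pinch b j)))))
        ≈⟨ +-congˡ (∑-distrib-+ (f zero) (λ j → ∑ (λ b → f (suc (punchIn j b)) (suc (pinch b j))))) ⟨
      ∑ (λ j → f (suc j) zero) + ∑ (λ j → f zero j + ∑ (λ b → f (suc (punchIn j b)) (suc (pinch b j)))) ∎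

    -- Deleting one of two columns lowers the index of the other exactly when the other is the later
    -- one. Reversing the order of deletion thus changes the parity of the sum of the two indices.
    sgn-exchange : ∀ {n} (j : Fin (suc n)) (b : Fin n) →
      sgn (toℕ (punchIn j b)) * sgn (toℕ (pinch b j)) ≈ - (sgn (toℕ j) * sgn (toℕ b))
    sgn-exchange {suc n} zero b = ≈.trans (*-identityʳ _) (-‿cong (≈.sym (*-identityˡ _)))
    sgn-exchange (suc j) zero = ≈.trans (*-identityˡ _) (≈.sym (≈.trans (-‿cong (*-identityʳ _)) (-‿involutive _)))
    sgn-exchange (suc j) (suc b) = ≈.trans (cancel _ _) (≈.trans (sgn-exchange j b) (-‿cong (≈.sym (cancel _ _))))
      where
      cancel : ∀ x y → - x * - y ≈ x * y
      cancel x y = ≈.trans (≈.sym (-‿distribˡ-* x (- y))) (≈.trans (-‿cong (≈.sym (-‿distribʳ-* x y))) (-‿involutive (x * y)))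

    module TwoRows (n : ℕ) where
      weight : (N : Fin n → Fin (suc (suc n)) → Carrier) → Fin (suc (suc n)) → Fin (suc n) → Carrier
      weight N j b = determinant n (λ a x → N a (punchIn j (punchIn b x)))

      term : (u v : Fin (suc (suc n)) → Carrier) (N : Fin n → Fin (suc (suc n)) → Carrier) → Fin (suc (suc n)) → Fin (suc n) → Carrier
      term u v N j b = (sgn (toℕ j) * sgn (toℕ b)) * (u j * (v (punchIn j b) * weight N j b))

      expand : ∀ M → determinant (suc (suc n)) M ≈ ∑ (λ j → ∑ (term (M zero) (M (suc zero)) (λ a → M (suc (suc a))) j))
      expand M = sum-cong-≋ row
        where
        N : Fin n → Fin (suc (suc n)) → Carrier
        N a = M (suc (suc a))
        row : ∀ j → sgn (toℕ j) * (M zero j * determinant (suc n) (minor M j)) ≈ ∑ (term (M zero) (M (suc zero)) N j)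
        row j = begin
          sgn (toℕ j) * (M zero j * ∑ inner)                         ≈⟨ *-congˡ (*-distribˡ-sum (M zero j) inner) ⟩
          sgn (toℕ j) * ∑ (λ b → M zero j * inner b)                 ≈⟨ *-distribˡ-sum (sgn (toℕ j)) (λ b → M zero j * inner b) ⟩
          ∑ (λ b → sgn (toℕ j) * (M zero j * inner b))               ≈⟨ sum-cong-≋ {suc n} (λ b → ≈.trans
            (*-congˡ (*-leftComm (M zero j) (sgn (toℕ b)) (M (suc zero) (punchIn j b) * weight N j b)))
            (≈.sym (*-assoc (sgn (toℕ j)) (sgn (toℕ b)) (M zero j * (M (suc zero) (punchIn j b) * weight N j b))))) ⟩
          ∑ (term (M zero) (M (suc zero)) N j)                       ∎
          where
          inner : Fin (suc n) → Carrier
          inner b = sgn (toℕ b) * (M (suc zero) (punchIn j b) * weight N j b)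

      term-exchange : ∀ u v N j b → term u v N (punchIn j b) (pinch b j) ≈ - term v u N j b
      term-exchange u v N j b = begin
        term u v N (punchIn j b) (pinch b j)
          ≈⟨ *-cong (sgn-exchange j b) (*-congˡ (*-cong (reflexive (cong v (punchIn-exchange j b)))
               (determinant-cong n (λ a x → reflexive (cong (N a) (punchIn-punchIn j b x)))))) ⟩
        - (sgn (toℕ j) * sgn (toℕ b)) * (u (punchIn j b) * (v j * weight N j b))
          ≈⟨ *-congˡ (*-leftComm (u (punchIn j b)) (v j) _) ⟩
        - (sgn (toℕ j) * sgn (toℕ b)) * (v j * (u (punchIn j b) * weight N j b))
          ≈⟨ -‿distribˡ-* (sgn (toℕ j) * sgn (toℕ b)) _ ⟨
        - term v u N j b ∎

      swap-rows : ∀ u v N → ∑ (λ j → ∑ (term u v N j)) ≈ - ∑ (λ j → ∑ (term v u N j))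
      swap-rows u v N = ≈.trans (∑∑-exchange (term u v N)) (≈.trans (sum-cong-≋ λ j →
        ≈.trans (sum-cong-≋ (term-exchange u v N j)) (∑-neg (term v u N j))) (∑-neg (λ j → ∑ (term v u N j))))

    determinant-transposition : ∀ n z → suc z < n → (M N : Fin n → Fin n → Carrier) →
      (∀ i j → N i j ≈ M (transposition z i) j) → determinant n N ≈ - determinant n M
    determinant-transposition (suc (suc n)) zero _ M N e = ≈.trans (TwoRows.expand n N) (≈.trans
      (TwoRows.swap-rows n (N zero) (N (suc zero)) (λ a → N (suc (suc a))))
      (-‿cong (≈.trans (≈.sym (TwoRows.expand n N′)) (determinant-cong (suc (suc n)) N′≈M))))
      where
      N′ : Fin (suc (suc n)) → Fin (suc (suc n)) → Carrier
      N′ zero = N (suc zero)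
      N′ (suc zero) = N zero
      N′ (suc (suc a)) = N (suc (suc a))
      N′≈M : ∀ i j → N′ i j ≈ M i j
      N′≈M zero j = e (suc zero) j
      N′≈M (suc zero) j = e zero j
      N′≈M (suc (suc a)) j = e (suc (suc a)) j
    determinant-transposition (suc n) (suc z) (s≤s z<n) M N e = ≈.trans (sum-cong-≋ λ j → begin
        sgn (toℕ j) * (N zero j * determinant n (minor N j))
          ≈⟨ *-congˡ (*-cong (e zero j) (determinant-transposition n z z<n (minor M j) (minor N j) (λ a b → e (suc a) (punchIn j b)))) ⟩
        sgn (toℕ j) * (M zero j * - determinant n (minor M j))
          ≈⟨ *-congˡ (-‿distribʳ-* (M zero j) _) ⟨
        sgn (toℕ j) * - (M zero j * determinant n (minor M j))
          ≈⟨ -‿distribʳ-* (sgn (toℕ j)) _ ⟨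
        - (sgn (toℕ j) * (M zero j * determinant n (minor M j))) ∎)
      (∑-neg (λ j → sgn (toℕ j) * (M zero j * determinant n (minor M j))))

  module R = CommutativeRing ΛR
  open Determinant ΛR using (determinant; determinant-cong; determinant-zeroRow; determinant-transposition; sgn; minor)
  open MonoidSum R.+-commutativeMonoid using (sum-cong-≋) renaming (sum to ∑)

  sumΛ-tabulate : ∀ {n} (f : Fin n → Λ) → sumΛ (tabulate f) ≡ ∑ f
  sumΛ-tabulate {zero} f = refl
  sumΛ-tabulate {suc n} f = cong (f zero ++_) (sumΛ-tabulate (λ i → f (suc i)))

  scaleΛ-sign : ∀ n p → scaleΛ (sign n) p ≃ sgn n *Λ p
  scaleΛ-sign zero p = ≃-trans (equal λ φ i → trans (pair-scale φ 1ℤ p) (ℤP.*-identityˡ _)) (≃-sym (*Λ-identityˡ p))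
  scaleΛ-sign (suc n) p = equal λ φ i → begin
    pair φ (scaleΛ (ℤ.- sign n) p)       ≡⟨ pair-scale φ (ℤ.- sign n) p ⟩
    ℤ.- sign n ℤ.* pair φ p              ≡⟨ ℤP.neg-distribˡ-* (sign n) (pair φ p) ⟨
    ℤ.- (sign n ℤ.* pair φ p)            ≡⟨ cong ℤ.-_ (pair-scale φ (sign n) p) ⟨
    ℤ.- pair φ (scaleΛ (sign n) p)       ≡⟨ cong ℤ.-_ (pairing (scaleΛ-sign n p) φ i) ⟩
    ℤ.- pair φ (sgn n *Λ p)              ≡⟨ pair-neg φ (sgn n *Λ p) ⟨
    pair φ (-Λ (sgn n *Λ p))             ≡⟨ pairing (-‿distribˡ-* (sgn n) p) φ i ⟩
    pair φ (sgn (suc n) *Λ p)            ∎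
    where
    open ≡-Reasoning
    open RingProperties R.ring using (-‿distribˡ-*)

  det≃determinant : ∀ n M → det n M ≃ determinant n M
  det≃determinant zero M = ≃-refl
  det≃determinant (suc n) M = ≃-trans (≃-reflexive (trans (cong sumΛ (map-tabulate id term)) (sumΛ-tabulate term)))
    (sum-cong-≋ λ j → ≃-trans (scaleΛ-sign (toℕ j) (M zero j *Λ det n (minor M j)))
      (*Λ-congˡ (sgn (toℕ j)) (*Λ-congˡ (M zero j) (det≃determinant n (minor M j)))))
    where
    term : Fin (suc n) → Λ
    term j = scaleΛ (sign (toℕ j)) (M zero j *Λ det n (minor M j))

  jacobiTrudi : ∀ ℓ → (Fin ℓ → ℤ) → Fin ℓ → Fin ℓ → Λ
  jacobiTrudi ℓ γ i j = h (γ i ℤ.+ + toℕ j ℤ.- + toℕ i)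

  schur-cong : ∀ ℓ {γ δ : Fin ℓ → ℤ} → (∀ x → γ x ≡ δ x) → schur ℓ γ ≃ schur ℓ δ
  schur-cong ℓ {γ} {δ} e = ≃-trans (det≃determinant ℓ (jacobiTrudi ℓ γ)) (≃-trans
    (determinant-cong ℓ (λ i j → ≃-reflexive (cong (λ a → h (a ℤ.+ + toℕ j ℤ.- + toℕ i)) (e i))))
    (≃-sym (det≃determinant ℓ (jacobiTrudi ℓ δ))))

  -- Row i of the Jacobi-Trudi matrix depends on γ only through γ_i - i. The hypothesis is the dot
  -- action of an adjacent transposition, which exchanges two rows of the matrix.
  schur-transposition : ∀ ℓ z → suc z < ℓ → (γ δ : Fin ℓ → ℤ) →
    (∀ x → δ x ℤ.- + toℕ x ≡ γ (transposition z x) ℤ.- + toℕ (transposition z x)) → schur ℓ δ ≃ (-Λ schur ℓ γ)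
  schur-transposition ℓ z z<ℓ γ δ e = ≃-trans (det≃determinant ℓ (jacobiTrudi ℓ δ)) (≃-trans
    (determinant-transposition ℓ z z<ℓ (jacobiTrudi ℓ γ) (jacobiTrudi ℓ δ) λ i j → ≃-reflexive (cong h
      (trans (regroup (δ i) (+ toℕ j) (+ toℕ i)) (trans (cong (ℤ._+ + toℕ j) (e i))
        (sym (regroup (γ (transposition z i)) (+ toℕ j) (+ toℕ (transposition z i))))))))
    (scaleΛ-cong -1ℤ (≃-sym (det≃determinant ℓ (jacobiTrudi ℓ γ)))))
    where
    regroup : ∀ a j i → a ℤ.+ j ℤ.- i ≡ (a ℤ.- i) ℤ.+ j
    regroup = ℤSolver.solve-∀

  h-negative : ∀ i → i ℤ.< 0ℤ → h i ≡ 0Λ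
  h-negative -[1+ n ] _ = refl
  h-negative (+ n) (ℤ.+<+ ())

  -- The last row has entries of index γ_i + j - i with j ≤ i, all negative.
  schur-negative : ∀ ℓ (γ : Fin ℓ → ℤ) i → suc (toℕ i) ≡ ℓ → γ i ℤ.< 0ℤ → schur ℓ γ ≃ 0Λ
  schur-negative ℓ γ i e neg = ≃-trans (det≃determinant ℓ (jacobiTrudi ℓ γ))
    (determinant-zeroRow ℓ (jacobiTrudi ℓ γ) i λ j → ≃-reflexive (h-negative _ (bound j)))
    where
    bound : ∀ j → γ i ℤ.+ + toℕ j ℤ.- + toℕ i ℤ.< 0ℤ
    bound j = subst (ℤ._< 0ℤ) (sym (ℤP.+-assoc (γ i) (+ toℕ j) (ℤ.- + toℕ i)))
      (subst (γ i ℤ.+ (+ toℕ j ℤ.- + toℕ i) ℤ.<_) (ℤP.+-identityʳ 0ℤ) (ℤP.+-mono-<-≤ neg (ℤP.i≤j⇒i-j≤0 (ℤ.+≤+ (ℕP.≤-pred (subst (toℕ j <_) (sym e) (FinP.toℕ<n j)))))))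

-- The series H as an iterated geometric series of raising operators.

module RaisingSeries where
  open import Data.Nat as ℕ using (ℕ; zero; suc; _≤_; _<_; _+_; _∸_; s≤s; z≤n)
  open import Data.Nat.Properties using (≤-trans; <-irrefl)
  open import Data.Integer as ℤ using (ℤ; +_; 0ℤ; -1ℤ)
  import Data.Integer.Properties as ℤP
  import Data.Integer.Tactic.RingSolver as ℤSolver
  open import Data.Fin as Fin using (Fin; zero; suc; toℕ)
  open import Data.Fin.Properties using (toℕ<n) renaming (_≟_ to _≟F_)
  open import Data.List using (List; []; _∷_; map; applyUpTo; filterᵇ)
  open import Data.List.Properties using (map-applyUpTo)
  open import Data.List.Membership.Propositional using (_∈_)
  open import Data.List.Membership.Propositional.Properties using (∈-filter⁺; ∈-filter⁻)
  open import Data.List.Membership.Propositional.Properties.WithK using (unique∧set⇒bag)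
  open import Data.List.Relation.Unary.All as All using (All; []; _∷_)
  open import Data.List.Relation.Unary.Unique.Propositional using (Unique)
  open import Data.List.Relation.Binary.BagAndSetEquality using (∼bag⇒↭)
  open import Data.List.Relation.Binary.Permutation.Propositional using (_↭_; prep; swap)
  import Data.List.Relation.Binary.Permutation.Propositional as Perm
  open import Data.Bool using (Bool; true; false; if_then_else_; T; T?)
  open import Data.Product using (_×_; _,_)
  open import Function using (_∘_; id)
  open import Function.Bundles using (mk⇔)
  open import Relation.Nullary using (yes; no; does)
  open import Relation.Nullary.Decidable using (dec-true; dec-false)
  open import Relation.Binary.PropositionalEquality
  import Algebra.Properties.CommutativeSemigroup as CSG
  open SymmetricFunctions

  open CSG R.+-commutativeSemigroup using () renaming (interchange to +Λ-interchange)

  unique-↭ : ∀ {A : Set} {xs ys : List A} → Unique xs → Unique ys → (∀ {x} → x ∈ xs → x ∈ ys) → (∀ {x} → x ∈ ys → x ∈ xs) → xs ↭ ys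
  unique-↭ u v f g = ∼bag⇒↭ (unique∧set⇒bag u v (mk⇔ f g))

  ∈-filterᵇ⁺ : ∀ {A : Set} (p : A → Bool) {x xs} → x ∈ xs → T (p x) → x ∈ filterᵇ p xs
  ∈-filterᵇ⁺ p = ∈-filter⁺ (T? ∘ p)

  ∈-filterᵇ⁻ : ∀ {A : Set} (p : A → Bool) {x} xs → x ∈ filterᵇ p xs → x ∈ xs × T (p x)
  ∈-filterᵇ⁻ p xs = ∈-filter⁻ (T? ∘ p) {xs = xs}

  infix 4 _≋_
  _≋_ : Series → Series → Set
  f ≋ g = ∀ d → f d ≃ g d

  infixl 6 _⊕_
  _⊕_ : Series → Series → Series
  (f ⊕ g) d = f d +Λ g d

  0S : Series
  0S _ = 0Λ

  negS : Series → Series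
  negS f d = -Λ f d

  ≋-refl : ∀ {f} → f ≋ f
  ≋-refl d = ≃-refl

  ≋-sym : ∀ {f g} → f ≋ g → g ≋ f
  ≋-sym e d = ≃-sym (e d)

  ≋-trans : ∀ {f g h} → f ≋ g → g ≋ h → f ≋ h
  ≋-trans e e′ d = ≃-trans (e d) (e′ d)

  ⊕-cong : ∀ {f g f′ g′} → f ≋ g → f′ ≋ g′ → f ⊕ f′ ≋ g ⊕ g′
  ⊕-cong e e′ d = +Λ-cong (e d) (e′ d)

  ⊕-identityʳ : ∀ {f g} → g ≋ 0S → f ⊕ g ≋ f
  ⊕-identityʳ {f} {g} e d = ≃-trans (+Λ-cong (≃-refl {f d}) (e d)) (R.+-identityʳ (f d))

  ⊕-identityˡ : ∀ {f g} → f ≋ 0S → f ⊕ g ≋ g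
  ⊕-identityˡ {f} {g} e d = +Λ-cong (e d) (≃-refl {g d})

  tShift-cong : ∀ s {f g} → f ≋ g → tShift s f ≋ tShift s g
  tShift-cong s e d with s ℕ.≤ᵇ d
  ... | true = e (d ∸ s)
  ... | false = ≃-refl

  tShift-suc : ∀ s f → tShift (suc s) f ≋ tShift 1 (tShift s f)
  tShift-suc zero f zero = ≃-refl
  tShift-suc (suc s) f zero = ≃-refl
  tShift-suc zero f (suc d) = ≃-refl
  tShift-suc (suc s) f (suc d) = ≃-refl

  tShift-+ : ∀ r s f → tShift (r + s) f ≋ tShift r (tShift s f)
  tShift-+ zero s f = ≋-refl
  tShift-+ (suc r) s f = ≋-trans (tShift-suc (r + s) f) (≋-trans (tShift-cong 1 (tShift-+ r s f)) (≋-sym (tShift-suc r (tShift s f))))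

  tShift-0S : ∀ s {f} → f ≋ 0S → tShift s f ≋ 0S
  tShift-0S s e d with s ℕ.≤ᵇ d
  ... | true = e (d ∸ s)
  ... | false = ≃-refl

  Roots : ℕ → Set
  Roots ℓ = List (Fin ℓ × Fin ℓ)

  sumTo : ℕ → (ℕ → Λ) → Λ
  sumTo n f = sumΛ (applyUpTo f n)

  sumTo-cong : ∀ n {f g : ℕ → Λ} → (∀ a → f a ≃ g a) → sumTo n f ≃ sumTo n g
  sumTo-cong zero e = ≃-refl
  sumTo-cong (suc n) e = +Λ-cong (e 0) (sumTo-cong n (λ a → e (suc a)))

  sumTo-neg : ∀ n (f : ℕ → Λ) → sumTo n (λ a → -Λ f a) ≃ (-Λ sumTo n f)
  sumTo-neg zero f = ≃-refl
  sumTo-neg (suc n) f = ≃-trans (+Λ-cong (≃-refl { -Λ f 0}) (sumTo-neg n (f ∘ suc))) (-‿+-comm (f 0) (sumTo n (f ∘ suc)))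
    where
    open import Algebra.Properties.Ring R.ring using (-‿+-comm)

  sumTo-0 : ∀ n {f : ℕ → Λ} → (∀ a → f a ≃ 0Λ) → sumTo n f ≃ 0Λ
  sumTo-0 zero e = ≃-refl
  sumTo-0 (suc n) e = +Λ-cong (e 0) (sumTo-0 n (λ a → e (suc a)))

  Hcoef-cons : ∀ {ℓ} i j (Ψ : Roots ℓ) γ d → Hcoef ((i , j) ∷ Ψ) γ d ≡ sumTo (suc d) (λ a → Hcoef Ψ (raise i j a γ) (d ∸ a))
  Hcoef-cons i j Ψ γ d = cong sumΛ (map-applyUpTo id _ (suc d))

  raise-cong : ∀ {ℓ} (i j : Fin ℓ) a {γ δ} → (∀ x → γ x ≡ δ x) → ∀ x → raise i j a γ x ≡ raise i j a δ x
  raise-cong i j a e x = cong (λ y → y ℤ.+ _ ℤ.- _) (e x)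

  Hcoef-cong : ∀ {ℓ} (Ψ : Roots ℓ) {γ δ} → (∀ x → γ x ≡ δ x) → Hcoef Ψ γ ≋ Hcoef Ψ δ
  Hcoef-cong [] e zero = schur-cong _ e
  Hcoef-cong [] e (suc d) = ≃-refl
  Hcoef-cong ((i , j) ∷ Ψ) {γ} {δ} e d = ≃-trans (≃-reflexive (Hcoef-cons i j Ψ γ d)) (≃-trans
    (sumTo-cong (suc d) (λ a → Hcoef-cong Ψ (raise-cong i j a e) (d ∸ a)))
    (≃-reflexive (sym (Hcoef-cons i j Ψ δ d))))

  select-+ : ∀ (b : Bool) m n → (if b then + (m + n) else 0ℤ) ≡ (if b then + m else 0ℤ) ℤ.+ (if b then + n else 0ℤ)
  select-+ true m n = ℤP.pos-+ m n
  select-+ false m n = refl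

  raise-raise : ∀ {ℓ} (i j : Fin ℓ) m n γ x → raise i j (m + n) γ x ≡ raise i j n (raise i j m γ) x
  raise-raise i j m n γ x = trans (cong₂ (λ u v → γ x ℤ.+ u ℤ.- v) (select-+ (does (x ≟F i)) m n) (select-+ (does (x ≟F j)) m n))
    (regroup (γ x) (if does (x ≟F i) then + m else 0ℤ) _ (if does (x ≟F j) then + m else 0ℤ) _)
    where
    regroup : ∀ g a b c d → g ℤ.+ (a ℤ.+ b) ℤ.- (c ℤ.+ d) ≡ g ℤ.+ a ℤ.- c ℤ.+ b ℤ.- d
    regroup = ℤSolver.solve-∀

  raise-comm : ∀ {ℓ} (i j i′ j′ : Fin ℓ) m n γ x → raise i j m (raise i′ j′ n γ) x ≡ raise i′ j′ n (raise i j m γ) x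
  raise-comm i j i′ j′ m n γ x = regroup (γ x) (if does (x ≟F i) then + m else 0ℤ) _ (if does (x ≟F i′) then + n else 0ℤ) _
    where
    regroup : ∀ g a b c d → g ℤ.+ c ℤ.- d ℤ.+ a ℤ.- b ≡ g ℤ.+ a ℤ.- b ℤ.+ c ℤ.- d
    regroup = ℤSolver.solve-∀

  raise-zero : ∀ {ℓ} (i j : Fin ℓ) γ x → raise i j 0 γ x ≡ γ x
  raise-zero i j γ x with does (x ≟F i) | does (x ≟F j)
  ... | true | true = trans (ℤP.+-identityʳ _) (ℤP.+-identityʳ _)
  ... | true | false = trans (ℤP.+-identityʳ _) (ℤP.+-identityʳ _)
  ... | false | true = trans (ℤP.+-identityʳ _) (ℤP.+-identityʳ _)
  ... | false | false = trans (ℤP.+-identityʳ _) (ℤP.+-identityʳ _)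

  -- The identity 1/(1 - t R) = 1 + t R/(1 - t R) for the raising operator R of (i , j).
  Hcoef-root : ∀ {ℓ} i j (Ψ : Roots ℓ) γ →
    Hcoef ((i , j) ∷ Ψ) γ ≋ Hcoef Ψ γ ⊕ tShift 1 (Hcoef ((i , j) ∷ Ψ) (raise i j 1 γ))
  Hcoef-root i j Ψ γ zero = ≃-trans (≃-reflexive (Hcoef-cons i j Ψ γ 0))
    (+Λ-cong (Hcoef-cong Ψ (raise-zero i j γ) 0) (≃-refl {0Λ}))
  Hcoef-root i j Ψ γ (suc d) = ≃-trans (≃-reflexive (Hcoef-cons i j Ψ γ (suc d)))
    (+Λ-cong (Hcoef-cong Ψ (raise-zero i j γ) (suc d))
      (≃-trans (sumTo-cong (suc d) (λ a → Hcoef-cong Ψ (raise-raise i j 1 a γ) (d ∸ a)))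
               (≃-reflexive (sym (Hcoef-cons i j Ψ (raise i j 1 γ) d)))))

  Hcoef-prep : ∀ {ℓ} α (Ψ Φ : Roots ℓ) → (∀ γ → Hcoef Ψ γ ≋ Hcoef Φ γ) → ∀ γ → Hcoef (α ∷ Ψ) γ ≋ Hcoef (α ∷ Φ) γ
  Hcoef-prep (i , j) Ψ Φ e γ d = ≃-trans (≃-reflexive (Hcoef-cons i j Ψ γ d)) (≃-trans
    (sumTo-cong (suc d) (λ a → e (raise i j a γ) (d ∸ a))) (≃-reflexive (sym (Hcoef-cons i j Φ γ d))))

  -- Induction on the degree in t: after `Hcoef-root` for both factors, products of the two
  -- geometric series occur only in lower degree, where their order may be changed.
  Hcoef-swap : ∀ {ℓ} (α β : Fin ℓ × Fin ℓ) (Ψ : Roots ℓ) d γ → Hcoef (α ∷ β ∷ Ψ) γ d ≃ Hcoef (β ∷ α ∷ Ψ) γ d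
  Hcoef-swap α@(i , j) β@(i′ , j′) Ψ zero γ = ≃-trans (first α β) (≃-sym (first β α))
    where
    first : ∀ α β → Hcoef (α ∷ β ∷ Ψ) γ 0 ≃ Hcoef Ψ γ 0
    first (i , j) (i′ , j′) = ≃-trans (Hcoef-root i j ((i′ , j′) ∷ Ψ) γ 0) (≃-trans (R.+-identityʳ _)
      (≃-trans (Hcoef-root i′ j′ Ψ γ 0) (R.+-identityʳ _)))
  Hcoef-swap α@(i , j) β@(i′ , j′) Ψ (suc d) γ = begin
    Hcoef (α ∷ β ∷ Ψ) γ (suc d)
      ≈⟨ Hcoef-root i j (β ∷ Ψ) γ (suc d) ⟩
    Hcoef (β ∷ Ψ) γ (suc d) +Λ Hcoef (α ∷ β ∷ Ψ) γα d
      ≈⟨ +Λ-cong (Hcoef-root i′ j′ Ψ γ (suc d)) (≃-trans (Hcoef-swap α β Ψ d γα) (Hcoef-root i′ j′ (α ∷ Ψ) γα d)) ⟩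
    (Hcoef Ψ γ (suc d) +Λ Hcoef (β ∷ Ψ) γβ d) +Λ (Hcoef (α ∷ Ψ) γα d +Λ tShift 1 (Hcoef (β ∷ α ∷ Ψ) (raise i′ j′ 1 γα)) d)
      ≈⟨ +Λ-interchange (Hcoef Ψ γ (suc d)) (Hcoef (β ∷ Ψ) γβ d) (Hcoef (α ∷ Ψ) γα d) _ ⟩
    (Hcoef Ψ γ (suc d) +Λ Hcoef (α ∷ Ψ) γα d) +Λ (Hcoef (β ∷ Ψ) γβ d +Λ tShift 1 (Hcoef (β ∷ α ∷ Ψ) (raise i′ j′ 1 γα)) d)
      ≈⟨ +Λ-cong (≃-sym (Hcoef-root i j Ψ γ (suc d))) (+Λ-cong (≃-refl {Hcoef (β ∷ Ψ) γβ d}) (both d)) ⟩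
    Hcoef (α ∷ Ψ) γ (suc d) +Λ (Hcoef (β ∷ Ψ) γβ d +Λ tShift 1 (Hcoef (α ∷ β ∷ Ψ) (raise i j 1 γβ)) d)
      ≈⟨ +Λ-cong (≃-refl {Hcoef (α ∷ Ψ) γ (suc d)}) (≃-trans (≃-sym (Hcoef-root i j (β ∷ Ψ) γβ d)) (Hcoef-swap α β Ψ d γβ)) ⟩
    Hcoef (α ∷ Ψ) γ (suc d) +Λ Hcoef (β ∷ α ∷ Ψ) γβ d
      ≈⟨ Hcoef-root i′ j′ (α ∷ Ψ) γ (suc d) ⟨
    Hcoef (β ∷ α ∷ Ψ) γ (suc d) ∎
    where
    open import Relation.Binary.Reasoning.Setoid R.setoid
    γα = raise i j 1 γ
    γβ = raise i′ j′ 1 γ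
    both : ∀ e → tShift 1 (Hcoef (β ∷ α ∷ Ψ) (raise i′ j′ 1 γα)) e ≃ tShift 1 (Hcoef (α ∷ β ∷ Ψ) (raise i j 1 γβ)) e
    both zero = ≃-refl
    both (suc e) = ≃-trans (Hcoef-cong (β ∷ α ∷ Ψ) (raise-comm i′ j′ i j 1 1 γ) e) (≃-sym (Hcoef-swap α β Ψ e (raise i j 1 γβ)))

  Hcoef-↭ : ∀ {ℓ} {Ψ Φ : Roots ℓ} → Ψ ↭ Φ → ∀ γ → Hcoef Ψ γ ≋ Hcoef Φ γ
  Hcoef-↭ Perm.refl γ = ≋-refl
  Hcoef-↭ (prep {xs} {ys} α s) γ = Hcoef-prep α xs ys (Hcoef-↭ s) γ
  Hcoef-↭ (swap {xs} {ys} α β s) γ d = ≃-trans (Hcoef-swap α β xs d γ)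
    (Hcoef-prep β (α ∷ xs) (α ∷ ys) (Hcoef-prep α xs ys (Hcoef-↭ s)) γ d)
  Hcoef-↭ (Perm.trans s s′) γ = ≋-trans (Hcoef-↭ s γ) (Hcoef-↭ s′ γ)

  transposition-involutive : ∀ {n} z (x : Fin n) → transposition z (transposition z x) ≡ x
  transposition-involutive zero zero = exchange01-zero
    where
    exchange01-zero : ∀ {n} → exchange01 {suc n} (exchange01 zero) ≡ zero
    exchange01-zero {zero} = refl
    exchange01-zero {suc n} = refl
  transposition-involutive zero (suc zero) = refl
  transposition-involutive zero (suc (suc x)) = refl
  transposition-involutive (suc z) zero = refl
  transposition-involutive (suc z) (suc x) = cong suc (transposition-involutive z x)

  transposition-≟ : ∀ {n} z (x i : Fin n) → does (x ≟F transposition z i) ≡ does (transposition z x ≟F i)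
  transposition-≟ z x i with transposition z x ≟F i
  ... | yes refl = dec-true (x ≟F _) (sym (transposition-involutive z x))
  ... | no x≢i = dec-false (x ≟F _) (λ { refl → x≢i (transposition-involutive z i) })

  transposeRoot : ∀ {ℓ} → ℕ → Fin ℓ × Fin ℓ → Fin ℓ × Fin ℓ
  transposeRoot z (i , j) = transposition z i , transposition z j

  Reflected : ∀ {ℓ} → ℕ → (γ δ : Fin ℓ → ℤ) → Set
  Reflected z γ δ = ∀ x → δ x ℤ.- + toℕ x ≡ γ (transposition z x) ℤ.- + toℕ (transposition z x)

  -- Exchanging coordinates commutes with raising if the roots are exchanged as well, so the sign of
  -- `schur-transposition` passes through all the geometric series.
  Hcoef-transposition : ∀ {ℓ} z → suc z < ℓ → (Ψ : Roots ℓ) → ∀ γ δ → Reflected z γ δ →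
    Hcoef (map (transposeRoot z) Ψ) δ ≋ negS (Hcoef Ψ γ)
  Hcoef-transposition z z<ℓ [] γ δ e zero = schur-transposition _ z z<ℓ γ δ e
  Hcoef-transposition z z<ℓ [] γ δ e (suc d) = ≃-refl
  Hcoef-transposition z z<ℓ ((i , j) ∷ Ψ) γ δ e d = ≃-trans (≃-reflexive (Hcoef-cons _ _ (map (transposeRoot z) Ψ) δ d)) (≃-trans
    (sumTo-cong (suc d) (λ a → Hcoef-transposition z z<ℓ Ψ (raise i j a γ) (raise (transposition z i) (transposition z j) a δ) (raised a) (d ∸ a)))
    (≃-trans (sumTo-neg (suc d) (λ a → Hcoef Ψ (raise i j a γ) (d ∸ a)))
      (scaleΛ-cong -1ℤ (≃-reflexive (sym (Hcoef-cons i j Ψ γ d))))))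
    where
    regroup : ∀ g a b c → g ℤ.+ a ℤ.- b ℤ.- c ≡ (g ℤ.- c) ℤ.+ a ℤ.- b
    regroup = ℤSolver.solve-∀
    raised : ∀ a → Reflected z (raise i j a γ) (raise (transposition z i) (transposition z j) a δ)
    raised a x = trans (cong₂ (λ u v → δ x ℤ.+ (if u then + a else 0ℤ) ℤ.- (if v then + a else 0ℤ) ℤ.- + toℕ x)
        (transposition-≟ z x i) (transposition-≟ z x j))
      (trans (regroup (δ x) _ _ (+ toℕ x)) (trans (cong (λ u → u ℤ.+ _ ℤ.- _) (e x))
        (sym (regroup (γ (transposition z x)) _ _ (+ toℕ (transposition z x))))))

  -- The last row x is never the upper row of a root. Raising can only lower γ x further, and every
  -- Schur function that occurs is zero.
  Hcoef-negative : ∀ {ℓ} (Ψ : Roots ℓ) (x : Fin ℓ) → suc (toℕ x) ≡ ℓ → All (λ (i , j) → toℕ i < toℕ j) Ψ →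
    ∀ γ → γ x ℤ.< 0ℤ → Hcoef Ψ γ ≋ 0S
  Hcoef-negative [] x e [] γ neg zero = schur-negative _ γ x e neg
  Hcoef-negative [] x e [] γ neg (suc d) = ≃-refl
  Hcoef-negative ((i , j) ∷ Ψ) x e (i<j ∷ ps) γ neg d = ≃-trans (≃-reflexive (Hcoef-cons i j Ψ γ d))
    (sumTo-0 (suc d) (λ a → Hcoef-negative Ψ x e ps (raise i j a γ) (raised a) (d ∸ a)))
    where
    x≢i : x ≢ i
    x≢i refl = <-irrefl refl (≤-trans (s≤s i<j) (subst (suc (toℕ j) ≤_) (sym e) (toℕ<n j)))
    nonneg : ∀ a (b : Bool) → 0ℤ ℤ.≤ (if b then + a else 0ℤ)
    nonneg a true = ℤ.+≤+ z≤n
    nonneg a false = ℤ.+≤+ z≤n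
    raised : ∀ a → raise i j a γ x ℤ.< 0ℤ
    raised a rewrite dec-false (x ≟F i) x≢i = ℤP.≤-<-trans
      (subst (λ u → u ℤ.- _ ℤ.≤ γ x) (sym (ℤP.+-identityʳ (γ x)))
        (subst (γ x ℤ.- (if does (x ≟F j) then + a else 0ℤ) ℤ.≤_) (ℤP.+-identityʳ (γ x))
          (ℤP.+-monoʳ-≤ (γ x) (ℤP.neg-mono-≤ (nonneg a (does (x ≟F j))))))) neg

-- Root sets given by first root columns, and reflections of their series.

module RootColumns where
  open import Data.Nat as ℕ using (ℕ; zero; suc; _≤_; _<_; _+_; s≤s)
  open import Data.Nat.Properties using (≤-trans; <-irrefl; <-trans; <⇒≤; ≤-reflexive; <ᵇ⇒<; <⇒<ᵇ; ≤ᵇ⇒≤; ≤⇒≤ᵇ; _≟_; <⇒≢; <-≤-trans; n<1+n; m≤n⇒m≤1+n; m≤n⇒m<n∨m≡n)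
  open import Data.Integer as ℤ using (ℤ; +_; 0ℤ; 1ℤ; -1ℤ)
  import Data.Integer.Properties as ℤP
  import Data.Nat.Properties as ℕP
  import Data.Integer.Tactic.RingSolver as ℤSolver
  open import Data.Fin as Fin using (Fin; zero; suc; toℕ; fromℕ<)
  open import Data.Fin.Properties using (toℕ-injective; toℕ-fromℕ<; toℕ<n) renaming (_≟_ to _≟F_)
  open import Data.List using ([]; _∷_; _++_; map; concatMap; allFin; filterᵇ; cartesianProduct)
  open import Data.List.Membership.Propositional using (_∈_)
  open import Data.List.Membership.Propositional.Properties using (∈-map⁺; ∈-map⁻; ∈-cartesianProduct⁺; ∈-allFin)
  open import Data.List.Relation.Unary.Any using (here; there)
  open import Data.List.Relation.Unary.All as All using (All)
  open import Data.List.Relation.Unary.AllPairs using ([]; _∷_)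
  open import Data.List.Relation.Unary.Unique.Propositional using (Unique)
  import Data.List.Relation.Unary.Unique.Propositional.Properties as UniqueP
  open import Data.List.Relation.Binary.Permutation.Propositional using (_↭_)
  open import Data.Bool using (Bool; if_then_else_; _∧_; T?)
  open import Data.Bool.Properties using (T-∧)
  open import Data.Product using (_×_; _,_; proj₁; proj₂)
  open import Data.Sum using (inj₁; inj₂)
  open import Data.Empty using (⊥-elim)
  open import Function using (_∘_)
  open import Function.Bundles using (Equivalence)
  open import Relation.Nullary using (yes; no; does)
  open import Relation.Nullary.Decidable using (dec-true; dec-false)
  open import Relation.Binary.PropositionalEquality hiding (J)
  open SymmetricFunctions
  open RaisingSeries
  open import Algebra.Properties.Ring R.ring using (-‿involutive) renaming (+-inverseˡ-unique to inverseˡ-unique)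

  upd : ℕ → ℕ → (ℕ → ℕ) → ℕ → ℕ
  upd i v D r = if does (r ≟ i) then v else D r

  upd-same : ∀ i v D → upd i v D i ≡ v
  upd-same i v D rewrite dec-true (i ≟ i) refl = refl

  upd-other : ∀ {i r} v D → r ≢ i → upd i v D r ≡ D r
  upd-other {i} {r} v D r≢i rewrite dec-false (r ≟ i) r≢i = refl

  δ : ℕ → ℕ → ℤ
  δ i r = if does (r ≟ i) then 1ℤ else 0ℤ

  δ-same : ∀ i → δ i i ≡ 1ℤ
  δ-same i rewrite dec-true (i ≟ i) refl = refl

  δ-other : ∀ {i r} → r ≢ i → δ i r ≡ 0ℤ
  δ-other {i} {r} r≢i rewrite dec-false (r ≟ i) r≢i = refl

  move : ℕ → ℕ → (ℕ → ℤ) → ℕ → ℤ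
  move i j g r = g r ℤ.+ δ i r ℤ.- δ j r

  move-other : ∀ {i j r} g → r ≢ i → r ≢ j → move i j g r ≡ g r
  move-other {r = r} g r≢i r≢j rewrite δ-other r≢i | δ-other r≢j = trans (ℤP.+-identityʳ _) (ℤP.+-identityʳ (g r))

  move-source : ∀ {i j} g → j ≢ i → move i j g j ≡ g j ℤ.- 1ℤ
  move-source {i} {j} g j≢i rewrite δ-other j≢i | δ-same j = cong (ℤ._- 1ℤ) (ℤP.+-identityʳ (g j))

  move-target : ∀ {i j} g → i ≢ j → move i j g i ≡ g i ℤ.+ 1ℤ
  move-target {i} {j} g i≢j rewrite δ-other i≢j | δ-same i = ℤP.+-identityʳ (g i ℤ.+ 1ℤ)

  does-toℕ : ∀ {n} (x y : Fin n) → does (x ≟F y) ≡ does (toℕ x ≟ toℕ y)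
  does-toℕ x y with x ≟F y
  ... | yes x≡y = sym (dec-true (toℕ x ≟ toℕ y) (cong toℕ x≡y))
  ... | no x≢y = sym (dec-false (toℕ x ≟ toℕ y) (λ e → x≢y (toℕ-injective e)))

  raise-move : ∀ {ℓ} (i j : Fin ℓ) g x → raise i j 1 (g ∘ toℕ) x ≡ move (toℕ i) (toℕ j) g (toℕ x)
  raise-move i j g x rewrite does-toℕ x i | does-toℕ x j = refl

  data Transposed (z : ℕ) : ℕ → ℕ → Set where
    up   : Transposed z z (suc z)
    down : Transposed z (suc z) z
    off  : ∀ {r} → r ≢ z → r ≢ suc z → Transposed z r r

  transposed : ∀ {n} z → suc z < n → (x : Fin n) → Transposed z (toℕ x) (toℕ (transposition z x))
  transposed {suc zero} zero (s≤s ()) zero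
  transposed {suc (suc n)} zero _ zero = up
  transposed {suc (suc n)} zero _ (suc zero) = down
  transposed {suc (suc n)} zero _ (suc (suc x)) = off (λ ()) (λ ())
  transposed (suc z) (s≤s z<n) zero = off (λ ()) (λ ())
  transposed (suc z) (s≤s z<n) (suc x) with toℕ x | toℕ (transposition z x) | transposed z z<n x
  ... | _ | _ | up = up
  ... | _ | _ | down = down
  ... | _ | _ | off p q = off (λ { refl → p refl }) (λ { refl → q refl })

  allPairs-product : ∀ ℓ → allPairs ℓ ≡ cartesianProduct (allFin ℓ) (allFin ℓ)
  allPairs-product ℓ = go (allFin ℓ)
    where
    go : ∀ xs → concatMap (λ i → map (i ,_) (allFin ℓ)) xs ≡ cartesianProduct xs (allFin ℓ)
    go [] = refl
    go (x ∷ xs) = cong (map (x ,_) (allFin ℓ) ++_) (go xs)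

  allPairs-unique : ∀ ℓ → Unique (allPairs ℓ)
  allPairs-unique ℓ rewrite allPairs-product ℓ = UniqueP.cartesianProduct⁺ (UniqueP.allFin⁺ ℓ) (UniqueP.allFin⁺ ℓ)

  ∈-allPairs : ∀ {ℓ} (α : Fin ℓ × Fin ℓ) → α ∈ allPairs ℓ
  ∈-allPairs {ℓ} (i , j) rewrite allPairs-product ℓ = ∈-cartesianProduct⁺ (∈-allFin i) (∈-allFin j)

  -- A set of roots is described by the first root column D r of each row r.

  isRoot : ∀ {ℓ} → (ℕ → ℕ) → Fin ℓ × Fin ℓ → Bool
  isRoot D (i , j) = (toℕ i ℕ.<ᵇ toℕ j) ∧ (D (toℕ i) ℕ.≤ᵇ toℕ j)

  module _ (ℓ : ℕ) where
    roots : (ℕ → ℕ) → Roots ℓ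
    roots D = filterᵇ (isRoot D) (allPairs ℓ)

    roots-unique : ∀ D → Unique (roots D)
    roots-unique D = UniqueP.filter⁺ (T? ∘ isRoot D) (allPairs-unique ℓ)

    ∈-roots⁺ : ∀ D {i j} → toℕ i < toℕ j → D (toℕ i) ≤ toℕ j → (i , j) ∈ roots D
    ∈-roots⁺ D p q = ∈-filterᵇ⁺ (isRoot D) (∈-allPairs _) (Equivalence.from T-∧ (<⇒<ᵇ p , ≤⇒≤ᵇ q))

    ∈-roots⁻ : ∀ D {i j} → (i , j) ∈ roots D → toℕ i < toℕ j × D (toℕ i) ≤ toℕ j
    ∈-roots⁻ D {i} {j} m with Equivalence.to T-∧ (proj₂ (∈-filterᵇ⁻ (isRoot D) (allPairs ℓ) m))
    ... | p , q = <ᵇ⇒< (toℕ i) (toℕ j) p , ≤ᵇ⇒≤ (D (toℕ i)) (toℕ j) q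

    𝓗 : (ℕ → ℕ) → (ℕ → ℤ) → Series
    𝓗 D g = Hcoef (roots D) (g ∘ toℕ)

    roots-↭ : ∀ D E → (∀ {i j : Fin ℓ} → toℕ i < toℕ j → D (toℕ i) ≤ toℕ j → E (toℕ i) ≤ toℕ j) →
      (∀ {i j : Fin ℓ} → toℕ i < toℕ j → E (toℕ i) ≤ toℕ j → D (toℕ i) ≤ toℕ j) → roots D ↭ roots E
    roots-↭ D E f g = unique-↭ (roots-unique D) (roots-unique E)
      (λ { {i , j} m → let p , q = ∈-roots⁻ D m in ∈-roots⁺ E p (f {i} {j} p q) })
      (λ { {i , j} m → let p , q = ∈-roots⁻ E m in ∈-roots⁺ D p (g {i} {j} p q) })

    𝓗-cong : ∀ D E g g′ → (∀ r → r < ℓ → D r ≡ E r) → (∀ r → r < ℓ → g r ≡ g′ r) → 𝓗 D g ≋ 𝓗 E g′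
    𝓗-cong D E g g′ e e′ = ≋-trans
      (Hcoef-↭ (roots-↭ D E (λ {i} {j} _ → subst (_≤ toℕ j) (e (toℕ i) (toℕ<n i))) (λ {i} {j} _ → subst (_≤ toℕ j) (sym (e (toℕ i) (toℕ<n i))))) (g ∘ toℕ))
      (Hcoef-cong (roots E) (λ x → e′ _ (toℕ<n x)))

    -- The counterpart of `𝓗-root` for a row without roots among the ℓ columns; both lead to the
    -- same new root set.
    𝓗-noroot : ∀ D g i → ℓ ≤ D i → 𝓗 D g ≋ 𝓗 (upd i (suc (D i)) D) g
    𝓗-noroot D g i ℓ≤ = Hcoef-↭ (roots-↭ D E (λ {a} {b} → to {a} {b}) (λ {a} {b} → from {a} {b})) (g ∘ toℕ)
      where
      E = upd i (suc (D i)) D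
      to : ∀ {a b : Fin ℓ} → toℕ a < toℕ b → D (toℕ a) ≤ toℕ b → E (toℕ a) ≤ toℕ b
      to {a} {b} _ p with toℕ a ≟ i
      ... | yes refl = ⊥-elim (<-irrefl refl (<-≤-trans (toℕ<n b) (≤-trans ℓ≤ p)))
      ... | no a≢i = subst (_≤ toℕ b) (sym (upd-other _ D a≢i)) p
      from : ∀ {a b : Fin ℓ} → toℕ a < toℕ b → E (toℕ a) ≤ toℕ b → D (toℕ a) ≤ toℕ b
      from {a} {b} _ p with toℕ a ≟ i
      ... | yes refl = <⇒≤ (subst (_≤ toℕ b) (upd-same i _ D) p)
      ... | no a≢i = subst (_≤ toℕ b) (upd-other _ D a≢i) p

    -- Without its first root, row i starts one column later, so both summands are again given by
    -- first root columns.
    𝓗-root : ∀ D g i → i < D i → D i < ℓ → 𝓗 D g ≋ 𝓗 (upd i (suc (D i)) D) g ⊕ tShift 1 (𝓗 D (move i (D i) g))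
    𝓗-root D g i i<Di Di<ℓ = ≋-trans (Hcoef-↭ perm (g ∘ toℕ)) (≋-trans (Hcoef-root I J (roots E) (g ∘ toℕ))
      (⊕-cong {f = 𝓗 E g} {f′ = tShift 1 (Hcoef ((I , J) ∷ roots E) (raise I J 1 (g ∘ toℕ)))} {g′ = tShift 1 (𝓗 D (move i (D i) g))} (≋-refl {𝓗 E g}) (tShift-cong 1 (≋-trans (Hcoef-cong ((I , J) ∷ roots E) raised)
        (≋-sym (Hcoef-↭ perm (move i (D i) g ∘ toℕ)))))))
      where
      E = upd i (suc (D i)) D
      I = fromℕ< (<-trans i<Di Di<ℓ)
      J = fromℕ< Di<ℓ
      I≡ : toℕ I ≡ i
      I≡ = toℕ-fromℕ< _
      J≡ : toℕ J ≡ D i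
      J≡ = toℕ-fromℕ< _
      raised : ∀ x → raise I J 1 (g ∘ toℕ) x ≡ move i (D i) g (toℕ x)
      raised x = trans (raise-move I J g x) (cong₂ (λ a b → move a b g (toℕ x)) I≡ J≡)
      fresh : All ((I , J) ≢_) (roots E)
      fresh = All.tabulate λ { m refl → <-irrefl refl (subst₂ _≤_ (trans (cong E I≡) (upd-same i _ D)) J≡ (proj₂ (∈-roots⁻ E m))) }
      to : ∀ {α} → α ∈ roots D → α ∈ (I , J) ∷ roots E
      to {a , b} m with ∈-roots⁻ D m
      ... | a<b , p with toℕ a ≟ i
      ...   | no a≢i = there (∈-roots⁺ E a<b (subst (_≤ toℕ b) (sym (upd-other _ D a≢i)) p))
      ...   | yes a≡i with m≤n⇒m<n∨m≡n p
      ...     | inj₂ Da≡b = here (cong₂ _,_ (toℕ-injective (trans a≡i (sym I≡))) (toℕ-injective (trans (sym Da≡b) (trans (cong D a≡i) (sym J≡)))))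
      ...     | inj₁ Da<b = there (∈-roots⁺ E a<b (subst (_≤ toℕ b) (trans (cong (suc ∘ D) a≡i) (sym (trans (cong E a≡i) (upd-same i _ D)))) Da<b))
      from : ∀ {α} → α ∈ (I , J) ∷ roots E → α ∈ roots D
      from (here refl) = ∈-roots⁺ D (subst₂ _<_ (sym I≡) (sym J≡) i<Di) (≤-reflexive (trans (cong D I≡) (sym J≡)))
      from {a , b} (there m) with ∈-roots⁻ E m
      ... | a<b , p with toℕ a ≟ i
      ...   | no a≢i = ∈-roots⁺ D a<b (subst (_≤ toℕ b) (upd-other _ D a≢i) p)
      ...   | yes a≡i = ∈-roots⁺ D a<b (≤-trans (≤-reflexive (cong D a≡i)) (<⇒≤ (subst (_≤ toℕ b) (trans (cong E a≡i) (upd-same i _ D)) p)))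
      perm : roots D ↭ (I , J) ∷ roots E
      perm = unique-↭ (roots-unique D) (fresh ∷ roots-unique E) to from

    𝓗-last : ∀ D g i → suc i ≡ ℓ → g i ℤ.< 0ℤ → 𝓗 D g ≋ 0S
    𝓗-last D g i e neg = Hcoef-negative (roots D) I (trans (cong suc I≡) e) (All.tabulate (λ m → proj₁ (∈-roots⁻ D m))) (g ∘ toℕ)
      (subst (λ r → g r ℤ.< 0ℤ) (sym I≡) neg)
      where
      I = fromℕ< (≤-reflexive e)
      I≡ : toℕ I ≡ i
      I≡ = toℕ-fromℕ< (≤-reflexive e)

    -- These conditions make the root set invariant under the exchange of z and z + 1: `later`
    -- excludes the root (z , z + 1), and `columns` excludes rows with a root in column z + 1 but
    -- none in column z.
    record Symmetric (z : ℕ) (D : ℕ → ℕ) : Set where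
      constructor symmetric
      field
        inside   : suc z < ℓ
        rows     : D z ≡ D (suc z)
        later    : suc z < D z
        columns  : ∀ r → r < z → D r ≢ suc z

    𝓗-reflect : ∀ {z D} g g′ → Symmetric z D → g′ z ≡ g (suc z) ℤ.- 1ℤ → g′ (suc z) ≡ g z ℤ.+ 1ℤ →
      (∀ r → r ≢ z → r ≢ suc z → g′ r ≡ g r) → 𝓗 D g′ ≋ negS (𝓗 D g)
    𝓗-reflect {z} {D} g g′ (symmetric z<ℓ rows later columns) e₁ e₂ e₃ =
      ≋-trans (≋-sym (Hcoef-↭ perm (g′ ∘ toℕ))) (Hcoef-transposition z z<ℓ (roots D) (g ∘ toℕ) (g′ ∘ toℕ) reflected)
      where
      regroup₁ : ∀ a b → a ℤ.- 1ℤ ℤ.- b ≡ a ℤ.- (1ℤ ℤ.+ b)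
      regroup₁ = ℤSolver.solve-∀
      regroup₂ : ∀ a b → a ℤ.+ 1ℤ ℤ.- (1ℤ ℤ.+ b) ≡ a ℤ.- b
      regroup₂ = ℤSolver.solve-∀
      reflected : Reflected z (g ∘ toℕ) (g′ ∘ toℕ)
      reflected x with toℕ x | toℕ (transposition z x) | transposed z z<ℓ x
      ... | _ | _ | up = trans (cong (ℤ._- + z) e₁) (regroup₁ (g (suc z)) (+ z))
      ... | _ | _ | down = trans (cong (ℤ._- + suc z) e₂) (regroup₂ (g z) (+ z))
      ... | r | _ | off p q = cong (ℤ._- + r) (e₃ r p q)
      closed : ∀ {i j i′ j′} → Transposed z i i′ → Transposed z j j′ → i < j → D i ≤ j → i′ < j′ × D i′ ≤ j′
      closed up up p q = ⊥-elim (<-irrefl refl p)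
      closed up down p q = ⊥-elim (<-irrefl refl (<-≤-trans later q))
      closed {j = j} up (off _ _) p q = <-≤-trans later q , subst (_≤ j) rows q
      closed down up p q = ⊥-elim (<-irrefl refl (<-trans (n<1+n z) p))
      closed down down p q = ⊥-elim (<-irrefl refl p)
      closed {j = j} down (off _ _) p q = <-trans (n<1+n z) p , subst (_≤ j) (sym rows) q
      closed (off _ _) up p q = <-trans p (n<1+n z) , m≤n⇒m≤1+n q
      closed {i} (off i≢z _) down p q with m≤n⇒m<n∨m≡n (ℕP.≤-pred p) | m≤n⇒m<n∨m≡n q
      ... | inj₂ i≡z | _ = ⊥-elim (i≢z i≡z)
      ... | inj₁ i<z | inj₂ Di≡ = ⊥-elim (columns i i<z Di≡)
      ... | inj₁ i<z | inj₁ Di< = i<z , ℕP.≤-pred Di<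
      closed (off _ _) (off _ _) p q = p , q
      transposeRoot-closed : ∀ {α} → α ∈ roots D → transposeRoot z α ∈ roots D
      transposeRoot-closed {i , j} m with ∈-roots⁻ D m
      ... | p , q with closed (transposed z z<ℓ i) (transposed z z<ℓ j) p q
      ...   | p′ , q′ = ∈-roots⁺ D p′ q′
      transposeRoot-involutive : ∀ α → transposeRoot z (transposeRoot z α) ≡ α
      transposeRoot-involutive (i , j) = cong₂ _,_ (transposition-involutive z i) (transposition-involutive z j)
      to : ∀ {α} → α ∈ map (transposeRoot z) (roots D) → α ∈ roots D
      to m with ∈-map⁻ (transposeRoot z) m
      ... | _ , m′ , refl = transposeRoot-closed m′
      from : ∀ {α} → α ∈ roots D → α ∈ map (transposeRoot z) (roots D)
      from {α} m = subst (_∈ map (transposeRoot z) (roots D)) (transposeRoot-involutive α) (∈-map⁺ (transposeRoot z) (transposeRoot-closed m))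
      perm : map (transposeRoot z) (roots D) ↭ roots D
      perm = unique-↭ (UniqueP.map⁺ (λ {α} {β} e → trans (sym (transposeRoot-involutive α)) (trans (cong (transposeRoot z) e) (transposeRoot-involutive β)))
        (roots-unique D)) (roots-unique D) to from

    cancel₁ : ∀ a → a ≡ a ℤ.+ 1ℤ ℤ.- 1ℤ
    cancel₁ = ℤSolver.solve-∀

    -- The dot reflection fixes such a g, so the series is its own negative.
    𝓗-zero : ∀ {z D} g → Symmetric z D → g (suc z) ≡ g z ℤ.+ 1ℤ → 𝓗 D g ≋ 0S
    𝓗-zero {z} {D} g sy e d = self-negative (𝓗-reflect g g sy (trans (cancel₁ (g z)) (cong (ℤ._- 1ℤ) (sym e))) e (λ r _ _ → refl) d)

    -- The part of `Symmetric` that concerns rows, with a weight fixed by the dot reflection. The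
    -- columns z and z + 1 may still differ in a row above.
    record Mirror (z : ℕ) (D : ℕ → ℕ) (g : ℕ → ℤ) : Set where
      constructor mirror
      field
        inside  : suc z < ℓ
        rows    : D z ≡ D (suc z)
        later   : suc z < D z
        weights : g (suc z) ≡ g z ℤ.+ 1ℤ

    -- With the root (u , z) added the rows and columns z and z + 1 become symmetric, so the series of the
    -- larger root set vanishes; expanding it at that root and reflecting the second summand gives the claim.
    𝓗-mirror : ∀ {z D g} → Mirror z D g → ∀ u → u < z → D u ≡ suc z → (∀ r → r < z → D r ≡ suc z → r ≡ u) →
      𝓗 D g ≋ tShift 1 (𝓗 (upd u z D) (move u (suc z) g))
    𝓗-mirror {z} {D} {g} (mirror z<ℓ rows later weights) u u<z Du unique = ≋-trans
      (𝓗-cong D (upd u (suc (E u)) E) g g restore (λ _ _ → refl)) (moveRight {p = 𝓗 E (move u (E u) g)} {q = 𝓗 E (move u (suc z) g)} (≋-trans (≋-sym rooted) (𝓗-zero g sy weights)) swapped)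
      where
      E = upd u z D
      u≢z : u ≢ z
      u≢z = <⇒≢ u<z
      u≢sz : u ≢ suc z
      u≢sz = <⇒≢ (<-trans u<z (n<1+n z))
      Ez : E z ≡ D z
      Ez = upd-other z D (u≢z ∘ sym)
      Esz : E (suc z) ≡ D (suc z)
      Esz = upd-other z D (u≢sz ∘ sym)
      columns : ∀ r → r < z → E r ≢ suc z
      columns r r<z with r ≟ u
      ... | yes refl = λ e → <⇒≢ (n<1+n z) (trans (sym (upd-same r z D)) e)
      ... | no r≢u = λ e → r≢u (unique r r<z (trans (sym (upd-other z D r≢u)) e))
      sy : Symmetric z E
      sy = symmetric z<ℓ (trans Ez (trans rows (sym Esz))) (subst (suc z <_) (sym Ez) later) columns
      Eu : E u ≡ z
      Eu = upd-same u z D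
      restore : ∀ r → r < ℓ → D r ≡ upd u (suc (E u)) E r
      restore r _ with r ≟ u
      ... | yes refl = trans Du (sym (trans (upd-same r _ E) (cong suc Eu)))
      ... | no r≢u = sym (trans (upd-other _ E r≢u) (upd-other z D r≢u))
      rooted : 𝓗 E g ≋ 𝓗 (upd u (suc (E u)) E) g ⊕ tShift 1 (𝓗 E (move u (E u) g))
      rooted = 𝓗-root E g u (subst (u <_) (sym Eu) u<z) (subst (_< ℓ) (sym Eu) (<-trans (n<1+n z) z<ℓ))
      moveRight : ∀ {f p q} → f ⊕ tShift 1 p ≋ 0S → p ≋ negS q → f ≋ tShift 1 q
      moveRight {f} {p} {q} e e′ d = ≃-trans (inverseˡ-unique (f d) _ (e d)) (≃-trans (scaleΛ-cong -1ℤ (tShift-cong 1 e′ d)) (negate d))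
        where
        negate : ∀ d → (-Λ tShift 1 (negS q) d) ≃ tShift 1 q d
        negate zero = ≃-refl
        negate (suc d) = -‿involutive (q d)
      -- As g (z + 1) = g z + 1, lowering g at z and lowering it at z + 1 give weights that the dot
      -- reflection interchanges.
      swapped : 𝓗 E (move u (E u) g) ≋ negS (𝓗 E (move u (suc z) g))
      swapped rewrite Eu = 𝓗-reflect (move u (suc z) g) (move u z g) sy at-z at-sz other
        where
        at-z : move u z g z ≡ move u (suc z) g (suc z) ℤ.- 1ℤ
        at-z = trans (move-source g (u≢z ∘ sym)) (cong (ℤ._- 1ℤ) (sym (trans (move-source g (u≢sz ∘ sym))
          (trans (cong (ℤ._- 1ℤ) weights) (sym (cancel₁ (g z)))))))
        at-sz : move u z g (suc z) ≡ move u (suc z) g z ℤ.+ 1ℤ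
        at-sz = trans (move-other {u} {z} g (u≢sz ∘ sym) (λ ())) (trans weights (cong (ℤ._+ 1ℤ) (sym (move-other g (u≢z ∘ sym) (<⇒≢ (n<1+n z))))))
        other : ∀ r → r ≢ z → r ≢ suc z → move u z g r ≡ move u (suc z) g r
        other r p q = cong (λ c → g r ℤ.+ δ u r ℤ.- c) (trans (δ-other p) (sym (δ-other q)))

-- Carrying a reflection upwards along chains of row pairs.

module MirrorChains where
  open import Data.Nat as ℕ using (ℕ; suc; _≤_; _<_; s≤s; pred)
  open import Data.Nat.Properties using (≤-refl; ≤-trans; <-irrefl; <-trans; <⇒≤; ≤-reflexive; _≟_; <⇒≢; <-≤-trans; n<1+n; m≤n⇒m≤1+n)
  open import Data.Integer as ℤ using (ℤ; 1ℤ)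
  import Data.Nat.Properties as ℕP
  import Data.Integer.Tactic.RingSolver as ℤSolver
  open import Data.Fin using (suc)
  open import Data.Product using (_×_; _,_; proj₁; proj₂)
  open import Function using (_∘_)
  open import Relation.Nullary using (yes; no)
  open import Relation.Binary.PropositionalEquality
  open SymmetricFunctions
  open RaisingSeries
  open RootColumns

  -- Two adjacent rows z, z + 1 joined to pairs of adjacent rows above: row y + 1 ends in column z + 1 and row y in column z.
  data PairChain (D : ℕ → ℕ) (g : ℕ → ℤ) : ℕ → ℕ → ℕ → Set where
    top  : ∀ {z a} → a < z → D a ≡ suc z → (∀ r → r < z → D r ≡ suc z → r ≡ a) → PairChain D g z 1 a
    step : ∀ {z p a} y → suc y < z → D y ≡ z → D (suc y) ≡ suc z → (∀ r → r < z → D r ≡ suc z → r ≡ suc y) →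
           g (suc y) ≡ g y → PairChain D g y p a → PairChain D g z (suc p) a

  -- The same ascent, ending at a pair for which no row starts its roots in the second column. There
  -- the root set is symmetric and the series vanishes.
  data PairBreak (D : ℕ → ℕ) (g : ℕ → ℤ) : ℕ → Set where
    stop : ∀ {z} → (∀ r → r < z → D r ≢ suc z) → PairBreak D g z
    step : ∀ {z} y → suc y < z → D y ≡ z → D (suc y) ≡ suc z → (∀ r → r < z → D r ≡ suc z → r ≡ suc y) →
           g (suc y) ≡ g y → PairBreak D g y → PairBreak D g z

  module _ {D D′ : ℕ → ℕ} {g g′ : ℕ → ℤ} where
    PairChain-local : ∀ {z p a} → (∀ r → r < z → D r ≡ D′ r) → (∀ r → r < z → g r ≡ g′ r) → PairChain D g z p a → PairChain D′ g′ z p a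
    PairChain-local e e′ (top a<z Da unique) = top a<z (trans (sym (e _ a<z)) Da) (λ r r<z q → unique r r<z (trans (e r r<z) q))
    PairChain-local e e′ (step y y<z Dy Dsy unique flat c) = step y y<z (trans (sym (e _ (<⇒≤ y<z))) Dy) (trans (sym (e _ y<z)) Dsy)
      (λ r r<z q → unique r r<z (trans (e r r<z) q)) (trans (sym (e′ _ y<z)) (trans flat (e′ _ (<⇒≤ y<z))))
      (PairChain-local (λ r r<y → e r (<-trans r<y (<⇒≤ y<z))) (λ r r<y → e′ r (<-trans r<y (<⇒≤ y<z))) c)

    PairBreak-local : ∀ {z} → (∀ r → r < z → D r ≡ D′ r) → (∀ r → r < z → g r ≡ g′ r) → PairBreak D g z → PairBreak D′ g′ z
    PairBreak-local e e′ (stop none) = stop (λ r r<z q → none r r<z (trans (e r r<z) q))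
    PairBreak-local e e′ (step y y<z Dy Dsy unique flat c) = step y y<z (trans (sym (e _ (<⇒≤ y<z))) Dy) (trans (sym (e _ y<z)) Dsy)
      (λ r r<z q → unique r r<z (trans (e r r<z) q)) (trans (sym (e′ _ y<z)) (trans flat (e′ _ (<⇒≤ y<z))))
      (PairBreak-local (λ r r<y → e r (<-trans r<y (<⇒≤ y<z))) (λ r r<y → e′ r (<-trans r<y (<⇒≤ y<z))) c)

  PairChain-bounds : ∀ {D g z p a} → PairChain D g z p a → a < z × D a ≤ suc z
  PairChain-bounds (top a<z Da _) = a<z , ≤-reflexive Da
  PairChain-bounds (step y y<z _ _ _ _ c) with PairChain-bounds c
  ... | a<y , Da≤ = <-trans a<y (<⇒≤ y<z) , ≤-trans Da≤ (m≤n⇒m≤1+n (<⇒≤ y<z))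

  move-move : ∀ a u z (g : ℕ → ℤ) r → move a u (move u z g) r ≡ move a z g r
  move-move a u z g r = regroup (g r) (δ u r) (δ z r) (δ a r)
    where
    regroup : ∀ x u z a → x ℤ.+ u ℤ.- z ℤ.+ a ℤ.- u ≡ x ℤ.+ a ℤ.- z
    regroup = ℤSolver.solve-∀

  module _ (ℓ : ℕ) where
    open Mirror

    -- The mirror step gives row y + 1 the root (y + 1 , z) and one unit of weight. Its roots now
    -- start where those of row y start, and g (y + 1) = g y has turned into the weight condition,
    -- so the reflection problem has moved to the pair y, y + 1.
    mirrored : ∀ {z D g y} → Mirror ℓ z D g → suc y < z → D y ≡ z → g (suc y) ≡ g y → Mirror ℓ y (upd (suc y) z D) (move (suc y) (suc z) g)
    mirrored {z} {D} {g} {y} m y<z Dy flat = mirror (<-trans y<z (<⇒≤ (inside m)))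
      (trans Dy′ (sym (upd-same (suc y) z D))) (subst (suc y <_) (sym Dy′) y<z)
      (trans (move-target g (<⇒≢ (m≤n⇒m≤1+n y<z))) (cong (ℤ._+ 1ℤ) (trans flat (sym (move-other g (<⇒≢ (n<1+n y)) (<⇒≢ (m≤n⇒m≤1+n (<⇒≤ y<z))))))))
      where
      Dy′ : upd (suc y) z D y ≡ z
      Dy′ = trans (upd-other z D (<⇒≢ (n<1+n y))) Dy

    belowUpd : ∀ {y z} (D : ℕ → ℕ) r → r < y → D r ≡ upd (suc y) z D r
    belowUpd {y} {z} D r r<y = sym (upd-other z D (<⇒≢ (m≤n⇒m≤1+n r<y)))

    belowMove : ∀ {y z} (g : ℕ → ℤ) → suc y < z → ∀ r → r < y → g r ≡ move (suc y) (suc z) g r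
    belowMove g y<z r r<y = sym (move-other g (<⇒≢ (m≤n⇒m≤1+n r<y)) (<⇒≢ (<-trans r<y (m≤n⇒m≤1+n (<⇒≤ y<z)))))

    𝓗-break : ∀ {z D g} → Mirror ℓ z D g → PairBreak D g z → 𝓗 ℓ D g ≋ 0S
    𝓗-break {z} = go (suc z) ≤-refl
      where
      go : ∀ n {z D g} → z < n → Mirror ℓ z D g → PairBreak D g z → 𝓗 ℓ D g ≋ 0S
      go (suc n) {g = g} _ m (stop none) = 𝓗-zero ℓ g (symmetric (inside m) (rows m) (later m) none) (weights m)
      go (suc n) {z} {D} {g} (s≤s z<n) m (step y y<z Dy Dsy unique flat c) = ≋-trans (𝓗-mirror ℓ m (suc y) y<z Dsy unique)
        (tShift-0S 1 (go n (<-≤-trans (<⇒≤ y<z) z<n) (mirrored m y<z Dy flat) (PairBreak-local (belowUpd D) (belowMove g y<z) c)))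

    -- At an intermediate pair the root (y + 1 , z), added by the mirror step, is taken away again
    -- once the pairs above are done. Expanding at it costs nothing: in the second summand z and z +
    -- 1 have become symmetric, with a weight fixed by the reflection. Only the row a at the top
    -- keeps an additional root.
    𝓗-chain : ∀ {z D g p a} → Mirror ℓ z D g → PairChain D g z p a →
      𝓗 ℓ D g ≋ tShift p (𝓗 ℓ (upd a (pred (D a)) D) (move a (suc z) g))
    𝓗-chain {z} {D} {g} {a = a} m (top a<z Da unique) = subst (λ v → 𝓗 ℓ D g ≋ tShift 1 (𝓗 ℓ (upd a (pred v) D) (move a (suc z) g))) (sym Da)
      (𝓗-mirror ℓ m a a<z Da unique)
    𝓗-chain {z} {D} {g} {suc p} {a} m (step y y<z Dy Dsy unique flat c) =
      ≋-trans (𝓗-mirror ℓ m (suc y) y<z Dsy unique)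
      (≋-trans (tShift-cong 1 (≋-trans
        (𝓗-chain (mirrored m y<z Dy flat) (PairChain-local (belowUpd D) (belowMove g y<z) c))
        (tShift-cong p (≋-trans (𝓗-cong ℓ E E (move a (suc y) (move (suc y) (suc z) g)) G (λ _ _ → refl) (λ r _ → move-move a (suc y) (suc z) g r))
          (≋-trans (𝓗-root ℓ E G (suc y) (subst (suc y <_) (sym Esy) y<z) (subst (_< ℓ) (sym Esy) (<⇒≤ (inside m))))
            (≋-trans (⊕-identityʳ (tShift-0S 1 vanishing)) (𝓗-cong ℓ (upd (suc y) (suc (E (suc y))) E) (upd a (pred (D a)) D) G G (λ r _ → restore r) (λ _ _ → refl))))))))
      (≋-sym (tShift-suc p (𝓗 ℓ (upd a (pred (D a)) D) (move a (suc z) g)))))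
      where
      D₁ = upd (suc y) z D
      E = upd a (pred (D₁ a)) D₁
      G = move a (suc z) g
      a<y : a < y
      a<y = proj₁ (PairChain-bounds c)
      a≢sy : a ≢ suc y
      a≢sy = <⇒≢ (m≤n⇒m≤1+n a<y)
      a<z : a < z
      a<z = <-trans a<y (<⇒≤ y<z)
      Esy : E (suc y) ≡ z
      Esy = trans (upd-other (pred (D₁ a)) D₁ (a≢sy ∘ sym)) (upd-same (suc y) z D)
      D₁a : D₁ a ≡ D a
      D₁a = upd-other z D a≢sy
      Ea : E a ≡ pred (D a)
      Ea = trans (upd-same a (pred (D₁ a)) D₁) (cong pred D₁a)
      E-other : ∀ {r} → r ≢ a → r ≢ suc y → E r ≡ D r
      E-other r≢a r≢sy = trans (upd-other (pred (D₁ a)) D₁ r≢a) (upd-other z D r≢sy)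
      Ez : E z ≡ D z
      Ez = E-other (<⇒≢ a<z ∘ sym) (<⇒≢ y<z ∘ sym)
      Esz : E (suc z) ≡ D (suc z)
      Esz = E-other (<⇒≢ (m≤n⇒m≤1+n a<z) ∘ sym) (<⇒≢ (m≤n⇒m≤1+n y<z) ∘ sym)
      restore : ∀ r → upd (suc y) (suc (E (suc y))) E r ≡ upd a (pred (D a)) D r
      restore r with r ≟ suc y
      ... | yes refl = trans (upd-same (suc y) _ E) (trans (cong suc Esy) (trans (sym Dsy) (sym (upd-other (pred (D a)) D (a≢sy ∘ sym)))))
      ... | no r≢sy with r ≟ a
      ...   | yes refl = trans (upd-other _ E r≢sy) (trans Ea (sym (upd-same r (pred (D r)) D)))
      ...   | no r≢a = trans (upd-other _ E r≢sy) (trans (E-other r≢a r≢sy) (sym (upd-other (pred (D a)) D r≢a)))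
      columns : ∀ r → r < z → E r ≢ suc z
      columns r r<z e with r ≟ suc y
      ... | yes refl = <⇒≢ (n<1+n z) (trans (sym Esy) e)
      ... | no r≢sy with r ≟ a
      ...   | no r≢a = r≢sy (unique r r<z (trans (sym (E-other r≢a r≢sy)) e))
      ...   | yes refl = <-irrefl refl (<-≤-trans (subst (_≤ z) (trans (sym Ea) e)
                (≤-trans (ℕP.pred-mono-≤ (proj₂ (PairChain-bounds c))) (<⇒≤ (<⇒≤ y<z)))) ≤-refl)
      sy : Symmetric ℓ z E
      sy = symmetric (inside m) (trans Ez (trans (rows m) (sym Esz))) (subst (suc z <_) (sym Ez) (later m)) columns
      G-eq : ∀ r → move (suc y) (E (suc y)) G r ≡ move (suc y) z G r
      G-eq r = cong (λ v → move (suc y) v G r) Esy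
      regroup : ∀ x → x ℤ.+ 1ℤ ℤ.- 1ℤ ≡ x ℤ.- 1ℤ ℤ.+ 1ℤ
      regroup = ℤSolver.solve-∀
      vanishing : 𝓗 ℓ E (move (suc y) (E (suc y)) G) ≋ 0S
      vanishing = 𝓗-zero ℓ (move (suc y) (E (suc y)) G) sy (trans (G-eq (suc z)) (trans (move-other G (<⇒≢ (m≤n⇒m≤1+n y<z) ∘ sym) (<⇒≢ (n<1+n z) ∘ sym))
        (trans (move-source g (<⇒≢ (m≤n⇒m≤1+n a<z) ∘ sym)) (trans (cong (ℤ._- 1ℤ) (weights m)) (trans (regroup (g z))
          (cong (ℤ._+ 1ℤ) (sym (trans (G-eq z) (trans (move-source G (<⇒≢ y<z ∘ sym))
            (cong (ℤ._- 1ℤ) (move-other g (<⇒≢ a<z ∘ sym) (<⇒≢ (n<1+n z)))))))))))))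

-- The bounce graph: chains of blocks and their obstructions.

module BounceGraph where
  open import Data.Nat as ℕ using (ℕ; zero; suc; _≤_; _<_; _+_; _∸_; s≤s; z≤n)
  open import Data.Nat.Properties using (≤-refl; <⇒≤; +-suc; +-comm; +-identityʳ; _≟_; _<?_; ≮⇒≥; <⇒≢; n<1+n; m≤n⇒m≤1+n; m≤n⇒m<n∨m≡n; anyUpTo?; <-cmp; m∸n+n≡m; +-cancelˡ-≡)
  open import Data.Nat.Induction using (<-rec)
  open import Data.Integer as ℤ using (ℤ; +_)
  import Data.Integer.Properties as ℤP
  import Data.Nat.Properties as ℕP
  open import Data.Fin using (zero; suc)
  open import Data.List using ([]; _∷_)
  open import Data.Bool using (true; false; if_then_else_)
  open import Data.Product using (_×_; _,_; ∃)
  open import Data.Sum using (_⊎_; inj₁; inj₂)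
  open import Data.Empty using (⊥-elim)
  open import Data.Vec using ([]; _∷_)
  open import Function using (_∘_)
  open import Relation.Nullary using (yes; no; does; ¬_)
  open import Relation.Nullary.Decidable using (dec-true; dec-false)
  open import Relation.Binary.Definitions using (tri<; tri≈; tri>)
  open import Relation.Binary.PropositionalEquality
  open LinearArithmetic
  open RootColumns

  -- The characteristic function of the rows a, ..., a + len - 1, recursive in the length because
  -- straightening adds one row at a time (`indicator-δ`).
  indicator : ℕ → ℕ → ℕ → ℕ
  indicator a zero r = 0
  indicator a (suc len) r = indicator a len r + (if does (r ≟ a + len) then 1 else 0)

  indicator-suc : ∀ {a} len {r} → r ≢ a + len → indicator a (suc len) r ≡ indicator a len r
  indicator-suc {a} len {r} r≢ = trans (cong (λ b → indicator a len r + (if b then 1 else 0)) (dec-false (r ≟ a + len) r≢)) (+-identityʳ _)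

  indicator-next : ∀ a len → indicator a (suc len) (a + len) ≡ suc (indicator a len (a + len))
  indicator-next a len = trans (cong (λ b → indicator a len (a + len) + (if b then 1 else 0)) (dec-true (a + len ≟ a + len) refl)) (+-comm _ 1)

  data InInterval (a len r : ℕ) : Set where
    outside : indicator a len r ≡ 0 → r < a ⊎ a + len ≤ r → InInterval a len r
    inside  : ∀ t → t < len → r ≡ a + t → indicator a len r ≡ 1 → InInterval a len r

  inInterval : ∀ a len r → InInterval a len r
  inInterval a zero r with r <? a
  ... | yes r<a = outside refl (inj₁ r<a)
  ... | no r≮a = outside refl (inj₂ (subst (_≤ r) (sym (+-identityʳ a)) (≮⇒≥ r≮a)))
  inInterval a (suc len) r with inInterval a len r
  ... | inside t t<len e e′ = inside t (m≤n⇒m≤1+n t<len) e (trans (indicator-suc len r≢) e′)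
    where
    r≢ : r ≢ a + len
    r≢ r≡ = <⇒≢ t<len (+-cancelˡ-≡ a t len (trans (sym e) r≡))
  ... | outside e o with r ≟ a + len
  ...   | yes refl = inside len ≤-refl refl (trans (indicator-next a len) (cong suc e))
  ...   | no r≢ = outside (trans (indicator-suc len r≢) e) (o′ o)
    where
    o′ : r < a ⊎ a + len ≤ r → r < a ⊎ a + suc len ≤ r
    o′ (inj₁ r<a) = inj₁ r<a
    o′ (inj₂ ≤r) = inj₂ (subst (_≤ r) (sym (+-suc a len)) (ℕP.≤∧≢⇒< ≤r (r≢ ∘ sym)))

  indicator-below : ∀ {a r} len → r < a → indicator a len r ≡ 0
  indicator-below {a} {r} len r<a with inInterval a len r
  ... | outside e _ = e
  ... | inside t _ refl _ = ⊥-elim (linarith (a ∷ t ∷ []) (λ a b → a :+ b :< a ⇒ ⊢ absurd) r<a)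

  indicator-above : ∀ {a r} len → a + len ≤ r → indicator a len r ≡ 0
  indicator-above {a} {r} len ≤r with inInterval a len r
  ... | outside e _ = e
  ... | inside t t<len refl _ = ⊥-elim (linarith (a ∷ len ∷ t ∷ []) (λ a b c → a :+ b :≤ a :+ c ⇒ c :< b ⇒ ⊢ absurd) ≤r t<len)

  indicator-inside : ∀ a {len t} → t < len → indicator a len (a + t) ≡ 1
  indicator-inside a {len} {t} t<len with inInterval a len (a + t)
  ... | inside _ _ _ e = e
  ... | outside _ (inj₁ <a) = ⊥-elim (linarith (a ∷ t ∷ []) (λ a b → a :+ b :< a ⇒ ⊢ absurd) <a)
  ... | outside _ (inj₂ ≤r) = ⊥-elim (linarith (a ∷ len ∷ t ∷ []) (λ a b c → a :+ b :≤ a :+ c ⇒ c :< b ⇒ ⊢ absurd) ≤r t<len)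

  indicator-δ : ∀ a len r → + indicator a (suc len) r ≡ + indicator a len r ℤ.+ δ (a + len) r
  indicator-δ a len r with does (r ≟ a + len)
  ... | true = ℤP.pos-+ (indicator a len r) 1
  ... | false = ℤP.pos-+ (indicator a len r) 0

  -- The bounce graph of a partition: D r is the first root column in row r of Δᵏ, joined to r by an edge.
  bounce : ℕ → (ℕ → ℕ) → ℕ → ℕ
  bounce k la r = r + suc k ∸ la r

  module Bounce (k : ℕ) (la : ℕ → ℕ) (la≤k : ∀ r → la r ≤ k) (antitone : ∀ {r s} → r ≤ s → la s ≤ la r) where
    D : ℕ → ℕ
    D = bounce k la

    D+la : ∀ r → D r + la r ≡ r + suc k
    D+la r = m∸n+n≡m (linarith (la r ∷ k ∷ r ∷ []) (λ a b c → a :≤ b ⇒ ⊢ a :≤ c :+ (con 1 :+ b)) (la≤k r))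

    r<Dr : ∀ r → r < D r
    r<Dr r = linarith (D r ∷ la r ∷ r ∷ k ∷ []) (λ a b c d → a :+ b :≡ c :+ (con 1 :+ d) ⇒ b :≤ d ⇒ ⊢ c :< a) (D+la r) (la≤k r)

    D-mono-< : ∀ {r s} → r < s → D r < D s
    D-mono-< {r} {s} r<s = linarith (D r ∷ la r ∷ r ∷ k ∷ D s ∷ la s ∷ s ∷ []) (λ a b c d e f g → a :+ b :≡ c :+ (con 1 :+ d) ⇒ e :+ f :≡ g :+ (con 1 :+ d) ⇒ f :≤ b ⇒ c :< g ⇒ ⊢ a :< e)
      (D+la r) (D+la s) (antitone (<⇒≤ r<s)) r<s

    D-mono-≤ : ∀ {r s} → r ≤ s → D r ≤ D s
    D-mono-≤ r≤s with m≤n⇒m<n∨m≡n r≤s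
    ... | inj₁ r<s = <⇒≤ (D-mono-< r<s)
    ... | inj₂ refl = ≤-refl

    D-injective : ∀ {r s} → D r ≡ D s → r ≡ s
    D-injective {r} {s} e with <-cmp r s
    ... | tri< r<s _ _ = ⊥-elim (<⇒≢ (D-mono-< r<s) e)
    ... | tri≈ _ r≡s _ = r≡s
    ... | tri> _ _ s<r = ⊥-elim (<⇒≢ (D-mono-< s<r) (sym e))

    D-next : ∀ {u r} → D r ≡ suc (D u) → r ≡ suc u
    D-next {u} {r} e with <-cmp r (suc u)
    ... | tri< r<su _ _ = ⊥-elim (linarith (D r ∷ D u ∷ []) (λ a b → a :≤ b ⇒ a :≡ con 1 :+ b ⇒ ⊢ absurd) (D-mono-≤ (ℕP.≤-pred r<su)) e)
    ... | tri≈ _ r≡su _ = r≡su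
    ... | tri> _ _ su<r = ⊥-elim (linarith (D u ∷ D (suc u) ∷ D r ∷ []) (λ a b c → a :< b ⇒ b :< c ⇒ c :≡ con 1 :+ a ⇒ ⊢ absurd) (D-mono-< (n<1+n u)) (D-mono-< su<r) e)

    D-flat : ∀ {r} → D (suc r) ≡ suc (D r) → la (suc r) ≡ la r
    D-flat {r} e = linarith (D (suc r) ∷ D r ∷ la r ∷ r ∷ k ∷ la (suc r) ∷ []) (λ a b c d e f → a :≡ con 1 :+ b ⇒ b :+ c :≡ d :+ (con 1 :+ e) ⇒ a :+ f :≡ (con 1 :+ d) :+ (con 1 :+ e) ⇒ ⊢ f :≡ c) e (D+la r) (D+la (suc r))

    flat-D : ∀ {r} → la (suc r) ≡ la r → D (suc r) ≡ suc (D r)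
    flat-D {r} e = linarith (la (suc r) ∷ la r ∷ D r ∷ r ∷ k ∷ D (suc r) ∷ []) (λ a b c d e f → a :≡ b ⇒ c :+ b :≡ d :+ (con 1 :+ e) ⇒ f :+ a :≡ (con 1 :+ d) :+ (con 1 :+ e) ⇒ ⊢ f :≡ con 1 :+ c) e (D+la r) (D+la (suc r))

    -- p levels of blocks of w + 1 consecutive rows above the block at z, each joined to the next by bounce edges;
    -- x starts the top block, and only its last w rows have upward edges, coming from rows a, …, a + w - 1.
    data Chain (w : ℕ) : (z p x a : ℕ) → Set where
      top  : ∀ {x a} → (∀ r → D r ≢ x) → (∀ i → i < w → D (a + i) ≡ suc (x + i)) → a + w ≤ x → Chain w x 1 x a
      step : ∀ {z p x a} y → (∀ i → i ≤ w → D (y + i) ≡ z + i) → y + w < z → Chain w y p x a → Chain w z (suc p) x a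

    -- The way in which a chain of width i fails to have width i + 1: the levels extend up to one
    -- where row z + i + 1 has no edge from above.
    data Break (i x : ℕ) : ℕ → Set where
      stop : ∀ {z} → x ≤ z → (∀ r → D r ≢ suc (z + i)) → Break i x z
      step : ∀ {z} y → D y ≡ z → (∀ t → t ≤ suc i → D (y + t) ≡ z + t) → y + suc i < z → Break i x y → Break i x z

    top≤ : ∀ {w z p x a} → Chain w z p x a → x ≤ z
    top≤ (top _ _ _) = ≤-refl
    top≤ {w} {z} {x = x} (step y _ y<z c) = linarith (y ∷ w ∷ z ∷ x ∷ []) (λ a b c d → a :+ b :< c ⇒ d :≤ a ⇒ ⊢ d :≤ c) y<z (top≤ c)

    break≤ : ∀ {i x z} → Break i x z → x ≤ z
    break≤ (stop x≤z _) = x≤z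
    break≤ {i} {x} {z} (step y _ _ y<z c) = linarith (y ∷ i ∷ z ∷ x ∷ []) (λ a b c d → a :+ (con 1 :+ b) :< c ⇒ d :≤ a ⇒ ⊢ d :≤ c) y<z (break≤ c)

    chain-top : ∀ {w z p x a} → Chain w z p x a → (∀ i → i < w → D (a + i) ≡ suc (x + i)) × a + w ≤ x
    chain-top (top _ e le) = e , le
    chain-top (step _ _ _ c) = chain-top c

    -- Injectivity of D forces the ascent from z, so a wider chain would pass through the level
    -- where the edge is missing.
    break-¬chain : ∀ {i w x z p x′ a} → i < w → Break i x z → ¬ Chain w z p x′ a
    break-¬chain i<w (stop _ none) (top _ e _) = none _ (e _ i<w)
    break-¬chain {i} {z = z} i<w (stop _ none) (step y e _ _) = none (y + suc i) (trans (e (suc i) i<w) (+-suc z i))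
    break-¬chain i<w (step y Dy _ _ _) (top none _ _) = none y Dy
    break-¬chain {z = z} i<w (step y Dy _ _ b) (step y′ e _ c)
      rewrite D-injective {y} {y′} (trans Dy (sym (trans (sym (cong D (+-identityʳ y′))) (trans (e 0 z≤n) (+-identityʳ z))))) = break-¬chain i<w b c

    chain-shrink : ∀ {w z p x a} → Chain (suc w) z p x a → Chain w z p x a
    chain-shrink {w} {x = x} {a} (top none e le) = top none (λ i i<w → e i (m≤n⇒m≤1+n i<w)) (linarith (a ∷ w ∷ x ∷ []) (λ a b c → a :+ (con 1 :+ b) :≤ c ⇒ ⊢ a :+ b :≤ c) le)
    chain-shrink {w} {z} (step y e y<z c) = step y (λ i i≤w → e i (m≤n⇒m≤1+n i≤w)) (linarith (y ∷ w ∷ z ∷ []) (λ a b c → a :+ (con 1 :+ b) :< c ⇒ ⊢ a :+ b :< c) y<z) (chain-shrink c)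

    preimage : ∀ v → (∃ λ r → D r ≡ v) ⊎ (∀ r → D r ≢ v)
    preimage v with anyUpTo? (λ r → D r ≟ v) v
    ... | yes (r , _ , e) = inj₁ (r , e)
    ... | no none = inj₂ (λ r e → none (r , subst (r <_) e (r<Dr r) , e))

    chain-start : ∀ z → ∃ λ p → ∃ λ x → Chain 0 z p x 0
    chain-start = <-rec _ go
      where
      go : ∀ z → (∀ {y} → y < z → ∃ λ p → ∃ λ x → Chain 0 y p x 0) → ∃ λ p → ∃ λ x → Chain 0 z p x 0
      go z rec with preimage z
      -- Width 0 imposes no condition on the row a, so 0 is a mere placeholder.
      ... | inj₂ none = 1 , z , top none (λ _ ()) z≤n
      ... | inj₁ (y , e) with rec (subst (y <_) e (r<Dr y))
      ...   | p , x , c = suc p , x , step y (λ { .0 z≤n → trans (cong D (+-identityʳ y)) (trans e (sym (+-identityʳ z))) })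
                (subst₂ _<_ (sym (+-identityʳ y)) e (r<Dr y)) c

    -- The row a may change only when i = 0, where it is a placeholder; the indicators of the empty
    -- interval agree.
    Extension : ℕ → (z p x a : ℕ) → Set
    Extension i z p x a = (∃ λ a′ → (∀ r → indicator a′ i r ≡ indicator a i r) × Chain (suc i) z p x a′) ⊎ Break i x z

    -- The bound keeps a larger block from running into the one below it: if y + i + 1 were z, then
    -- D z would be z + i + 1. One level up it holds again, because D y = z.
    chain-extend : ∀ {i z p x a} → Chain i z p x a → suc (z + i) < D z → Extension i z p x a
    chain-extend {i} {z} {a = a} (top none e le) z<Dz with preimage (suc (z + i))
    ... | inj₂ none′ = inj₂ (stop ≤-refl none′)
    ... | inj₁ (r , Dr) = inj₁ (first i a r refl Dr e le)
      where
      first : ∀ j a r → j ≡ i → D r ≡ suc (z + j) → (∀ t → t < j → D (a + t) ≡ suc (z + t)) → a + j ≤ z →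
        ∃ λ a′ → (∀ r → indicator a′ j r ≡ indicator a j r) × Chain (suc j) z 1 z a′
      first zero a r refl Dr e le = r , (λ _ → refl) , top none (λ { .0 (s≤s z≤n) → trans (cong D (+-identityʳ r)) Dr })
        r+1≤z
        where
        r≤z : r ≤ z
        r≤z = linarith (r ∷ D r ∷ z ∷ []) (λ a b c → a :< b ⇒ b :≡ con 1 :+ (c :+ con 0) ⇒ ⊢ a :≤ c) (r<Dr r) Dr
        r+1≤z : r + 1 ≤ z
        r+1≤z with m≤n⇒m<n∨m≡n r≤z
        ... | inj₁ r<z = linarith (r ∷ z ∷ []) (λ a b → a :< b ⇒ ⊢ a :+ con 1 :≤ b) r<z
        ... | inj₂ refl = ⊥-elim (<⇒≢ z<Dz (sym Dr))
      first (suc j) a r refl Dr e le = a , (λ _ → refl) , top none e′ le′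
        where
        r≡ : r ≡ a + suc j
        r≡ = trans (D-next (trans Dr (cong suc (trans (+-suc z j) (sym (e j ≤-refl)))))) (sym (+-suc a j))
        e′ : ∀ t → t < suc (suc j) → D (a + t) ≡ suc (z + t)
        e′ t t<ssj with m≤n⇒m<n∨m≡n (ℕP.≤-pred t<ssj)
        ... | inj₁ t<sj = e t t<sj
        ... | inj₂ refl = trans (cong D (sym r≡)) Dr
        le′ : a + suc (suc j) ≤ z
        le′ with m≤n⇒m<n∨m≡n le
        ... | inj₁ lt = linarith (a ∷ j ∷ z ∷ []) (λ a b c → a :+ (con 1 :+ b) :< c ⇒ ⊢ a :+ (con 1 :+ (con 1 :+ b)) :≤ c) lt
        ... | inj₂ eq = ⊥-elim (<⇒≢ z<Dz (sym (trans (cong D (trans (sym eq) (sym r≡))) Dr)))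
    chain-extend {i} {z} {x = x} (step y e y<z c) z<Dz with preimage (suc (z + i))
    ... | inj₂ none = inj₂ (stop (linarith (y ∷ i ∷ z ∷ x ∷ []) (λ a b c d → a :+ b :< c ⇒ d :≤ a ⇒ ⊢ d :≤ c) y<z (top≤ c)) none)
    ... | inj₁ (r , Dr) = extended (chain-extend c (linarith (y ∷ i ∷ z ∷ D y ∷ []) (λ a b c d → a :+ (con 1 :+ b) :< c ⇒ c :≡ d ⇒ ⊢ con 1 :+ (a :+ b) :< d) y<z′ (sym Dy)))
      where
      Dy : D y ≡ z
      Dy = trans (cong D (sym (+-identityʳ y))) (trans (e 0 z≤n) (+-identityʳ z))
      r≡ : r ≡ y + suc i
      r≡ = trans (D-next (trans Dr (cong suc (sym (e i ≤-refl))))) (sym (+-suc y i))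
      e′ : ∀ t → t ≤ suc i → D (y + t) ≡ z + t
      e′ t t≤si with m≤n⇒m<n∨m≡n t≤si
      ... | inj₁ t<si = e t (ℕP.≤-pred t<si)
      ... | inj₂ refl = trans (cong D (sym r≡)) (trans Dr (sym (+-suc z i)))
      y<z′ : y + suc i < z
      y<z′ with m≤n⇒m<n∨m≡n y<z
      ... | inj₁ lt = linarith (y ∷ i ∷ z ∷ []) (λ a b c → con 1 :+ (a :+ b) :< c ⇒ ⊢ a :+ (con 1 :+ b) :< c) lt
      ... | inj₂ eq = ⊥-elim (<⇒≢ z<Dz (sym (trans (cong D (trans (sym eq) (trans (sym (+-suc y i)) (sym r≡)))) Dr)))
      extended : ∀ {p x a} → Extension i y p x a → Extension i z (suc p) x a
      extended (inj₁ (a′ , same , c′)) = inj₁ (a′ , same , step y e′ y<z′ c′)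
      extended (inj₂ b) = inj₂ (step y Dy e′ y<z′ b)

-- Straightening A_z one row at a time.

module Straightening where
  open import Data.Nat as ℕ using (ℕ; zero; suc; _≤_; _<_; _+_; _*_; _∸_; s≤s; pred)
  open import Data.Nat.Properties using (≤-refl; ≤-trans; <-trans; <⇒≤; ≤-reflexive; m≤m+n; +-suc; +-comm; +-identityʳ; _≟_; _<?_; ≮⇒≥; <⇒≢; n<1+n; m≤n⇒m≤1+n; m≤n⇒m<n∨m≡n; *-suc; *-zeroʳ)
  open import Data.Integer as ℤ using (ℤ; +_; 0ℤ; 1ℤ)
  import Data.Integer.Properties as ℤP
  import Data.Integer.Tactic.RingSolver as ℤSolver
  open import Data.Fin using (zero; suc)
  open import Data.List using ([]; _∷_)
  open import Data.Product using (_×_; _,_; proj₁; proj₂)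
  open import Data.Sum using (_⊎_; inj₁; inj₂)
  open import Data.Empty using (⊥; ⊥-elim)
  open import Data.Vec using ([]; _∷_)
  open import Relation.Nullary using (yes; no; ¬_)
  open import Relation.Binary.PropositionalEquality
  open LinearArithmetic
  open SymmetricFunctions
  open RaisingSeries
  open RootColumns
  open MirrorChains
  open BounceGraph

  module Straighten (ℓ k : ℕ) (la : ℕ → ℕ) (la≤k : ∀ r → la r ≤ k) (antitone : ∀ {r s} → r ≤ s → la s ≤ la r) where
    open Bounce k la la≤k antitone

    -- Root set and weight after the first i + 1 rows of the block at z were shortened and j rows at a lengthened.
    firstRoot : (z i a j : ℕ) → ℕ → ℕ
    firstRoot z i a j r = D r + indicator z (suc i) r ∸ indicator a j r

    weight : (z i a j : ℕ) → ℕ → ℤ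
    weight z i a j r = + la r ℤ.- + indicator z (suc i) r ℤ.+ + indicator a j r

    firstRoot-value : ∀ z i a j r {I J} → indicator z (suc i) r ≡ I → indicator a j r ≡ J → firstRoot z i a j r ≡ D r + I ∸ J
    firstRoot-value z i a j r = cong₂ (λ I J → D r + I ∸ J)

    weight-value : ∀ z i a j r {I J} → indicator z (suc i) r ≡ I → indicator a j r ≡ J → weight z i a j r ≡ + la r ℤ.- + I ℤ.+ + J
    weight-value z i a j r = cong₂ (λ I J → + la r ℤ.- + I ℤ.+ + J)

    weight-plain : ∀ z i a j r → indicator z (suc i) r ≡ 0 → indicator a j r ≡ 0 → weight z i a j r ≡ + la r
    weight-plain z i a j r e e′ = trans (weight-value z i a j r e e′) (trans (ℤP.+-identityʳ _) (ℤP.+-identityʳ (+ la r)))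

    record Frame (z i x a j : ℕ) : Set where
      constructor frame
      field
        x≤z   : x ≤ z
        a+j≤x : a + j ≤ x
        edges : ∀ t → t < j → D (a + t) ≡ suc (x + t)
        after : suc (z + i) ≤ D z
        j≤    : j ≤ suc i

    module _ {z i x a j : ℕ} (F : Frame z i x a j) where
      open Frame F

      E : ℕ → ℕ
      E = firstRoot z i a j

      a-above : ∀ {r} → x ≤ r → indicator a j r ≡ 0
      a-above x≤r = indicator-above j (≤-trans a+j≤x x≤r)

      E-between : ∀ {r} → x ≤ r → r < z → E r ≡ D r
      E-between x≤r r<z = trans (firstRoot-value z i a j _ (indicator-below (suc i) r<z) (a-above x≤r)) (+-identityʳ _)

      E-in : ∀ {t} → t < suc i → E (z + t) ≡ suc (D (z + t))
      E-in {t} t<si = trans (firstRoot-value z i a j (z + t) (indicator-inside z t<si) (a-above (≤-trans x≤z (m≤m+n z t)))) (+-comm (D (z + t)) 1)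

      E-after : ∀ {r} → z + suc i ≤ r → E r ≡ D r
      E-after {r} le = trans (firstRoot-value z i a j r (indicator-above (suc i) le) (a-above (linarith (x ∷ z ∷ i ∷ r ∷ []) (λ a b c d → a :≤ b ⇒ b :+ (con 1 :+ c) :≤ d ⇒ ⊢ a :≤ d) x≤z le))) (+-identityʳ _)

      -- Modified rows do not interfere in the levels between x and z: the rows of the block start
      -- their roots beyond column z + i + 1, and the lengthened ones in a column x + t with t ≤ i,
      -- hence at most y + i.
      E-hit : ∀ {y} → x ≤ y → y ≤ z → ∀ r → r < y + i → E r ≡ suc (y + i) → D r ≡ suc (y + i) × (r < a ⊎ a + j ≤ r) × r < z
      E-hit {y} x≤y y≤z r r<y+i Er with inInterval z (suc i) r
      ... | inside t t<si refl _ = ⊥-elim (linarith (D (z + t) ∷ y ∷ i ∷ z ∷ D z ∷ []) (λ a b c d e → con 1 :+ a :≡ con 1 :+ (b :+ c) ⇒ b :≤ d ⇒ e :≤ a ⇒ con 1 :+ (d :+ c) :≤ e ⇒ ⊢ absurd)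
              (trans (sym (E-in t<si)) Er) y≤z (D-mono-≤ (m≤m+n z t)) after)
      ... | outside e (inj₂ le) = ⊥-elim (linarith (z ∷ i ∷ r ∷ y ∷ []) (λ a b c d → a :+ (con 1 :+ b) :≤ c ⇒ c :< d :+ b ⇒ d :≤ a ⇒ ⊢ absurd) le r<y+i y≤z)
      ... | outside e (inj₁ r<z) with inInterval a j r
      ...   | outside e′ o = trans (sym (trans (firstRoot-value z i a j r e e′) (+-identityʳ _))) Er , o , r<z
      ...   | inside t t<j refl e′ = ⊥-elim (linarith (x ∷ t ∷ y ∷ i ∷ j ∷ []) (λ a b c d e → a :+ b :+ con 0 :≡ con 1 :+ (c :+ d) ⇒ a :≤ c ⇒ b :< e ⇒ e :≤ con 1 :+ d ⇒ ⊢ absurd)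
                (trans (sym (trans (firstRoot-value z i a j (a + t) e e′) (cong (λ v → v + 0 ∸ 1) (edges t t<j)))) Er) x≤y t<j j≤)

      module _ (g : ℕ → ℤ) (plain : ∀ r → x ≤ r → r < z → g r ≡ + la r) where

        record Level (y′ y : ℕ) : Set where
          constructor level
          field
            below  : suc (y′ + i) < y + i
            edge   : E (y′ + i) ≡ y + i
            edge′  : E (suc (y′ + i)) ≡ suc (y + i)
            unique : ∀ r → r < y + i → E r ≡ suc (y + i) → r ≡ suc (y′ + i)
            flat   : g (suc (y′ + i)) ≡ g (y′ + i)

        level-of : ∀ {y′ y} → x ≤ y′ → y ≤ z → y′ + suc i < y → (∀ t → t ≤ suc i → D (y′ + t) ≡ y + t) → Level y′ y
        level-of {y′} {y} x≤y′ y≤z y′<y e = level (linarith (y′ ∷ i ∷ y ∷ []) (λ a b c → a :+ (con 1 :+ b) :< c ⇒ ⊢ con 1 :+ (a :+ b) :< c :+ b) y′<y)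
          (trans (E-between x≤ ≤z) Dy) (trans (E-between (m≤n⇒m≤1+n x≤) <z) Dsy)
          (λ r r<y Er → D-injective (trans (proj₁ (E-hit (≤-trans x≤y′ (linarith (y′ ∷ i ∷ y ∷ []) (λ a b c → a :+ (con 1 :+ b) :< c ⇒ ⊢ a :≤ c) y′<y)) y≤z r r<y Er)) (sym Dsy)))
          (trans (plain _ (m≤n⇒m≤1+n x≤) <z) (trans (cong +_ (D-flat (trans Dsy (cong suc (sym Dy))))) (sym (plain _ x≤ ≤z))))
          where
          x≤ : x ≤ y′ + i
          x≤ = ≤-trans x≤y′ (m≤m+n y′ i)
          <z : suc (y′ + i) < z
          <z = linarith (y′ ∷ i ∷ y ∷ z ∷ []) (λ a b c d → a :+ (con 1 :+ b) :< c ⇒ c :≤ d ⇒ ⊢ con 1 :+ (a :+ b) :< d) y′<y y≤z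
          ≤z : y′ + i < z
          ≤z = <⇒≤ <z
          Dy : D (y′ + i) ≡ y + i
          Dy = e i (m≤n⇒m≤1+n ≤-refl)
          Dsy : D (suc (y′ + i)) ≡ suc (y + i)
          Dsy = trans (cong D (sym (+-suc y′ i))) (trans (e (suc i) ≤-refl) (+-suc y i))

        -- The last upward edge of the chain is already used up: once lengthened, row a + i starts
        -- its roots in column x + i, and by injectivity of D no other row starts in x + i + 1.
        pairBreak-unhit : ∀ {y p} → j ≡ suc i → Chain (suc i) y p x a → y ≤ z → PairBreak E g (y + i)
        pairBreak-unhit j≡ (top none e _) _ = stop λ r r<x Er → hit r (E-hit ≤-refl x≤z r r<x Er)
          where
          hit : ∀ r → D r ≡ suc (x + i) × (r < a ⊎ a + j ≤ r) × r < z → ⊥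
          hit r (Dr , o , _) with D-injective {r} {a + i} (trans Dr (sym (e i ≤-refl)))
          hit r (Dr , inj₁ r<a , _) | refl = linarith (a ∷ i ∷ []) (λ a b → a :+ b :< a ⇒ ⊢ absurd) r<a
          hit r (Dr , inj₂ ≤r , _) | refl = linarith (a ∷ j ∷ i ∷ []) (λ a b c → a :+ b :≤ a :+ c ⇒ b :≡ con 1 :+ c ⇒ ⊢ absurd) ≤r j≡
        pairBreak-unhit {y} j≡ (step y′ e y′<y c) y≤z = step (y′ + i) below edge edge′ unique flat
          (pairBreak-unhit j≡ c (linarith (y′ ∷ i ∷ y ∷ z ∷ []) (λ a b c d → a :+ (con 1 :+ b) :< c ⇒ c :≤ d ⇒ ⊢ a :≤ d) y′<y y≤z))
          where open Level (level-of (top≤ c) y≤z y′<y e)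

        pairBreak : ∀ {y} → Break i x y → y ≤ z → PairBreak E g (y + i)
        pairBreak (stop x≤y none) y≤z = stop λ r r<y Er → none r (proj₁ (E-hit x≤y y≤z r r<y Er))
        pairBreak {y} (step y′ _ e y′<y b) y≤z = step (y′ + i) below edge edge′ unique flat
          (pairBreak b (linarith (y′ ∷ i ∷ y ∷ z ∷ []) (λ a b c d → a :+ (con 1 :+ b) :< c ⇒ c :≤ d ⇒ ⊢ a :≤ d) y′<y y≤z))
          where open Level (level-of (break≤ b) y≤z y′<y e)

        pairChain : ∀ {y p} → j ≡ i → Chain (suc i) y p x a → y ≤ z → PairChain E g (y + i) p (a + i)
        pairChain j≡ (top none e le) _ = top (linarith (a ∷ i ∷ x ∷ []) (λ a b c → a :+ (con 1 :+ b) :≤ c ⇒ ⊢ a :+ b :< c :+ b) le)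
          (trans (firstRoot-value z i a j (a + i) (indicator-below (suc i) (linarith (a ∷ i ∷ x ∷ z ∷ []) (λ a b c d → a :+ (con 1 :+ b) :≤ c ⇒ c :≤ d ⇒ ⊢ a :+ b :< d) le x≤z))
            (indicator-above j (≤-reflexive (cong (_+_ a) j≡)))) (trans (+-identityʳ _) (e i ≤-refl)))
          (λ r r<x Er → D-injective (trans (proj₁ (E-hit ≤-refl x≤z r r<x Er)) (sym (e i ≤-refl))))
        pairChain {y} j≡ (step y′ e y′<y c) y≤z = step (y′ + i) below edge edge′ unique flat
          (pairChain j≡ c (linarith (y′ ∷ i ∷ y ∷ z ∷ []) (λ a b c d → a :+ (con 1 :+ b) :< c ⇒ c :≤ d ⇒ ⊢ a :≤ d) y′<y y≤z))
          where open Level (level-of (top≤ c) y≤z y′<y e)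

      -- Row z + i, already shortened, starts its roots one column later than before, exactly where
      -- row z + i + 1 with the same part starts.
      mirror-at : ∀ g → suc (z + i) < ℓ → la (suc (z + i)) ≡ la (z + i) → g (suc (z + i)) ≡ g (z + i) ℤ.+ 1ℤ → Mirror ℓ (z + i) E g
      mirror-at g <ℓ same weights = mirror <ℓ
        (trans (E-in ≤-refl) (trans (sym (flat-D same)) (sym (E-after (≤-reflexive (+-suc z i))))))
        (subst (suc (z + i) <_) (sym (E-in ≤-refl)) (s≤s (r<Dr (z + i)))) weights

    weight-step : ∀ z i a r → move (a + i) (suc (z + i)) (weight z i a i) r ≡ weight z (suc i) a (suc i) r
    weight-step z i a r = trans (regroup (+ la r) (+ indicator z (suc i) r) (+ indicator a i r) (δ (a + i) r) (δ (suc (z + i)) r))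
      (cong₂ (λ I J → + la r ℤ.- I ℤ.+ J)
        (trans (cong (λ v → + indicator z (suc i) r ℤ.+ δ v r) (sym (+-suc z i))) (sym (indicator-δ z (suc i) r)))
        (sym (indicator-δ a i r)))
      where
      regroup : ∀ l I J d e → l ℤ.- I ℤ.+ J ℤ.+ d ℤ.- e ≡ l ℤ.- (I ℤ.+ e) ℤ.+ (J ℤ.+ d)
      regroup = ℤSolver.solve-∀

    firstRoot-lengthen : ∀ z i a → a + i < z → ∀ r → upd (a + i) (pred (firstRoot z i a i (a + i))) (firstRoot z i a i) r ≡ firstRoot z i a (suc i) r
    firstRoot-lengthen z i a a<z r with r ≟ a + i
    ... | yes refl = trans (upd-same (a + i) _ (firstRoot z i a i))
            (trans (cong pred (firstRoot-value z i a i (a + i) (indicator-below (suc i) a<z) (indicator-above i ≤-refl)))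
              (sym (firstRoot-value z i a (suc i) (a + i) (indicator-below (suc i) a<z) (indicator-inside a ≤-refl))))
    ... | no r≢ = trans (upd-other _ (firstRoot z i a i) r≢) (cong (λ J → D r + indicator z (suc i) r ∸ J) (sym (indicator-suc i r≢)))

    firstRoot-shorten : ∀ z i a j → a + j ≤ z → ∀ r →
      upd (suc (z + i)) (suc (firstRoot z i a j (suc (z + i)))) (firstRoot z i a j) r ≡ firstRoot z (suc i) a j r
    firstRoot-shorten z i a j a≤z r with r ≟ suc (z + i)
    ... | yes refl = trans (upd-same (suc (z + i)) _ (firstRoot z i a j))
            (trans (cong suc (trans (firstRoot-value z i a j r (indicator-above (suc i) (≤-reflexive (+-suc z i))) above) (+-identityʳ (D r))))
              (sym (trans (firstRoot-value z (suc i) a j r (trans (cong (indicator z (suc (suc i))) (sym (+-suc z i))) (indicator-inside z ≤-refl)) above) (+-comm (D r) 1))))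
      where
      above : indicator a j (suc (z + i)) ≡ 0
      above = indicator-above j (linarith (a ∷ j ∷ z ∷ i ∷ []) (λ a b c d → a :+ b :≤ c ⇒ ⊢ a :+ b :≤ con 1 :+ (c :+ d)) a≤z)
    ... | no r≢ = trans (upd-other _ (firstRoot z i a j) r≢)
            (cong (λ I → D r + I ∸ indicator a j r) (sym (indicator-suc (suc i) (λ e → r≢ (trans e (+-suc z i))))))

    state : (z i a : ℕ) → Series
    state z i a = 𝓗 ℓ (firstRoot z i a i) (weight z i a i)

    module _ {z i p x a : ℕ} (c : Chain (suc i) z p x a) (z<Dz : suc (z + i) < D z) (z<ℓ : suc (z + i) < ℓ) (same : la (suc (z + i)) ≡ la (z + i)) where
      private
        q : ℕ
        q = suc (z + i)
        a≤x : a + suc i ≤ x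
        a≤x = proj₂ (chain-top c)
        a≤z : a + suc i ≤ z
        a≤z = ≤-trans a≤x (top≤ c)
        F₀ : Frame z i x a i
        F₀ = frame (top≤ c) (linarith (a ∷ i ∷ x ∷ []) (λ a b c → a :+ (con 1 :+ b) :≤ c ⇒ ⊢ a :+ b :≤ c) a≤x) (λ t t<i → proj₁ (chain-top c) t (m≤n⇒m≤1+n t<i)) (<⇒≤ z<Dz) (m≤n⇒m≤1+n ≤-refl)
        F₁ : Frame z i x a (suc i)
        F₁ = frame (top≤ c) a≤x (proj₁ (chain-top c)) (<⇒≤ z<Dz) ≤-refl
        W₀ = weight z i a i
        W₁ = weight z (suc i) a (suc i)
        E₁ = firstRoot z i a (suc i)
        W-in : ∀ {i′} t → t < suc i′ → i′ ≤ suc i → weight z i′ a i′ (z + t) ≡ + la (z + t) ℤ.- 1ℤ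
        W-in {i′} t t<si i′≤ = trans (weight-value z i′ a i′ (z + t) (indicator-inside z t<si)
          (indicator-above i′ (linarith (a ∷ i ∷ z ∷ i′ ∷ t ∷ []) (λ a b c d e → a :+ (con 1 :+ b) :≤ c ⇒ d :≤ con 1 :+ b ⇒ ⊢ a :+ d :≤ c :+ e) a≤z i′≤))) (ℤP.+-identityʳ _)
        q≡ : z + suc i ≡ q
        q≡ = +-suc z i
        restore : ∀ v → v ≡ v ℤ.- 1ℤ ℤ.+ 1ℤ
        restore = ℤSolver.solve-∀
        weights₀ : W₀ q ≡ W₀ (z + i) ℤ.+ 1ℤ
        weights₀ = trans (weight-plain z i a i q (indicator-above (suc i) (≤-reflexive q≡)) (indicator-above i (linarith (a ∷ i ∷ z ∷ []) (λ a b c → a :+ (con 1 :+ b) :≤ c ⇒ ⊢ a :+ b :≤ con 1 :+ (c :+ b)) a≤z)))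
          (trans (cong +_ same) (trans (restore (+ la (z + i))) (cong (ℤ._+ 1ℤ) (sym (W-in i ≤-refl (m≤n⇒m≤1+n ≤-refl))))))
        plain₀ : ∀ r → x ≤ r → r < z → W₀ r ≡ + la r
        plain₀ r x≤r r<z = weight-plain z i a i r (indicator-below (suc i) r<z) (a-above F₀ x≤r)
        plain₁ : ∀ r → x ≤ r → r < z → W₁ r ≡ + la r
        plain₁ r x≤r r<z = weight-plain z (suc i) a (suc i) r (indicator-below (suc (suc i)) r<z) (a-above F₁ x≤r)
        E₁q : E₁ q ≡ D q
        E₁q = E-after F₁ (≤-reflexive q≡)
        G = move q (E₁ q) W₁
        plainG : ∀ r → x ≤ r → r < z → G r ≡ + la r
        plainG r x≤r r<z = trans (move-other W₁ (<⇒≢ r<q) (<⇒≢ (<-trans r<q (subst (q <_) (sym E₁q) (r<Dr q))))) (plain₁ r x≤r r<z)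
          where
          r<q : r < q
          r<q = linarith (r ∷ z ∷ i ∷ []) (λ a b c → a :< b ⇒ ⊢ a :< con 1 :+ (b :+ c)) r<z
        weightsG : G q ≡ G (z + i) ℤ.+ 1ℤ
        weightsG = trans (move-target W₁ (<⇒≢ (subst (q <_) (sym E₁q) (r<Dr q)))) (cong (ℤ._+ 1ℤ)
          (trans (trans (cong W₁ (sym q≡)) (W-in {suc i} (suc i) ≤-refl ≤-refl)) (trans (cong (λ v → + v ℤ.- 1ℤ) (trans (cong la q≡) same))
            (sym (trans (move-other W₁ (<⇒≢ (n<1+n (z + i))) (<⇒≢ (<-trans (n<1+n (z + i)) (subst (q <_) (sym E₁q) (r<Dr q)))))
              (W-in {suc i} i (m≤n⇒m≤1+n ≤-refl) ≤-refl))))))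
        removeRoot : 𝓗 ℓ E₁ W₁ ≋ 𝓗 ℓ (upd q (suc (E₁ q)) E₁) W₁
        removeRoot with E₁ q <? ℓ
        ... | no ≮ℓ = 𝓗-noroot ℓ E₁ W₁ q (≮⇒≥ ≮ℓ)
        ... | yes <ℓ = ≋-trans (𝓗-root ℓ E₁ W₁ q (subst (q <_) (sym E₁q) (r<Dr q)) <ℓ)
          (⊕-identityʳ {f = 𝓗 ℓ (upd q (suc (E₁ q)) E₁) W₁} (tShift-0S 1 (𝓗-break ℓ (mirror-at F₁ G z<ℓ same weightsG) (pairBreak-unhit F₁ G plainG refl c ≤-refl))))

      -- The pair chain lengthens row a + i and takes a box from row z + i + 1, with a factor t for
      -- each level. The first root of row z + i + 1 must still go; in the expansion at that root
      -- the second summand vanishes by `pairBreak-unhit`.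
      pass : state z i a ≋ tShift p (state z (suc i) a)
      pass = ≋-trans (𝓗-chain ℓ (mirror-at F₀ W₀ z<ℓ same weights₀) (pairChain F₀ W₀ plain₀ refl c ≤-refl))
        (tShift-cong p (≋-trans (𝓗-cong ℓ (upd (a + i) (pred (firstRoot z i a i (a + i))) (firstRoot z i a i)) E₁ (move (a + i) q W₀) W₁
            (λ r _ → firstRoot-lengthen z i a (linarith (a ∷ i ∷ z ∷ []) (λ a b c → a :+ (con 1 :+ b) :≤ c ⇒ ⊢ a :+ b :< c) a≤z) r) (λ r _ → weight-step z i a r))
          (≋-trans removeRoot (𝓗-cong ℓ (upd q (suc (E₁ q)) E₁) (firstRoot z (suc i) a (suc i)) W₁ W₁
            (λ r _ → firstRoot-shorten z i a (suc i) a≤z r) (λ _ _ → refl)))))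

    module _ {z i p x a : ℕ} (c : Chain i z p x a) (z<Dz : suc (z + i) ≤ D z) (z<ℓ : suc (z + i) < ℓ) (same : la (suc (z + i)) ≡ la (z + i)) where
      private
        F : Frame z i x a i
        F = frame (top≤ c) (proj₂ (chain-top c)) (proj₁ (chain-top c)) z<Dz (m≤n⇒m≤1+n ≤-refl)
        W = weight z i a i
        a≤z : a + i ≤ z
        a≤z = ≤-trans (proj₂ (chain-top c)) (top≤ c)
        restore : ∀ v → v ≡ v ℤ.- 1ℤ ℤ.+ 0ℤ ℤ.+ 1ℤ
        restore = ℤSolver.solve-∀
        weights : W (suc (z + i)) ≡ W (z + i) ℤ.+ 1ℤ
        weights = trans (weight-plain z i a i (suc (z + i)) (indicator-above (suc i) (≤-reflexive (+-suc z i))) (indicator-above i (linarith (a ∷ i ∷ z ∷ []) (λ a b c → a :+ b :≤ c ⇒ ⊢ a :+ b :≤ con 1 :+ (c :+ b)) a≤z)))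
          (trans (cong +_ same) (trans (restore (+ la (z + i))) (cong (ℤ._+ 1ℤ) (sym
            (weight-value z i a i (z + i) (indicator-inside z ≤-refl) (indicator-above i (≤-trans a≤z (m≤m+n z i))))))))
        plain : ∀ r → x ≤ r → r < z → W r ≡ + la r
        plain r x≤r r<z = weight-plain z i a i r (indicator-below (suc i) r<z) (a-above F x≤r)

      state-break : Break i x z → state z i a ≋ 0S
      state-break b = 𝓗-break ℓ (mirror-at F W z<ℓ same weights) (pairBreak F W plain b ≤-refl)

      -- The block reaches the row its own bounce edge leads to.
      state-overlap : suc (z + i) ≡ D z → state z i a ≋ 0S
      state-overlap e = 𝓗-break ℓ (mirror-at F W z<ℓ same weights) (stop λ r r<z Er → absurd-hit r (E-hit F (top≤ c) ≤-refl r r<z Er))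
        where
        absurd-hit : ∀ r → D r ≡ suc (z + i) × (r < a ⊎ a + i ≤ r) × r < z → ⊥
        -- The only row whose first root column is z + i + 1 = D z is z itself, which does not lie
        -- above z.
        absurd-hit r (Dr , _ , r<z) = <⇒≢ r<z (D-injective (trans Dr e))

    -- The second half of `bad` is kept for the comparison with cores: it shows that such a z is not
    -- the bottom row of a cover.
    data Outcome (z i : ℕ) : Set where
      good : ∀ {p x a} → z + i < D z → Chain i z p x a → state z 0 0 ≋ tShift (p * i) (state z i a) → Outcome z i
      bad  : state z 0 0 ≋ 0S → (z + i < D z → ∀ {p x a} → ¬ Chain i z p x a) → Outcome z i

    outcome : ∀ z i → z + i < ℓ → (∀ t → t ≤ i → la (z + t) ≡ la z) → Outcome z i
    outcome z zero _ _ with chain-start z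
    ... | p , x , c = good (subst (_< D z) (sym (+-identityʳ z)) (r<Dr z)) c (subst (λ s → state z 0 0 ≋ tShift s (state z 0 0)) (sym (*-zeroʳ p)) ≋-refl)
    outcome z (suc i) <ℓ same with outcome z i (linarith (z ∷ i ∷ ℓ ∷ []) (λ a b c → a :+ (con 1 :+ b) :< c ⇒ ⊢ a :+ b :< c) <ℓ) (λ t t≤i → same t (m≤n⇒m≤1+n t≤i))
    ... | bad e none = bad e (λ lt c → none (linarith (z ∷ i ∷ D z ∷ []) (λ a b c → a :+ (con 1 :+ b) :< c ⇒ ⊢ a :+ b :< c) lt) (chain-shrink c))
    ... | good {p} {x} {a} lt c e = continue (m≤n⇒m<n∨m≡n lt)
      where
      <ℓ′ : suc (z + i) < ℓ
      <ℓ′ = subst (_< ℓ) (+-suc z i) <ℓ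
      same′ : la (suc (z + i)) ≡ la (z + i)
      same′ = trans (cong la (sym (+-suc z i))) (trans (same (suc i) ≤-refl) (sym (same i (m≤n⇒m≤1+n ≤-refl))))
      continue : suc (z + i) < D z ⊎ suc (z + i) ≡ D z → Outcome z (suc i)
      continue (inj₂ eq) = bad (≋-trans e (tShift-0S (p * i) (state-overlap c lt <ℓ′ same′ eq)))
        (λ lt′ _ → linarith (z ∷ i ∷ D z ∷ []) (λ a b c → a :+ (con 1 :+ b) :< c ⇒ con 1 :+ (a :+ b) :≡ c ⇒ ⊢ absurd) lt′ eq)
      continue (inj₁ lt′) with chain-extend c lt′
      ... | inj₂ b = bad (≋-trans e (tShift-0S (p * i) (state-break c lt <ℓ′ same′ b))) (λ _ → break-¬chain ≤-refl b)
      ... | inj₁ (a′ , ind≡ , c′) = good (subst (_< D z) (sym (+-suc z i)) lt′) c′ (≋-trans e (≋-trans (tShift-cong (p * i)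
          (≋-trans (𝓗-cong ℓ (firstRoot z i a i) (firstRoot z i a′ i) (weight z i a i) (weight z i a′ i)
              (λ r _ → cong (λ J → D r + indicator z (suc i) r ∸ J) (sym (ind≡ r))) (λ r _ → cong (λ J → + la r ℤ.- + indicator z (suc i) r ℤ.+ + J) (sym (ind≡ r))))
            (pass c′ lt′ <ℓ′ same′)))
          (≋-trans (≋-sym (tShift-+ (p * i) p (state z (suc i) a′)))
            (subst (λ s → tShift (p * i + p) (state z (suc i) a′) ≋ tShift s (state z (suc i) a′)) (trans (+-comm (p * i) p) (sym (*-suc p i))) ≋-refl))))

-- Cores, their beads and the removal of translated ribbons.

module CoreRibbons where
  open import Data.Nat as ℕ using (ℕ; zero; suc; _≤_; _<_; _+_; _*_; _∸_; s≤s; z≤n)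
  open import Data.Nat.Properties using (≤-refl; ≤-trans; <-trans; <⇒≤; ≤-reflexive; m≤m+n; m≤n+m; +-suc; +-comm; +-identityʳ; _≤?_; ≰⇒>; n<1+n; m≤n⇒m≤1+n; m+[n∸m]≡n; m≤n⇒m<n∨m≡n)
  open import Data.Integer using (+_)
  import Data.Nat.Properties as ℕP
  open import Data.Fin using (zero; suc)
  open import Data.List using (List; []; _∷_)
  open import Data.List.Membership.Propositional using (_∈_; find; lose)
  open import Data.List.Relation.Unary.Any using (here; there; any?)
  open import Data.Product using (_×_; _,_; proj₁; proj₂; ∃)
  open import Data.Sum using (_⊎_; inj₁; inj₂)
  open import Data.Empty using (⊥; ⊥-elim)
  open import Data.Vec using ([]; _∷_)
  open import Function using (_∘_)
  open import Relation.Nullary using (Dec; yes; no; ¬_)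
  open import Relation.Binary.PropositionalEquality
  open import Relation.Nullary.Decidable using (_×-dec_)
  open LinearArithmetic
  open BounceGraph

  -- Row r of the core has la r boxes of hook length at most k, preceded by as many boxes as row D r
  -- has. The argument f bounds the recursion; R steps suffice because D r > r and the parts vanish
  -- from row R on.
  coreRows : ℕ → (ℕ → ℕ) → ℕ → ℕ → ℕ
  coreRows k la zero r = 0
  coreRows k la (suc f) r = la r + coreRows k la f (bounce k la r)

  record IsCore (k R : ℕ) (la K : ℕ → ℕ) : Set where
    field
      la≤k     : ∀ r → la r ≤ k
      la-zero  : ∀ r → R ≤ r → la r ≡ 0
      K-zero   : ∀ r → R ≤ r → K r ≡ 0
      rec      : ∀ r → K r ≡ la r + K (bounce k la r)

  coreRows-zero : ∀ k la f r → (∀ s → r ≤ s → la s ≡ 0) → (∀ s → la s ≤ k) → coreRows k la f r ≡ 0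
  coreRows-zero k la zero r z b = refl
  coreRows-zero k la (suc f) r z b rewrite z r ≤-refl = coreRows-zero k la f (r + suc k) (λ s le → z s (linarith (r ∷ k ∷ s ∷ []) (λ a b c → a :+ (con 1 :+ b) :≤ c ⇒ ⊢ a :≤ c) le)) b

  coreRows-stable : ∀ k la R f r → (∀ s → R ≤ s → la s ≡ 0) → (∀ s → la s ≤ k) → (∀ s → s < bounce k la s) →
    R ≤ r + f → coreRows k la f r ≡ coreRows k la (suc f) r
  coreRows-stable k la R zero r z b later R≤ = sym (trans (+-identityʳ (la r)) (z r (subst (R ≤_) (+-identityʳ r) R≤)))
  coreRows-stable k la R (suc f) r z b later R≤ = cong (_+_ (la r)) (coreRows-stable k la R f (bounce k la r) z b later
    (linarith (R ∷ r ∷ f ∷ bounce k la r ∷ []) (λ a b c d → a :≤ b :+ (con 1 :+ c) ⇒ b :< d ⇒ ⊢ a :≤ d :+ c) R≤ (later r)))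

  isCore-coreRows : ∀ {k R la} → (∀ r → la r ≤ k) → (∀ {r s} → r ≤ s → la s ≤ la r) → (∀ r → R ≤ r → la r ≡ 0) → IsCore k R la (coreRows k la R)
  isCore-coreRows {k} {R} {la} b anti z = record
    { la≤k = b ; la-zero = z
    ; K-zero = λ r R≤r → coreRows-zero k la R r (λ s r≤s → z s (≤-trans R≤r r≤s)) b
    ; rec = λ r → coreRows-stable k la R R r z b (Bounce.r<Dr k la b anti) (m≤n+m R r) }

  module Beads {k R : ℕ} {la K : ℕ → ℕ} (core : IsCore k R la K) (antitone : ∀ {r s} → r ≤ s → la s ≤ la r) where
    open IsCore core public
    open Bounce k la la≤k antitone public

    -- The bead of row r sits at K r − r; the bead of D r lies k + 1 positions below the one of r.
    edge : ∀ r → K r + D r ≡ K (D r) + (r + suc k)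
    edge r = linarith (K r ∷ la r ∷ K (D r) ∷ D r ∷ r ∷ k ∷ []) (λ a b c d e f → a :≡ b :+ c ⇒ d :+ b :≡ e :+ (con 1 :+ f) ⇒ ⊢ a :+ d :≡ c :+ (e :+ (con 1 :+ f))) (rec r) (D+la r)

    -- From row R on K vanishes and the claim is clear. It is carried upwards, since D is increasing
    -- and every bounce edge lowers the bead by the same amount k + 1.
    beads-decrease : ∀ {r s} → r < s → K s + r < K r + s
    beads-decrease {r} {s} = go R (m≤n+m R r)
      where
      go : ∀ f {r s} → R ≤ r + f → r < s → K s + r < K r + s
      go zero {r} {s} R≤ r<s = subst₂ (λ u v → u + r < v + s) (sym (K-zero s (≤-trans R≤r (<⇒≤ r<s)))) (sym (K-zero r R≤r)) r<s
        where
        R≤r : R ≤ r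
        R≤r = subst (R ≤_) (+-identityʳ r) R≤
      go (suc f) {r} {s} R≤ r<s = linarith (K r ∷ D r ∷ K (D r) ∷ r ∷ k ∷ K s ∷ D s ∷ K (D s) ∷ s ∷ []) (λ a b c d e f g h i → a :+ b :≡ c :+ (d :+ (con 1 :+ e)) ⇒ f :+ g :≡ h :+ (i :+ (con 1 :+ e)) ⇒ h :+ b :< c :+ g ⇒ ⊢ f :+ d :< a :+ i)
        (edge r) (edge s) (go f (linarith (R ∷ r ∷ f ∷ D r ∷ []) (λ a b c d → a :≤ b :+ (con 1 :+ c) ⇒ b :< d ⇒ ⊢ a :≤ d :+ c) R≤ (r<Dr r)) (D-mono-< r<s))

    beads-weakly : ∀ {r s} → r ≤ s → K s + r ≤ K r + s
    beads-weakly r≤s with m≤n⇒m<n∨m≡n r≤s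
    ... | inj₁ r<s = <⇒≤ (beads-decrease r<s)
    ... | inj₂ refl = ≤-refl

    K-suc≤ : ∀ r → K (suc r) ≤ K r
    K-suc≤ r = linarith (K (suc r) ∷ r ∷ K r ∷ []) (λ a b c → a :+ b :< c :+ (con 1 :+ b) ⇒ ⊢ a :≤ c) (beads-decrease (n<1+n r))

    K-antitone : ∀ {r s} → r ≤ s → K s ≤ K r
    K-antitone {r} {zero} z≤n = ≤-refl
    K-antitone {r} {suc s} r≤ with m≤n⇒m<n∨m≡n r≤
    ... | inj₂ refl = ≤-refl
    ... | inj₁ r<s = ≤-trans (K-suc≤ s) (K-antitone (ℕP.≤-pred r<s))

    levels : ∀ {w z p x a} → Chain w z p x a → List ℕ
    levels (top {x} _ _ _) = x ∷ []
    levels (step {z} y _ _ c) = z ∷ levels c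

    z∈levels : ∀ {w z p x a} (c : Chain w z p x a) → z ∈ levels c
    z∈levels (top _ _ _) = here refl
    z∈levels (step _ _ _ _) = here refl

    levels≤ : ∀ {w z p x a} (c : Chain w z p x a) {y} → y ∈ levels c → y ≤ z
    levels≤ (top _ _ _) (here refl) = ≤-refl
    levels≤ (step _ _ _ c) (here refl) = ≤-refl
    levels≤ {w} {z} (step y _ y<z c) {v} (there m) = linarith (v ∷ y ∷ w ∷ z ∷ []) (λ a b c d → a :≤ b ⇒ b :+ c :< d ⇒ ⊢ a :≤ d) (levels≤ c m) y<z

    level-above : ∀ {w z p x a} (c : Chain w z p x a) {y r i} → y ∈ levels c → i ≤ w → D r ≡ y + i →
      (∃ λ y′ → y′ ∈ levels c × r ≡ y′ + i) ⊎ (∃ λ t → t < w × r ≡ a + t)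
    level-above (top {x} none e _) {r = r} {zero} (here refl) i≤w Dr = ⊥-elim (none r (trans Dr (+-identityʳ x)))
    level-above (top {x} none e _) {r = r} {suc i} (here refl) i≤w Dr = inj₂ (i , i≤w , D-injective (trans Dr (trans (+-suc x i) (sym (e i i≤w)))))
    level-above (step y′ e _ c) {i = i} (here refl) i≤w Dr = inj₁ (y′ , there (z∈levels c) , D-injective (trans Dr (sym (e i i≤w))))
    level-above (step _ _ _ c) (there m) i≤w Dr with level-above c m i≤w Dr
    ... | inj₁ (y′ , m′ , e) = inj₁ (y′ , there m′ , e)
    ... | inj₂ o = inj₂ o

    -- By `block` and `drop` the run of rows from z on with part la z ends exactly at z + w, so z
    -- determines the width.
    record Good (z w p x a : ℕ) : Set where
      field
        positive : 0 < la z
        block    : ∀ t → t ≤ w → la (z + t) ≡ la z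
        drop     : la (suc (z + w)) < la z
        short    : z + w < D z
        chain    : Chain w z p x a

  module Ribbons {k R : ℕ} {la K : ℕ → ℕ} (core : IsCore k R la K) (antitone : ∀ {r s} → r ≤ s → la s ≤ la r)
                 {z w p x a : ℕ} (good : Beads.Good core antitone z w p x a) where
      open Beads core antitone
      open Good good

      μ : ℕ → ℕ
      μ r = la r + indicator a w r ∸ indicator z (suc w) r

      x≤z : x ≤ z
      x≤z = top≤ chain

      a+w≤x : a + w ≤ x
      a+w≤x = proj₂ (chain-top chain)

      a-edges : ∀ t → t < w → D (a + t) ≡ suc (x + t)
      a-edges = proj₁ (chain-top chain)

      μ-value : ∀ {r I J} → indicator z (suc w) r ≡ I → indicator a w r ≡ J → μ r ≡ la r + J ∸ I
      μ-value {r} = cong₂ (λ I J → la r + J ∸ I)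

      μ-block : ∀ t → t ≤ w → suc (μ (z + t)) ≡ la z
      μ-block t t≤w = trans (cong suc (trans (μ-value {z + t} (indicator-inside z (s≤s t≤w)) (indicator-above w (linarith (a ∷ w ∷ x ∷ z ∷ t ∷ []) (λ a b c d e → a :+ b :≤ c ⇒ c :≤ d ⇒ ⊢ a :+ b :≤ d :+ e) a+w≤x x≤z)))
        (cong (_∸ 1) (trans (+-identityʳ (la (z + t))) (block t t≤w))))) (ℕP.m+[n∸m]≡n positive)

      μ-a : ∀ t → t < w → μ (a + t) ≡ suc (la (a + t))
      μ-a t t<w = trans (μ-value {a + t} (indicator-below (suc w) (linarith (a ∷ w ∷ x ∷ z ∷ t ∷ []) (λ a b c d e → a :+ b :≤ c ⇒ c :≤ d ⇒ e :< b ⇒ ⊢ a :+ e :< d) a+w≤x x≤z t<w)) (indicator-inside a t<w)) (+-comm (la (a + t)) 1)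

      data Position (r : ℕ) : Set where
        in-a     : ∀ t → t < w → r ≡ a + t → Position r
        in-block : ∀ t → t ≤ w → r ≡ z + t → Position r
        other    : μ r ≡ la r → (r < a ⊎ a + w ≤ r) → (r < z ⊎ z + suc w ≤ r) → Position r

      position : ∀ r → Position r
      position r with inInterval a w r | inInterval z (suc w) r
      ... | inside t t<w e _ | _ = in-a t t<w e
      ... | outside _ _ | inside t t≤w e _ = in-block t (ℕP.≤-pred t≤w) e
      ... | outside e o | outside e′ o′ = other (trans (μ-value {r} e′ e) (+-identityʳ (la r))) o o′

      μ≤k : ∀ r → μ r ≤ k
      μ≤k r with position r
      ... | other e _ _ = subst (_≤ k) (sym e) (la≤k r)
      ... | in-block t t≤w refl = linarith (μ (z + t) ∷ la z ∷ k ∷ []) (λ a b c → con 1 :+ a :≡ b ⇒ b :≤ c ⇒ ⊢ a :≤ c) (μ-block t t≤w) (la≤k z)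
      ... | in-a t t<w refl = linarith (μ (a + t) ∷ la (a + t) ∷ D (a + t) ∷ x ∷ t ∷ a ∷ k ∷ w ∷ []) (λ a b c d e f g h → a :≡ con 1 :+ b ⇒ c :≡ con 1 :+ (d :+ e) ⇒ c :+ b :≡ f :+ e :+ (con 1 :+ g) ⇒ f :+ h :≤ d ⇒ e :< h ⇒ ⊢ a :≤ g)
              (μ-a t t<w) (a-edges t t<w) (D+la (a + t)) a+w≤x t<w

      -- This leaves room for lengthening row a. Equal parts in r and a would make the edge of r end
      -- in D a - 1 = x, but no edge ends in the top row x.
      rise : ∀ r → suc r ≡ a → 0 < w → la a < la r
      rise r refl 0<w = linarith (D r ∷ D (suc r) ∷ x ∷ la (suc r) ∷ r ∷ k ∷ la r ∷ []) (λ a b c d e f g → a :< b ⇒ b :≡ con 1 :+ c ⇒ b :+ d :≡ (con 1 :+ e) :+ (con 1 :+ f) ⇒ a :+ g :≡ e :+ (con 1 :+ f) ⇒ a :< c ⇒ ⊢ d :< g)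
        (D-mono-< (n<1+n r)) Da (D+la (suc r)) (D+la r) Dr<x
        where
        Da : D (suc r) ≡ suc x
        Da = trans (cong D (sym (+-identityʳ (suc r)))) (trans (a-edges 0 0<w) (cong suc (+-identityʳ x)))
        Dr<x : D r < x
        Dr<x = ℕP.≤∧≢⇒< (ℕP.≤-pred (subst (D r <_) Da (D-mono-< (n<1+n r)))) (none chain r)
          where
          none : ∀ {z p} → Chain w z p x a → ∀ r → D r ≢ x
          none (top none _ _) = none
          none (step _ _ _ c) = none c

      μ-suc≤ : ∀ r → μ (suc r) ≤ μ r
      μ-suc≤ r with position r | position (suc r)
      ... | other e _ _ | other e′ _ _ = subst₂ _≤_ (sym e′) (sym e) (antitone (m≤n⇒m≤1+n ≤-refl))
      ... | other e _ _ | in-block t t≤w e′ = linarith (μ (z + t) ∷ la (z + t) ∷ la r ∷ μ r ∷ []) (λ a b c d → a :< b ⇒ b :≤ c ⇒ d :≡ c ⇒ ⊢ a :≤ d) (μ< t t≤w) (antitone (subst (r ≤_) e′ (m≤n⇒m≤1+n ≤-refl))) e |> subst (λ s → μ s ≤ μ r) (sym e′)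
        where
        infixl 0 _|>_
        _|>_ : ∀ {A B : Set} → A → (A → B) → B
        v |> f = f v
        μ< : ∀ t → t ≤ w → μ (z + t) < la (z + t)
        μ< t t≤w = ≤-reflexive (trans (μ-block t t≤w) (sym (block t t≤w)))
      ... | other e o _ | in-a t t<w e′ = entering t t<w e′ o
        where
        entering : ∀ t → t < w → suc r ≡ a + t → (r < a ⊎ a + w ≤ r) → μ (suc r) ≤ μ r
        entering zero 0<w e′ _ = linarith (μ (suc r) ∷ la (a + 0) ∷ la a ∷ la r ∷ μ r ∷ []) (λ a b c d e → a :≡ con 1 :+ b ⇒ b :≡ c ⇒ c :< d ⇒ e :≡ d ⇒ ⊢ a :≤ e)
          (trans (cong μ e′) (μ-a 0 0<w)) (cong la (+-identityʳ a)) (rise r (trans e′ (+-identityʳ a)) 0<w) e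
        entering (suc t) t<w e′ (inj₁ r<a) = ⊥-elim (linarith (r ∷ a ∷ t ∷ []) (λ a b c → con 1 :+ a :≡ b :+ (con 1 :+ c) ⇒ a :< b ⇒ ⊢ absurd) e′ r<a)
        entering (suc t) t<w e′ (inj₂ ≤r) = ⊥-elim (linarith (r ∷ a ∷ t ∷ w ∷ []) (λ a b c d → con 1 :+ a :≡ b :+ (con 1 :+ c) ⇒ b :+ d :≤ a ⇒ con 1 :+ c :< d ⇒ ⊢ absurd) e′ ≤r t<w)
      ... | in-a t t<w refl | other e′ _ _ = linarith (μ (a + t) ∷ la (a + t) ∷ μ (suc (a + t)) ∷ la (suc (a + t)) ∷ []) (λ a b c d → a :≡ con 1 :+ b ⇒ c :≡ d ⇒ d :≤ b ⇒ ⊢ c :≤ a)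
              (μ-a t t<w) e′ (antitone (m≤n⇒m≤1+n ≤-refl))
      ... | in-a t t<w refl | in-a t′ t′<w e = linarith (μ (a + t) ∷ la (a + t) ∷ μ (suc (a + t)) ∷ la (suc (a + t)) ∷ []) (λ a b c d → a :≡ con 1 :+ b ⇒ c :≡ con 1 :+ d ⇒ d :≤ b ⇒ ⊢ c :≤ a)
              (μ-a t t<w) (trans (cong μ e) (trans (μ-a t′ t′<w) (cong (ℕ.suc ∘ la) (sym e)))) (antitone (m≤n⇒m≤1+n ≤-refl))
      ... | in-a t t<w refl | in-block t′ t′≤w e = linarith (μ (a + t) ∷ la (a + t) ∷ μ (suc (a + t)) ∷ la z ∷ la (suc (a + t)) ∷ []) (λ a b c d e → a :≡ con 1 :+ b ⇒ con 1 :+ c :≡ d ⇒ e :≡ d ⇒ e :≤ b ⇒ ⊢ c :≤ a)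
              (μ-a t t<w) (trans (cong (ℕ.suc ∘ μ) e) (μ-block t′ t′≤w)) (trans (cong la e) (block t′ t′≤w)) (antitone (m≤n⇒m≤1+n ≤-refl))
      ... | in-block t t≤w refl | in-a t′ t′<w e = ⊥-elim (linarith (z ∷ t ∷ a ∷ t′ ∷ w ∷ x ∷ []) (λ a b c d e f → con 1 :+ (a :+ b) :≡ c :+ d ⇒ d :< e ⇒ c :+ e :≤ f ⇒ f :≤ a ⇒ ⊢ absurd) e t′<w a+w≤x x≤z)
      ... | in-block t t≤w refl | in-block t′ t′≤w e = linarith (μ (z + t) ∷ la z ∷ μ (suc (z + t)) ∷ []) (λ a b c → con 1 :+ a :≡ b ⇒ con 1 :+ c :≡ b ⇒ ⊢ c :≤ a)
              (μ-block t t≤w) (trans (cong (ℕ.suc ∘ μ) e) (μ-block t′ t′≤w))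
      ... | in-block t t≤w refl | other e _ (inj₁ <z) = ⊥-elim (linarith (z ∷ t ∷ []) (λ a b → con 1 :+ (a :+ b) :< a ⇒ ⊢ absurd) <z)
      ... | in-block t t≤w refl | other e _ (inj₂ ≤s) = linarith (μ (z + t) ∷ la z ∷ μ (suc (z + t)) ∷ la (suc (z + t)) ∷ la (suc (z + w)) ∷ []) (λ a b c d e → con 1 :+ a :≡ b ⇒ c :≡ d ⇒ d :≤ e ⇒ e :< b ⇒ ⊢ c :≤ a)
              (μ-block t t≤w) e (antitone (linarith (z ∷ w ∷ t ∷ []) (λ a b c → a :+ (con 1 :+ b) :≤ con 1 :+ (a :+ c) ⇒ ⊢ con 1 :+ (a :+ b) :≤ con 1 :+ (a :+ c)) ≤s)) drop

      μ-antitone : ∀ {r s} → r ≤ s → μ s ≤ μ r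
      μ-antitone {r} {zero} z≤n = ≤-refl
      μ-antitone {r} {suc s} r≤ with m≤n⇒m<n∨m≡n r≤
      ... | inj₂ refl = ≤-refl
      ... | inj₁ r<s = ≤-trans (μ-suc≤ s) (μ-antitone (ℕP.≤-pred r<s))

      z+w<R : z + w < R
      z+w<R = ≰⇒> (λ R≤ → linarith (la (z + w) ∷ la z ∷ []) (λ a b → a :≡ b ⇒ a :≡ con 0 ⇒ con 0 :< b ⇒ ⊢ absurd) (block w ≤-refl) (la-zero (z + w) R≤) positive)

      μ-zero : ∀ r → R ≤ r → μ r ≡ 0
      μ-zero r R≤r with position r
      ... | other e _ _ = trans e (la-zero r R≤r)
      ... | in-block t t≤w refl = ⊥-elim (linarith (R ∷ z ∷ t ∷ w ∷ []) (λ a b c d → a :≤ b :+ c ⇒ c :≤ d ⇒ b :+ d :< a ⇒ ⊢ absurd) R≤r t≤w z+w<R)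
      ... | in-a t t<w refl = ⊥-elim (linarith (R ∷ a ∷ t ∷ w ∷ x ∷ z ∷ []) (λ a b c d e f → a :≤ b :+ c ⇒ c :< d ⇒ b :+ d :≤ e ⇒ e :≤ f ⇒ f :+ d :< a ⇒ ⊢ absurd) R≤r t<w a+w≤x x≤z z+w<R)

      K′ : ℕ → ℕ
      K′ = coreRows k μ R

      core′ : IsCore k R μ K′
      core′ = isCore-coreRows μ≤k μ-antitone μ-zero

      module ′ = Beads core′ μ-antitone

      agree-below : ∀ r → z + w < r → K′ r ≡ K r
      agree-below r = go R (m≤n+m R r)
        where
        go : ∀ f {r} → R ≤ r + f → z + w < r → K′ r ≡ K r
        go zero {r} R≤ _ = trans (′.K-zero r R≤r) (sym (K-zero r R≤r))
          where
          R≤r : R ≤ r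
          R≤r = subst (R ≤_) (+-identityʳ r) R≤
        go (suc f) {r} R≤ <r with position r
        ... | in-block t t≤w refl = ⊥-elim (linarith (z ∷ w ∷ t ∷ []) (λ a b c → a :+ b :< a :+ c ⇒ c :≤ b ⇒ ⊢ absurd) <r t≤w)
        ... | in-a t t<w refl = ⊥-elim (linarith (z ∷ w ∷ a ∷ t ∷ x ∷ []) (λ a b c d e → a :+ b :< c :+ d ⇒ d :< b ⇒ c :+ b :≤ e ⇒ e :≤ a ⇒ ⊢ absurd) <r t<w a+w≤x x≤z)
        ... | other e _ _ = trans (′.rec r) (trans (cong₂ (λ u v → u + K′ (r + suc k ∸ v)) e e)
                (trans (cong (_+_ (la r)) (go f (linarith (R ∷ r ∷ f ∷ D r ∷ []) (λ a b c d → a :≤ b :+ (con 1 :+ c) ⇒ b :< d ⇒ ⊢ a :≤ d :+ c) R≤ (r<Dr r)) (<-trans <r (r<Dr r)))) (sym (rec r))))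

      -- The rows y, ..., y + w of K / K′ form one ribbon: neighbouring rows share exactly one
      -- column, and the last row is not joined to the row below.
      record Removed (y : ℕ) : Set where
        field
          shifted : ∀ i → i < w → suc (K′ (y + i)) ≡ K (suc (y + i))
          last<   : K′ (y + w) < K (y + w)
          last≥   : K (suc (y + w)) ≤ K′ (y + w)

      D-block : ∀ t → t ≤ w → D (z + t) ≡ D z + t
      D-block t t≤w = linarith (D (z + t) ∷ la (z + t) ∷ z ∷ t ∷ k ∷ D z ∷ la z ∷ []) (λ a b c d e f g → a :+ b :≡ c :+ d :+ (con 1 :+ e) ⇒ f :+ g :≡ c :+ (con 1 :+ e) ⇒ b :≡ g ⇒ ⊢ a :≡ f :+ d) (D+la (z + t)) (D+la z) (block t t≤w)

      -- The shortened row z + t bounces to D z + t + 1 instead of D z + t, a row below the block,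
      -- where the two cores agree.
      K′-block : ∀ t → t ≤ w → suc (K′ (z + t)) ≡ la z + K (suc (D z + t))
      K′-block t t≤w = trans (cong suc (′.rec (z + t))) (cong₂ _+_ (μ-block t t≤w)
        (trans (cong K′ (linarith (′.D (z + t) ∷ μ (z + t) ∷ z ∷ t ∷ k ∷ la z ∷ D z ∷ []) (λ a b c d e f g → a :+ b :≡ c :+ d :+ (con 1 :+ e) ⇒ con 1 :+ b :≡ f ⇒ g :+ f :≡ c :+ (con 1 :+ e) ⇒ ⊢ a :≡ con 1 :+ (g :+ d)) (′.D+la (z + t)) (μ-block t t≤w) (D+la z)))
          (agree-below _ (linarith (z ∷ w ∷ D z ∷ t ∷ []) (λ a b c d → a :+ b :< c ⇒ ⊢ a :+ b :< con 1 :+ (c :+ d)) short))))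

      removed-bottom : Removed z
      removed-bottom = record
        { shifted = λ i i<w → trans (K′-block i (<⇒≤ i<w)) (sym (trans (cong K (sym (+-suc z i))) (trans (rec (z + suc i))
            (cong₂ _+_ (block (suc i) i<w) (cong K (trans (D-block (suc i) i<w) (+-suc (D z) i)))))))
        ; last< = linarith (K′ (z + w) ∷ la z ∷ K (suc (D z + w)) ∷ K (D z + w) ∷ K (z + w) ∷ []) (λ a b c d e → con 1 :+ a :≡ b :+ c ⇒ c :≤ d ⇒ e :≡ b :+ d ⇒ ⊢ a :< e)
            (K′-block w ≤-refl) (K-suc≤ (D z + w)) (trans (rec (z + w)) (cong₂ _+_ (block w ≤-refl) (cong K (D-block w ≤-refl))))
        ; last≥ = linarith (K′ (z + w) ∷ la z ∷ K (suc (D z + w)) ∷ K (suc (z + w)) ∷ D (suc (z + w)) ∷ K (D (suc (z + w))) ∷ z ∷ w ∷ k ∷ D z ∷ []) (λ a b c d e f g h i j → con 1 :+ a :≡ b :+ c ⇒ d :+ e :≡ f :+ ((con 1 :+ (g :+ h)) :+ (con 1 :+ i)) ⇒ f :+ (con 1 :+ (j :+ h)) :< c :+ e ⇒ j :+ b :≡ g :+ (con 1 :+ i) ⇒ ⊢ d :≤ a)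
            (K′-block w ≤-refl) (edge (suc (z + w))) (beads-decrease D<) (D+la z) }
        where
        D< : suc (D z + w) < D (suc (z + w))
        D< = linarith (D (suc (z + w)) ∷ la (suc (z + w)) ∷ z ∷ w ∷ k ∷ D z ∷ la z ∷ []) (λ a b c d e f g → a :+ b :≡ (con 1 :+ (c :+ d)) :+ (con 1 :+ e) ⇒ f :+ g :≡ c :+ (con 1 :+ e) ⇒ b :< g ⇒ ⊢ con 1 :+ (f :+ d) :< a)
          (D+la (suc (z + w))) (D+la z) drop

      μ-level : ∀ {y z′} → (∀ i → i ≤ w → D (y + i) ≡ z′ + i) → y + w < z′ → z′ ≤ z → x ≤ y → ∀ i → i ≤ w → μ (y + i) ≡ la (y + i)
      μ-level {y} {z′} e y<z′ z′≤z x≤y i i≤w with position (y + i)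
      ... | in-block t t≤w e′ = ⊥-elim (linarith (y ∷ i ∷ z ∷ t ∷ w ∷ z′ ∷ []) (λ a b c d e f → a :+ b :≡ c :+ d ⇒ b :≤ e ⇒ a :+ e :< f ⇒ f :≤ c ⇒ ⊢ absurd) e′ i≤w y<z′ z′≤z)
      ... | in-a t t<w e′ = ⊥-elim (linarith (y ∷ i ∷ a ∷ t ∷ w ∷ x ∷ []) (λ a b c d e f → a :+ b :≡ c :+ d ⇒ d :< e ⇒ c :+ e :≤ f ⇒ f :≤ a ⇒ ⊢ absurd) e′ t<w a+w≤x x≤y)
      ... | other e′ _ _ = e′

      K′-level : ∀ {y z′} → (∀ i → i ≤ w → D (y + i) ≡ z′ + i) → y + w < z′ → z′ ≤ z → x ≤ y → ∀ i → i ≤ w → K′ (y + i) ≡ la (y + i) + K′ (z′ + i)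
      K′-level {y} e y<z′ z′≤z x≤y i i≤w = trans (′.rec (y + i)) (cong₂ _+_ μ≡ (cong K′ (trans (cong (y + i + suc k ∸_) μ≡) (e i i≤w))))
        where
        μ≡ = μ-level e y<z′ z′≤z x≤y i i≤w

      -- The rows y + i keep their parts and their edges to z′ + i, so the two cores differ there
      -- exactly as one level below. Consecutive edges force equal parts, which transports
      -- `shifted`.
      removed-above : ∀ {y z′} → (∀ i → i ≤ w → D (y + i) ≡ z′ + i) → y + w < z′ → z′ ≤ z → x ≤ y → Removed z′ → Removed y
      removed-above {y} {z′} e y<z′ z′≤z x≤y below = record
        { shifted = λ i i<w → trans (cong suc (K′-row i (<⇒≤ i<w))) (trans (sym (+-suc (la (y + i)) (K′ (z′ + i)))) (trans (cong₂ _+_ (sym (D-flat (consecutive i i<w))) (Removed.shifted below i i<w))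
            (sym (trans (rec (suc (y + i))) (cong (λ v → la (suc (y + i)) + K v) (trans (consecutive i i<w) (cong suc (e i (<⇒≤ i<w)))))))))
        ; last< = linarith (K′ (y + w) ∷ la (y + w) ∷ K′ (z′ + w) ∷ K (y + w) ∷ K (z′ + w) ∷ []) (λ a b c d e → a :≡ b :+ c ⇒ d :≡ b :+ e ⇒ c :< e ⇒ ⊢ a :< d)
            (K′-row w ≤-refl) (trans (rec (y + w)) (cong (λ v → la (y + w) + K v) (e w ≤-refl))) (Removed.last< below)
        ; last≥ = linarith (K′ (y + w) ∷ la (y + w) ∷ K′ (z′ + w) ∷ K (suc (y + w)) ∷ D (suc (y + w)) ∷ K (D (suc (y + w))) ∷ y ∷ w ∷ k ∷ z′ ∷ K (suc (z′ + w)) ∷ D (y + w) ∷ []) (λ a b c d e f g h i j k l → a :≡ b :+ c ⇒ d :+ e :≡ f :+ ((con 1 :+ (g :+ h)) :+ (con 1 :+ i)) ⇒ f :+ (con 1 :+ (j :+ h)) :≤ k :+ e ⇒ k :≤ c ⇒ l :+ b :≡ g :+ h :+ (con 1 :+ i) ⇒ l :≡ j :+ h ⇒ ⊢ d :≤ a)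
            (K′-row w ≤-refl) (edge (suc (y + w))) (beads-weakly (subst (λ v → suc v ≤ D (suc (y + w))) (e w ≤-refl) (D-mono-< (n<1+n (y + w))))) (Removed.last≥ below) (D+la (y + w)) (e w ≤-refl) }
        where
        consecutive : ∀ i → i < w → D (suc (y + i)) ≡ suc (D (y + i))
        consecutive i i<w = trans (cong D (sym (+-suc y i))) (trans (e (suc i) i<w) (trans (+-suc z′ i) (cong suc (sym (e i (<⇒≤ i<w))))))
        K′-row = K′-level e y<z′ z′≤z x≤y

      removed : ∀ {y} → y ∈ levels chain → Removed y
      removed = go chain ≤-refl removed-bottom
        where
        go : ∀ {z′ p′} (c : Chain w z′ p′ x a) → z′ ≤ z → Removed z′ → ∀ {y} → y ∈ levels c → Removed y
        go (top _ _ _) _ rz (here refl) = rz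
        go (step _ _ _ _) _ rz (here refl) = rz
        go {z′} (step y e y<z′ c) z′≤z rz (there m) = go c (linarith (y ∷ w ∷ z′ ∷ z ∷ []) (λ a b c d → a :+ b :< c ⇒ c :≤ d ⇒ ⊢ a :≤ d) y<z′ z′≤z) (removed-above e y<z′ z′≤z (top≤ c) rz) m

      InRibbon : ℕ → Set
      InRibbon r = ∃ λ y → ∃ λ i → y ∈ levels chain × i ≤ w × r ≡ y + i

      x∈levels : ∀ {z′ p′} (c : Chain w z′ p′ x a) → x ∈ levels c
      x∈levels (top _ _ _) = here refl
      x∈levels (step _ _ _ c) = there (x∈levels c)

      agree : ∀ r → ¬ InRibbon r → K′ r ≡ K r
      agree r = go R (m≤n+m R r)
        where
        go : ∀ f {r} → R ≤ r + f → ¬ InRibbon r → K′ r ≡ K r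
        go zero {r} R≤ _ = trans (′.K-zero r R≤r) (sym (K-zero r R≤r))
          where
          R≤r : R ≤ r
          R≤r = subst (R ≤_) (+-identityʳ r) R≤
        go (suc f) {r} R≤ free with position r
        ... | in-block t t≤w refl = ⊥-elim (free (z , t , z∈levels chain , t≤w , refl))
        -- The edge of the lengthened row now ends in x + t instead of x + t + 1. By `shifted` this
        -- loses exactly the box that its part has gained.
        ... | in-a t t<w refl = linarith (K′ (a + t) ∷ la (a + t) ∷ K′ (x + t) ∷ K (suc (x + t)) ∷ K (a + t) ∷ []) (λ a b c d e → a :≡ (con 1 :+ b) :+ c ⇒ con 1 :+ c :≡ d ⇒ e :≡ b :+ d ⇒ ⊢ a :≡ e)
                (trans (′.rec (a + t)) (cong₂ (λ u v → u + K′ v) (μ-a t t<w) D′)) (Removed.shifted (removed (x∈levels chain)) t t<w)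
                (trans (rec (a + t)) (cong (λ v → la (a + t) + K v) (a-edges t t<w)))
          where
          D′ : ′.D (a + t) ≡ x + t
          D′ = linarith (′.D (a + t) ∷ μ (a + t) ∷ a ∷ t ∷ k ∷ la (a + t) ∷ D (a + t) ∷ x ∷ []) (λ a b c d e f g h → a :+ b :≡ c :+ d :+ (con 1 :+ e) ⇒ b :≡ con 1 :+ f ⇒ g :+ f :≡ c :+ d :+ (con 1 :+ e) ⇒ g :≡ con 1 :+ (h :+ d) ⇒ ⊢ a :≡ h :+ d)
            (′.D+la (a + t)) (μ-a t t<w) (D+la (a + t)) (a-edges t t<w)
        ... | other e o _ = trans (′.rec r) (trans (cong₂ (λ u v → u + K′ (r + suc k ∸ v)) e e)
                (trans (cong (_+_ (la r)) (go f (linarith (R ∷ r ∷ f ∷ D r ∷ []) (λ a b c d → a :≤ b :+ (con 1 :+ c) ⇒ b :< d ⇒ ⊢ a :≤ d :+ c) R≤ (r<Dr r)) freeD)) (sym (rec r))))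
          where
          freeD : ¬ InRibbon (D r)
          freeD (y , i , m , i≤w , Dr) with level-above chain m i≤w Dr
          ... | inj₁ (y′ , m′ , e′) = free (y′ , i , m′ , i≤w , e′)
          ... | inj₂ (t , t<w , refl) = apart o
            where
            apart : a + t < a ⊎ a + w ≤ a + t → ⊥
            apart (inj₁ <a) = linarith (a ∷ t ∷ []) (λ a b → a :+ b :< a ⇒ ⊢ absurd) <a
            apart (inj₂ ≤r) = linarith (a ∷ w ∷ t ∷ []) (λ a b c → a :+ b :≤ a :+ c ⇒ c :< b ⇒ ⊢ absurd) ≤r t<w

      inRibbon? : ∀ r → Dec (InRibbon r)
      inRibbon? r with any? (λ y → (y ≤? r) ×-dec (r ≤? y + w)) (levels chain)
      ... | yes hit with find hit
      ...   | y , m , y≤r , r≤y+w = yes (y , r ∸ y , m , ℕP.m≤n+o⇒m∸n≤o r y r≤y+w , sym (m+[n∸m]≡n y≤r))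
      inRibbon? r | no none = no λ { (y , i , m , i≤w , refl) → none (lose m (m≤m+n y i , ℕP.+-monoʳ-≤ y i≤w)) }

      K′≤K : ∀ r → K′ r ≤ K r
      K′≤K r with inRibbon? r
      ... | no free = ≤-reflexive (agree r free)
      ... | yes (y , i , m , i≤w , refl) with m≤n⇒m<n∨m≡n i≤w
      ...   | inj₂ refl = <⇒≤ (Removed.last< (removed m))
      ...   | inj₁ i<w = linarith (K′ (y + i) ∷ K (suc (y + i)) ∷ K (y + i) ∷ []) (λ a b c → con 1 :+ a :≡ b ⇒ b :≤ c ⇒ ⊢ a :≤ c)
              (Removed.shifted (removed m) i i<w) (K-suc≤ (y + i))

      -- Here j counts the levels between z and y, each raising the beads by k + 1. It translates
      -- the rows of a ribbon into bead positions.
      level-position : ∀ {y} → y ∈ levels chain → ∃ λ j →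
        (∀ t → t ≤ w → K (y + t) + (z + t) ≡ K (z + t) + (y + t) + j * suc k) × (K′ (y + w) + (z + w) ≡ K′ (z + w) + (y + w) + j * suc k)
      level-position = go chain ≤-refl 0 (λ t _ → sym (+-identityʳ (K (z + t) + (z + t)))) (sym (+-identityʳ (K′ (z + w) + (z + w))))
        where
        Position′ : ℕ → ℕ → Set
        Position′ j y = (∀ t → t ≤ w → K (y + t) + (z + t) ≡ K (z + t) + (y + t) + j * suc k) × (K′ (y + w) + (z + w) ≡ K′ (z + w) + (y + w) + j * suc k)
        go : ∀ {z′ p′} (c : Chain w z′ p′ x a) → z′ ≤ z → ∀ j → (∀ t → t ≤ w → K (z′ + t) + (z + t) ≡ K (z + t) + (z′ + t) + j * suc k) →
          K′ (z′ + w) + (z + w) ≡ K′ (z + w) + (z′ + w) + j * suc k → ∀ {y} → y ∈ levels c → ∃ λ j → Position′ j y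
        go (top _ _ _) _ j e e′ (here refl) = j , e , e′
        go (step _ _ _ _) _ j e e′ (here refl) = j , e , e′
        go {z′} (step y ey y<z′ c) z′≤z j e e′ (there m) = go c (linarith (y ∷ w ∷ z′ ∷ z ∷ []) (λ a b c d → a :+ b :< c ⇒ c :≤ d ⇒ ⊢ a :≤ d) y<z′ z′≤z) (suc j)
          (λ t t≤w → linarith (K (y + t) ∷ D (y + t) ∷ K (D (y + t)) ∷ y ∷ t ∷ k ∷ z′ ∷ K (z′ + t) ∷ z ∷ K (z + t) ∷ j * suc k ∷ []) (λ a b c d e f g h i j k → a :+ b :≡ c :+ (d :+ e :+ (con 1 :+ f)) ⇒ b :≡ g :+ e ⇒ c :≡ h ⇒ h :+ (i :+ e) :≡ j :+ (g :+ e) :+ k ⇒ ⊢ a :+ (i :+ e) :≡ j :+ (d :+ e) :+ ((con 1 :+ f) :+ k)) (edge (y + t)) (ey t t≤w) (cong K (ey t t≤w)) (e t t≤w))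
          (linarith (K′ (y + w) ∷ la (y + w) ∷ K′ (z′ + w) ∷ D (y + w) ∷ y ∷ w ∷ k ∷ z′ ∷ z ∷ K′ (z + w) ∷ j * suc k ∷ []) (λ a b c d e f g h i j k → a :≡ b :+ c ⇒ d :+ b :≡ e :+ f :+ (con 1 :+ g) ⇒ d :≡ h :+ f ⇒ c :+ (i :+ f) :≡ j :+ (h :+ f) :+ k ⇒ ⊢ a :+ (i :+ f) :≡ j :+ (e :+ f) :+ ((con 1 :+ g) :+ k)) (K′-level ey y<z′ z′≤z (top≤ c) w ≤-refl) (D+la (y + w)) (ey w ≤-refl) e′) m

-- The exchange argument for two nested cores.

module CoverExchange where
  open import Data.Nat as ℕ using (ℕ; zero; suc; _≤_; _<_; _+_; _*_; _∸_; s≤s; z≤n)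
  open import Data.Nat.Properties using (≤-refl; <-irrefl; <-trans; <⇒≤; ≤-antisym; ≤-reflexive; m≤m+n; +-suc; +-assoc; +-identityʳ; _≟_; _≤?_; _<?_; ≰⇒>; ≮⇒≥; <-≤-trans; n<1+n; m≤n⇒m≤1+n; m+[n∸m]≡n; m≤n⇒m<n∨m≡n; anyUpTo?; <-cmp)
  open import Data.Integer using (+_)
  import Data.Nat.Properties as ℕP
  open import Data.Fin using (zero; suc)
  open import Data.List using ([]; _∷_)
  open import Data.Bool using (T)
  open import Data.Product using (_×_; _,_; proj₁; proj₂; ∃)
  open import Data.Sum using (_⊎_; inj₁; inj₂)
  open import Data.Empty using (⊥; ⊥-elim)
  open import Data.Vec using ([]; _∷_)
  open import Relation.Nullary using (Dec; yes; no; ¬_)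
  open import Relation.Binary.Definitions using (tri<; tri≈; tri>)
  open import Relation.Binary.PropositionalEquality
  open import Relation.Nullary.Decidable using (decidable-stable; _×-dec_)
  open LinearArithmetic
  open BounceGraph
  open CoreRibbons

  module Positions (L : ℕ) where
    -- Positions are shifted by L so that all beads that matter sit at natural numbers.
    Bead : (ℕ → ℕ) → ℕ → Set
    Bead K u = ∃ λ r → u + r ≡ K r + L

    bead? : ∀ {K} → (∀ r → K r ≤ K 0) → ∀ u → Dec (Bead K u)
    bead? {K} bounded u with anyUpTo? (λ r → u + r ≟ K r + L) (suc (K 0 + L))
    ... | yes (r , _ , e) = yes (r , e)
    ... | no none = no λ { (r , e) → none (r , linarith (u ∷ r ∷ K r ∷ L ∷ K 0 ∷ []) (λ a b c d e → a :+ b :≡ c :+ d ⇒ c :≤ e ⇒ ⊢ b :< con 1 :+ (e :+ d)) e (bounded r) , e) }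

  crossing : ∀ {P : ℕ → Set} → (∀ t → Dec (P t)) → ∀ N → P 0 → ¬ P N → ∃ λ w → P w × ¬ P (suc w)
  crossing P? zero p np = ⊥-elim (np p)
  crossing P? (suc N) p np with P? N
  ... | yes pN = N , pN , np
  ... | no npN = crossing P? N p npN

  module Exchange {k R : ℕ} {la K μ T : ℕ → ℕ} (core : IsCore k R la K) (antitone : ∀ {r s} → r ≤ s → la s ≤ la r)
                  (coreT : IsCore k R μ T) (T-antitone : ∀ {r s} → r ≤ s → T s ≤ T r) (T≤K : ∀ r → T r ≤ K r) where
    open Beads core antitone
    private
      module τ = IsCore coreT
      n L : ℕ
      n = suc k
      L = R + suc k
    open Positions L

    κ? : ∀ u → Dec (Bead K u)
    κ? = bead? (λ r → K-antitone z≤n)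

    -- The contents of the skew shape, shifted by L + 1.
    Skew : ℕ → Set
    Skew u = ∃ λ r → T r + L < u + r × u + r ≤ K r + L

    skew? : ∀ u → Dec (Skew u)
    skew? u with anyUpTo? (λ r → (T r + L <? u + r) ×-dec (u + r ≤? K r + L)) (suc (K 0 + L))
    ... | yes (r , _ , e) = yes (r , e)
    ... | no none = no λ { (r , e , e′) → none (r , linarith (u ∷ r ∷ K r ∷ L ∷ K 0 ∷ []) (λ a b c d e → a :+ b :≤ c :+ d ⇒ c :≤ e ⇒ ⊢ b :< con 1 :+ (e :+ d)) e′ (K-antitone z≤n) , e , e′) }

    skew-bounds : ∀ {u} → Skew u → u ≤ K 0 + L × n ≤ u
    skew-bounds {u} (r , e , e′) = linarith (u ∷ r ∷ K r ∷ L ∷ K 0 ∷ []) (λ a b c d e → a :+ b :≤ c :+ d ⇒ c :≤ e ⇒ ⊢ a :≤ e :+ d) e′ (K-antitone z≤n) ,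
      linarith (T r ∷ R ∷ k ∷ u ∷ r ∷ []) (λ a b c d e → a :+ (b :+ (con 1 :+ c)) :< d :+ e ⇒ e :< b ⇒ ⊢ con 1 :+ c :≤ d) e r<R
      where
      r<R : r < R
      r<R = ≰⇒> (λ R≤r → linarith (T r ∷ L ∷ u ∷ r ∷ K r ∷ []) (λ a b c d e → a :+ b :< c :+ d ⇒ c :+ d :≤ e :+ b ⇒ e :≡ con 0 ⇒ ⊢ absurd) e e′ (K-zero r R≤r))

    -- A bounce edge is one step down a runner of the abacus with n = k + 1 runners.
    κ-flush : ∀ {u} → Bead K (u + n) → Bead K u
    κ-flush {u} (r , e) = D r , linarith (u ∷ k ∷ r ∷ K r ∷ L ∷ D r ∷ K (D r) ∷ []) (λ a b c d e f g → a :+ (con 1 :+ b) :+ c :≡ d :+ e ⇒ d :+ f :≡ g :+ (c :+ (con 1 :+ b)) ⇒ ⊢ a :+ f :≡ g :+ e) e (edge r)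

    τ-flush : ∀ {u} → Bead T (u + n) → Bead T u
    τ-flush {u} (r , e) = Dτ , linarith (u ∷ k ∷ r ∷ T r ∷ L ∷ μ r ∷ T Dτ ∷ Dτ ∷ []) (λ a b c d e f g h → a :+ (con 1 :+ b) :+ c :≡ d :+ e ⇒ d :≡ f :+ g ⇒ h :+ f :≡ c :+ (con 1 :+ b) ⇒ ⊢ a :+ h :≡ g :+ e) e (τ.rec r)
      (ℕP.m∸n+n≡m (linarith (μ r ∷ k ∷ r ∷ []) (λ a b c → a :≤ b ⇒ ⊢ a :≤ c :+ (con 1 :+ b)) (τ.la≤k r)))
      where
      Dτ = bounce k μ r

    κ-flush* : ∀ {u} j → Bead K (u + j * n) → Bead K u
    κ-flush* {u} zero b = subst (Bead K) (+-identityʳ u) b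
    κ-flush* {u} (suc j) b = κ-flush* j (κ-flush (subst (Bead K) (linarith (u ∷ k ∷ j * suc k ∷ []) (λ a b c → ⊢ a :+ ((con 1 :+ b) :+ c) :≡ a :+ c :+ (con 1 :+ b))) b))

    τ-flush* : ∀ {u} j → Bead T (u + j * n) → Bead T u
    τ-flush* {u} zero b = subst (Bead T) (+-identityʳ u) b
    τ-flush* {u} (suc j) b = τ-flush* j (τ-flush (subst (Bead T) (linarith (u ∷ k ∷ j * suc k ∷ []) (λ a b c → ⊢ a :+ ((con 1 :+ b) :+ c) :≡ a :+ c :+ (con 1 :+ b))) b))

    κ-row-unique : ∀ {u r s} → u + r ≡ K r + L → u + s ≡ K s + L → r ≡ s
    κ-row-unique {u} {r} {s} e e′ with <-cmp r s
    ... | tri< r<s _ _ = ⊥-elim (linarith (u ∷ r ∷ K r ∷ L ∷ s ∷ K s ∷ []) (λ a b c d e f → a :+ b :≡ c :+ d ⇒ a :+ e :≡ f :+ d ⇒ f :+ b :< c :+ e ⇒ ⊢ absurd) e e′ (beads-decrease r<s))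
    ... | tri≈ _ r≡s _ = r≡s
    ... | tri> _ _ s<r = ⊥-elim (linarith (u ∷ r ∷ K r ∷ L ∷ s ∷ K s ∷ []) (λ a b c d e f → a :+ b :≡ c :+ d ⇒ a :+ e :≡ f :+ d ⇒ c :+ e :< f :+ b ⇒ ⊢ absurd) e e′ (beads-decrease s<r))

    T-beads : ∀ {r s} → r ≤ s → T s + r ≤ T r + s
    T-beads {r} {s} r≤s = linarith (T s ∷ T r ∷ r ∷ s ∷ []) (λ a b c d → a :≤ b ⇒ c :≤ d ⇒ ⊢ a :+ c :≤ b :+ d) (T-antitone r≤s) r≤s

    τ-row-unique : ∀ {u r s} → u + r ≡ T r + L → u + s ≡ T s + L → r ≡ s
    τ-row-unique {u} {r} {s} e e′ with <-cmp r s
    ... | tri< r<s _ _ = ⊥-elim (linarith (u ∷ r ∷ T r ∷ L ∷ s ∷ T s ∷ []) (λ a b c d e f → a :+ b :≡ c :+ d ⇒ a :+ e :≡ f :+ d ⇒ f :≤ c ⇒ b :< e ⇒ ⊢ absurd) e e′ (T-antitone (<⇒≤ r<s)) r<s)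
    ... | tri≈ _ r≡s _ = r≡s
    ... | tri> _ _ s<r = ⊥-elim (linarith (u ∷ r ∷ T r ∷ L ∷ s ∷ T s ∷ []) (λ a b c d e f → a :+ b :≡ c :+ d ⇒ a :+ e :≡ f :+ d ⇒ c :≤ f ⇒ e :< b ⇒ ⊢ absurd) e e′ (T-antitone (<⇒≤ s<r)) s<r)

    lost-skew : ∀ {c} → Bead K c → ¬ Bead T c → Skew c
    lost-skew {c} (r , e) no-τ with m≤n⇒m<n∨m≡n (T≤K r)
    ... | inj₁ lt = r , linarith (T r ∷ K r ∷ c ∷ r ∷ L ∷ []) (λ a b c d e → a :< b ⇒ c :+ d :≡ b :+ e ⇒ ⊢ a :+ e :< c :+ d) lt e , ≤-reflexive e
    ... | inj₂ eq = ⊥-elim (no-τ (r , trans e (cong (λ v → v + L) (sym eq))))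

    gained-skew : ∀ {e} → Bead T e → ¬ Bead K e → Skew (suc e)
    gained-skew {e} (r , eq) no-κ with m≤n⇒m<n∨m≡n (T≤K r)
    ... | inj₁ lt = r , linarith (e ∷ r ∷ T r ∷ L ∷ []) (λ a b c d → a :+ b :≡ c :+ d ⇒ ⊢ c :+ d :< (con 1 :+ a) :+ b) eq , linarith (e ∷ r ∷ T r ∷ L ∷ K r ∷ []) (λ a b c d e → a :+ b :≡ c :+ d ⇒ c :< e ⇒ ⊢ (con 1 :+ a) :+ b :≤ e :+ d) eq lt
    ... | inj₂ eq′ = ⊥-elim (no-κ (r , trans eq (cong (λ v → v + L) eq′)))

    -- The positions of the skew shape form intervals. Just below such an interval sits a bead that
    -- only τ has; by `skew-top` its last position is a bead that only κ has.
    skew-bottom : ∀ {v} → Skew (suc v) → ¬ Skew v → Bead T v × ¬ Bead K v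
    skew-bottom {v} (r , e , e′) none = (r , v≡) , not-κ
      where
      v≡ : v + r ≡ T r + L
      v≡ with T r + L <? v + r
      ... | yes lt = ⊥-elim (none (r , lt , linarith (v ∷ r ∷ K r ∷ L ∷ []) (λ a b c d → (con 1 :+ a) :+ b :≤ c :+ d ⇒ ⊢ a :+ b :≤ c :+ d) e′))
      ... | no ≮ = ≤-antisym (≮⇒≥ ≮) (linarith (T r ∷ L ∷ v ∷ r ∷ []) (λ a b c d → a :+ b :< (con 1 :+ c) :+ d ⇒ ⊢ a :+ b :≤ c :+ d) e)
      not-κ : ¬ Bead K v
      not-κ (s , es) with T s + L <? v + s
      ... | yes lt = none (s , lt , ≤-reflexive es)
      ... | no ≮ with τ-row-unique {v} {s} {r} (linarith (v ∷ s ∷ K s ∷ L ∷ T s ∷ []) (λ a b c d e → a :+ b :≡ c :+ d ⇒ a :+ b :≤ e :+ d ⇒ e :≤ c ⇒ ⊢ a :+ b :≡ e :+ d) es (≮⇒≥ ≮) (T≤K s)) v≡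
      ...   | refl = linarith (v ∷ r ∷ K r ∷ L ∷ []) (λ a b c d → (con 1 :+ a) :+ b :≤ c :+ d ⇒ a :+ b :≡ c :+ d ⇒ ⊢ absurd) e′ es

    skew-top : ∀ {v} → Skew v → ¬ Skew (suc v) → Bead K v × ¬ Bead T v
    skew-top {v} (r , e , e′) none = (r , v≡) , not-τ
      where
      v≡ : v + r ≡ K r + L
      v≡ with suc v + r ≤? K r + L
      ... | yes le = ⊥-elim (none (r , linarith (T r ∷ L ∷ v ∷ r ∷ []) (λ a b c d → a :+ b :< c :+ d ⇒ ⊢ a :+ b :< (con 1 :+ c) :+ d) e , le))
      ... | no ≰ = linarith (K r ∷ L ∷ v ∷ r ∷ []) (λ a b c d → a :+ b :< (con 1 :+ c) :+ d ⇒ c :+ d :≤ a :+ b ⇒ ⊢ c :+ d :≡ a :+ b) (≰⇒> ≰) e′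
      not-τ : ¬ Bead T v
      not-τ (s , es) with suc v + s ≤? K s + L
      ... | yes le = none (s , linarith (v ∷ s ∷ T s ∷ L ∷ []) (λ a b c d → a :+ b :≡ c :+ d ⇒ ⊢ c :+ d :< (con 1 :+ a) :+ b) es , le)
      ... | no ≰ with κ-row-unique {v} {s} {r} (linarith (v ∷ s ∷ T s ∷ L ∷ K s ∷ []) (λ a b c d e → a :+ b :≡ c :+ d ⇒ e :+ d :< (con 1 :+ a) :+ b ⇒ c :≤ e ⇒ ⊢ a :+ b :≡ e :+ d) es (≰⇒> ≰) (T≤K s)) v≡
      ...   | refl = linarith (T r ∷ L ∷ v ∷ r ∷ []) (λ a b c d → a :+ b :< c :+ d ⇒ c :+ d :≡ a :+ b ⇒ ⊢ absurd) e es

    SkewBetween : ℕ → ℕ → Set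
    SkewBetween e c = ∀ u → e < u → u ≤ c → Skew u

    walk-down : ∀ {c} d v → c ≡ d + v → Skew c → ¬ Skew v → ∃ λ f → v ≤ f × f < c × (Bead T f × ¬ Bead K f) × SkewBetween f c
    walk-down zero v refl s none = ⊥-elim (none s)
    walk-down {suc c} (suc d) v e s none with skew? c
    ... | no none′ = c , linarith (c ∷ d ∷ v ∷ []) (λ a b c → con 1 :+ a :≡ (con 1 :+ b) :+ c ⇒ ⊢ c :≤ a) e , n<1+n c , skew-bottom s none′ ,
            λ u c<u u≤ → subst Skew (≤-antisym c<u u≤) s
    ... | yes s′ with walk-down {c} d v (ℕP.suc-injective e) s′ none
    ...   | f , v≤f , f<c , b , between = f , v≤f , m≤n⇒m≤1+n f<c , b , between′
      where
      between′ : SkewBetween f (suc c)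
      between′ u f<u u≤ with m≤n⇒m<n∨m≡n u≤
      ... | inj₁ u<sc = between u f<u (ℕP.≤-pred u<sc)
      ... | inj₂ refl = s

    climb : ∀ {e} d m v → v ≡ d + m → e < m → Skew m → SkewBetween e m → ¬ Skew v → ∃ λ f → e < f × f < v × (Bead K f × ¬ Bead T f) × SkewBetween e f
    climb zero m .m refl _ s _ none = ⊥-elim (none s)
    climb {e} (suc d) m v v≡ e<m s between none with skew? (suc m)
    ... | no none′ = m , e<m , linarith (v ∷ d ∷ m ∷ []) (λ a b c → a :≡ (con 1 :+ b) :+ c ⇒ ⊢ c :< a) v≡ , skew-top s none′ , between
    ... | yes s′ = climb d (suc m) v (trans v≡ (sym (+-suc d m))) (m≤n⇒m≤1+n e<m) s′ between′ none
      where
      between′ : SkewBetween e (suc m)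
      between′ u e<u u≤ with m≤n⇒m<n∨m≡n u≤
      ... | inj₁ u<sm = between u e<u (ℕP.≤-pred u<sm)
      ... | inj₂ refl = s′

    -- Moving the bead c of κ down to e removes a single ribbon and stays above τ, but the result
    -- need not be a core.
    record LostGained (e c : ℕ) : Set where
      constructor lostGained
      field
        lost    : Bead K c
        lost¬   : ¬ Bead T c
        gained  : Bead T e
        gained¬ : ¬ Bead K e
        order   : e < c
        between : SkewBetween e c

    -- Moving every bead c + j n (j ≥ 0) of κ down to the gap e₀ + n + j n keeps κ above τ.
    record Admissible (e₀ c : ℕ) : Set where
      constructor admissible
      field
        bead   : Bead K c
        gap    : ¬ Bead K (e₀ + n)
        lowest : Bead K e₀
        order  : e₀ + n < c
        ribbon : ∀ j → Bead K (c + j * n) → SkewBetween (e₀ + n + j * n) (c + j * n)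

    -- What minimality of c - e₀ forces. A violation of one of the fields gives a closer admissible
    -- pair, with c - n or f in place of c, or with f in place of e₀.
    record Tight (e₀ c : ℕ) : Set where
      field
        close : c < e₀ + n + n
        hits  : ∀ f → e₀ + n < f → f < c → Bead K f → ∀ j → Bead K (c + j * n) → Bead K (f + suc j * n)
        gaps  : ∀ f → e₀ < f → f + n < c → ¬ Bead K (f + n) → ¬ Bead K f

    module _ (none : ∀ {e₀ c} → Admissible e₀ c → ¬ Tight e₀ c) where
      -- Descent on the distance of c from the gap: an admissible pair that is not tight leads to a
      -- closer one.
      no-admissible : ∀ m {e₀ c} → c < e₀ + n + m → ¬ Admissible e₀ c
      no-admissible zero {e₀} {c} <m (admissible _ _ _ order _) = linarith (c ∷ e₀ ∷ k ∷ []) (λ a b c → a :< b :+ (con 1 :+ c) :+ con 0 ⇒ b :+ (con 1 :+ c) :< a ⇒ ⊢ absurd) <m order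
      no-admissible (suc m) {e₀} {c} <m ad@(admissible bead gap lowest order ribbon) = none ad record { close = close ; hits = hits ; gaps = gaps }
        where
        close : c < e₀ + n + n
        close with c <? e₀ + n + n
        ... | yes lt = lt
        -- Level j + 1 of the pair with c - n ends at c + j n and lies inside level j of the given
        -- pair.
        ... | no ≮ = ⊥-elim (no-admissible m (linarith (c ∷ c′ ∷ k ∷ e₀ ∷ m ∷ []) (λ a b c d e → a :≡ b :+ (con 1 :+ c) ⇒ a :< d :+ (con 1 :+ c) :+ (con 1 :+ e) ⇒ ⊢ b :< d :+ (con 1 :+ c) :+ e) c≡ <m)
                (admissible bead′ gap lowest (ℕP.≤∧≢⇒< (linarith (c ∷ c′ ∷ k ∷ e₀ ∷ []) (λ a b c d → a :≡ b :+ (con 1 :+ c) ⇒ d :+ (con 1 :+ c) :+ (con 1 :+ c) :≤ a ⇒ ⊢ d :+ (con 1 :+ c) :≤ b) c≡ (≮⇒≥ ≮)) (λ e → gap (subst (Bead K) (sym e) bead′))) ribbon′))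
          where
          c′ = c ∸ n
          c≡ : c ≡ c′ + n
          c≡ = sym (ℕP.m∸n+n≡m (linarith (e₀ ∷ k ∷ c ∷ []) (λ a b c → a :+ (con 1 :+ b) :+ (con 1 :+ b) :≤ c ⇒ ⊢ con 1 :+ b :≤ c) (≮⇒≥ ≮)))
          bead′ : Bead K c′
          bead′ = κ-flush (subst (Bead K) c≡ bead)
          ribbon′ : ∀ j → Bead K (c′ + j * n) → SkewBetween (e₀ + n + j * n) (c′ + j * n)
          ribbon′ zero _ u <u u≤ = ribbon 0 (subst (Bead K) (sym (+-identityʳ c)) bead) u <u (linarith (u ∷ c′ ∷ c ∷ k ∷ []) (λ a b c d → a :≤ b :+ con 0 ⇒ c :≡ b :+ (con 1 :+ d) ⇒ ⊢ a :≤ c :+ con 0) u≤ c≡)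
          ribbon′ (suc j) b u <u u≤ = ribbon j (subst (Bead K) same b) u (linarith (e₀ ∷ k ∷ j * suc k ∷ u ∷ []) (λ a b c d → a :+ (con 1 :+ b) :+ ((con 1 :+ b) :+ c) :< d ⇒ ⊢ a :+ (con 1 :+ b) :+ c :< d) <u) (subst (u ≤_) same u≤)
            where
            same : c′ + suc j * n ≡ c + j * n
            same = linarith (c ∷ c′ ∷ k ∷ j * suc k ∷ []) (λ a b c d → a :≡ b :+ (con 1 :+ c) ⇒ ⊢ b :+ ((con 1 :+ c) :+ d) :≡ a :+ d) c≡
        hits : ∀ f → e₀ + n < f → f < c → Bead K f → ∀ j → Bead K (c + j * n) → Bead K (f + suc j * n)
        hits f e<f f<c bf j bc = decidable-stable (κ? _) λ not → no-admissible m (linarith (f ∷ c ∷ e₀ ∷ k ∷ m ∷ []) (λ a b c d e → a :< b ⇒ b :< c :+ (con 1 :+ d) :+ (con 1 :+ e) ⇒ ⊢ a :< c :+ (con 1 :+ d) :+ e) f<c <m)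
          (admissible bf gap lowest e<f (ribbon′ not))
          where
          -- Up to level j the ribbons of f lie inside those of c; higher levels do not occur,
          -- because the runner of f has a gap at f + (j + 1) n.
          ribbon′ : ¬ Bead K (f + suc j * n) → ∀ i → Bead K (f + i * n) → SkewBetween (e₀ + n + i * n) (f + i * n)
          ribbon′ not i b u <u u≤ with i ≤? j
          ... | yes i≤j = ribbon i (κ-flush* (j ∸ i) (subst (Bead K) same bc)) u <u (linarith (u ∷ f ∷ i * suc k ∷ c ∷ []) (λ a b c d → a :≤ b :+ c ⇒ b :< d ⇒ ⊢ a :≤ d :+ c) u≤ f<c)
            where
            same : c + j * n ≡ c + i * n + (j ∸ i) * n
            same = trans (cong (λ v → c + v * n) (sym (m+[n∸m]≡n i≤j))) (trans (cong (_+_ c) (ℕP.*-distribʳ-+ n i (j ∸ i))) (sym (+-assoc c (i * n) ((j ∸ i) * n))))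
          ... | no i≰j = ⊥-elim (not (κ-flush* (i ∸ suc j) (subst (Bead K) same b)))
            where
            same : f + i * n ≡ f + suc j * n + (i ∸ suc j) * n
            same = trans (cong (λ v → f + v * n) (sym (m+[n∸m]≡n (≰⇒> i≰j)))) (trans (cong (_+_ f) (ℕP.*-distribʳ-+ n (suc j) (i ∸ suc j))) (sym (+-assoc f (suc j * n) ((i ∸ suc j) * n))))
        gaps : ∀ f → e₀ < f → f + n < c → ¬ Bead K (f + n) → ¬ Bead K f
        gaps f e<f f<c no-f bf = no-admissible m (linarith (c ∷ e₀ ∷ k ∷ m ∷ f ∷ []) (λ a b c d e → a :< b :+ (con 1 :+ c) :+ (con 1 :+ d) ⇒ b :< e ⇒ ⊢ a :< e :+ (con 1 :+ c) :+ d) <m e<f)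
          (admissible bead no-f bf f<c (λ j b u <u → ribbon j b u (linarith (f ∷ k ∷ j * suc k ∷ u ∷ e₀ ∷ []) (λ a b c d e → a :+ (con 1 :+ b) :+ c :< d ⇒ e :< a ⇒ ⊢ e :+ (con 1 :+ b) :+ c :< d) <u e<f)))

      -- The shift L = R + n puts beads of empty rows on all positions below n, so each runner
      -- begins with a bead and `lowest-gap` stops above it.
      small-bead : ∀ {u} → u < n → Bead K u
      small-bead {u} u<n = L ∸ u , trans (m+[n∸m]≡n u≤L) (sym (cong (λ v → v + L) (K-zero _ (linarith (u ∷ L ∸ u ∷ R ∷ k ∷ []) (λ a b c d → a :+ b :≡ c :+ (con 1 :+ d) ⇒ a :< con 1 :+ d ⇒ ⊢ c :≤ b) (m+[n∸m]≡n u≤L) u<n))))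
        where
        u≤L : u ≤ L
        u≤L = linarith (u ∷ k ∷ R ∷ []) (λ a b c → a :< con 1 :+ b ⇒ ⊢ a :≤ c :+ (con 1 :+ b)) u<n

      lowest-gap : ∀ f {e} → e < f → ¬ Bead K e → ∃ λ e₀ → ∃ λ r → e ≡ e₀ + n + r * n × Bead K e₀ × ¬ Bead K (e₀ + n)
      lowest-gap zero ()
      lowest-gap (suc f) {e} e<f no-e with e <? n
      ... | yes e<n = ⊥-elim (no-e (small-bead e<n))
      ... | no ≮ with κ? (e ∸ n)
      ...   | yes b = e ∸ n , 0 , trans e≡ (sym (+-identityʳ _)) , b , λ b′ → no-e (subst (Bead K) (sym e≡) b′)
        where
        e≡ : e ≡ e ∸ n + n
        e≡ = sym (ℕP.m∸n+n≡m (≮⇒≥ ≮))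
      ...   | no no-b with lowest-gap f {e ∸ n} (linarith (e ∷ f ∷ e ∸ n ∷ k ∷ []) (λ a b c d → a :< con 1 :+ b ⇒ c :+ (con 1 :+ d) :≡ a ⇒ ⊢ c :< b) e<f (ℕP.m∸n+n≡m (≮⇒≥ ≮))) no-b
      ...     | e₀ , r , e≡ , rest = e₀ , suc r , linarith (e ∸ n ∷ k ∷ e ∷ e₀ ∷ r * suc k ∷ []) (λ a b c d e → a :+ (con 1 :+ b) :≡ c ⇒ a :≡ d :+ (con 1 :+ b) :+ e ⇒ ⊢ c :≡ d :+ (con 1 :+ b) :+ ((con 1 :+ b) :+ e)) (ℕP.m∸n+n≡m (≮⇒≥ ≮)) e≡ , rest

      -- Both ends are pushed down their runners by r steps, until e reaches the lowest gap. Were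
      -- some level j of the resulting pair to leave the skew shape, a shorter lost and gained pair
      -- would start at one of its ends: at the upper end if j ≥ r, where flushness of τ makes the
      -- bead a lost one, and at the lower end if j < r, where it makes the gap a gained one.
      no-lostGained : ∀ m {e c} → c < e + m → ¬ LostGained e c
      no-lostGained zero {e} {c} <m lg = linarith (c ∷ e ∷ []) (λ a b → a :< b :+ con 0 ⇒ b :< a ⇒ ⊢ absurd) <m (LostGained.order lg)
      no-lostGained (suc m) {e} {c} <m (lostGained lost lost¬ gained gained¬ order between) with lowest-gap (suc e) ≤-refl gained¬
      ... | e₀ , r , e≡ , lowest , gap = no-admissible (suc d) (linarith (e₀ ∷ k ∷ d ∷ []) (λ a b c → ⊢ a :+ (con 1 :+ b) :+ c :< a :+ (con 1 :+ b) :+ (con 1 :+ c))) (admissible bead₀ gap lowest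
            (linarith (e ∷ d ∷ c ∷ e₀ ∷ k ∷ []) (λ a b c d e → a :+ b :≡ c ⇒ a :< c ⇒ ⊢ d :+ (con 1 :+ e) :< d :+ (con 1 :+ e) :+ b) e+d order) ribbon)
        where
        d = c ∸ e
        e+d : e + d ≡ c
        e+d = m+[n∸m]≡n (<⇒≤ order)
        c₀ = e₀ + n + d
        c≡ : c ≡ c₀ + r * n
        c≡ = linarith (e ∷ d ∷ c ∷ e₀ ∷ k ∷ r * suc k ∷ []) (λ a b c d e f → a :+ b :≡ c ⇒ a :≡ d :+ (con 1 :+ e) :+ f ⇒ ⊢ c :≡ d :+ (con 1 :+ e) :+ b :+ f) e+d e≡
        d≤m : d ≤ m
        d≤m = linarith (e ∷ d ∷ c ∷ m ∷ []) (λ a b c d → a :+ b :≡ c ⇒ c :< a :+ (con 1 :+ d) ⇒ ⊢ b :≤ d) e+d <m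
        bead₀ : Bead K c₀
        bead₀ = κ-flush* r (subst (Bead K) c≡ lost)
        ribbon : ∀ j → Bead K (c₀ + j * n) → SkewBetween (e₀ + n + j * n) (c₀ + j * n)
        ribbon j b u <u u≤ = decidable-stable (skew? u) contra
          where
          contra : ¬ ¬ Skew u
          contra no-u with r ≤? j
          ... | yes r≤j = shorter (walk-down (c₀ + j * n ∸ u) u (sym (ℕP.m∸n+n≡m u≤)) (lost-skew b lost′) no-u)
            where
            same : c₀ + j * n ≡ c + (j ∸ r) * n
            same = trans (cong (λ v → c₀ + v * n) (sym (m+[n∸m]≡n r≤j))) (trans (cong (_+_ c₀) (ℕP.*-distribʳ-+ n r (j ∸ r)))
              (trans (sym (+-assoc c₀ (r * n) ((j ∸ r) * n))) (cong (λ v → v + (j ∸ r) * n) (sym c≡))))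
            lost′ : ¬ Bead T (c₀ + j * n)
            lost′ bt = lost¬ (τ-flush* (j ∸ r) (subst (Bead T) same bt))
            shorter : (∃ λ f → u ≤ f × f < c₀ + j * n × (Bead T f × ¬ Bead K f) × SkewBetween f (c₀ + j * n)) → ⊥
            shorter (f , u≤f , f< , (bt , nk) , bw) = no-lostGained m
              (linarith (e₀ ∷ k ∷ j * suc k ∷ u ∷ f ∷ d ∷ m ∷ []) (λ a b c d e f g → a :+ (con 1 :+ b) :+ c :< d ⇒ d :≤ e ⇒ f :≤ g ⇒ ⊢ a :+ (con 1 :+ b) :+ f :+ c :< e :+ g) <u u≤f d≤m) (lostGained b lost′ bt nk f< bw)
          ... | no r≰j = shorter (climb (u ∸ suc e′) (suc e′) u (sym (ℕP.m∸n+n≡m <u)) ≤-refl start (λ v e<v v≤ → subst Skew (≤-antisym e<v v≤) start) no-u)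
            where
            e′ = e₀ + n + j * n
            same : e ≡ e′ + (r ∸ j) * n
            same = trans e≡ (trans (cong (λ v → e₀ + n + v * n) (sym (m+[n∸m]≡n (<⇒≤ (≰⇒> r≰j))))) (trans (cong (_+_ (e₀ + n)) (ℕP.*-distribʳ-+ n j (r ∸ j)))
              (sym (+-assoc (e₀ + n) (j * n) ((r ∸ j) * n)))))
            gained′ : Bead T e′
            gained′ = τ-flush* (r ∸ j) (subst (Bead T) same gained)
            gained¬′ : ¬ Bead K e′
            gained¬′ bk = gap (κ-flush* j bk)
            start : Skew (suc e′)
            start = gained-skew gained′ gained¬′
            shorter : (∃ λ f → e′ < f × f < u × (Bead K f × ¬ Bead T f) × SkewBetween e′ f) → ⊥
            shorter (f , e<f , f<u , (bk , nt) , bw) = no-lostGained m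
              (linarith (f ∷ u ∷ e₀ ∷ k ∷ d ∷ j * suc k ∷ m ∷ []) (λ a b c d e f g → a :< b ⇒ b :≤ c :+ (con 1 :+ d) :+ e :+ f ⇒ e :≤ g ⇒ ⊢ a :< c :+ (con 1 :+ d) :+ f :+ g) f<u u≤ d≤m) (lostGained bk nt gained′ gained¬′ e<f bw)

      -- A single position of the skew shape suffices: its interval ends above in a lost bead, and
      -- going down from there one meets a gained one.
      no-strict : ∀ r → ¬ (T r < K r)
      no-strict r lt = top-of (climb {u₀ ∸ 1} (suc (K 0 + L) ∸ u₀) u₀ (suc (K 0 + L)) (sym (ℕP.m∸n+n≡m (m≤n⇒m≤1+n (proj₁ (skew-bounds start)))))
          (linarith (k ∷ u₀ ∷ u₀ ∸ 1 ∷ []) (λ a b c → con 1 :+ a :≤ b ⇒ c :+ con 1 :≡ b ⇒ ⊢ c :< b) (proj₂ (skew-bounds start)) u₀-1) start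
          (λ u <u u≤ → subst Skew (linarith (u ∷ u₀ ∷ u₀ ∸ 1 ∷ []) (λ a b c → a :≤ b ⇒ c :< a ⇒ c :+ con 1 :≡ b ⇒ ⊢ b :≡ a) u≤ <u u₀-1) start) (λ s → <-irrefl refl (proj₁ (skew-bounds s))))
        where
        r<R : r < R
        r<R = ≰⇒> (λ R≤r → linarith (T r ∷ K r ∷ []) (λ a b → a :< b ⇒ b :≡ con 0 ⇒ ⊢ absurd) lt (K-zero r R≤r))
        u₀ = K r + L ∸ r
        u₀≡ : u₀ + r ≡ K r + L
        u₀≡ = ℕP.m∸n+n≡m (linarith (r ∷ R ∷ K r ∷ k ∷ []) (λ a b c d → a :< b ⇒ ⊢ a :≤ c :+ (b :+ (con 1 :+ d))) r<R)
        start : Skew u₀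
        start = r , linarith (u₀ ∷ r ∷ K r ∷ L ∷ T r ∷ []) (λ a b c d e → a :+ b :≡ c :+ d ⇒ e :< c ⇒ ⊢ e :+ d :< a :+ b) u₀≡ lt , ≤-reflexive u₀≡
        u₀-1 : u₀ ∸ 1 + 1 ≡ u₀
        u₀-1 = ℕP.m∸n+n≡m (linarith (k ∷ u₀ ∷ []) (λ a b → con 1 :+ a :≤ b ⇒ ⊢ con 1 :≤ b) (proj₂ (skew-bounds start)))
        finish : ∀ {c} → Bead K c → ¬ Bead T c → (∃ λ f → 0 ≤ f × f < c × (Bead T f × ¬ Bead K f) × SkewBetween f c) → ⊥
        finish {c} bk nt (f , _ , f<c , (bt , nk) , bw) = no-lostGained (suc c) (linarith (c ∷ f ∷ []) (λ a b → ⊢ a :< b :+ (con 1 :+ a))) (lostGained bk nt bt nk f<c bw)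
        top-of : (∃ λ c → u₀ ∸ 1 < c × c < suc (K 0 + L) × (Bead K c × ¬ Bead T c) × SkewBetween (u₀ ∸ 1) c) → ⊥
        top-of (c , _ , _ , (bk , nt) , _) = finish bk nt (walk-down c 0 (sym (+-identityʳ c)) (lost-skew bk nt) (λ s → linarith (k ∷ []) (λ a → con 1 :+ a :≤ con 0 ⇒ ⊢ absurd) (proj₂ (skew-bounds s))))

    module FromTight {e₀ c : ℕ} (ad : Admissible e₀ c) (tight : Tight e₀ c) where
      open Admissible ad
      open Tight tight

      z = proj₁ bead
      q = proj₁ lowest

      z≡ : c + z ≡ K z + L
      z≡ = proj₂ bead

      q≡ : e₀ + q ≡ K q + L
      q≡ = proj₂ lowest

      Inside : ℕ → Set
      Inside t = e₀ + n + (z + t) < K (z + t) + L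

      -- The block to be removed consists of the rows from z on whose beads lie above the gap e₀ +
      -- n.
      extent : ∃ λ w → Inside w × ¬ Inside (suc w)
      extent = crossing (λ t → e₀ + n + (z + t) <? K (z + t) + L) (R + L)
        (subst (λ s → e₀ + n + s < K s + L) (sym (+-identityʳ z)) (linarith (e₀ ∷ k ∷ c ∷ z ∷ K z ∷ L ∷ []) (λ a b c d e f → a :+ (con 1 :+ b) :< c ⇒ c :+ d :≡ e :+ f ⇒ ⊢ a :+ (con 1 :+ b) :+ d :< e :+ f) order z≡))
        (λ lt → linarith (e₀ ∷ k ∷ z ∷ R ∷ L ∷ K (z + (R + L)) ∷ []) (λ a b c d e f → a :+ (con 1 :+ b) :+ (c :+ (d :+ e)) :< f :+ e ⇒ f :≡ con 0 ⇒ ⊢ absurd) lt (K-zero (z + (R + L)) (linarith (R ∷ z ∷ L ∷ []) (λ a b c → ⊢ a :≤ b :+ (a :+ c)))))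

      w = proj₁ extent

      inside-w : Inside w
      inside-w = proj₁ (proj₂ extent)

      beyond : K (suc (z + w)) + L < e₀ + n + suc (z + w)
      beyond with m≤n⇒m<n∨m≡n (≮⇒≥ (proj₂ (proj₂ extent)))
      ... | inj₁ lt = subst (λ s → K s + L < e₀ + n + s) (+-suc z w) lt
      ... | inj₂ eq = ⊥-elim (gap (z + suc w , sym eq))

      inside≤ : ∀ t → t ≤ w → Inside t
      inside≤ t t≤w = linarith (e₀ ∷ k ∷ z ∷ w ∷ K (z + w) ∷ L ∷ t ∷ K (z + t) ∷ []) (λ a b c d e f g h → a :+ (con 1 :+ b) :+ (c :+ d) :< e :+ f ⇒ e :+ (c :+ g) :≤ h :+ (c :+ d) ⇒ ⊢ a :+ (con 1 :+ b) :+ (c :+ g) :< h :+ f)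
        inside-w (beads-weakly (ℕP.+-monoʳ-≤ z t≤w))

      -- A bead strictly between the beads of D r and D (r + 1) would come from a gap between those of r and r + 1.
      no-row-between : ∀ t → t ≤ w → ∀ s → D (z + t) < s → s < D (suc (z + t)) → K s + L ≤ e₀ + s
      no-row-between t t≤w s <s s< with K s + L ≤? e₀ + s
      ... | yes le = le
      ... | no ≰ = ⊥-elim (gaps f (linarith (e₀ ∷ s ∷ K s ∷ L ∷ f ∷ []) (λ a b c d e → a :+ b :< c :+ d ⇒ e :+ b :≡ c :+ d ⇒ ⊢ a :< e) (≰⇒> ≰) f≡) f<c not-f (s , f≡))
        where
        f = K s + L ∸ s
        f≡ : f + s ≡ K s + L
        f≡ = ℕP.m∸n+n≡m (linarith (e₀ ∷ s ∷ K s ∷ L ∷ []) (λ a b c d → a :+ b :< c :+ d ⇒ ⊢ b :≤ c :+ d) (≰⇒> ≰))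
        f<row : f + n + (z + t) < K (z + t) + L
        f<row = linarith (f ∷ s ∷ K s ∷ L ∷ D (z + t) ∷ K (D (z + t)) ∷ K (z + t) ∷ z ∷ t ∷ k ∷ []) (λ a b c d e f g h i j → a :+ b :≡ c :+ d ⇒ c :+ e :< f :+ b ⇒ g :+ e :≡ f :+ (h :+ i :+ (con 1 :+ j)) ⇒ ⊢ a :+ (con 1 :+ j) :+ (h :+ i) :< g :+ d)
          f≡ (beads-decrease <s) (edge (z + t))
        row<f : K (suc (z + t)) + L < f + n + suc (z + t)
        row<f = linarith (f ∷ s ∷ K s ∷ L ∷ K (D (suc (z + t))) ∷ D (suc (z + t)) ∷ K (suc (z + t)) ∷ z ∷ t ∷ k ∷ []) (λ a b c d e f g h i j → a :+ b :≡ c :+ d ⇒ e :+ b :< c :+ f ⇒ g :+ f :≡ e :+ ((con 1 :+ (h :+ i)) :+ (con 1 :+ j)) ⇒ ⊢ g :+ d :< a :+ (con 1 :+ j) :+ (con 1 :+ (h :+ i)))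
          f≡ (beads-decrease s<) (edge (suc (z + t)))
        f<c : f + n < c
        f<c = linarith (f ∷ k ∷ z ∷ t ∷ K (z + t) ∷ L ∷ K z ∷ c ∷ []) (λ a b c d e f g h → a :+ (con 1 :+ b) :+ (c :+ d) :< e :+ f ⇒ e :+ c :≤ g :+ (c :+ d) ⇒ h :+ c :≡ g :+ f ⇒ ⊢ a :+ (con 1 :+ b) :< h) f<row (beads-weakly (m≤m+n z t)) z≡
        not-f : ¬ Bead K (f + n)
        not-f (s′ , e′) with s′ ≤? z + t
        ... | yes le = linarith (f ∷ k ∷ s′ ∷ K s′ ∷ L ∷ z ∷ t ∷ K (z + t) ∷ []) (λ a b c d e f g h → a :+ (con 1 :+ b) :+ c :≡ d :+ e ⇒ a :+ (con 1 :+ b) :+ (f :+ g) :< h :+ e ⇒ h :+ c :≤ d :+ (f :+ g) ⇒ ⊢ absurd) e′ f<row (beads-weakly le)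
        ... | no ≰′ = linarith (f ∷ k ∷ s′ ∷ K s′ ∷ L ∷ K (suc (z + t)) ∷ z ∷ t ∷ []) (λ a b c d e f g h → a :+ (con 1 :+ b) :+ c :≡ d :+ e ⇒ f :+ e :< a :+ (con 1 :+ b) :+ (con 1 :+ (g :+ h)) ⇒ d :+ (con 1 :+ (g :+ h)) :≤ f :+ c ⇒ ⊢ absurd) e′ row<f (beads-weakly (≰⇒> ≰′))

      consecutive : ∀ t → t < w → D (suc (z + t)) ≡ suc (D (z + t))
      consecutive t t<w with suc (D (z + t)) <? D (suc (z + t))
      ... | no ≮ = ≤-antisym (≮⇒≥ ≮) (D-mono-< (n<1+n (z + t)))
      ... | yes lt = ⊥-elim (linarith (K (suc (D (z + t))) ∷ L ∷ e₀ ∷ D (z + t) ∷ k ∷ z ∷ t ∷ K (z + suc t) ∷ K (suc (z + t)) ∷ D (suc (z + t)) ∷ K (D (suc (z + t))) ∷ []) (λ a b c d e f g h i j k → a :+ b :≤ c :+ (con 1 :+ d) ⇒ c :+ (con 1 :+ e) :+ (f :+ (con 1 :+ g)) :< h :+ b ⇒ f :+ (con 1 :+ g) :≡ con 1 :+ (f :+ g) ⇒ h :≡ i ⇒ i :+ j :≡ k :+ ((con 1 :+ (f :+ g)) :+ (con 1 :+ e)) ⇒ k :+ (con 1 :+ d) :< a :+ j ⇒ ⊢ absurd)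
          (no-row-between t (<⇒≤ t<w) (suc (D (z + t))) ≤-refl lt) (inside≤ (suc t) t<w) (+-suc z t) (cong K (+-suc z t)) (edge (suc (z + t))) (beads-decrease lt))

      block : ∀ t → t ≤ w → la (z + t) ≡ la z
      block zero _ = cong la (+-identityʳ z)
      block (suc t) t<w = trans (cong la (+-suc z t)) (trans (D-flat (consecutive t t<w)) (block t (<⇒≤ t<w)))

      Dq< : D (z + w) < q
      Dq< with q ≤? D (z + w)
      ... | no ≰ = ≰⇒> ≰
      ... | yes le = ⊥-elim (linarith (e₀ ∷ q ∷ K q ∷ L ∷ K (D (z + w)) ∷ D (z + w) ∷ K (z + w) ∷ z ∷ w ∷ k ∷ []) (λ a b c d e f g h i j → a :+ b :≡ c :+ d ⇒ e :+ b :≤ c :+ f ⇒ g :+ f :≡ e :+ (h :+ i :+ (con 1 :+ j)) ⇒ a :+ (con 1 :+ j) :+ (h :+ i) :< g :+ d ⇒ ⊢ absurd)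
          q≡ (beads-weakly le) (edge (z + w)) inside-w)

      q<D : q < D (suc (z + w))
      q<D with D (suc (z + w)) ≤? q
      ... | no ≰ = ≰⇒> ≰
      ... | yes le = ⊥-elim (linarith (e₀ ∷ q ∷ K q ∷ L ∷ D (suc (z + w)) ∷ K (D (suc (z + w))) ∷ K (suc (z + w)) ∷ z ∷ w ∷ k ∷ []) (λ a b c d e f g h i j → a :+ b :≡ c :+ d ⇒ c :+ e :≤ f :+ b ⇒ g :+ e :≡ f :+ ((con 1 :+ (h :+ i)) :+ (con 1 :+ j)) ⇒ g :+ d :< a :+ (con 1 :+ j) :+ (con 1 :+ (h :+ i)) ⇒ ⊢ absurd)
          q≡ (beads-weakly le) (edge (suc (z + w))) beyond)

      q-next : q ≡ suc (D (z + w))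
      q-next with m≤n⇒m<n∨m≡n Dq<
      ... | inj₂ eq = sym eq
      ... | inj₁ lt = ⊥-elim (linarith (K (suc (D (z + w))) ∷ L ∷ e₀ ∷ D (z + w) ∷ q ∷ K q ∷ []) (λ a b c d e f → a :+ b :≤ c :+ (con 1 :+ d) ⇒ c :+ e :≡ f :+ b ⇒ f :+ (con 1 :+ d) :< a :+ e ⇒ ⊢ absurd)
          (no-row-between w ≤-refl (suc (D (z + w))) ≤-refl (<-trans lt q<D)) q≡ (beads-decrease lt))

      drop : la (suc (z + w)) < la z
      drop = linarith (la (z + w) ∷ la z ∷ D (z + w) ∷ z ∷ w ∷ k ∷ D (suc (z + w)) ∷ la (suc (z + w)) ∷ q ∷ []) (λ a b c d e f g h i → a :≡ b ⇒ c :+ a :≡ d :+ e :+ (con 1 :+ f) ⇒ g :+ h :≡ (con 1 :+ (d :+ e)) :+ (con 1 :+ f) ⇒ i :< g ⇒ c :< i ⇒ ⊢ h :< b)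
        (block w ≤-refl) (D+la (z + w)) (D+la (suc (z + w))) q<D Dq<

      -- By `close` the beads of the block lie less than n below c, while the bead of D z lies
      -- exactly n below it.
      short : z + w < D z
      short with z + w <? D z
      ... | yes lt = lt
      ... | no ≮ = ⊥-elim (linarith (K z ∷ D z ∷ K (D z) ∷ z ∷ k ∷ K (z + w) ∷ w ∷ c ∷ e₀ ∷ L ∷ []) (λ a b c d e f g h i j → a :+ b :≡ c :+ (d :+ (con 1 :+ e)) ⇒ f :+ b :≤ c :+ (d :+ g) ⇒ h :< i :+ (con 1 :+ e) :+ (con 1 :+ e) ⇒ h :+ d :≡ a :+ j ⇒ i :+ (con 1 :+ e) :+ (d :+ g) :< f :+ j ⇒ ⊢ absurd)
          (edge z) (beads-weakly (≮⇒≥ ≮)) close z≡ inside-w)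

      -- Level j of the chain: the rows y + t carry the beads of the rows z + t, raised by j (k + 1).
      raised : ∀ j t → t ≤ w → Bead K (c + j * n) → 1 ≤ t → ∃ λ r → K r + (z + t) ≡ K (z + t) + r + (n + j * n)
      raised j t t≤w b 1≤t = r , linarith (f ∷ k ∷ j * suc k ∷ r ∷ K r ∷ L ∷ z ∷ t ∷ K (z + t) ∷ []) (λ a b c d e f g h i → a :+ ((con 1 :+ b) :+ c) :+ d :≡ e :+ f ⇒ a :+ (g :+ h) :≡ i :+ f ⇒ ⊢ e :+ (g :+ h) :≡ i :+ d :+ ((con 1 :+ b) :+ c)) (proj₂ hit) f≡
        where
        f = K (z + t) + L ∸ (z + t)
        f≡ : f + (z + t) ≡ K (z + t) + L
        f≡ = ℕP.m∸n+n≡m (linarith (e₀ ∷ k ∷ z ∷ t ∷ K (z + t) ∷ L ∷ []) (λ a b c d e f → a :+ (con 1 :+ b) :+ (c :+ d) :< e :+ f ⇒ ⊢ c :+ d :≤ e :+ f) (inside≤ t t≤w))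
        hit : Bead K (f + suc j * n)
        hit = hits f (linarith (e₀ ∷ k ∷ z ∷ t ∷ K (z + t) ∷ L ∷ f ∷ []) (λ a b c d e f g → a :+ (con 1 :+ b) :+ (c :+ d) :< e :+ f ⇒ g :+ (c :+ d) :≡ e :+ f ⇒ ⊢ a :+ (con 1 :+ b) :< g) (inside≤ t t≤w) f≡)
          (linarith (K (z + t) ∷ z ∷ K z ∷ t ∷ f ∷ L ∷ c ∷ []) (λ a b c d e f g → a :+ b :< c :+ (b :+ d) ⇒ e :+ (b :+ d) :≡ a :+ f ⇒ g :+ b :≡ c :+ f ⇒ ⊢ e :< g) (beads-decrease (linarith (t ∷ z ∷ []) (λ a b → con 1 :≤ a ⇒ ⊢ b :< b :+ a) 1≤t)) f≡ z≡) (z + t , f≡) j b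
        r = proj₁ hit

      record Raised (j y : ℕ) : Set where
        constructor raised-by
        field carries : ∀ t → t ≤ w → K (y + t) + (z + t) ≡ K (z + t) + (y + t) + j * n
      open Raised

      raised-row : ∀ {j y t r} → Raised j y → t ≤ w → K r + (z + t) ≡ K (z + t) + r + (n + j * n) → D r ≡ y + t
      raised-row {j} {y} {t} {r} ry t≤w e with <-cmp (D r) (y + t)
      ... | tri≈ _ eq _ = eq
      ... | tri< lt _ _ = ⊥-elim (linarith (K r ∷ z ∷ t ∷ K (z + t) ∷ r ∷ k ∷ j * suc k ∷ K (y + t) ∷ y ∷ D r ∷ K (D r) ∷ []) (λ a b c d e f g h i j k → a :+ (b :+ c) :≡ d :+ e :+ ((con 1 :+ f) :+ g) ⇒ h :+ (b :+ c) :≡ d :+ (i :+ c) :+ g ⇒ a :+ j :≡ k :+ (e :+ (con 1 :+ f)) ⇒ h :+ j :< k :+ (i :+ c) ⇒ ⊢ absurd)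
              e (carries ry t t≤w) (edge r) (beads-decrease lt))
      ... | tri> _ _ lt = ⊥-elim (linarith (K r ∷ z ∷ t ∷ K (z + t) ∷ r ∷ k ∷ j * suc k ∷ K (y + t) ∷ y ∷ D r ∷ K (D r) ∷ []) (λ a b c d e f g h i j k → a :+ (b :+ c) :≡ d :+ e :+ ((con 1 :+ f) :+ g) ⇒ h :+ (b :+ c) :≡ d :+ (i :+ c) :+ g ⇒ a :+ j :≡ k :+ (e :+ (con 1 :+ f)) ⇒ k :+ (i :+ c) :< h :+ j ⇒ ⊢ absurd)
              e (carries ry t t≤w) (edge r) (beads-decrease lt))

      above-level : ∀ {j y r t} → Raised j y → t ≤ w → K r + (z + t) ≡ K (z + t) + r + (n + j * n) → r < y
      above-level {j} {y} {r} {t} ry t≤w e with r <? y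
      ... | yes lt = lt
      ... | no ≮ = ⊥-elim (linarith (K r ∷ z ∷ t ∷ K (z + t) ∷ r ∷ k ∷ j * suc k ∷ K (y + 0) ∷ K (z + 0) ∷ y ∷ K y ∷ K z ∷ e₀ ∷ L ∷ c ∷ []) (λ a b c d e f g h i j k l m n o → a :+ (b :+ c) :≡ d :+ e :+ ((con 1 :+ f) :+ g) ⇒ h :+ (b :+ con 0) :≡ i :+ (j :+ con 0) :+ g ⇒ h :≡ k ⇒ i :≡ l ⇒ a :+ j :≤ k :+ e ⇒ m :+ (con 1 :+ f) :+ (b :+ c) :< d :+ n ⇒ o :+ b :≡ l :+ n ⇒ o :< m :+ (con 1 :+ f) :+ (con 1 :+ f) ⇒ ⊢ absurd)
          e (carries ry 0 z≤n) (cong K (+-identityʳ y)) (cong K (+-identityʳ z)) (beads-weakly (≮⇒≥ ≮)) (inside≤ t t≤w) z≡ close)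

      level-bead : ∀ {j y} → Raised j y → Bead K (c + j * n)
      level-bead {j} {y} ry = y , linarith (K (y + 0) ∷ z ∷ K (z + 0) ∷ y ∷ j * suc k ∷ K y ∷ K z ∷ c ∷ L ∷ []) (λ a b c d e f g h i → a :+ (b :+ con 0) :≡ c :+ (d :+ con 0) :+ e ⇒ a :≡ f ⇒ c :≡ g ⇒ h :+ b :≡ g :+ i ⇒ ⊢ h :+ e :+ d :≡ f :+ i)
        (carries ry 0 z≤n) (cong K (+-identityʳ y)) (cong K (+-identityʳ z)) z≡

      consecutive-rows : ∀ {j y r} s → Raised j y → 1 ≤ s → K r + (z + s) ≡ K (z + s) + r + (n + j * n) → ∀ t → s + t ≤ w →
        K (r + t) + (z + (s + t)) ≡ K (z + (s + t)) + (r + t) + (n + j * n)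
      consecutive-rows {j} {y} {r} s ry _ e zero s≤w =
        subst₂ (λ u v → K u + (z + v) ≡ K (z + v) + u + (n + j * n)) (sym (+-identityʳ r)) (sym (+-identityʳ s)) e
      consecutive-rows {j} {y} {r} s ry 1≤s e (suc t) st≤w with raised j (s + suc t) st≤w (level-bead ry) (linarith (s ∷ t ∷ []) (λ a b → con 1 :≤ a ⇒ ⊢ con 1 :≤ a :+ (con 1 :+ b)) 1≤s)
      ... | r′ , e′ = subst (λ u → K u + (z + (s + suc t)) ≡ K (z + (s + suc t)) + u + (n + j * n)) r′≡ e′
        where
        st≤ : s + t ≤ w
        st≤ = linarith (s ∷ t ∷ w ∷ []) (λ a b c → a :+ (con 1 :+ b) :≤ c ⇒ ⊢ a :+ b :≤ c) st≤w
        prev = consecutive-rows s ry 1≤s e t st≤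
        r′≡ : r′ ≡ r + suc t
        r′≡ = trans (D-next (trans (raised-row ry st≤w e′) (trans (cong (_+_ y) (+-suc s t)) (trans (+-suc y (s + t)) (cong suc (sym (raised-row ry st≤ prev))))))) (sym (+-suc r t))

      Chained : ℕ → Set
      Chained y = ∃ λ p → ∃ λ x → ∃ λ a → Chain w y p x a

      -- A level is followed by another one as long as the runner of c has a bead there; f bounds
      -- the ascent, since levels move to smaller rows.
      build : ∀ f j y → y < f → Raised j y → Chained y
      build (suc f) j y (s≤s y≤f) ry with κ? (c + suc j * n)
      ... | yes (r , er) = chained (build f (suc j) r (<-≤-trans r<y y≤f) (raised-by ry′))
        where
        er′ : K r + (z + 0) ≡ K (z + 0) + r + (n + j * n)
        er′ = linarith (c ∷ k ∷ j * suc k ∷ r ∷ K r ∷ L ∷ z ∷ K z ∷ K (z + 0) ∷ []) (λ a b c d e f g h i → a :+ ((con 1 :+ b) :+ c) :+ d :≡ e :+ f ⇒ a :+ g :≡ h :+ f ⇒ i :≡ h ⇒ ⊢ e :+ (g :+ con 0) :≡ i :+ d :+ ((con 1 :+ b) :+ c)) er z≡ (cong K (+-identityʳ z))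
        r<y : r < y
        r<y = above-level ry z≤n er′
        ry′ : ∀ t → t ≤ w → K (r + t) + (z + t) ≡ K (z + t) + (r + t) + (n + j * n)
        ry′ zero _ = subst (λ u → K u + (z + 0) ≡ K (z + 0) + u + (n + j * n)) (sym (+-identityʳ r)) er′
        ry′ (suc t) t<w with raised j 1 (linarith (t ∷ w ∷ []) (λ a b → con 1 :+ a :≤ b ⇒ ⊢ con 1 :≤ b) t<w) (level-bead ry) ≤-refl
        ... | r₁ , e₁ = subst (λ u → K u + (z + suc t) ≡ K (z + suc t) + u + (n + j * n)) (trans (cong (λ u → u + t) r₁≡) (sym (+-suc r t))) (consecutive-rows 1 ry ≤-refl e₁ t t<w)
          where
          r₁≡ : r₁ ≡ suc r
          r₁≡ = D-next (trans (raised-row ry (linarith (t ∷ w ∷ []) (λ a b → con 1 :+ a :≤ b ⇒ ⊢ con 1 :≤ b) t<w) e₁) (trans (+-suc y 0) (cong suc (sym (raised-row ry z≤n er′)))))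
        chained : Chained r → Chained y
        chained (p , x , a , ch) = suc p , x , a , step r (λ t t≤w → raised-row ry t≤w (ry′ t t≤w)) (above-level ry ≤-refl (ry′ w ≤-refl)) ch
      ... | no none = top-level w refl
        where
        no-up : ∀ r → D r ≢ y
        no-up r refl = none (r , linarith (c ∷ z ∷ K z ∷ L ∷ K (D r + 0) ∷ K (z + 0) ∷ D r ∷ j * suc k ∷ K (D r) ∷ K r ∷ r ∷ k ∷ []) (λ a b c d e f g h i j k l → a :+ b :≡ c :+ d ⇒ e :+ (b :+ con 0) :≡ f :+ (g :+ con 0) :+ h ⇒ e :≡ i ⇒ f :≡ c ⇒ j :+ g :≡ i :+ (k :+ (con 1 :+ l)) ⇒ ⊢ a :+ ((con 1 :+ l) :+ h) :+ k :≡ j :+ d)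
          z≡ (carries ry 0 z≤n) (cong K (+-identityʳ (D r))) (cong K (+-identityʳ z)) (edge r))
        top-level : ∀ v → v ≡ w → Chained y
        top-level zero refl′ = 1 , y , 0 , top no-up (λ i i<w → ⊥-elim (linarith (i ∷ w ∷ []) (λ a b → a :< b ⇒ con 0 :≡ b ⇒ ⊢ absurd) i<w refl′)) (linarith (w ∷ y ∷ []) (λ a b → con 0 :≡ a ⇒ ⊢ con 0 :+ a :≤ b) refl′)
        -- The runner of c ends here, but `hits` still raises the beads of the rows z + 1, ..., z +
        -- w. The rows that carry them are the w rows joined to the top block.
        top-level (suc v) v≡ with raised j 1 (linarith (v ∷ w ∷ []) (λ a b → con 1 :+ a :≡ b ⇒ ⊢ con 1 :≤ b) v≡) (level-bead ry) ≤-refl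
        ... | r , er = 1 , y , r , top no-up (λ i i<w → trans (raised-row ry i<w (rows i i<w)) (+-suc y i))
              (linarith (r ∷ v ∷ y ∷ w ∷ []) (λ a b c d → a :+ b :< c ⇒ con 1 :+ b :≡ d ⇒ ⊢ a :+ d :≤ c) (above-level ry (≤-reflexive v≡) (rows v (≤-reflexive v≡))) v≡)
          where
          rows : ∀ i → suc i ≤ w → K (r + i) + (z + suc i) ≡ K (z + suc i) + (r + i) + (n + j * n)
          rows i i<w = consecutive-rows 1 ry ≤-refl er i i<w

      built : Chained z
      built = build (suc z) 0 z ≤-refl (raised-by λ t _ → sym (+-identityʳ (K (z + t) + (z + t))))

      good : Good z w (proj₁ built) (proj₁ (proj₂ built)) (proj₁ (proj₂ (proj₂ built)))
      good = record
        { positive = linarith (la (suc (z + w)) ∷ la z ∷ []) (λ a b → a :< b ⇒ ⊢ con 0 :< b) drop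
        ; block = block ; drop = drop ; short = short ; chain = proj₂ (proj₂ (proj₂ built)) }

      module Rib = Ribbons core antitone good

      -- The last row of the block receives the gap as its new bead. This is where it matters that
      -- the row q of e₀ follows D (z + w) directly.
      K′-bottom : Rib.K′ (z + w) + L ≡ e₀ + n + (z + w)
      K′-bottom = linarith (K′z ∷ la z ∷ K (suc (D z + w)) ∷ e₀ ∷ q ∷ K q ∷ L ∷ D z ∷ w ∷ z ∷ k ∷ []) (λ a b c d e f g h i j k → con 1 :+ a :≡ b :+ c ⇒ d :+ e :≡ f :+ g ⇒ e :≡ con 1 :+ (h :+ i) ⇒ f :≡ c ⇒ h :+ b :≡ j :+ (con 1 :+ k) ⇒ ⊢ a :+ g :≡ d :+ (con 1 :+ k) :+ (j :+ i))
        (Rib.K′-block w ≤-refl) q≡ q≡′ (cong K q≡′) (D+la z)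
        where
        K′z = Rib.K′ (z + w)
        q≡′ : q ≡ suc (D z + w)
        q≡′ = trans q-next (cong suc (Rib.D-block w ≤-refl))

      -- The position just above the new bead of a ribbon row belongs to the skew shape by
      -- admissibility. A box of the skew shape with this content lies in that row or above it, and
      -- τ ends before the box; as the beads of τ decrease, τ cannot pass K′ in the ribbon row.
      T≤K′ : ∀ r → T r ≤ Rib.K′ r
      T≤K′ r with Rib.inRibbon? r
      ... | no free = subst (T r ≤_) (sym (Rib.agree r free)) (T≤K r)
      ... | yes (y , i , m , i≤w , refl) with Rib.level-position m | Rib.removed m
      ...   | j , ry , e′ | rem = under (m≤n⇒m<n∨m≡n i≤w)
        where
        K′y = Rib.K′ (y + w)
        last : K′y + L ≡ e₀ + n + j * n + (y + w)
        last = linarith (K′y ∷ z ∷ w ∷ K′z ∷ y ∷ j * suc k ∷ L ∷ e₀ ∷ k ∷ []) (λ a b c d e f g h i → a :+ (b :+ c) :≡ d :+ (e :+ c) :+ f ⇒ d :+ g :≡ h :+ (con 1 :+ i) :+ (b :+ c) ⇒ ⊢ a :+ g :≡ h :+ (con 1 :+ i) :+ f :+ (e :+ c)) e′ K′-bottom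
          where
          K′z = Rib.K′ (z + w)
        at : ∀ v → K (y + v) + y ≤ K y + (y + v) → K (y + v) + L ≤ c + j * n + (y + v)
        at v le = linarith (K (y + v) ∷ y ∷ K y ∷ v ∷ c ∷ j * suc k ∷ L ∷ []) (λ a b c d e f g → a :+ b :≤ c :+ (b :+ d) ⇒ e :+ f :+ b :≡ c :+ g ⇒ ⊢ a :+ g :≤ e :+ f :+ (b :+ d)) le (proj₂ (level-bead (raised-by {j} {y} ry)))
        under : i < w ⊎ i ≡ w → T (y + i) ≤ Rib.K′ (y + i)
        under (inj₁ i<w) = bound (ribbon j (level-bead (raised-by {j} {y} ry)) u <u u≤)
          where
          s = suc (y + i)
          -- By `shifted` the new bead of row y + i is the bead of row s in κ, so u lies just above
          -- it.
          u = suc (K s + L ∸ s)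
          Ks : e₀ + n + j * n + s < K s + L
          Ks = linarith (K (y + suc i) ∷ z ∷ i ∷ K (z + suc i) ∷ y ∷ j * suc k ∷ e₀ ∷ k ∷ L ∷ K s ∷ s ∷ []) (λ a b c d e f g h i j k → a :+ (b :+ (con 1 :+ c)) :≡ d :+ (e :+ (con 1 :+ c)) :+ f ⇒ g :+ (con 1 :+ h) :+ (b :+ (con 1 :+ c)) :< d :+ i ⇒ a :≡ j ⇒ e :+ (con 1 :+ c) :≡ k ⇒ ⊢ g :+ (con 1 :+ h) :+ f :+ k :< j :+ i)
            (ry (suc i) i<w) (inside≤ (suc i) i<w) (cong K (+-suc y i)) (+-suc y i)
          u≡ : u + s ≡ suc (K s + L)
          u≡ = cong suc (ℕP.m∸n+n≡m (linarith (e₀ ∷ k ∷ j * suc k ∷ s ∷ K s ∷ L ∷ []) (λ a b c d e f → a :+ (con 1 :+ b) :+ c :+ d :< e :+ f ⇒ ⊢ d :≤ e :+ f) Ks))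
          <u : e₀ + n + j * n < u
          <u = linarith (u ∷ s ∷ K s ∷ L ∷ e₀ ∷ k ∷ j * suc k ∷ []) (λ a b c d e f g → a :+ b :≡ con 1 :+ (c :+ d) ⇒ e :+ (con 1 :+ f) :+ g :+ b :< c :+ d ⇒ ⊢ e :+ (con 1 :+ f) :+ g :< a) u≡ Ks
          u≤ : u ≤ c + j * n
          u≤ = linarith (u ∷ s ∷ K s ∷ L ∷ y ∷ K y ∷ c ∷ j * suc k ∷ []) (λ a b c d e f g h → a :+ b :≡ con 1 :+ (c :+ d) ⇒ c :+ e :< f :+ b ⇒ g :+ h :+ e :≡ f :+ d ⇒ ⊢ a :≤ g :+ h) u≡ (beads-decrease (s≤s (m≤m+n y i))) (proj₂ (level-bead (raised-by {j} {y} ry)))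
          bound : Skew u → T (y + i) ≤ Rib.K′ (y + i)
          bound (r′ , lo , hi) with r′ ≤? y + i
          ... | yes le = linarith (T r′ ∷ L ∷ u ∷ r′ ∷ T (y + i) ∷ y ∷ i ∷ s ∷ K s ∷ K′i ∷ []) (λ a b c d e f g h i j → a :+ b :< c :+ d ⇒ e :+ d :≤ a :+ (f :+ g) ⇒ c :+ h :≡ con 1 :+ (i :+ b) ⇒ con 1 :+ j :≡ i ⇒ h :≡ con 1 :+ (f :+ g) ⇒ ⊢ e :≤ j)
                  lo (T-beads le) u≡ (Rib.Removed.shifted rem i i<w) refl
            where
            K′i = Rib.K′ (y + i)
          ... | no ≰ = ⊥-elim (linarith (u ∷ r′ ∷ K r′ ∷ L ∷ s ∷ K s ∷ []) (λ a b c d e f → a :+ b :≤ c :+ d ⇒ a :+ e :≡ con 1 :+ (f :+ d) ⇒ c :+ e :≤ f :+ b ⇒ ⊢ absurd) hi u≡ (beads-weakly (≰⇒> ≰)))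
        under (inj₂ refl) = bound (ribbon j (level-bead (raised-by {j} {y} ry)) (suc (e₀ + n + j * n)) ≤-refl (linarith (e₀ ∷ k ∷ c ∷ j * suc k ∷ []) (λ a b c d → a :+ (con 1 :+ b) :< c ⇒ ⊢ con 1 :+ (a :+ (con 1 :+ b) :+ d) :≤ c :+ d) order))
          where
          bound : Skew (suc (e₀ + n + j * n)) → T (y + w) ≤ K′y
          bound (r′ , lo , hi) with r′ ≤? y + w
          ... | yes le = linarith (T r′ ∷ L ∷ e₀ ∷ k ∷ j * suc k ∷ r′ ∷ T (y + w) ∷ y ∷ w ∷ K′y ∷ []) (λ a b c d e f g h i j → a :+ b :< (con 1 :+ (c :+ (con 1 :+ d) :+ e)) :+ f ⇒ g :+ f :≤ a :+ (h :+ i) ⇒ j :+ b :≡ c :+ (con 1 :+ d) :+ e :+ (h :+ i) ⇒ ⊢ g :≤ j)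
                  lo (T-beads le) last
          ... | no ≰ = ⊥-elim (linarith (e₀ ∷ k ∷ j * suc k ∷ r′ ∷ K r′ ∷ L ∷ y ∷ w ∷ K (suc (y + w)) ∷ K′y ∷ []) (λ a b c d e f g h i j → (con 1 :+ (a :+ (con 1 :+ b) :+ c)) :+ d :≤ e :+ f ⇒ e :+ (con 1 :+ (g :+ h)) :≤ i :+ d ⇒ i :≤ j ⇒ j :+ f :≡ a :+ (con 1 :+ b) :+ c :+ (g :+ h) ⇒ ⊢ absurd)
                  hi (beads-weakly (≰⇒> ≰)) (Rib.Removed.last≥ rem) last)

    exchange : (∀ {z w p x a} (g : Good z w p x a) → ¬ (∀ r → T r ≤ Ribbons.K′ core antitone g r)) → ∀ r → ¬ (T r < K r)
    exchange none = no-strict (λ ad tight → none (FromTight.good ad tight) (FromTight.T≤K′ ad tight))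

-- Hook lengths and partitions as lists.

module PartitionLists where
  open import Data.Nat as ℕ using (ℕ; zero; suc; _≤_; _<_; _+_; _∸_; s≤s; z≤n; _⊓_)
  open import Data.Nat.Properties using (≤-refl; ≤-trans; <-irrefl; <-trans; ≤-antisym; ≤-reflexive; m≤m+n; +-comm; <ᵇ⇒<; <⇒<ᵇ; ≤ᵇ⇒≤; ≤⇒≤ᵇ; _≟_; _≤?_; _<?_; ≰⇒>; ≮⇒≥; <-≤-trans; ≤-<-trans; n<1+n; m≤n⇒m≤1+n; m+[n∸m]≡n; m≤n⇒m<n∨m≡n)
  open import Data.Integer using (+_)
  import Data.Nat.Properties as ℕP
  open import Data.Fin using (zero; suc)
  open import Data.List using (List; []; _∷_; _++_; map; filterᵇ; length; upTo; applyUpTo; replicate)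
  open import Data.List.Membership.Propositional using (_∈_)
  open import Data.List.Membership.Propositional.Properties using (∈-map⁺; ∈-map⁻; ∈-concat⁺′; ∈-concat⁻′; ∈-applyUpTo⁺; ∈-applyUpTo⁻)
  open import Data.List.Relation.Unary.Any using (here)
  open import Data.List.Relation.Unary.All as All using (All; []; _∷_)
  open import Data.List.Relation.Unary.AllPairs using ([]; _∷_)
  open import Data.List.Relation.Unary.Unique.Propositional using (Unique)
  import Data.List.Relation.Unary.Unique.Propositional.Properties as UniqueP
  open import Data.Bool using (Bool; true; false; T; not)
  open import Data.Bool.Properties using (T-∧; T-≡)
  open import Data.Product using (_×_; _,_; proj₁; proj₂; ∃)
  open import Data.Sum using (inj₁; inj₂)
  open import Data.Empty using (⊥; ⊥-elim)
  open import Data.Vec using ([]; _∷_)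
  open import Function using (_∘_; id)
  open import Function.Bundles using (Equivalence)
  open import Relation.Nullary using (Dec; yes; no; ¬_)
  open import Relation.Binary.PropositionalEquality
  open import Data.List.Properties using (map-upTo; length-++; length-replicate; length-applyUpTo)
  import Data.List.Relation.Unary.All.Properties as AllP
  import Data.List.Relation.Unary.AllPairs.Properties as AllPairsP
  open LinearArithmetic
  open BounceGraph
  open CoreRibbons

  rowLen-[] : ∀ xs r → length xs ≤ r → rowLen xs r ≡ 0
  rowLen-[] [] r _ = refl
  rowLen-[] (x ∷ xs) (suc r) (s≤s le) = rowLen-[] xs r le

  rowLen-applyUpTo : ∀ f n r → r < n → rowLen (applyUpTo f n) r ≡ f r
  rowLen-applyUpTo f (suc n) zero _ = refl
  rowLen-applyUpTo f (suc n) (suc r) (s≤s r<n) = rowLen-applyUpTo (f ∘ ℕ.suc) n r r<n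

  rowLen-ext : ∀ xs ys → length xs ≡ length ys → (∀ r → rowLen xs r ≡ rowLen ys r) → xs ≡ ys
  rowLen-ext [] [] _ _ = refl
  rowLen-ext (x ∷ xs) (y ∷ ys) e f = cong₂ _∷_ (f 0) (rowLen-ext xs ys (ℕP.suc-injective e) (λ r → f (ℕ.suc r)))

  rowLen-consT : ∀ x ys r → rowLen (consT x ys) r ≡ rowLen (x ∷ ys) r
  rowLen-consT zero [] zero = refl
  rowLen-consT zero [] (suc r) = refl
  rowLen-consT (suc x) [] r = refl
  rowLen-consT zero (y ∷ ys) r = refl
  rowLen-consT (suc x) (y ∷ ys) r = refl

  rowLen-trim : ∀ xs r → rowLen (trim xs) r ≡ rowLen xs r
  rowLen-trim [] r = refl
  rowLen-trim (x ∷ xs) zero = rowLen-consT x (trim xs) 0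
  rowLen-trim (x ∷ xs) (suc r) = trans (rowLen-consT x (trim xs) (ℕ.suc r)) (rowLen-trim xs r)

  length-consT : ∀ x ys → length (consT x ys) ≤ ℕ.suc (length ys)
  length-consT zero [] = z≤n
  length-consT (suc x) [] = ≤-refl
  length-consT zero (y ∷ ys) = ≤-refl
  length-consT (suc x) (y ∷ ys) = ≤-refl

  length-trim : ∀ xs ℓ → (∀ r → ℓ ≤ r → rowLen xs r ≡ 0) → length (trim xs) ≤ ℓ
  length-trim [] ℓ _ = z≤n
  length-trim (x ∷ xs) (suc ℓ) zeros = ≤-trans (length-consT x (trim xs)) (s≤s (length-trim xs ℓ (λ r le → zeros (ℕ.suc r) (s≤s le))))
  length-trim (x ∷ xs) zero zeros with trim xs | length-trim xs 0 (λ r _ → zeros (ℕ.suc r) z≤n) | zeros 0 z≤n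
  ... | [] | _ | refl = z≤n

  rowLen-replicate : ∀ m r → rowLen (replicate m 0) r ≡ 0
  rowLen-replicate zero r = refl
  rowLen-replicate (suc m) zero = refl
  rowLen-replicate (suc m) (suc r) = rowLen-replicate m r

  rowLen-++-zeros : ∀ xs m r → rowLen (xs ++ replicate m 0) r ≡ rowLen xs r
  rowLen-++-zeros [] m r = rowLen-replicate m r
  rowLen-++-zeros (x ∷ xs) m zero = refl
  rowLen-++-zeros (x ∷ xs) m (suc r) = rowLen-++-zeros xs m r

  length-pad : ∀ ℓ xs → length xs ≤ ℓ → length (pad ℓ xs) ≡ ℓ
  length-pad ℓ xs le = trans (length-++ xs) (trans (cong (_+_ (length xs)) (length-replicate (ℓ ∸ length xs))) (m+[n∸m]≡n le))

  Decreasing : List ℕ → Set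
  Decreasing κ = ∀ r → rowLen κ (ℕ.suc r) ≤ rowLen κ r

  decreasing-antitone : ∀ {κ} → Decreasing κ → ∀ {r s} → r ≤ s → rowLen κ s ≤ rowLen κ r
  decreasing-antitone {κ} dec {r} {zero} z≤n = ≤-refl
  decreasing-antitone {κ} dec {r} {suc s} r≤ with m≤n⇒m<n∨m≡n r≤
  ... | inj₂ refl = ≤-refl
  ... | inj₁ r<s = ≤-trans (dec s) (decreasing-antitone {κ} dec (ℕP.≤-pred r<s))

  colLen-empty : ∀ κ c → (∀ r → rowLen κ r ≤ c) → colLen κ c ≡ 0
  colLen-empty [] c _ = refl
  colLen-empty (a ∷ κ) c le with c ℕ.<ᵇ a in eq
  ... | false = colLen-empty κ c (λ r → le (ℕ.suc r))
  ... | true = ⊥-elim (<-irrefl refl (<-≤-trans (<ᵇ⇒< c a (Equivalence.from T-≡ eq)) (le 0)))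

  colLen⁺ : ∀ κ → Decreasing κ → ∀ {c r} → c < rowLen κ r → r < colLen κ c
  colLen⁺ (a ∷ κ) dec {c} {r} lt with c ℕ.<ᵇ a in eq
  ... | false = ⊥-elim (subst T eq (<⇒<ᵇ (<-≤-trans lt (decreasing-antitone {a ∷ κ} dec {0} {r} z≤n))))
  colLen⁺ (a ∷ κ) dec {c} {zero} lt | true = s≤s z≤n
  colLen⁺ (a ∷ κ) dec {c} {suc r} lt | true = s≤s (colLen⁺ κ (λ r → dec (ℕ.suc r)) lt)

  colLen⁻ : ∀ κ → Decreasing κ → ∀ {c r} → r < colLen κ c → c < rowLen κ r
  colLen⁻ (a ∷ κ) dec {c} {r} lt with c ℕ.<ᵇ a in eq
  colLen⁻ (a ∷ κ) dec {c} {zero} lt | true = <ᵇ⇒< c a (Equivalence.from T-≡ eq)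
  colLen⁻ (a ∷ κ) dec {c} {suc r} (s≤s lt) | true = colLen⁻ κ (λ r → dec (ℕ.suc r)) lt
  ... | false with colLen κ c | colLen-empty κ c (λ r → ≤-trans (decreasing-antitone {a ∷ κ} dec {0} {ℕ.suc r} z≤n) (≮⇒≥ (λ c<a → subst T eq (<⇒<ᵇ c<a)))) | lt
  ...   | _ | refl | ()

  -- In this additive form no truncated subtraction remains.
  hook-value : ∀ κ → Decreasing κ → ∀ {r c} → c < rowLen κ r → hook κ r c + ℕ.suc (c + r) ≡ rowLen κ r + colLen κ c
  hook-value κ dec {r} {c} lt = linarith (arm ∷ c ∷ K ∷ leg ∷ r ∷ C ∷ []) (λ a b c d e f → a :+ (con 1 :+ b) :≡ c ⇒ d :+ (con 1 :+ e) :≡ f ⇒ ⊢ a :+ d :+ con 1 :+ (con 1 :+ (b :+ e)) :≡ c :+ f) arm≡ leg≡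
    where
    K = rowLen κ r
    C = colLen κ c
    arm = K ∸ c ∸ 1
    leg = C ∸ r ∸ 1
    arm≡ : arm + ℕ.suc c ≡ K
    arm≡ = trans (cong (λ v → v + ℕ.suc c) (trans (ℕP.∸-+-assoc K c 1) (cong (K ∸_) (+-comm c 1)))) (ℕP.m∸n+n≡m lt)
    leg≡ : leg + ℕ.suc r ≡ C
    leg≡ = trans (cong (λ v → v + ℕ.suc r) (trans (ℕP.∸-+-assoc C r 1) (cong (C ∸_) (+-comm r 1)))) (ℕP.m∸n+n≡m (colLen⁺ κ dec lt))

  allᵇ⁻ : ∀ bs → T (allᵇ bs) → All T bs
  allᵇ⁻ [] _ = []
  allᵇ⁻ (b ∷ bs) t with Equivalence.to T-∧ t
  ... | p , q = p ∷ allᵇ⁻ bs q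

  allᵇ⁺ : ∀ {bs} → All T bs → T (allᵇ bs)
  allᵇ⁺ [] = _
  allᵇ⁺ (p ∷ ps) = Equivalence.from T-∧ (p , allᵇ⁺ ps)

  module _ (k : ℕ) (κ : List ℕ) where
    private
      cells : ℕ → List Bool
      cells r = map (λ c → not (hook κ r c ℕ.≡ᵇ ℕ.suc k)) (upTo (rowLen κ r))

    coreᵇ⁻ : T (coreᵇ k κ) → ∀ {r c} → c < rowLen κ r → hook κ r c ≢ ℕ.suc k
    coreᵇ⁻ t {r} {c} lt e = absurd-hook (AllP.applyUpTo⁻ _ (rowLen κ r)
        (subst (All T) (map-upTo (λ c → not (hook κ r c ℕ.≡ᵇ ℕ.suc k)) (rowLen κ r)) row) lt)
      where
      row : All T (cells r)
      row = AllP.applyUpTo⁻ cells (length κ) (subst (All (All T)) (map-upTo cells (length κ)) (AllP.concat⁻ (allᵇ⁻ _ t)))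
        (ℕP.≰⇒> (λ le → linarith (c ∷ K ∷ []) (λ a b → a :< b ⇒ b :≡ con 0 ⇒ ⊢ absurd) lt (rowLen-[] κ r le)))
        where K = rowLen κ r
      absurd-hook : T (not (hook κ r c ℕ.≡ᵇ ℕ.suc k)) → ⊥
      absurd-hook t with hook κ r c ℕ.≡ᵇ ℕ.suc k | ℕP.≡⇒≡ᵇ (hook κ r c) (ℕ.suc k) e
      absurd-hook () | true | _

    coreᵇ⁺ : (∀ {r c} → c < rowLen κ r → hook κ r c ≢ ℕ.suc k) → T (coreᵇ k κ)
    coreᵇ⁺ f = allᵇ⁺ (AllP.concat⁺ (subst (All (All T)) (sym (map-upTo cells (length κ))) (AllP.applyUpTo⁺₁ cells (length κ) λ {r} _ →
      subst (All T) (sym (map-upTo _ (rowLen κ r))) (AllP.applyUpTo⁺₁ _ (rowLen κ r) λ {c} lt → notEqual r c (f lt)))))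
      where
      notEqual : ∀ r c → hook κ r c ≢ ℕ.suc k → T (not (hook κ r c ℕ.≡ᵇ ℕ.suc k))
      notEqual r c ne with hook κ r c ℕ.≡ᵇ ℕ.suc k in eq
      ... | false = _
      ... | true = ne (ℕP.≡ᵇ⇒≡ (hook κ r c) (ℕ.suc k) (Equivalence.from T-≡ eq))

  -- Hooks decrease along a row, so the boxes counted by `pmap` are the last m ones of the row.
  count-threshold : ∀ (P : ℕ → Bool) (f : ℕ → ℕ) N m → m ≤ N → (∀ c → c < N → N ≤ c + m → T (P (f c))) → (∀ c → c + m < N → ¬ T (P (f c))) →
    length (filterᵇ P (applyUpTo f N)) ≡ m
  count-threshold P f zero zero _ _ _ = refl
  count-threshold P f (suc N) m m≤ yes-above no-below with P (f 0) in eq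
  ... | true = count-true m m≤ yes-above no-below
    where
    count-true : ∀ m → m ≤ ℕ.suc N → (∀ c → c < ℕ.suc N → ℕ.suc N ≤ c + m → T (P (f c))) → (∀ c → c + m < ℕ.suc N → ¬ T (P (f c))) →
      ℕ.suc (length (filterᵇ P (applyUpTo (f ∘ ℕ.suc) N))) ≡ m
    count-true m m≤ yes-above no-below with m≤n⇒m<n∨m≡n m≤
    ... | inj₁ lt = ⊥-elim (no-below 0 lt (Equivalence.from T-≡ eq))
    ... | inj₂ refl = cong ℕ.suc (count-threshold P (f ∘ ℕ.suc) N N ≤-refl
            (λ c c<N _ → yes-above (ℕ.suc c) (s≤s c<N) (linarith (N ∷ c ∷ []) (λ a b → ⊢ con 1 :+ a :≤ (con 1 :+ b) :+ (con 1 :+ a)))) (λ c lt → ⊥-elim (linarith (c ∷ N ∷ []) (λ a b → a :+ b :< b ⇒ ⊢ absurd) lt)))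
  ... | false with m≤n⇒m<n∨m≡n m≤
  ...   | inj₂ refl = ⊥-elim (subst T eq (yes-above 0 (s≤s z≤n) ≤-refl))
  ...   | inj₁ lt = count-threshold P (f ∘ ℕ.suc) N m (ℕP.≤-pred lt) (λ c c<N le → yes-above (ℕ.suc c) (s≤s c<N) (s≤s le)) (λ c lt′ → no-below (ℕ.suc c) (s≤s lt′))

  threshold : ∀ (P : ℕ → Set) → (∀ c → Dec (P c)) → ∀ N → (∀ {c c′} → c ≤ c′ → c′ < N → P c → P c′) →
    ∃ λ m → m ≤ N × (∀ c → c < N → N ≤ c + m → P c) × (∀ c → c + m < N → ¬ P c)
  threshold P P? zero up-closed = 0 , z≤n , (λ c ()) , (λ c ())
  threshold P P? (suc N) up-closed with P? N
  ... | no np = 0 , z≤n , (λ c lt le → ⊥-elim (linarith (c ∷ N ∷ []) (λ a b → a :< con 1 :+ b ⇒ con 1 :+ b :≤ a :+ con 0 ⇒ ⊢ absurd) lt le)) ,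
          λ c lt pc → np (up-closed (linarith (c ∷ N ∷ []) (λ a b → a :+ con 0 :< con 1 :+ b ⇒ ⊢ a :≤ b) lt) ≤-refl pc)
  ... | yes pN with threshold P P? N (λ le lt → up-closed le (m≤n⇒m≤1+n lt))
  ...   | m , m≤N , above , below = ℕ.suc m , s≤s m≤N , above′ , λ c lt → below c (linarith (c ∷ m ∷ N ∷ []) (λ a b c → a :+ (con 1 :+ b) :< con 1 :+ c ⇒ ⊢ a :+ b :< c) lt)
    where
    above′ : ∀ c → c < ℕ.suc N → ℕ.suc N ≤ c + ℕ.suc m → P c
    above′ c lt le with m≤n⇒m<n∨m≡n lt
    ... | inj₁ lt′ = above c (ℕP.≤-pred lt′) (linarith (N ∷ c ∷ m ∷ []) (λ a b c → con 1 :+ a :≤ b :+ (con 1 :+ c) ⇒ ⊢ a :≤ b :+ c) le)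
    ... | inj₂ refl = pN

  pmap-entry : ℕ → List ℕ → ℕ → ℕ
  pmap-entry k κ r = length (filterᵇ (λ c → hook κ r c ℕ.≤ᵇ k) (upTo (rowLen κ r)))

  module FromHooks (k : ℕ) (κ : List ℕ) (dec : Decreasing κ) (no-hook : ∀ {r c} → c < rowLen κ r → hook κ r c ≢ ℕ.suc k) where
    K : ℕ → ℕ
    K = rowLen κ

    C : ℕ → ℕ
    C = colLen κ

    hook-closed : ∀ r {c c′} → c ≤ c′ → c′ < K r → hook κ r c ≤ k → hook κ r c′ ≤ k
    hook-closed r {c} {c′} c≤ c′< le = linarith (hc ∷ c ∷ r ∷ K r ∷ C c ∷ hc′ ∷ c′ ∷ C c′ ∷ k ∷ []) (λ a b c d e f g h i → a :+ (con 1 :+ (b :+ c)) :≡ d :+ e ⇒ f :+ (con 1 :+ (g :+ c)) :≡ d :+ h ⇒ h :≤ e ⇒ b :≤ g ⇒ a :≤ i ⇒ ⊢ f :≤ i)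
        (hook-value κ dec (≤-<-trans c≤ c′<)) (hook-value κ dec c′<) C≤ c≤ le
      where
      hc = hook κ r c
      hc′ = hook κ r c′
      C≤ : C c′ ≤ C c
      C≤ = ≮⇒≥ (λ lt → <-irrefl refl (colLen⁺ κ dec {c} {C c} (≤-<-trans c≤ (colLen⁻ κ dec lt))))

    -- Let c₁ = K r - p be the first column with hook length at most k. That bound says that column
    -- c₁ does not reach row d. The hook at c₁ - 1 exceeds k and is not k + 1, so it is at least k +
    -- 2, and column c₁ - 1 does reach row d. Hence K d = c₁.
    row : ∀ r → let p = pmap-entry k κ r in p ≤ k × K r ≡ p + K (r + ℕ.suc k ∸ p)
    row r with threshold (λ c → hook κ r c ≤ k) (λ c → hook κ r c ≤? k) (K r) (hook-closed r)
    ... | p , p≤ , above , below = subst (λ v → v ≤ k × K r ≡ v + K (r + ℕ.suc k ∸ v)) (sym entry) (p≤k , K≡)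
      where
      entry : pmap-entry k κ r ≡ p
      entry = count-threshold (λ c → hook κ r c ℕ.≤ᵇ k) id (K r) p p≤ (λ c lt le → ≤⇒≤ᵇ (above c lt le)) (λ c lt t → below c lt (≤ᵇ⇒≤ (hook κ r c) k t))
      c₁ = K r ∸ p
      c₁≡ : c₁ + p ≡ K r
      c₁≡ = ℕP.m∸n+n≡m p≤
      leg : ∀ {c} → c < K r → r < C c
      leg = colLen⁺ κ dec
      p≤k : p ≤ k
      p≤k with p ≟ 0
      ... | yes e = subst (_≤ k) (sym e) z≤n
      ... | no p≢0 = linarith (h₁ ∷ c₁ ∷ r ∷ K r ∷ C c₁ ∷ k ∷ p ∷ []) (λ a b c d e f g → a :+ (con 1 :+ (b :+ c)) :≡ d :+ e ⇒ c :< e ⇒ a :≤ f ⇒ b :+ g :≡ d ⇒ ⊢ g :≤ f) (hook-value κ dec c₁<) (leg c₁<) (above c₁ c₁< (≤-reflexive (sym c₁≡))) c₁≡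
        where
        h₁ = hook κ r c₁
        c₁< : c₁ < K r
        c₁< = linarith (c₁ ∷ p ∷ K r ∷ []) (λ a b c → a :+ b :≡ c ⇒ con 0 :< b ⇒ ⊢ a :< c) c₁≡ (ℕP.n≢0⇒n>0 p≢0)
      d = r + ℕ.suc k ∸ p
      d≡ : d + p ≡ r + ℕ.suc k
      d≡ = ℕP.m∸n+n≡m (linarith (p ∷ k ∷ r ∷ []) (λ a b c → a :≤ b ⇒ ⊢ a :≤ c :+ (con 1 :+ b)) p≤k)
      big-hook : ∀ c → c + p < K r → ℕ.suc k < hook κ r c
      big-hook c lt = ℕP.≤∧≢⇒< (≰⇒> (below c lt)) (no-hook (linarith (c ∷ p ∷ K r ∷ []) (λ a b c → a :+ b :< c ⇒ ⊢ a :< c) lt) ∘ sym)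
      K≡ : K r ≡ p + K d
      K≡ = ≤-antisym lower upper
        where
        upper : p + K d ≤ K r
        upper with p ≟ 0
        ... | yes e = linarith (p ∷ K d ∷ K r ∷ []) (λ a b c → a :≡ con 0 ⇒ b :≤ c ⇒ ⊢ a :+ b :≤ c) e (decreasing-antitone {κ} dec (linarith (d ∷ p ∷ r ∷ k ∷ []) (λ a b c d → a :+ b :≡ c :+ (con 1 :+ d) ⇒ b :≤ d ⇒ ⊢ c :≤ a) d≡ p≤k))
        ... | no p≢0 = linarith (K d ∷ c₁ ∷ p ∷ K r ∷ []) (λ a b c d → a :≤ b ⇒ b :+ c :≡ d ⇒ ⊢ c :+ a :≤ d) (≮⇒≥ (λ lt → linarith (d ∷ C c₁ ∷ h₁ ∷ c₁ ∷ r ∷ K r ∷ k ∷ p ∷ []) (λ a b c d e f g h → a :< b ⇒ c :+ (con 1 :+ (d :+ e)) :≡ f :+ b ⇒ c :≤ g ⇒ d :+ h :≡ f ⇒ a :+ h :≡ e :+ (con 1 :+ g) ⇒ ⊢ absurd)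
                (colLen⁺ κ dec lt) (hook-value κ dec c₁<) (above c₁ c₁< (≤-reflexive (sym c₁≡))) c₁≡ d≡)) c₁≡
          where
          h₁ = hook κ r c₁
          c₁< : c₁ < K r
          c₁< = linarith (c₁ ∷ p ∷ K r ∷ []) (λ a b c → a :+ b :≡ c ⇒ con 0 :< b ⇒ ⊢ a :< c) c₁≡ (ℕP.n≢0⇒n>0 p≢0)
        lower : K r ≤ p + K d
        lower with c₁ ≟ 0
        ... | yes e = linarith (c₁ ∷ p ∷ K r ∷ K d ∷ []) (λ a b c d → a :≡ con 0 ⇒ a :+ b :≡ c ⇒ ⊢ c :≤ b :+ d) e c₁≡
        ... | no c₁≢0 = linarith (c ∷ K d ∷ c₁ ∷ p ∷ K r ∷ []) (λ a b c d e → a :< b ⇒ a :+ con 1 :≡ c ⇒ c :+ d :≡ e ⇒ ⊢ e :≤ d :+ b) (colLen⁻ κ dec d<C) c≡ c₁≡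
          where
          c = c₁ ∸ 1
          hk = hook κ r c
          c≡ : c + 1 ≡ c₁
          c≡ = ℕP.m∸n+n≡m (ℕP.n≢0⇒n>0 c₁≢0)
          d<C : d < C c
          d<C = linarith (k ∷ hk ∷ c ∷ r ∷ K r ∷ C c ∷ c₁ ∷ p ∷ d ∷ []) (λ a b c d e f g h i → con 1 :+ a :< b ⇒ b :+ (con 1 :+ (c :+ d)) :≡ e :+ f ⇒ c :+ con 1 :≡ g ⇒ g :+ h :≡ e ⇒ i :+ h :≡ d :+ (con 1 :+ a) ⇒ ⊢ i :< f)
            (big-hook c (linarith (c ∷ c₁ ∷ p ∷ K r ∷ []) (λ a b c d → a :+ con 1 :≡ b ⇒ b :+ c :≡ d ⇒ ⊢ a :+ c :< d) c≡ c₁≡)) (hook-value κ dec (linarith (c ∷ c₁ ∷ p ∷ K r ∷ []) (λ a b c d → a :+ con 1 :≡ b ⇒ b :+ c :≡ d ⇒ ⊢ a :< d) c≡ c₁≡)) c≡ c₁≡ d≡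

  rowLen-pmap : ∀ k κ r → r < length κ → rowLen (pmap k κ) r ≡ pmap-entry k κ r
  rowLen-pmap k κ r lt = trans (cong (λ xs → rowLen xs r) (map-upTo (pmap-entry k κ) (length κ))) (rowLen-applyUpTo (pmap-entry k κ) (length κ) r lt)

  length-pmap : ∀ k κ → length (pmap k κ) ≡ length κ
  length-pmap k κ = trans (cong length (map-upTo (pmap-entry k κ) (length κ))) (length-applyUpTo (pmap-entry k κ) (length κ))

  pmap-isCore : ∀ k κ → Decreasing κ → T (coreᵇ k κ) → IsCore k (length κ) (rowLen (pmap k κ)) (rowLen κ)
  pmap-isCore k κ dec t = record { la≤k = λ r → proj₁ (each r) ; la-zero = zero-beyond ; K-zero = rowLen-[] κ ; rec = λ r → proj₂ (each r) }
    where
    zero-beyond : ∀ r → length κ ≤ r → rowLen (pmap k κ) r ≡ 0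
    zero-beyond r le = rowLen-[] (pmap k κ) r (subst (_≤ r) (sym (length-pmap k κ)) le)
    each : ∀ r → rowLen (pmap k κ) r ≤ k × rowLen κ r ≡ rowLen (pmap k κ) r + rowLen κ (bounce k (rowLen (pmap k κ)) r)
    each r with r <? length κ
    ... | yes lt rewrite rowLen-pmap k κ r lt = FromHooks.row k κ dec (coreᵇ⁻ k κ t) r
    ... | no ≮ rewrite zero-beyond r (≮⇒≥ ≮) = z≤n , trans (rowLen-[] κ r (≮⇒≥ ≮)) (sym (rowLen-[] κ (r + ℕ.suc k) (≤-trans (≮⇒≥ ≮) (m≤m+n r (ℕ.suc k)))))

  module ToHooks (k : ℕ) (κ : List ℕ) (dec : Decreasing κ) {R : ℕ} {la : ℕ → ℕ} (core : IsCore k R la (rowLen κ)) where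
    open IsCore core
    private
      K = rowLen κ
      C = colLen κ
      d : ℕ → ℕ
      d = bounce k la
      d≡ : ∀ r → d r + la r ≡ r + ℕ.suc k
      d≡ r = ℕP.m∸n+n≡m (linarith (la r ∷ k ∷ r ∷ []) (λ a b c → a :≤ b ⇒ ⊢ a :≤ c :+ (con 1 :+ b)) (la≤k r))

    -- The converse of `FromHooks.row`: whether column c reaches row D r depends on c < K (D r), and
    -- this puts the hook below or above k + 1, never at it.
    small : ∀ r c → c < K r → K r ≤ c + la r → hook κ r c ≤ k
    small r c lt le = linarith (hk ∷ c ∷ r ∷ K r ∷ C c ∷ d r ∷ la r ∷ k ∷ []) (λ a b c d e f g h → a :+ (con 1 :+ (b :+ c)) :≡ d :+ e ⇒ e :≤ f ⇒ d :≤ b :+ g ⇒ f :+ g :≡ c :+ (con 1 :+ h) ⇒ ⊢ a :≤ h)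
      (hook-value κ dec lt) (≮⇒≥ (λ d<C → linarith (c ∷ K (d r) ∷ K r ∷ la r ∷ []) (λ a b c d → a :< b ⇒ c :≡ d :+ b ⇒ c :≤ a :+ d ⇒ ⊢ absurd) (colLen⁻ κ dec d<C) (rec r) le)) le (d≡ r)
      where hk = hook κ r c

    large : ∀ r c → c + la r < K r → ℕ.suc k < hook κ r c
    large r c lt = linarith (hk ∷ c ∷ r ∷ K r ∷ C c ∷ d r ∷ la r ∷ k ∷ []) (λ a b c d e f g h → a :+ (con 1 :+ (b :+ c)) :≡ d :+ e ⇒ f :< e ⇒ b :+ g :< d ⇒ f :+ g :≡ c :+ (con 1 :+ h) ⇒ ⊢ con 1 :+ h :< a)
      (hook-value κ dec (linarith (c ∷ la r ∷ K r ∷ []) (λ a b c → a :+ b :< c ⇒ ⊢ a :< c) lt)) (colLen⁺ κ dec (linarith (K r ∷ la r ∷ K (d r) ∷ c ∷ []) (λ a b c d → a :≡ b :+ c ⇒ d :+ b :< a ⇒ ⊢ d :< c) (rec r) lt)) lt (d≡ r)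
      where hk = hook κ r c

    isCoreᵇ : T (coreᵇ k κ)
    isCoreᵇ = coreᵇ⁺ k κ λ {r} {c} lt e → no-hook r c lt e
      where
      no-hook : ∀ r c → c < K r → hook κ r c ≢ ℕ.suc k
      no-hook r c lt e with K r ≤? c + la r
      ... | yes le = <-irrefl refl (<-≤-trans (subst (k <_) (sym e) (n<1+n k)) (small r c lt le))
      ... | no ≰ = <-irrefl (sym e) (large r c (≰⇒> ≰))

    entry : ∀ r → pmap-entry k κ r ≡ la r
    entry r = count-threshold (λ c → hook κ r c ℕ.≤ᵇ k) id (K r) (la r) (linarith (K r ∷ la r ∷ K (d r) ∷ []) (λ a b c → a :≡ b :+ c ⇒ ⊢ b :≤ a) (rec r))
      (λ c lt le → ≤⇒≤ᵇ (small r c lt le)) (λ c lt t → <-irrefl refl (<-≤-trans (<-trans (n<1+n k) (large r c lt)) (≤ᵇ⇒≤ (hook κ r c) k t)))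

  ∈-gen⁺ : ∀ κ u xs → length xs ≡ length κ → rowLen xs 0 ≤ u → Decreasing xs → (∀ r → rowLen xs r ≤ rowLen κ r) → xs ∈ gen κ u
  ∈-gen⁺ [] u [] _ _ _ _ = here refl
  ∈-gen⁺ (a ∷ κ) u (x ∷ xs) e x≤u dec sub = ∈-concat⁺′ (∈-map⁺ (x ∷_) (∈-gen⁺ κ x xs (ℕP.suc-injective e) (dec 0) (λ r → dec (ℕ.suc r)) (λ r → sub (ℕ.suc r))))
    (∈-map⁺ (λ b → map (b ∷_) (gen κ b)) (∈-applyUpTo⁺ id (s≤s (ℕP.⊓-glb (sub 0) x≤u))))

  ∈-gen⁻ : ∀ κ u {xs} → xs ∈ gen κ u → length xs ≡ length κ × rowLen xs 0 ≤ u × Decreasing xs × (∀ r → rowLen xs r ≤ rowLen κ r)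
  ∈-gen⁻ [] u (here refl) = refl , z≤n , (λ r → z≤n) , (λ r → z≤n)
  ∈-gen⁻ (a ∷ κ) u m with ∈-concat⁻′ (map (λ b → map (b ∷_) (gen κ b)) (upTo (ℕ.suc (a ⊓ u)))) m
  ... | _ , m₁ , m₂ with ∈-map⁻ (λ b → map (b ∷_) (gen κ b)) m₂
  ...   | b , m₃ , refl with ∈-map⁻ (b ∷_) m₁ | ∈-applyUpTo⁻ id m₃
  ...     | xs , m₄ , refl | _ , b<n , refl with ∈-gen⁻ κ b m₄
  ...       | len , x≤b , dec , sub = cong ℕ.suc len , ≤-trans (ℕP.≤-pred b<n) (ℕP.m⊓n≤n a u) , dec′ , sub′
    where
    dec′ : Decreasing (b ∷ xs)
    dec′ zero = x≤b
    dec′ (suc r) = dec r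
    sub′ : ∀ r → rowLen (b ∷ xs) r ≤ rowLen (a ∷ κ) r
    sub′ zero = ≤-trans (ℕP.≤-pred b<n) (ℕP.m⊓n≤m a u)
    sub′ (suc r) = sub r

  gen-unique : ∀ κ u → Unique (gen κ u)
  gen-unique [] u = [] ∷ []
  gen-unique (a ∷ κ) u = UniqueP.concat⁺ {xss = map cons (upTo (ℕ.suc (a ⊓ u)))}
    (AllP.map⁺ {f = cons} (All.tabulate λ {b} _ → UniqueP.map⁺ {f = b ∷_} (λ { refl → refl }) (gen-unique κ b)))
    (AllPairsP.map⁺ {f = cons} (AllPairsP.applyUpTo⁺₁ id (ℕ.suc (a ⊓ u)) λ {i} {j} i<j _ (m , m′) → disjoint i j i<j m m′))
    where
    cons : ℕ → List (List ℕ)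
    cons b = map (b ∷_) (gen κ b)
    disjoint : ∀ i j → i < j → ∀ {xs} → xs ∈ map (i ∷_) (gen κ i) → xs ∈ map (j ∷_) (gen κ j) → ⊥
    disjoint i j i<j m m′ with ∈-map⁻ (i ∷_) m | ∈-map⁻ (j ∷_) m′
    ... | _ , _ , refl | _ , _ , refl = <-irrefl refl i<j

-- Sizes of cores, uniqueness and classification of covers.

module CoreCovers where
  open import Data.Nat as ℕ using (ℕ; zero; suc; _≤_; _<_; _+_; _∸_; s≤s; z≤n)
  open import Data.Nat.Properties using (≤-refl; ≤-trans; <-irrefl; <⇒≤; ≤-antisym; ≤-reflexive; m≤m+n; +-suc; +-comm; +-identityʳ; <ᵇ⇒<; <⇒<ᵇ; _≟_; _<?_; ≮⇒≥; <⇒≢; <-≤-trans; <-cmp; allUpTo?)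
  open import Data.Integer using (+_)
  import Data.Nat.Properties as ℕP
  open import Data.Fin using (zero; suc)
  open import Data.List using (List; []; _∷_; filterᵇ; length; applyUpTo)
  open import Data.List.Membership.Propositional using (_∈_)
  open import Data.List.Relation.Unary.Any using (here; there)
  open import Data.List.Relation.Unary.All as All using (All; []; _∷_)
  open import Data.List.Relation.Unary.AllPairs using ([]; _∷_)
  open import Data.List.Relation.Unary.Unique.Propositional using (Unique)
  open import Data.Bool using (true; false; if_then_else_; T)
  open import Data.Product using (_×_; _,_; proj₁; proj₂; ∃)
  open import Data.Empty using (⊥-elim)
  open import Data.Vec using ([]; _∷_)
  open import Function using (_∘_)
  open import Relation.Nullary using (Dec; yes; no; does; ¬_)
  open import Relation.Binary.Definitions using (tri<; tri≈; tri>)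
  open import Relation.Binary.PropositionalEquality
  open import Data.Nat.ListAction using (sum)
  open import Relation.Nullary.Decidable using (decidable-stable)
  open LinearArithmetic
  open BounceGraph
  open CoreRibbons
  open CoverExchange

  total : (ℕ → ℕ) → ℕ → ℕ
  total f n = sum (applyUpTo f n)

  total-cong : ∀ {f g} n → (∀ r → r < n → f r ≡ g r) → total f n ≡ total g n
  total-cong zero e = refl
  total-cong (suc n) e = cong₂ _+_ (e 0 (s≤s z≤n)) (total-cong n (λ r r<n → e (ℕ.suc r) (s≤s r<n)))

  total-+ : ∀ f g n → total (λ r → f r + g r) n ≡ total f n + total g n
  total-+ f g zero = refl
  total-+ f g (suc n) = linarith (tf+g ∷ tf ∷ tg ∷ f 0 ∷ g 0 ∷ []) (λ a b c d e → a :≡ b :+ c ⇒ ⊢ d :+ e :+ a :≡ d :+ b :+ (e :+ c)) (total-+ (f ∘ ℕ.suc) (g ∘ ℕ.suc) n)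
    where
    tf+g = total (λ r → f (ℕ.suc r) + g (ℕ.suc r)) n
    tf = total (f ∘ ℕ.suc) n
    tg = total (g ∘ ℕ.suc) n

  total-zero : ∀ n → total (λ _ → 0) n ≡ 0
  total-zero zero = refl
  total-zero (suc n) = total-zero n

  total-single : ∀ c n → c < n → total (λ r → if does (r ≟ c) then 1 else 0) n ≡ 1
  total-single zero (suc n) _ = cong ℕ.suc (total-zero n)
  total-single (suc c) (suc n) (s≤s c<n) = total-single c n c<n

  total-indicator : ∀ a len n → a + len ≤ n → total (indicator a len) n ≡ len
  total-indicator a zero n _ = total-zero n
  total-indicator a (suc len) n le = trans (total-+ (indicator a len) (λ r → if does (r ≟ a + len) then 1 else 0) n)
    (trans (cong₂ _+_ (total-indicator a len n (linarith (a ∷ len ∷ n ∷ []) (λ a b c → a :+ (con 1 :+ b) :≤ c ⇒ ⊢ a :+ b :≤ c) le)) (total-single (a + len) n (linarith (a ∷ len ∷ n ∷ []) (λ a b c → a :+ (con 1 :+ b) :≤ c ⇒ ⊢ a :+ b :< c) le))) (+-comm len 1))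

  coreRows-cong : ∀ k {la μ} → (∀ r → la r ≡ μ r) → ∀ f r → coreRows k la f r ≡ coreRows k μ f r
  coreRows-cong k e zero r = refl
  coreRows-cong k {la} {μ} e (suc f) r = cong₂ _+_ (e r) (trans (coreRows-cong k e f (bounce k la r)) (cong (λ v → coreRows k μ f (r + ℕ.suc k ∸ v)) (e r)))

  module _ {k R : ℕ} {la K : ℕ → ℕ} (core : IsCore k R la K) (antitone : ∀ {r s} → r ≤ s → la s ≤ la r) where
    open Beads core antitone

    record Cover : Set where
      constructor cover
      field
        {bottom width height topRow lengthened} : ℕ
        good : Good bottom width height topRow lengthened
      module Rib = Ribbons core antitone good
      rows : ℕ → ℕ
      rows = Rib.μ
      shape : ℕ → ℕ
      shape = Rib.K′
    open Cover

    -- The block loses w + 1 boxes and the lengthened rows gain w.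
    cover-total : (g : Cover) → ℕ.suc (total (rows g) R) ≡ total la R
    cover-total g = linarith (lw ∷ tla ∷ width g ∷ tμ ∷ []) (λ a b c d → a :≡ b :+ c ⇒ a :≡ d :+ (con 1 :+ c) ⇒ ⊢ con 1 :+ d :≡ b)
      (trans (total-+ la (indicator (lengthened g) (width g)) R) (cong (_+_ tla) (total-indicator (lengthened g) (width g) R
        (linarith (a ∷ w ∷ x ∷ z ∷ R ∷ []) (λ a b c d e → a :+ b :≤ c ⇒ c :≤ d ⇒ d :+ b :< e ⇒ ⊢ a :+ b :≤ e) (Rib.a+w≤x g) (Rib.x≤z g) (Rib.z+w<R g)))))
      (trans (total-cong R (λ r _ → pointwise r)) (trans (total-+ (rows g) (indicator z (ℕ.suc w)) R) (cong (_+_ tμ) (total-indicator z (ℕ.suc w) R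
        (linarith (z ∷ w ∷ R ∷ []) (λ a b c → a :+ b :< c ⇒ ⊢ a :+ (con 1 :+ b) :≤ c) (Rib.z+w<R g))))))
      where
      a = lengthened g
      w = width g
      x = topRow g
      z = bottom g
      tla = total la R
      tμ = total (rows g) R
      lw = total (λ r → la r + indicator (lengthened g) (width g) r) R
      pointwise : ∀ r → la r + indicator a w r ≡ rows g r + indicator z (ℕ.suc w) r
      pointwise r with inInterval z (ℕ.suc w) r
      ... | outside e _ = sym (trans (cong₂ _+_ (cong (la r + indicator a w r ∸_) e) e) (+-identityʳ _))
      ... | inside t t≤w refl e = sym (trans (cong₂ _+_ (cong (la (z + t) + indicator a w (z + t) ∸_) e) e)
              (ℕP.m∸n+n≡m (≤-trans (subst (1 ≤_) (sym (Good.block (good g) t (ℕP.≤-pred t≤w))) (Good.positive (good g))) (m≤m+n (la (z + t)) _))))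

    -- By the recursion the bead of the bounce target of r lies k + 1 below that of r, and distinct
    -- rows have distinct beads; so K determines the target and with it the part.
    bounce-determined : ∀ {μ T} → IsCore k R μ T → (∀ r → T r ≡ K r) → ∀ r → μ r ≡ la r
    bounce-determined {μ} {T} coreT e r = same (<-cmp d (D r))
      where
      d = bounce k μ r
      d+μ : d + μ r ≡ r + ℕ.suc k
      d+μ = ℕP.m∸n+n≡m (linarith (μ r ∷ k ∷ r ∷ []) (λ a b c → a :≤ b ⇒ ⊢ a :≤ c :+ (con 1 :+ b)) (IsCore.la≤k coreT r))
      T-rec : K r ≡ μ r + K d
      T-rec = trans (sym (e r)) (trans (IsCore.rec coreT r) (cong (_+_ (μ r)) (e d)))
      same : _ → μ r ≡ la r
      same (tri≈ _ d≡D _) = linarith (d ∷ μ r ∷ r ∷ k ∷ D r ∷ la r ∷ []) (λ a b c d e f → a :+ b :≡ c :+ (con 1 :+ d) ⇒ e :+ f :≡ c :+ (con 1 :+ d) ⇒ a :≡ e ⇒ ⊢ b :≡ f) d+μ (D+la r) d≡D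
      same (tri< lt _ _) = ⊥-elim (linarith (d ∷ μ r ∷ r ∷ k ∷ D r ∷ la r ∷ K r ∷ K d ∷ K (D r) ∷ []) (λ a b c d e f g h i → a :+ b :≡ c :+ (con 1 :+ d) ⇒ e :+ f :≡ c :+ (con 1 :+ d) ⇒ g :≡ b :+ h ⇒ g :≡ f :+ i ⇒ i :+ a :< h :+ e ⇒ ⊢ absurd) d+μ (D+la r) T-rec (rec r) (beads-decrease lt))
      same (tri> _ _ lt) = ⊥-elim (linarith (d ∷ μ r ∷ r ∷ k ∷ D r ∷ la r ∷ K r ∷ K d ∷ K (D r) ∷ []) (λ a b c d e f g h i → a :+ b :≡ c :+ (con 1 :+ d) ⇒ e :+ f :≡ c :+ (con 1 :+ d) ⇒ g :≡ b :+ h ⇒ g :≡ f :+ i ⇒ h :+ e :< i :+ a ⇒ ⊢ absurd) d+μ (D+la r) T-rec (rec r) (beads-decrease lt))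

    chain-unique : ∀ {w z p x a p′ x′ a′} → Chain w z p x a → Chain w z p′ x′ a′ → x ≡ x′ × (0 < w → a ≡ a′)
    chain-unique {z = z} {a = a} {a′ = a′} (top _ e _) (top _ e′ _) = refl , λ 0<w → D-injective
      (trans (trans (cong D (sym (+-identityʳ a))) (e 0 0<w)) (sym (trans (cong D (sym (+-identityʳ a′))) (e′ 0 0<w))))
    chain-unique {z = z} (top none _ _) (step y e _ _) = ⊥-elim (none y (trans (cong D (sym (+-identityʳ y))) (trans (e 0 z≤n) (+-identityʳ z))))
    chain-unique {z = z} (step y e _ _) (top none _ _) = ⊥-elim (none y (trans (cong D (sym (+-identityʳ y))) (trans (e 0 z≤n) (+-identityʳ z))))
    chain-unique {z = z} (step y e _ c) (step y′ e′ _ c′)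
      with D-injective {y} {y′} (trans (trans (cong D (sym (+-identityʳ y))) (e 0 z≤n)) (sym (trans (cong D (sym (+-identityʳ y′))) (e′ 0 z≤n))))
    ... | refl = chain-unique c c′

    width≤ : ∀ {z w p x a w′ p′ x′ a′} → Good z w p x a → Good z w′ p′ x′ a′ → w ≤ w′
    width≤ {z} {w} {w′ = w′} g g′ = ≮⇒≥ (λ w′<w → <-irrefl (Good.block g (ℕ.suc w′) w′<w) (subst (λ r → la r < la z) (sym (+-suc z w′)) (Good.drop g′)))

    rows-unique : ∀ {z w p x a w′ p′ x′ a′} (g : Good z w p x a) (g′ : Good z w′ p′ x′ a′) → ∀ r → rows (cover g) r ≡ rows (cover g′) r
    rows-unique {z} {w} {a = a} {a′ = a′} g g′ r with ≤-antisym (width≤ g g′) (width≤ g′ g)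
    ... | refl = cong (λ v → la r + v ∸ indicator z (ℕ.suc w) r) (same w refl)
      where
      same : ∀ v → v ≡ w → indicator a w r ≡ indicator a′ w r
      same zero refl = refl
      same (suc v) v≡ = cong (λ b → indicator b w r) (proj₂ (chain-unique (Good.chain g) (Good.chain g′)) (subst (0 <_) v≡ (s≤s z≤n)))

    shape-unique : ∀ {z w p x a w′ p′ x′ a′} (g : Good z w p x a) (g′ : Good z w′ p′ x′ a′) → ∀ r → shape (cover g) r ≡ shape (cover g′) r
    shape-unique g g′ r = coreRows-cong k (rows-unique g g′) R r

    down^ : ℕ → ℕ → ℕ
    down^ zero m = m
    down^ (suc j) m = D (down^ j m)

    -- As `levels` begins with the bottom row, this is the number of levels below y: the number N in
    -- the spin, and the number of bounces from y down to z.
    depth : ∀ {y} {ys : List ℕ} → y ∈ ys → ℕ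
    depth (here _) = 0
    depth (there m) = ℕ.suc (depth m)

    level-down : ∀ {w z p x a} (c : Chain w z p x a) {y} (m : y ∈ levels c) → down^ (depth m) y ≡ z
    level-down (top _ _ _) (here refl) = refl
    level-down (step _ _ _ _) (here refl) = refl
    level-down {z = z} (step y e _ c) (there m) = trans (cong D (level-down c m)) (trans (cong D (sym (+-identityʳ y))) (trans (e 0 z≤n) (+-identityʳ z)))

    down-level : ∀ {w z p x a} (c : Chain w z p x a) j m → down^ j m ≡ z → ∃ λ (i : m ∈ levels c) → depth i ≡ j
    down-level (top _ _ _) zero m refl = here refl , refl
    down-level (top none _ _) (suc j) m e = ⊥-elim (none (down^ j m) e)
    down-level (step _ _ _ _) zero m refl = here refl , refl
    down-level {z = z} (step y e _ c) (suc j) m e′ with down-level c j m (D-injective (trans e′ (sym (trans (cong D (sym (+-identityʳ y))) (trans (e 0 z≤n) (+-identityʳ z))))))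
    ... | i , d = there i , cong ℕ.suc d

    length-levels : ∀ {w z p x a} (c : Chain w z p x a) → length (levels c) ≡ p
    length-levels (top _ _ _) = refl
    length-levels (step _ _ _ c) = cong ℕ.suc (length-levels c)

    levels-unique : ∀ {w z p x a} (c : Chain w z p x a) → Unique (levels c)
    levels-unique (top _ _ _) = [] ∷ []
    levels-unique {w} {z} (step y e y<z c) = All.tabulate (λ {v} m z≡v → linarith (v ∷ y ∷ w ∷ z ∷ []) (λ a b c d → a :≤ b ⇒ b :+ c :< d ⇒ d :≡ a ⇒ ⊢ absurd) (levels≤ c m) y<z z≡v) ∷ levels-unique c

    none-greater : ∀ y ys → (∀ {v} → v ∈ ys → v ≤ y) → filterᵇ (y ℕ.<ᵇ_) ys ≡ []
    none-greater y [] _ = refl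
    none-greater y (v ∷ ys) le with y ℕ.<ᵇ v in eq
    ... | true = ⊥-elim (<-irrefl refl (<-≤-trans (<ᵇ⇒< y v (subst T (sym eq) _)) (le (here refl))))
    ... | false = none-greater y ys (λ m → le (there m))

    levels-greater : ∀ {w z p x a} (c : Chain w z p x a) {y} (m : y ∈ levels c) → length (filterᵇ (y ℕ.<ᵇ_) (levels c)) ≡ depth m
    levels-greater c@(top {z} _ _ _) (here refl) = cong length (none-greater z (levels c) (levels≤ c))
    levels-greater {z = z} c@(step _ _ _ _) (here refl) = cong length (none-greater z (levels c) (levels≤ c))
    levels-greater {w} {z} (step v e v<z c) {y} (there m) with y ℕ.<ᵇ z in eq
    ... | true = cong ℕ.suc (levels-greater c m)
    ... | false = ⊥-elim (subst T eq (<⇒<ᵇ (linarith (y ∷ v ∷ w ∷ z ∷ []) (λ a b c d → a :≤ b ⇒ b :+ c :< d ⇒ ⊢ a :< d) (levels≤ c m) v<z)))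

  -- Induction on the size of the larger core. If the cores differ, the exchange argument puts a
  -- cover of the larger one above the smaller one, and its size is less by one. Comparing sizes is
  -- decidable, so the argument may proceed by contradiction.
  total-monotone : ∀ f {k R la K} (core : IsCore k R la K) (antitone : ∀ {r s} → r ≤ s → la s ≤ la r) {μ T} (coreT : IsCore k R μ T) →
    (∀ {r s} → r ≤ s → T s ≤ T r) → (∀ r → T r ≤ K r) → total la R < f →
    total μ R ≤ total la R × (total μ R ≡ total la R → ∀ r → T r ≡ K r)
  total-monotone (suc f) {k} {R} {la} {K} core antitone {μ} {T} coreT T-anti T≤K la<f = decide (allUpTo? (λ r → T r ≟ K r) R)
    where
    extend : (∀ {r} → r < R → T r ≡ K r) → ∀ r → T r ≡ K r
    extend eq r with r <? R
    ... | yes r<R = eq r<R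
    ... | no ≮ = trans (IsCore.K-zero coreT r (≮⇒≥ ≮)) (sym (IsCore.K-zero core r (≮⇒≥ ≮)))
    decide : Dec (∀ {r} → r < R → T r ≡ K r) → total μ R ≤ total la R × (total μ R ≡ total la R → ∀ r → T r ≡ K r)
    decide (yes eq) = ≤-reflexive (total-cong R (λ r _ → bounce-determined core antitone coreT (extend eq) r)) , λ _ → extend eq
    decide (no differ) = <⇒≤ strict , λ e → ⊥-elim (<⇒≢ strict e)
      where
      strict : total μ R < total la R
      strict = decidable-stable (total μ R <? total la R) λ not-less →
        differ (λ {r} _ → ≤-antisym (T≤K r) (≮⇒≥ (Exchange.exchange core antitone coreT T-anti T≤K (λ g T≤K′ → not-less (less g T≤K′)) r)))
        where
        less : ∀ {z w p x a} (g : Beads.Good core antitone z w p x a) → (∀ r → T r ≤ Ribbons.K′ core antitone g r) → total μ R < total la R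
        less g T≤K′ = linarith (tμ ∷ tg ∷ tla ∷ []) (λ a b c → a :≤ b ⇒ con 1 :+ b :≡ c ⇒ ⊢ a :< c) (proj₁ (total-monotone f (Ribbons.core′ core antitone g) (Ribbons.μ-antitone core antitone g) coreT T-anti T≤K′
            (linarith (tg ∷ tla ∷ f ∷ []) (λ a b c → con 1 :+ a :≡ b ⇒ b :< con 1 :+ c ⇒ ⊢ a :< c) (cover-total core antitone (cover g)) la<f))) (cover-total core antitone (cover g))
          where
          tμ = total μ R
          tla = total la R
          tg = total (Ribbons.μ core antitone g) R

  -- Some cover lies weakly above T by the exchange argument; it has the same size as T, and
  -- `total-monotone` makes them equal.
  covers-classified : ∀ {k R la K} (core : IsCore k R la K) (antitone : ∀ {r s} → r ≤ s → la s ≤ la r) {μ T} (coreT : IsCore k R μ T) →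
    (∀ {r s} → r ≤ s → T s ≤ T r) → (∀ r → T r ≤ K r) → ℕ.suc (total μ R) ≡ total la R →
    ¬ ¬ (∃ λ (g : Cover core antitone) → ∀ r → T r ≡ Cover.shape g r)
  covers-classified {k} {R} {la} {K} core antitone {μ} {T} coreT T-anti T≤K e none =
    <-irrefl (total-cong R (λ r _ → bounce-determined core antitone coreT same r)) (≤-reflexive e)
    where
    same : ∀ r → T r ≡ K r
    same r = ≤-antisym (T≤K r) (≮⇒≥ (Exchange.exchange core antitone coreT T-anti T≤K (λ g T≤K′ → none (cover g , proj₂ (total-monotone _
      (Ribbons.core′ core antitone g) (Ribbons.μ-antitone core antitone g) coreT T-anti T≤K′ ≤-refl) (ℕP.suc-injective (trans e (sym (cover-total core antitone (cover g))))))) r))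

-- Components, heights and spin of the covers.

module CoverShapes where
  open import Data.Nat as ℕ using (ℕ; zero; suc; _≤_; _<_; _+_; _*_; _∸_; s≤s; z≤n)
  open import Data.Nat.Properties using (≤-trans; <-irrefl; <⇒≤; ≤-reflexive; m≤m+n; m≤n+m; +-suc; +-identityʳ; <ᵇ⇒<; <⇒<ᵇ; _<?_; ≮⇒≥; <⇒≢; <-≤-trans; ≤-<-trans; m≤n⇒m<n∨m≡n)
  open import Data.Integer using (+_)
  import Data.Nat.Properties as ℕP
  open import Data.Fin using (zero; suc)
  open import Data.List using (List; []; _∷_; map; filterᵇ; length; upTo; applyUpTo)
  open import Data.List.Membership.Propositional using (_∈_)
  open import Data.List.Relation.Unary.Any using (here; there)
  import Data.List.Relation.Unary.Unique.Propositional.Properties as UniqueP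
  open import Data.Bool using (Bool; true; false; _∧_; T; T?; not)
  open import Data.Bool.Properties using (T-∧)
  open import Data.Product using (_×_; _,_; proj₁; proj₂)
  open import Data.Sum using (inj₁; inj₂)
  open import Data.Empty using (⊥; ⊥-elim)
  open import Data.Vec using ([]; _∷_)
  open import Function using (_∘_; id)
  open import Function.Bundles using (Equivalence)
  open import Relation.Nullary using (yes; no; ¬_)
  open import Relation.Binary.PropositionalEquality
  open import Data.List.Properties using (length-applyUpTo)
  open import Data.List.Relation.Binary.Permutation.Propositional.Properties using (↭-length)
  open import Data.List.Membership.Propositional.Properties using (∈-applyUpTo⁺)
  open LinearArithmetic
  open RaisingSeries
  open BounceGraph
  open CoreRibbons
  open PartitionLists
  open CoreCovers

  countᵇ-map : ∀ (P : ℕ → Bool) xs → countᵇ (map P xs) ≡ length (filterᵇ P xs)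
  countᵇ-map P [] = refl
  countᵇ-map P (x ∷ xs) with P x
  ... | true = cong ℕ.suc (countᵇ-map P xs)
  ... | false = countᵇ-map P xs

  module _ (τ κ : List ℕ) (dτ : Decreasing τ) (dκ : Decreasing κ) where
    -- Rows decrease in length, so the maximum in `linked` is attained by τ in row r and the minimum
    -- by κ in row r + 1.
    linked⁺ : ∀ r → rowLen τ r < rowLen κ (ℕ.suc r) → T (linked τ κ r)
    linked⁺ r lt = <⇒<ᵇ (subst₂ _<_ (sym (ℕP.m≥n⇒m⊔n≡m (dτ r))) (sym (ℕP.m≥n⇒m⊓n≡n (dκ r))) lt)

    linked⁻ : ∀ r → T (linked τ κ r) → rowLen τ r < rowLen κ (ℕ.suc r)
    linked⁻ r t = subst₂ _<_ (ℕP.m≥n⇒m⊔n≡m (dτ r)) (ℕP.m≥n⇒m⊓n≡n (dκ r)) (<ᵇ⇒< _ _ t)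

    T-not : ∀ {b} → ¬ T b → T (not b)
    T-not {true} f = f _
    T-not {false} f = _

    not-T : ∀ {b} → T (not b) → ¬ T b
    not-T {false} _ ()

    starts⁺ : ∀ s → rowLen τ s < rowLen κ s → (∀ r → ℕ.suc r ≡ s → rowLen κ s ≤ rowLen τ r) → T (starts τ κ s)
    starts⁺ zero lt _ = <⇒<ᵇ lt
    starts⁺ (suc r) lt above = Equivalence.from T-∧ (<⇒<ᵇ lt , T-not (λ l → <-irrefl refl (<-≤-trans (linked⁻ r l) (above r refl))))

    starts⁻ : ∀ s → T (starts τ κ s) → rowLen τ s < rowLen κ s × (∀ r → ℕ.suc r ≡ s → rowLen κ s ≤ rowLen τ r)
    starts⁻ zero t = <ᵇ⇒< _ _ t , λ r ()
    starts⁻ (suc r) t with Equivalence.to T-∧ t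
    ... | p , q = <ᵇ⇒< _ _ p , λ { .r refl → ≮⇒≥ (λ lt → not-T q (linked⁺ r lt)) }

    heightFrom-value : ∀ w f r → w ≤ f → (∀ i → i < w → rowLen τ (r + i) < rowLen κ (ℕ.suc (r + i))) →
      rowLen κ (ℕ.suc (r + w)) ≤ rowLen τ (r + w) → heightFrom τ κ f r ≡ ℕ.suc w
    heightFrom-value zero zero r _ _ _ = refl
    heightFrom-value w (suc f) r w≤f joined end with linked τ κ r in eq
    heightFrom-value zero (suc f) r w≤f joined end | false = refl
    heightFrom-value zero (suc f) r w≤f joined end | true = ⊥-elim (<-irrefl refl (<-≤-trans (linked⁻ r (subst T (sym eq) _))
      (subst (λ s → rowLen κ (ℕ.suc s) ≤ rowLen τ s) (+-identityʳ r) end)))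
    heightFrom-value (suc w) (suc f) r w≤f joined end | false = ⊥-elim (subst T eq (linked⁺ r (subst (λ s → rowLen τ s < rowLen κ (ℕ.suc s)) (+-identityʳ r) (joined 0 (s≤s z≤n)))))
    heightFrom-value (suc w) (suc f) r (s≤s w≤f) joined end | true = cong ℕ.suc (heightFrom-value w f (ℕ.suc r) w≤f
      (λ i i<w → subst (λ s → rowLen τ s < rowLen κ (ℕ.suc s)) (+-suc r i) (joined (ℕ.suc i) (s≤s i<w)))
      (subst (λ s → rowLen κ (ℕ.suc s) ≤ rowLen τ s) (+-suc r w) end))

  isCore-cong : ∀ {k R la la′ K K′} → (∀ r → la r ≡ la′ r) → (∀ r → K r ≡ K′ r) → IsCore k R la K → IsCore k R la′ K′
  isCore-cong {k} {R} {la} {la′} {K} {K′} e e′ c = record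
    { la≤k = λ r → subst (_≤ k) (e r) (la≤k r)
    ; la-zero = λ r le → trans (sym (e r)) (la-zero r le)
    ; K-zero = λ r le → trans (sym (e′ r)) (K-zero r le)
    ; rec = λ r → trans (sym (e′ r)) (trans (rec r) (cong₂ _+_ (e r) (trans (e′ (bounce k la r)) (cong (λ v → K′ (r + ℕ.suc k ∸ v)) (e r))))) }
    where open IsCore c

  module CoverShape (k : ℕ) (κ : List ℕ) (dκ : Decreasing κ) {la : ℕ → ℕ} (core : IsCore k (length κ) la (rowLen κ))
                    (antitone : ∀ {r s} → r ≤ s → la s ≤ la r) (g : Cover core antitone) where
    open Beads core antitone
    open Cover g
    open Rib using (Removed; removed; agree; inRibbon?)
    open Good good using (chain; short; block; positive)
    private
      n : ℕ
      n = length κ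

    coverList : List ℕ
    coverList = applyUpTo shape n

    rowLen-coverList : ∀ r → rowLen coverList r ≡ shape r
    rowLen-coverList r with r <? n
    ... | yes r<n = rowLen-applyUpTo shape n r r<n
    ... | no ≮ = trans (rowLen-[] coverList r (subst (_≤ r) (sym (length-applyUpTo shape n)) (≮⇒≥ ≮))) (sym (Rib.′.K-zero r (≮⇒≥ ≮)))

    coverList-decreasing : Decreasing coverList
    coverList-decreasing r = subst₂ _≤_ (sym (rowLen-coverList (ℕ.suc r))) (sym (rowLen-coverList r)) (Rib.′.K-suc≤ r)

    coverList⊆ : ∀ r → rowLen coverList r ≤ rowLen κ r
    coverList⊆ r = subst (_≤ rowLen κ r) (sym (rowLen-coverList r)) (Rib.K′≤K r)

    coverList∈ : coverList ∈ subParts κ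
    coverList∈ = ∈-gen⁺ κ (rowLen κ 0) coverList (length-applyUpTo shape n) (coverList⊆ 0) coverList-decreasing coverList⊆

    coverList-core : IsCore k n rows (rowLen coverList)
    coverList-core = isCore-cong (λ _ → refl) (λ r → sym (rowLen-coverList r)) Rib.core′

    module Hooks = ToHooks k coverList coverList-decreasing coverList-core

    pmap-coverList : pmap k coverList ≡ applyUpTo rows n
    pmap-coverList = rowLen-ext _ _ (trans (length-pmap k coverList) (trans (length-applyUpTo shape n) (sym (length-applyUpTo rows n)))) each
      where
      each : ∀ r → rowLen (pmap k coverList) r ≡ rowLen (applyUpTo rows n) r
      each r with r <? n
      ... | yes r<n = trans (rowLen-pmap k coverList r (subst (r <_) (sym (length-applyUpTo shape n)) r<n)) (trans (Hooks.entry r) (sym (rowLen-applyUpTo rows n r r<n)))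
      ... | no ≮ = trans (rowLen-[] (pmap k coverList) r (subst (_≤ r) (sym (trans (length-pmap k coverList) (length-applyUpTo shape n))) (≮⇒≥ ≮)))
                         (sym (rowLen-[] (applyUpTo rows n) r (subst (_≤ r) (sym (length-applyUpTo rows n)) (≮⇒≥ ≮))))

    rowLen-pmap-coverList : ∀ r → rowLen (pmap k coverList) r ≡ rows r
    rowLen-pmap-coverList r rewrite pmap-coverList with r <? n
    ... | yes r<n = rowLen-applyUpTo rows n r r<n
    ... | no ≮ = trans (rowLen-[] (applyUpTo rows n) r (subst (_≤ r) (sym (length-applyUpTo rows n)) (≮⇒≥ ≮))) (sym (Rib.μ-zero r (≮⇒≥ ≮)))

    removed-rows : ∀ {y} → y ∈ levels chain → (∀ i → i < width → rowLen coverList (y + i) < rowLen κ (ℕ.suc (y + i))) × rowLen κ (ℕ.suc (y + width)) ≤ rowLen coverList (y + width)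
    removed-rows {y} m = (λ i i<w → subst (_< rowLen κ (ℕ.suc (y + i))) (sym (rowLen-coverList (y + i))) (≤-reflexive (Removed.shifted (removed m) i i<w))) ,
      subst (rowLen κ (ℕ.suc (y + width)) ≤_) (sym (rowLen-coverList (y + width))) (Removed.last≥ (removed m))

    first-row< : ∀ {y} → y ∈ levels chain → shape y < rowLen κ y
    first-row< {y} m with m≤n⇒m<n∨m≡n (z≤n {width})
    ... | inj₂ e = subst (λ r → shape r < rowLen κ r) (trans (cong (_+_ y) (sym e)) (+-identityʳ y)) (Removed.last< (removed m))
    ... | inj₁ 0<w = ≤-trans (subst (λ r → ℕ.suc (shape r) ≤ rowLen κ (ℕ.suc r)) (+-identityʳ y) (≤-reflexive (Removed.shifted (removed m) 0 0<w))) (dκ y)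

    -- The row above a level is unchanged or the last row of another ribbon, and in either case it
    -- is not linked to the level.
    level-starts : ∀ {y} → y ∈ levels chain → T (starts coverList κ y)
    level-starts {y} m = starts⁺ coverList κ coverList-decreasing dκ y (subst (_< rowLen κ y) (sym (rowLen-coverList y)) (first-row< m)) above
      where
      above : ∀ r → ℕ.suc r ≡ y → rowLen κ y ≤ rowLen coverList r
      above r refl with inRibbon? r
      ... | no free = subst (rowLen κ (ℕ.suc r) ≤_) (sym (trans (rowLen-coverList r) (agree r free))) (dκ r)
      ... | yes (y′ , i , m′ , i≤w , r≡) with m≤n⇒m<n∨m≡n i≤w
      ...   | inj₂ refl = subst (λ s → rowLen κ (ℕ.suc s) ≤ rowLen coverList s) (sym r≡) (proj₂ (removed-rows m′))
      ...   | inj₁ i<w = ⊥-elim (separated chain m m′)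
        where
        -- Otherwise r + 1 would be an inner row of the block at y′, but distinct levels are more
        -- than w rows apart.
        separated : ∀ {z p} (c : Chain width z p topRow lengthened) → ℕ.suc r ∈ levels c → y′ ∈ levels c → ⊥
        separated (top _ _ _) (here e) (here e′) = linarith (r ∷ z ∷ y′ ∷ i ∷ []) (λ a b c d → con 1 :+ a :≡ b ⇒ c :≡ b ⇒ a :≡ c :+ d ⇒ ⊢ absurd) e e′ r≡
          where z = topRow
        separated {z} (step v _ _ _) (here e) (here e′) = linarith (r ∷ z ∷ y′ ∷ i ∷ []) (λ a b c d → con 1 :+ a :≡ b ⇒ c :≡ b ⇒ a :≡ c :+ d ⇒ ⊢ absurd) e e′ r≡
        separated {z} (step v _ v<z c) (here e) (there m₂) = linarith (r ∷ z ∷ y′ ∷ v ∷ width ∷ i ∷ []) (λ a b c d e f → con 1 :+ a :≡ b ⇒ c :≤ d ⇒ d :+ e :< b ⇒ a :≡ c :+ f ⇒ f :< e ⇒ ⊢ absurd) e (levels≤ c m₂) v<z r≡ i<w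
        separated {z} (step v _ v<z c) (there m₁) (here e′) = linarith (r ∷ v ∷ y′ ∷ z ∷ width ∷ i ∷ []) (λ a b c d e f → con 1 :+ a :≤ b ⇒ c :≡ d ⇒ b :+ e :< d ⇒ a :≡ c :+ f ⇒ ⊢ absurd) (levels≤ c m₁) e′ v<z r≡
        separated (step _ _ _ c) (there m₁) (there m₂) = separated c m₁ m₂

    starts-level : ∀ s → T (starts coverList κ s) → s ∈ levels chain
    starts-level s t with starts⁻ coverList κ coverList-decreasing dκ s t
    ... | lt , above with inRibbon? s
    ...   | no free = ⊥-elim (<⇒≢ lt (trans (rowLen-coverList s) (agree s free)))
    ...   | yes (y , zero , m , _ , refl) = subst (_∈ levels chain) (sym (+-identityʳ y)) m
    ...   | yes (y , suc i , m , i<w , refl) = ⊥-elim (<-irrefl refl (<-≤-trans (proj₁ (removed-rows m) i i<w)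
              (subst (λ r → rowLen κ r ≤ rowLen coverList (y + i)) (+-suc y i) (above (y + i) (sym (+-suc y i))))))

    level<n : ∀ {y} → y ∈ levels chain → y < n
    level<n m = ≤-<-trans (levels≤ chain m) (≤-<-trans (m≤m+n bottom width) Rib.z+w<R)

    -- With Q constantly true this counts the components, with Q s meaning y < s those below a mark
    -- at y.
    count-starts : ∀ (Q : ℕ → Bool) → length (filterᵇ (λ s → Q s ∧ starts coverList κ s) (upTo n)) ≡ length (filterᵇ Q (levels chain))
    count-starts Q = ↭-length (unique-↭ (UniqueP.filter⁺ (T? ∘ λ s → Q s ∧ starts coverList κ s) (UniqueP.upTo⁺ n)) (UniqueP.filter⁺ (T? ∘ Q) (levels-unique core antitone chain)) to from)
      where
      to : ∀ {s} → s ∈ filterᵇ (λ s → Q s ∧ starts coverList κ s) (upTo n) → s ∈ filterᵇ Q (levels chain)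
      to {s} m with Equivalence.to T-∧ (proj₂ (∈-filterᵇ⁻ _ (upTo n) m))
      ... | q , t = ∈-filterᵇ⁺ Q (starts-level s t) q
      from : ∀ {s} → s ∈ filterᵇ Q (levels chain) → s ∈ filterᵇ (λ s → Q s ∧ starts coverList κ s) (upTo n)
      from m with ∈-filterᵇ⁻ Q (levels chain) m
      ... | l , q = ∈-filterᵇ⁺ _ (∈-applyUpTo⁺ id (level<n l)) (Equivalence.from T-∧ (q , level-starts l))

    filter-true : ∀ (xs : List ℕ) → filterᵇ (λ _ → true) xs ≡ xs
    filter-true [] = refl
    filter-true (x ∷ xs) = cong (x ∷_) (filter-true xs)

    -- There are p components, each of height w + 1, so c (h - 1) is p w.
    spin-value : ∀ {y} (m : y ∈ levels chain) → spin coverList κ y ≡ height * width + depth core antitone m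
    spin-value {y} m = cong₂ _+_ (cong₂ _*_ components (cong (_∸ 1) heights)) below
      where
      len : length coverList ≡ n
      len = length-applyUpTo shape n
      components : ncomp coverList κ ≡ height
      components = trans (countᵇ-map (starts coverList κ) (upTo n)) (trans (count-starts (λ _ → true))
        (trans (cong length (filter-true (levels chain))) (length-levels core antitone chain)))
      heights : heightFrom coverList κ n y ≡ ℕ.suc width
      heights = heightFrom-value coverList κ coverList-decreasing dκ width n y
        (≤-trans (m≤n+m width bottom) (<⇒≤ Rib.z+w<R)) (proj₁ (removed-rows m)) (proj₂ (removed-rows m))
      below : nBelow coverList κ y ≡ depth core antitone m
      below = trans (countᵇ-map _ (upTo n)) (trans (count-starts (y ℕ.<ᵇ_)) (levels-greater core antitone chain m))

-- Expansion of the left side along the bounce path.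

module SeriesExpansion where
  open import Data.Nat as ℕ using (ℕ; zero; suc; _≤_; _<_; _+_; _*_; _∸_; s≤s; z≤n)
  open import Data.Nat.Properties using (≤-refl; ≤-trans; <-irrefl; <⇒≤; ≤-antisym; ≤-reflexive; m≤m+n; m≤n+m; +-suc; +-comm; +-identityʳ; <ᵇ⇒<; <⇒<ᵇ; _≟_; _<?_; ≰⇒>; ≮⇒≥; ≤-<-trans; m+[n∸m]≡n; m≤n⇒m<n∨m≡n)
  open import Data.Integer as ℤ using (ℤ; +_; 0ℤ; 1ℤ)
  import Data.Integer.Properties as ℤP
  import Data.Nat.Properties as ℕP
  import Data.Integer.Tactic.RingSolver as ℤSolver
  open import Data.Fin as Fin using (Fin; zero; suc; toℕ)
  open import Data.List using (List; []; _∷_; map; length)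
  open import Data.List.Membership.Propositional using (_∈_)
  open import Data.List.Relation.Unary.Any using (here; there)
  open import Data.List.Relation.Unary.All as All using (All; []; _∷_)
  open import Data.List.Relation.Unary.AllPairs using ([]; _∷_; AllPairs)
  import Data.List.Relation.Unary.Unique.Propositional.Properties as UniqueP
  open import Data.List.Relation.Binary.Permutation.Propositional using (_↭_; prep; swap)
  open import Data.Bool using (Bool; true; false; _∧_; T; T?)
  open import Data.Bool.Properties using (T-∧)
  open import Data.Product using (_×_; _,_; proj₁; proj₂; ∃)
  open import Data.Sum using (_⊎_; inj₁; inj₂)
  open import Data.Empty using (⊥-elim)
  open import Data.Vec as Vec using ([]; _∷_; Vec; lookup; toList; fromList)
  open import Function using (_∘_)
  open import Function.Bundles using (Equivalence)
  open import Relation.Nullary using (Dec; yes; no; does)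
  open import Relation.Binary.PropositionalEquality hiding (J)
  open import Data.Nat.ListAction using (sum)
  open import Data.Vec.Properties using (toList∘fromList)
  import Data.List.Relation.Binary.Permutation.Propositional as Perm
  import Algebra.Properties.CommutativeSemigroup as CSG
  open LinearArithmetic
  open SymmetricFunctions
  open RaisingSeries
  open RootColumns
  open BounceGraph
  open Straightening
  open CoreRibbons
  open CoverExchange using (crossing)
  open CoreCovers

  open CSG R.+-commutativeSemigroup using () renaming (x∙yz≈y∙xz to +Λ-leftComm)

  lookup-rowLen : ∀ {n} (v : Vec ℕ n) i → lookup v i ≡ rowLen (toList v) (toℕ i)
  lookup-rowLen (x Vec.∷ v) zero = refl
  lookup-rowLen (x Vec.∷ v) (suc i) = lookup-rowLen v i

  T-does⁻ : ∀ {P : Set} (d : Dec P) → T (does d) → P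
  T-does⁻ (yes p) _ = p

  T-does⁺ : ∀ {P : Set} (d : Dec P) → P → T (does d)
  T-does⁺ (yes _) _ = _
  T-does⁺ (no ¬p) p = ¬p p

  module _ (k : ℕ) {ℓ : ℕ} (v : Vec ℕ ℓ) (v≤k : ∀ i → lookup v i ≤ k) where
    private
      la : ℕ → ℕ
      la = rowLen (toList v)
      side : ∀ i → ℤ
      side i = + k ℤ.- + lookup v i ℤ.+ + ℕ.suc (toℕ i)
      side-value : ∀ i → side i ≡ + (k ∸ lookup v i + ℕ.suc (toℕ i))
      side-value i = cong (ℤ._+ + ℕ.suc (toℕ i)) (trans (ℤP.m-n≡m⊖n k (lookup v i)) (ℤP.⊖-≥ (v≤k i)))
      D+la : ∀ i → bounce k la (toℕ i) + lookup v i ≡ toℕ i + ℕ.suc k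
      D+la i = trans (cong (λ x → bounce k la (toℕ i) + x) (lookup-rowLen v i)) (ℕP.m∸n+n≡m (≤-trans (subst (_≤ k) (lookup-rowLen v i) (v≤k i)) (linarith (k ∷ i′ ∷ []) (λ a b → ⊢ a :≤ b :+ (con 1 :+ a)))))
        where i′ = toℕ i

    -- In 1-based indices k - λ_i + i < j; for 0-based ones this is i + k + 1 - λ_i ≤ j.
    Δk-roots : Δk k v ↭ roots ℓ (bounce k la)
    Δk-roots = unique-↭ (UniqueP.filter⁺ (T? ∘ inΔ) (allPairs-unique ℓ)) (roots-unique ℓ (bounce k la)) to from
      where
      inΔ : Fin ℓ × Fin ℓ → Bool
      inΔ (i , j) = (toℕ i ℕ.<ᵇ toℕ j) ∧ does (side i ℤ.<? + ℕ.suc (toℕ j))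
      to : ∀ {α} → α ∈ Δk k v → α ∈ roots ℓ (bounce k la)
      to {i , j} m with Equivalence.to T-∧ (proj₂ (∈-filterᵇ⁻ inΔ (allPairs ℓ) m))
      ... | p , q = ∈-roots⁺ ℓ (bounce k la) (<ᵇ⇒< (toℕ i) (toℕ j) p)
            (linarith (kl ∷ i′ ∷ j′ ∷ l ∷ k ∷ Di ∷ []) (λ a b c d e f → a :+ (con 1 :+ b) :< con 1 :+ c ⇒ a :+ d :≡ e ⇒ f :+ d :≡ b :+ (con 1 :+ e) ⇒ ⊢ f :≤ c) (ℤP.drop‿+<+ (subst (ℤ._< + ℕ.suc (toℕ j)) (side-value i) (T-does⁻ (side i ℤ.<? _) q))) (ℕP.m∸n+n≡m (v≤k i)) (D+la i))
        where
        i′ = toℕ i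
        j′ = toℕ j
        l = lookup v i
        kl = k ∸ lookup v i
        Di = bounce k la (toℕ i)
      from : ∀ {α} → α ∈ roots ℓ (bounce k la) → α ∈ Δk k v
      from {i , j} m with ∈-roots⁻ ℓ (bounce k la) m
      ... | p , q = ∈-filterᵇ⁺ inΔ (∈-allPairs _) (Equivalence.from T-∧ (<⇒<ᵇ p , T-does⁺ (side i ℤ.<? _)
            (subst (ℤ._< + ℕ.suc (toℕ j)) (sym (side-value i)) (ℤ.+<+ (linarith (Di ∷ j′ ∷ kl ∷ l ∷ k ∷ i′ ∷ []) (λ a b c d e f → a :≤ b ⇒ c :+ d :≡ e ⇒ a :+ d :≡ f :+ (con 1 :+ e) ⇒ ⊢ c :+ (con 1 :+ f) :< con 1 :+ b) q (ℕP.m∸n+n≡m (v≤k i)) (D+la i))))))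
        where
        i′ = toℕ i
        j′ = toℕ j
        l = lookup v i
        kl = k ∸ lookup v i
        Di = bounce k la (toℕ i)

    H-Δk : ∀ γ g → (∀ i → γ i ≡ g (toℕ i)) → H (Δk k v) γ ≋ 𝓗 ℓ (bounce k la) g
    H-Δk γ g e = ≋-trans (Hcoef-↭ Δk-roots γ) (Hcoef-cong (roots ℓ (bounce k la)) e)

  kSchur-𝓗 : ∀ k ℓ xs → length xs ≡ ℓ → (∀ r → rowLen xs r ≤ k) → kSchur k (fromList xs) ≋ 𝓗 ℓ (bounce k (rowLen xs)) (λ r → + rowLen xs r)
  kSchur-𝓗 k _ xs refl b = subst (λ ys → kSchur k (fromList xs) ≋ 𝓗 (length xs) (bounce k (rowLen ys)) (λ r → + rowLen ys r)) (toList∘fromList xs)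
    (H-Δk k (fromList xs) (λ i → subst (_≤ k) (sym (trans (lookup-rowLen (fromList xs) i) (cong (λ ys → rowLen ys (toℕ i)) (toList∘fromList xs)))) (b (toℕ i)))
      (λ i → + lookup (fromList xs) i) (λ r → + rowLen (toList (fromList xs)) r) (λ i → cong +_ (lookup-rowLen (fromList xs) i)))

  sumΛ-↭ : ∀ {A : Set} (f : A → Λ) {xs ys} → xs ↭ ys → sumΛ (map f xs) ≃ sumΛ (map f ys)
  sumΛ-↭ f Perm.refl = ≃-refl
  sumΛ-↭ f (prep {xs} {ys} x s) = +Λ-cong (≃-refl {f x}) (sumΛ-↭ f s)
  sumΛ-↭ f (swap {xs} {ys} x y s) = ≃-trans (+Λ-leftComm (f x) (f y) (sumΛ (map f xs))) (+Λ-cong (≃-refl {f y}) (+Λ-cong (≃-refl {f x}) (sumΛ-↭ f s)))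
  sumΛ-↭ f (Perm.trans s s′) = ≃-trans (sumΛ-↭ f s) (sumΛ-↭ f s′)

  sum-total : ∀ xs → sum xs ≡ total (rowLen xs) (length xs)
  sum-total [] = refl
  sum-total (x ∷ xs) = cong (_+_ x) (sum-total xs)

  module Expansion (ℓ k : ℕ) {R : ℕ} {la K : ℕ → ℕ} (core : IsCore k R la K) (antitone : ∀ {r s} → r ≤ s → la s ≤ la r) (la-ℓ : ∀ r → ℓ ≤ r → la r ≡ 0) where
    open Beads core antitone
    open Straighten ℓ k la la≤k antitone using (state; firstRoot; weight; outcome; bad; firstRoot-value; weight-value) renaming (good to goodOutcome)
    open Cover

    removedSeries : ℕ → Series
    removedSeries z = 𝓗 ℓ D (λ r → + la r ℤ.- δ z r)

    coverSeries : Cover core antitone → Series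
    coverSeries g = 𝓗 ℓ (bounce k (rows g)) (λ r → + rows g r)

    positive⇒<ℓ : ∀ {r} → 0 < la r → r < ℓ
    positive⇒<ℓ {r} p = ≰⇒> (λ le → <-irrefl (sym (la-ℓ r le)) p)

    -- A vanishing contribution comes with the absence of covers at z, without which the list of
    -- entries could not be shown complete.
    Contribution : ℕ → Set
    Contribution z = (∃ λ (g : Cover core antitone) → bottom g ≡ z × state z 0 0 ≋ tShift (height g * width g) (coverSeries g))
                   ⊎ (state z 0 0 ≋ 0S × (∀ (g : Cover core antitone) → bottom g ≢ z))

    module _ {z w p x a : ℕ} (good : Good z w p x a) where
      private
        open module Rb = Ribbons core antitone good using (μ; μ≤k; a+w≤x; x≤z)
        b+μ : ∀ r → bounce k μ r + μ r ≡ r + ℕ.suc k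
        b+μ r = ℕP.m∸n+n≡m (linarith (μ r ∷ k ∷ r ∷ []) (λ a b c → a :≤ b ⇒ ⊢ a :≤ c :+ (con 1 :+ b)) (μ≤k r))
        I J : ℕ → ℕ
        I = indicator z (ℕ.suc w)
        J = indicator a w

      -- A box less moves the first root one column to the right, a box more one to the left; so the
      -- end of straightening is the series of the partition μ with its own root set.
      final-rows : ∀ r → firstRoot z w a w r ≡ bounce k μ r × weight z w a w r ≡ + μ r
      final-rows r with inInterval z (ℕ.suc w) r | inInterval a w r
      ... | outside e _ | outside e′ _ = trans (firstRoot-value z w a w r e e′) (trans (+-identityʳ (D r)) (cong (r + ℕ.suc k ∸_) (sym μ≡))) ,
            trans (weight-value z w a w r e e′) (trans (ℤP.+-identityʳ _) (trans (ℤP.+-identityʳ (+ la r)) (cong +_ (sym μ≡))))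
        where
        μ≡ : μ r ≡ la r
        μ≡ = trans (Rb.μ-value {r} e e′) (+-identityʳ (la r))
      ... | inside t t<sw refl e | outside e′ _ = trans (firstRoot-value z w a w (z + t) e e′)
              (linarith (B ∷ m ∷ z ∷ t ∷ k ∷ D (z + t) ∷ la (z + t) ∷ la z ∷ []) (λ a b c d e f g h → a :+ b :≡ c :+ d :+ (con 1 :+ e) ⇒ f :+ g :≡ c :+ d :+ (con 1 :+ e) ⇒ con 1 :+ b :≡ h ⇒ g :≡ h ⇒ ⊢ f :+ con 1 :≡ a) (b+μ (z + t)) (D+la (z + t)) sm (Good.block good t t≤w)) ,
            trans (weight-value z w a w (z + t) e e′) (trans (ℤP.+-identityʳ _) (cong (λ v → + v ℤ.- 1ℤ) (trans (Good.block good t t≤w) (sym sm))))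
        where
        t≤w : t ≤ w
        t≤w = ℕP.≤-pred t<sw
        B = bounce k μ (z + t)
        m = μ (z + t)
        sm : ℕ.suc m ≡ la z
        sm = Rb.μ-block t t≤w
      ... | outside e _ | inside t t<w refl e′ = trans (firstRoot-value z w a w (a + t) e e′)
              (linarith (D (a + t) ∷ B ∷ p′ ∷ []) (λ a b c → a :+ con 0 :≡ con 1 :+ b ⇒ con 1 :+ c :≡ a :+ con 0 ⇒ ⊢ c :≡ b)
                (linarith (B ∷ m ∷ a ∷ t ∷ k ∷ D (a + t) ∷ la (a + t) ∷ []) (λ a b c d e f g → a :+ b :≡ c :+ d :+ (con 1 :+ e) ⇒ f :+ g :≡ c :+ d :+ (con 1 :+ e) ⇒ b :≡ con 1 :+ g ⇒ ⊢ f :+ con 0 :≡ con 1 :+ a) (b+μ (a + t)) (D+la (a + t)) (Rb.μ-a t t<w))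
                (ℕP.m+[n∸m]≡n (linarith (a ∷ t ∷ D (a + t) ∷ []) (λ a b c → a :+ b :< c ⇒ ⊢ con 1 :≤ c :+ con 0) (r<Dr (a + t))))) ,
            trans (weight-value z w a w (a + t) e e′) (cong +_ (linarith (m ∷ la (a + t) ∷ []) (λ a b → a :≡ con 1 :+ b ⇒ ⊢ b :+ con 0 :+ con 1 :≡ a) (Rb.μ-a t t<w)))
        where
        B = bounce k μ (a + t)
        m = μ (a + t)
        p′ = D (a + t) + 0 ∸ 1
      ... | inside t _ refl _ | inside t′ t′<w e _ = ⊥-elim (linarith (z ∷ t ∷ a ∷ t′ ∷ w ∷ x ∷ []) (λ a b c d e f → a :+ b :≡ c :+ d ⇒ d :< e ⇒ c :+ e :≤ f ⇒ f :≤ a ⇒ ⊢ absurd) e t′<w a+w≤x x≤z)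

      state-final : state z w a ≋ coverSeries (cover good)
      state-final = 𝓗-cong ℓ (firstRoot z w a w) (bounce k μ) (weight z w a w) (λ r → + μ r) (λ r _ → proj₁ (final-rows r)) (λ r _ → proj₂ (final-rows r))

    contribution : ∀ z → z < ℓ → Contribution z
    contribution z z<ℓ with la z ≟ 0
    -- For a zero part the block is taken down to the last row ℓ - 1, where the weight becomes -1.
    ... | yes la0 = inj₂ (vanish (outcome z w z+w<ℓ (λ t _ → trans (la0′ t) (sym la0))) , λ { g refl → <-irrefl (sym la0) (Good.positive (good g)) })
      where
      la0′ : ∀ t → la (z + t) ≡ 0
      la0′ t = ℕP.n≤0⇒n≡0 (subst (la (z + t) ≤_) la0 (antitone (m≤m+n z t)))
      w = ℓ ∸ ℕ.suc z
      z+w≡ : ℕ.suc (z + w) ≡ ℓ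
      z+w≡ = m+[n∸m]≡n z<ℓ
      z+w<ℓ : z + w < ℓ
      z+w<ℓ = ≤-reflexive z+w≡
      vanish : Straighten.Outcome ℓ k la la≤k antitone z w → state z 0 0 ≋ 0S
      vanish (bad e _) = e
      vanish (goodOutcome {p} {x} {a} lt c e) = ≋-trans e (tShift-0S (p * w) (𝓗-last ℓ (firstRoot z w a w) (weight z w a w) (z + w) z+w≡
        (subst (ℤ._< 0ℤ) (sym (trans (weight-value z w a w (z + w) (indicator-inside z ≤-refl)
          (indicator-above w (linarith (a ∷ w ∷ x ∷ z ∷ []) (λ a b c d → a :+ b :≤ c ⇒ c :≤ d ⇒ ⊢ a :+ b :≤ d :+ b) (proj₂ (chain-top c)) (top≤ c)))) (cong (λ v → + v ℤ.- + 1 ℤ.+ + 0) (la0′ w)))) ℤ.-<+)))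
    ... | no la≢0 with crossing (λ t → la (z + t) ≟ la z) ℓ (cong la (+-identityʳ z)) (λ e → la≢0 (trans (sym e) (la-ℓ (z + ℓ) (m≤n+m ℓ z))))
    ...   | w , at-w , not-after = classify (outcome z w (positive⇒<ℓ (subst (0 <_) (sym at-w) positive)) block)
      where
      positive : 0 < la z
      positive = ℕP.n≢0⇒n>0 la≢0
      block : ∀ t → t ≤ w → la (z + t) ≡ la z
      block t t≤w = ≤-antisym (antitone (m≤m+n z t)) (subst (_≤ la (z + t)) at-w (antitone (ℕP.+-monoʳ-≤ z t≤w)))
      drop : la (ℕ.suc (z + w)) < la z
      drop = subst (λ s → la s < la z) (+-suc z w) (ℕP.≤∧≢⇒< (antitone (m≤m+n z (ℕ.suc w))) not-after)
      goodAt : ∀ {p x a} → z + w < D z → Chain w z p x a → Good z w p x a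
      goodAt lt c = record { positive = positive ; block = block ; drop = drop ; short = lt ; chain = c }
      classify : Straighten.Outcome ℓ k la la≤k antitone z w → Contribution z
      classify (goodOutcome {p} lt c e) = inj₁ (cover (goodAt lt c) , refl , ≋-trans e (tShift-cong (p * w) (state-final (goodAt lt c))))
      classify (bad e none) = inj₂ (e , λ g b≡ → refute g b≡)
        where
        same-width : ∀ {w′ p x a} → Good z w′ p x a → w′ ≡ w
        same-width {w′} g = ≤-antisym
          (≮⇒≥ (λ w<w′ → not-after (Good.block g (ℕ.suc w) w<w′)))
          (≮⇒≥ (λ w′<w → <-irrefl (block (ℕ.suc w′) w′<w) (subst (λ s → la s < la z) (sym (+-suc z w′)) (Good.drop g))))
        refute : ∀ (g : Cover core antitone) → bottom g ≢ z
        refute (cover g) refl with same-width g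
        ... | refl = none (Good.short g) (Good.chain g)

    state-start : ∀ z → state z 0 0 ≋ 𝓗 ℓ (upd z (ℕ.suc (D z)) D) (λ r → + la r ℤ.- δ z r)
    state-start z = 𝓗-cong ℓ (firstRoot z 0 0 0) (upd z (ℕ.suc (D z)) D) (weight z 0 0 0) (λ r → + la r ℤ.- δ z r) (λ r _ → rows≡ r) (λ r _ → weights≡ r)
      where
      rows≡ : ∀ r → firstRoot z 0 0 0 r ≡ upd z (ℕ.suc (D z)) D r
      rows≡ r with r ≟ z
      ... | yes refl = trans (firstRoot-value z 0 0 0 z (trans (cong (indicator z 1) (sym (+-identityʳ z))) (indicator-inside z {1} {0} (s≤s z≤n))) refl)
              (trans (+-comm (D z) 1) (sym (upd-same z _ D)))
      ... | no r≢z = trans (firstRoot-value z 0 0 0 r (indicator-suc 0 (λ e → r≢z (trans e (+-identityʳ z)))) refl) (trans (+-identityʳ (D r)) (sym (upd-other _ D r≢z)))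
      weights≡ : ∀ r → weight z 0 0 0 r ≡ + la r ℤ.- δ z r
      weights≡ r = trans (ℤP.+-identityʳ _) (cong (λ v → + la r ℤ.- v) (trans (indicator-δ z 0 r) (trans (ℤP.+-identityˡ _) (cong (λ v → δ v r) (+-identityʳ z)))))

    removed-step : ∀ z → D z < ℓ → removedSeries z ≋ state z 0 0 ⊕ tShift 1 (removedSeries (D z))
    removed-step z Dz<ℓ = ≋-trans (𝓗-root ℓ D (λ r → + la r ℤ.- δ z r) z (r<Dr z) Dz<ℓ)
      (⊕-cong {f′ = tShift 1 (𝓗 ℓ D (move z (D z) (λ r → + la r ℤ.- δ z r)))} {g′ = tShift 1 (removedSeries (D z))} (≋-sym (state-start z))
        (tShift-cong 1 (𝓗-cong ℓ D D (move z (D z) (λ r → + la r ℤ.- δ z r)) (λ r → + la r ℤ.- δ (D z) r) (λ _ _ → refl) (λ r _ → regroup (+ la r) (δ z r) (δ (D z) r)))))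
      where
      regroup : ∀ l d e → l ℤ.- d ℤ.+ d ℤ.- e ≡ l ℤ.- e
      regroup = ℤSolver.solve-∀

    removed-last : ∀ z → ℓ ≤ D z → removedSeries z ≋ state z 0 0
    removed-last z le = ≋-trans (𝓗-noroot ℓ D (λ r → + la r ℤ.- δ z r) z le) (≋-sym (state-start z))

    module Path (m : ℕ) where
      path : ℕ → ℕ
      path j = down^ core antitone j m

      Entry : Set
      Entry = ∃ λ (g : Cover core antitone) → ∃ λ j → path j ≡ bottom g

      entrySeries : Entry → Series
      entrySeries (g , j , _) = tShift j (tShift (height g * width g) (coverSeries g))

      sumS : List Entry → Series
      sumS es d = sumΛ (map (λ e → entrySeries e d) es)

      -- Bottoms of different entries are separated by a bounce, so the later one lies below the
      -- whole block of the earlier one.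
      Apart : Entry → Entry → Set
      Apart (g , _) (g′ , _) = D (bottom g) ≤ bottom g′

      -- In `complete` covers are compared by their bottom rows, which determine the shape but not
      -- the placeholder a of a cover of width 0.
      record Expanded (j : ℕ) : Set where
        field
          entries  : List Entry
          expands  : tShift j (removedSeries (path j)) ≋ sumS entries
          complete : ∀ (g : Cover core antitone) i → j ≤ i → path i ≡ bottom g → ∃ λ (e : Entry) → e ∈ entries × bottom (proj₁ e) ≡ bottom g
          beyond   : All (λ (e : Entry) → path j ≤ bottom (proj₁ e)) entries
          apart    : AllPairs Apart entries

      path-mono : ∀ {i j} → i ≤ j → path i ≤ path j
      path-mono {i} {zero} z≤n = ≤-refl
      path-mono {i} {suc j} i≤ with m≤n⇒m<n∨m≡n i≤
      ... | inj₂ refl = ≤-refl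
      ... | inj₁ i<sj = ≤-trans (path-mono (ℕP.≤-pred i<sj)) (<⇒≤ (r<Dr (path j)))

      tShift-⊕ : ∀ s f f′ → tShift s (f ⊕ f′) ≋ tShift s f ⊕ tShift s f′
      tShift-⊕ s f f′ d with s ℕ.≤ᵇ d
      ... | true = ≃-refl
      ... | false = ≃-refl

      expand : ∀ f j → ℓ ≤ path j + f → path j < ℓ → Expanded j
      expand zero j le lt = ⊥-elim (linarith (ℓ ∷ path j ∷ []) (λ a b → a :≤ b :+ con 0 ⇒ b :< a ⇒ ⊢ absurd) le lt)
      expand (suc f) j le lt = combine-with (contribution (path j) lt)
        where
        record Rest : Set where
          field
            entries  : List Entry
            -- S stands for the summand of row `path j`, which becomes a cover entry or zero.
            expands  : ∀ S → S ≋ tShift j (state (path j) 0 0) → tShift j (removedSeries (path j)) ≋ S ⊕ sumS entries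
            complete : ∀ (g : Cover core antitone) i → ℕ.suc j ≤ i → path i ≡ bottom g → ∃ λ (e : Entry) → e ∈ entries × bottom (proj₁ e) ≡ bottom g
            beyond   : All (λ (e : Entry) → D (path j) ≤ bottom (proj₁ e)) entries
            apart    : AllPairs Apart entries
        rest : Rest
        rest with D (path j) <? ℓ
        ... | no ≮ = record
          { entries = []
          ; expands = λ S e → ≋-trans (tShift-cong j (removed-last (path j) (≮⇒≥ ≮))) (≋-trans (≋-sym e) (≋-sym (⊕-identityʳ {S} {sumS []} (λ _ → ≃-refl))))
          ; complete = λ g i j<i e → ⊥-elim (≮ (≤-<-trans (path-mono j<i) (subst (_< ℓ) (sym e) (positive⇒<ℓ (Good.positive (good g))))))
          ; beyond = [] ; apart = [] }
        ... | yes lt′ = record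
          { entries = E.entries
          ; expands = λ S e → ≋-trans (tShift-cong j (removed-step (path j) lt′)) (≋-trans (tShift-⊕ j (state (path j) 0 0) (tShift 1 (removedSeries (D (path j)))))
              (⊕-cong {tShift j (state (path j) 0 0)} {S} {tShift j (tShift 1 (removedSeries (D (path j))))} {sumS E.entries} (≋-sym e)
                (≋-trans (≋-sym (tShift-+ j 1 (removedSeries (D (path j))))) (≋-trans (subst (λ s → tShift (j + 1) (removedSeries (D (path j))) ≋ tShift s (removedSeries (D (path j)))) (+-comm j 1) ≋-refl) E.expands))))
          ; complete = E.complete ; beyond = E.beyond ; apart = E.apart }
          where module E = Expanded (expand f (ℕ.suc j) (linarith (ℓ ∷ path j ∷ f ∷ D (path j) ∷ []) (λ a b c d → a :≤ b :+ (con 1 :+ c) ⇒ b :< d ⇒ ⊢ a :≤ d :+ c) le (r<Dr (path j))) lt′)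
        open Rest rest
        later : All (λ (e : Entry) → path j ≤ bottom (proj₁ e)) entries
        later = All.map (≤-trans (<⇒≤ (r<Dr (path j)))) beyond
        combine-with : Contribution (path j) → Expanded j
        combine-with (inj₂ (e , none)) = record
          { entries = entries
          ; expands = ≋-trans (expands 0S (≋-sym (tShift-0S j e))) (⊕-identityˡ {0S} {sumS entries} ≋-refl)
          ; complete = complete′ ; beyond = later ; apart = apart }
          where
          complete′ : ∀ (g : Cover core antitone) i → j ≤ i → path i ≡ bottom g → ∃ λ (e : Entry) → e ∈ entries × bottom (proj₁ e) ≡ bottom g
          complete′ g i j≤i e with m≤n⇒m<n∨m≡n j≤i
          ... | inj₁ j<i = complete g i j<i e
          ... | inj₂ refl = ⊥-elim (none g (sym e))
        combine-with (inj₁ (g₀ , b≡ , e)) = record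
          { entries = e₀ ∷ entries
          ; expands = expands (entrySeries e₀) (≋-sym (tShift-cong j e))
          ; complete = complete′
          ; beyond = ≤-reflexive (sym b≡) ∷ later
          ; apart = All.map {P = λ (e : Entry) → D (path j) ≤ bottom (proj₁ e)} (λ {e} → subst (λ b → D b ≤ bottom (proj₁ e)) (sym b≡)) beyond ∷ apart }
          where
          e₀ : Entry
          e₀ = g₀ , j , sym b≡
          complete′ : ∀ (g : Cover core antitone) i → j ≤ i → path i ≡ bottom g → ∃ λ (e : Entry) → e ∈ e₀ ∷ entries × bottom (proj₁ e) ≡ bottom g
          complete′ g i j≤i e with m≤n⇒m<n∨m≡n j≤i
          ... | inj₂ refl = e₀ , here refl , trans b≡ e
          ... | inj₁ j<i with complete g i j<i e
          ...   | e′ , m′ , b = e′ , there m′ , b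

-- Comparison with the sum over marked covers.

open import Data.Nat as ℕ using (ℕ; _≤_; _<_; _+_; _*_; _∸_; z≤n)
open import Data.Nat.Properties using (<-irrefl; m≤n+m; +-comm; _≟_; _<?_; ≮⇒≥; <⇒≢; <-≤-trans; ≤-<-trans)
open import Data.Integer as ℤ using (ℤ; +_; 0ℤ; 1ℤ)
import Data.Nat.Properties as ℕP
open import Data.Fin as Fin using (Fin; toℕ; fromℕ<)
open import Data.Fin.Properties using (toℕ-fromℕ<; toℕ<n)
open import Data.List using (List; []; _∷_; map; filterᵇ; length)
open import Data.List.Membership.Propositional using (_∈_)
open import Data.List.Membership.Propositional.Properties using (∈-map⁺; ∈-map⁻)
import Data.List.Relation.Unary.Unique.Propositional.Properties as UniqueP
open import Data.List.Relation.Binary.Permutation.Propositional using (_↭_)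
open import Data.Bool using (Bool; if_then_else_; T; T?)
open import Data.Bool.Properties using (T-∧)
open import Data.Product using (_,_; proj₁; proj₂)
open import Data.Empty using (⊥-elim)
open import Data.Vec as Vec using ([]; _∷_; Vec; lookup; toList; fromList)
open import Function using (_∘_)
open import Function.Bundles using (Equivalence)
open import Relation.Nullary using (yes; no)
open import Relation.Binary.PropositionalEquality
open import Data.List.Properties using (length-applyUpTo; ≡-dec)
import Data.List.Relation.Unary.AllPairs as AllPairs
import Data.List.Relation.Unary.AllPairs.Properties as AllPairsP
import Data.List.Membership.DecPropositional as DecMembership
open import Data.Nat.ListAction using (sum)
open import Data.Vec.Properties using (length-toList)
open import Relation.Nullary.Decidable using (decidable-stable)
open LinearArithmetic
open SymmetricFunctions
open RaisingSeries
open RootColumns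
open BounceGraph
open CoreRibbons
open PartitionLists
open CoreCovers
open CoverShapes
open SeriesExpansion

module _ (k ℓ : ℕ) (κ : List ℕ) (dκ : Decreasing κ) {la : ℕ → ℕ} (core : IsCore k (length κ) la (rowLen κ)) (antitone : ∀ {r s} → r ≤ s → la s ≤ la r)
         (la-ℓ : ∀ r → ℓ ≤ r → la r ≡ 0) (sum-la : sum (pmap k κ) ≡ total la (length κ)) (m : ℕ) where
  open Beads core antitone
  open Expansion ℓ k core antitone la-ℓ
  open Path m
  open Cover
  private
    n : ℕ
    n = length κ
    module Shape (g : Cover core antitone) = CoverShape k κ dκ core antitone g

    shapeOf : Entry → List ℕ
    shapeOf (g , _) = Shape.coverList g

    markedAt : List ℕ → Bool
    markedAt τ = markedCoverᵇ k τ κ m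

    term : List ℕ → Series
    term τ = tShift (spin τ κ m) (kSchur k (fromList (pad ℓ (trim (pmap k τ)))))

  same-shape : ∀ (g g′ : Cover core antitone) → bottom g ≡ bottom g′ → ∀ r → shape g r ≡ shape g′ r
  same-shape (cover g) (cover g′) refl = shape-unique core antitone g g′

  same-list : ∀ g g′ → (∀ r → shape {core = core} {antitone} g r ≡ shape g′ r) → Shape.coverList g ≡ Shape.coverList g′
  same-list g g′ e = rowLen-ext _ _ (trans (length-applyUpTo (shape g) n) (sym (length-applyUpTo (shape g′) n)))
    (λ r → trans (Shape.rowLen-coverList g r) (trans (e r) (sym (Shape.rowLen-coverList g′ r))))

  rows-ℓ : ∀ (g : Cover core antitone) r → ℓ ≤ r → rows g r ≡ 0
  rows-ℓ g r ℓ≤r with Rib.position g r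
  ... | Rib.other e _ _ = trans e (la-ℓ r ℓ≤r)
  ... | Rib.in-block t t≤w refl = ⊥-elim (<-irrefl refl (<-≤-trans (positive⇒<ℓ (subst (0 <_) (sym (Good.block (good g) t t≤w)) (Good.positive (good g)))) ℓ≤r))
  ... | Rib.in-a t t<w refl = ⊥-elim (linarith (ℓ ∷ a ∷ t ∷ w ∷ x ∷ z ∷ []) (λ a b c d e f → a :≤ b :+ c ⇒ c :< d ⇒ b :+ d :≤ e ⇒ e :≤ f ⇒ f :< a ⇒ ⊢ absurd) ℓ≤r t<w (Rib.a+w≤x g) (Rib.x≤z g) (positive⇒<ℓ (Good.positive (good g))))
    where
    a = lengthened g
    w = width g
    x = topRow g
    z = bottom g

  -- The j bounces from m to the bottom row make m a level of depth j, so the spin j + p w matches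
  -- t^j from the expansion and t^(p w) from straightening.
  term-entry : ∀ (e : Entry) → term (shapeOf e) ≋ entrySeries e
  term-entry (g , j , e) = ≋-trans (subst (λ s → tShift (spin τ κ m) S ≋ tShift s S) spin≡ ≋-refl)
    (≋-trans (tShift-+ j (height g * width g) S) (tShift-cong j (tShift-cong (height g * width g) S≋)))
    where
    τ = Shape.coverList g
    μs = pad ℓ (trim (pmap k τ))
    S = kSchur k (fromList μs)
    hit = down-level core antitone (Good.chain (good g)) j m e
    spin≡ : spin τ κ m ≡ j + height g * width g
    spin≡ = trans (Shape.spin-value g (proj₁ hit)) (trans (+-comm (height g * width g) _) (cong (λ v → v + height g * width g) (proj₂ hit)))
    rowLen-μs : ∀ r → rowLen μs r ≡ rows g r
    rowLen-μs r = trans (rowLen-++-zeros (trim (pmap k τ)) _ r) (trans (rowLen-trim (pmap k τ) r) (Shape.rowLen-pmap-coverList g r))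
    S≋ : S ≋ coverSeries g
    S≋ = ≋-trans (kSchur-𝓗 k ℓ μs (length-pad ℓ (trim (pmap k τ)) (length-trim (pmap k τ) ℓ (λ r le → trans (Shape.rowLen-pmap-coverList g r) (rows-ℓ g r le))))
        (λ r → subst (_≤ k) (sym (rowLen-μs r)) (Rib.μ≤k g r)))
      (𝓗-cong ℓ (bounce k (rowLen μs)) (bounce k (rows g)) (λ r → + rowLen μs r) (λ r → + rows g r)
        (λ r _ → cong (r + ℕ.suc k ∸_) (rowLen-μs r)) (λ r _ → cong +_ (rowLen-μs r)))

  sum-rows : ∀ g → ℕ.suc (sum (pmap k (Shape.coverList g))) ≡ sum (pmap k κ)
  sum-rows g = trans (cong (ℕ.suc ∘ sum) (Shape.pmap-coverList g)) (trans (cover-total core antitone g) (sym sum-la))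

  module _ (ex : Expanded 0) where
    open Expanded ex

    -- Decidable membership removes the double negation of `covers-classified`. A mark at the first
    -- row of a component makes m a level, which puts the bottom row of the cover on the bounce path
    -- of m.
    marked⇒cover : ∀ {τ} → τ ∈ filterᵇ markedAt (subParts κ) → τ ∈ map shapeOf entries
    marked⇒cover {τ} τ∈ with ∈-filterᵇ⁻ markedAt (subParts κ) τ∈
    ... | τ∈sub , marked with ∈-gen⁻ κ (rowLen κ 0) τ∈sub | Equivalence.to T-∧ marked
    ...   | len , _ , dτ , τ⊆κ | isCore , rest with Equivalence.to T-∧ rest
    ...     | sums , starts-m = decidable-stable (DecMembership._∈?_ (≡-dec _≟_) τ (map shapeOf entries)) λ τ∉ →
                covers-classified core antitone coreT (decreasing-antitone {τ} dτ) τ⊆κ totals (λ (g , same) → τ∉ (found g same))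
      where
      coreT : IsCore k n (rowLen (pmap k τ)) (rowLen τ)
      coreT = subst (λ v → IsCore k v (rowLen (pmap k τ)) (rowLen τ)) len (pmap-isCore k τ dτ isCore)
      totals : ℕ.suc (total (rowLen (pmap k τ)) n) ≡ total la n
      totals = trans (cong ℕ.suc (trans (cong (total (rowLen (pmap k τ))) (sym (trans (length-pmap k τ) len))) (sym (sum-total (pmap k τ)))))
        (trans (ℕP.≡ᵇ⇒≡ _ _ sums) sum-la)
      found : ∀ g → (∀ r → rowLen τ r ≡ shape g r) → τ ∈ map shapeOf entries
      found g same = subst (_∈ map shapeOf entries) (trans (same-list (proj₁ e) g (same-shape (proj₁ e) g b≡)) (sym τ≡)) (∈-map⁺ shapeOf e∈)
        where
        τ≡ : τ ≡ Shape.coverList g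
        τ≡ = rowLen-ext τ _ (trans len (sym (length-applyUpTo (shape g) n))) (λ r → trans (same r) (sym (Shape.rowLen-coverList g r)))
        level : m ∈ levels (Good.chain (good g))
        level = Shape.starts-level g m (subst (λ σ → T (starts σ κ m)) τ≡ starts-m)
        hit = complete g (depth core antitone level) z≤n (level-down core antitone (Good.chain (good g)) level)
        e = proj₁ hit
        e∈ = proj₁ (proj₂ hit)
        b≡ = proj₂ (proj₂ hit)

    cover⇒marked : ∀ {τ} → τ ∈ map shapeOf entries → τ ∈ filterᵇ markedAt (subParts κ)
    cover⇒marked τ∈ with ∈-map⁻ shapeOf τ∈
    ... | (g , j , e) , _ , refl = ∈-filterᵇ⁺ markedAt (Shape.coverList∈ g) (Equivalence.from T-∧ (Shape.Hooks.isCoreᵇ g ,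
          Equivalence.from T-∧ (ℕP.≡⇒≡ᵇ _ _ (sum-rows g) , Shape.level-starts g (proj₁ (down-level core antitone (Good.chain (good g)) j m e)))))

    -- The later cover removes boxes from the last row of its bottom block; that row lies below the
    -- block of the earlier cover, which leaves it unchanged.
    covers-distinct : ∀ {e e′} → Apart e e′ → shapeOf e ≢ shapeOf e′
    covers-distinct {g , _} {g′ , _} apart e = <⇒≢ (Rib.Removed.last< (Rib.removed g′ (z∈levels (Good.chain (good g′)))))
      (trans (sym (trans (sym (Shape.rowLen-coverList g row)) (trans (cong (λ τ → rowLen τ row) e) (Shape.rowLen-coverList g′ row))))
        (Rib.agree-below g row (linarith (z ∷ w ∷ D z ∷ z′ ∷ w′ ∷ []) (λ a b c d e → a :+ b :< c ⇒ c :≤ d ⇒ ⊢ a :+ b :< d :+ e) (Good.short (good g)) apart)))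
      where
      z = bottom g
      w = width g
      z′ = bottom g′
      w′ = width g′
      row = z′ + w′

    marked↭ : filterᵇ markedAt (subParts κ) ↭ map shapeOf entries
    marked↭ = unique-↭ (UniqueP.filter⁺ (T? ∘ markedAt) (gen-unique κ (rowLen κ 0)))
      (AllPairsP.map⁺ (AllPairs.map (λ {e} {e′} → covers-distinct {e} {e′}) apart)) marked⇒cover cover⇒marked

    removed≋rhs : removedSeries m ≋ rhs k ℓ κ m
    removed≋rhs d = ≃-trans (expands d) (≃-trans (each entries) (≃-sym (sumΛ-↭ (λ τ → term τ d) marked↭)))
      where
      each : ∀ es → sumΛ (map (λ e → entrySeries e d) es) ≃ sumΛ (map (λ τ → term τ d) (map shapeOf es))
      each [] = ≃-refl
      each (e ∷ es) = +Λ-cong (≃-sym (term-entry e d)) (each es)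

theorem9p2 : (k ℓ : ℕ) → 1 ≤ k → 1 ≤ ℓ → (la : Vec ℕ ℓ) → ParK k la → (m : Fin ℓ)
    → (κ : List ℕ) → IsPartition κ → T (coreᵇ k κ) → trim (pmap k κ) ≡ trim (toList la)
    → (d : ℕ) → H (Δk k la) (minusε la m) d ≈Λ rhs k ℓ κ (toℕ m) d
theorem9p2 k ℓ _ _ la (la≤k , la-decreasing) m κ (_ , dκ) coreκ p≡la d = ≃⇒≈Λ (≃-trans
  (H-Δk k la la≤k (minusε la m) (λ r → + L r ℤ.- δ (toℕ m) r) weights d)
  -- The bounce path is strictly increasing, so it leaves the ℓ rows after at most ℓ steps.
  (removed≋rhs k ℓ κ dκ core antitone L-ℓ sums (toℕ m) (Expansion.Path.expand ℓ k core antitone L-ℓ (toℕ m) ℓ 0 (m≤n+m ℓ (toℕ m)) (toℕ<n m)) d))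
  where
  L : ℕ → ℕ
  L = rowLen (toList la)
  L-ℓ : ∀ r → ℓ ≤ r → L r ≡ 0
  L-ℓ r le = rowLen-[] (toList la) r (subst (_≤ r) (sym (length-toList la)) le)
  parts : ∀ r → rowLen (pmap k κ) r ≡ L r
  parts r = trans (sym (rowLen-trim (pmap k κ) r)) (trans (cong (λ xs → rowLen xs r) p≡la) (rowLen-trim (toList la) r))
  core : IsCore k (length κ) L (rowLen κ)
  core = isCore-cong parts (λ _ → refl) (pmap-isCore k κ dκ coreκ)
  at : ∀ {r} (lt : r < ℓ) → lookup la (fromℕ< lt) ≡ L r
  at lt = trans (lookup-rowLen la (fromℕ< lt)) (cong L (toℕ-fromℕ< lt))
  antitone : ∀ {r s} → r ≤ s → L s ≤ L r
  antitone {r} {s} r≤s with s <? ℓ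
  ... | no ≮ = subst (_≤ L r) (sym (L-ℓ s (≮⇒≥ ≮))) z≤n
  ... | yes s<ℓ = subst₂ _≤_ (at s<ℓ) (at r<ℓ) (la-decreasing (fromℕ< r<ℓ) (fromℕ< s<ℓ) (subst₂ _≤_ (sym (toℕ-fromℕ< r<ℓ)) (sym (toℕ-fromℕ< s<ℓ)) r≤s))
    where
    r<ℓ : r < ℓ
    r<ℓ = ≤-<-trans r≤s s<ℓ
  sums : sum (pmap k κ) ≡ total L (length κ)
  sums = trans (sum-total (pmap k κ)) (trans (cong (total (rowLen (pmap k κ))) (length-pmap k κ)) (total-cong (length κ) (λ r _ → parts r)))
  weights : ∀ i → minusε la m i ≡ + L (toℕ i) ℤ.- δ (toℕ m) (toℕ i)
  weights i = cong₂ (λ a b → + a ℤ.- (if b then 1ℤ else 0ℤ)) (lookup-rowLen la i) (does-toℕ i m)
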